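{- Let $N\ge 2$ and let $\Phi_N(x,y)\in\mathbb Z[x,y]$ be the classical modular polynomial of level $N$. Then the total degree of $\Phi_N(x,y)$, regarded as a polynomial in the two independent variables $x,y$, is equal to the degree of the one-variable polynomial $\Phi_N(x,x)$.
   Context: Let $j$ be the modular $j$-invariant, $j=E_4^3/\Delta$ with $E_4(z)=1+240\sum_{n\ge1}\sigma_3(n)q^n$ and $\Delta(z)=q\prod_{n\ge1}(1-q^n)^{24}$, $q=e^{2\pi i z}$. The classical modular polynomial $\Phi_N\in\mathbb Z[x,y]$ is the minimal polynomial of $j(Nz)$ over $\mathbb C(j)$ (so that $\Phi_N(j(z),j(Nz))=0$); it is symmetric, irreducible in $\mathbb C[x,y]$, and of degree $\psi(N)=N\prod_{p\mid N}(1+1/p)$ in each variable separately. -}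

module Defs where

open import Data.Bool using (Bool; true; false; if_then_else_; _∧_)
open import Data.Nat as ℕ using (ℕ; zero; suc; _∸_; _≤_; _<_)
open import Data.Nat.Divisibility using (_∣_; _∣?_; quotient)
open import Data.Nat.Primality using (prime?)
open import Data.Integer as ℤ using (ℤ; +_; 0ℤ; 1ℤ; -_)
open import Data.Product using (Σ; _×_; ∃; ∃-syntax; _,_)
open import Data.Sum using (_⊎_)
open import Relation.Nullary using (does; yes; no; ¬_)
open import Relation.Binary.PropositionalEquality using (_≡_; _≢_)

-- Formal power series over ℤ in q, ℤ[[q]] : coefficient functions.

PS : Set
PS = ℕ → ℤ

sumTo : (ℕ → ℤ) → ℕ → ℤ
sumTo f zero    = f 0
sumTo f (suc n) = sumTo f n ℤ.+ f (suc n)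

_⊕_ : PS → PS → PS
(f ⊕ g) n = f n ℤ.+ g n

_⊗_ : PS → PS → PS
(f ⊗ g) n = sumTo (λ k → f k ℤ.* g (n ∸ k)) n

scalePS : ℤ → PS → PS
scalePS c f n = c ℤ.* f n

onePS : PS
onePS zero    = 1ℤ
onePS (suc _) = 0ℤ

zeroPS : PS
zeroPS _ = 0ℤ

_^PS_ : PS → ℕ → PS
f ^PS zero    = onePS
f ^PS (suc k) = f ⊗ (f ^PS k)

sumPS : (ℕ → PS) → ℕ → PS
sumPS F zero    = F 0
sumPS F (suc n) = sumPS F n ⊕ F (suc n)

dilate : ℕ → PS → PS
dilate N f n with N ∣? n
... | yes p = f (quotient p)
... | no _  = 0ℤ

σ₃ : ℕ → ℤ
σ₃ n = sumTo (λ d → if (does (d ∣? n) ∧ does (1 ℕ.≤? d)) then + (d ℕ.* d ℕ.* d) else 0ℤ) n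

E₄ : PS
E₄ zero    = 1ℤ
E₄ (suc n) = + 240 ℤ.* σ₃ (suc n)

oneMinusQ : ℕ → PS
oneMinusQ k zero    = 1ℤ
oneMinusQ k (suc n) = if does (suc n ℕ.≟ k) then - 1ℤ else 0ℤ

partialEta24 : ℕ → PS
partialEta24 zero    = onePS
partialEta24 (suc m) = partialEta24 m ⊗ (oneMinusQ (suc m) ^PS 24)

-- Δ = q ∏_{n≥1} (1-q^n)^24 ; the coefficient of q^{m+1} only depends
-- on the factors with n ≤ m+1.
Δ : PS
Δ zero    = 0ℤ
Δ (suc m) = partialEta24 (suc m) m

-- ψ(N) = N ∏_{p ∣ N} (1 + 1/p), stated multiplicatively:
-- ψ(N) · ∏_{p∣N} p = N · ∏_{p∣N} (p+1).

prodPrimeDivisors : (ℕ → ℕ) → ℕ → ℕ → ℕ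
prodPrimeDivisors f N zero    = 1
prodPrimeDivisors f N (suc p) =
  prodPrimeDivisors f N p ℕ.*
  (if (does (prime? (suc p)) ∧ does (suc p ∣? N)) then f (suc p) else 1)

IsPsi : ℕ → ℕ → Set
IsPsi N n = n ℕ.* prodPrimeDivisors (λ p → p) N N ≡ N ℕ.* prodPrimeDivisors suc N N

-- Polynomials in ℤ[x,y]: coefficient of x^a y^b, with finite support.

record Poly2 : Set where
  field
    coeff   : ℕ → ℕ → ℤ
    bound   : ℕ
    support : ∀ a b → (bound < a ⊎ bound < b) → coeff a b ≡ 0ℤ
open Poly2 public

-- Δ(q)^B Δ(q^N)^B · P(j(q), j(q^N)) with j = E₄³/Δ, denominators cleared
-- (B = bound P ≥ all exponents occurring in P).
clearedEval : Poly2 → ℕ → PS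
clearedEval P N =
  sumPS (λ a → sumPS (λ b →
      scalePS (coeff P a b)
        (((E₄ ^PS (3 ℕ.* a)) ⊗ (Δ ^PS (bound P ∸ a))) ⊗
         ((dilate N E₄ ^PS (3 ℕ.* b)) ⊗ (dilate N Δ ^PS (bound P ∸ b)))))
    (bound P)) (bound P)

VanishesOnModularCurve : ℕ → Poly2 → Set
VanishesOnModularCurve N P = ∀ m → clearedEval P N m ≡ 0ℤ

MonicInY : Poly2 → ℕ → Set
MonicInY P n =
  (coeff P 0 n ≡ 1ℤ) ×
  (∀ a → 1 ≤ a → coeff P a n ≡ 0ℤ) ×
  (∀ a b → n < b → coeff P a b ≡ 0ℤ)

-- P is the classical modular polynomial Φ_N: the (unique) polynomial,
-- monic of degree ψ(N) in y, with P(j(z), j(Nz)) = 0, i.e. the minimal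
-- polynomial of j(Nz) over ℂ(j).
IsModularPolynomial : ℕ → Poly2 → Set
IsModularPolynomial N P =
  Σ ℕ λ n → IsPsi N n × MonicInY P n × VanishesOnModularCurve N P

IsTotalDegree : Poly2 → ℕ → Set
IsTotalDegree P d =
  (∃[ a ] ∃[ b ] (a ℕ.+ b ≡ d × coeff P a b ≢ 0ℤ)) ×
  (∀ a b → coeff P a b ≢ 0ℤ → a ℕ.+ b ≤ d)

diagonal : Poly2 → ℕ → ℤ
diagonal P k = sumTo (λ a → coeff P a (k ∸ a)) k

IsDegree : (ℕ → ℤ) → ℕ → Set
IsDegree f d = (f d ≢ 0ℤ) × (∀ k → f k ≢ 0ℤ → k ≤ d)

{-# OPTIONS --safe #-}
module Submission where

-- Evaluate P (j(q), j(q^N)) = 0 near each cusp h/a with a d = N, over ℚ(i) with explicit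
-- error bounds. There log |j(q)| and log |j(q^N)| are in the ratio d : a and exceed every
-- other scale, so only the monomials on the edge of the Newton polygon of P in direction
-- (d, a) survive. By Dedekind's congruence the edge polynomial nearly vanishes at φ(e)
-- well-separated points, e = gcd (a, d), hence the edge has height at least (d/e) φ(e).
-- These heights sum to ψ(N), the degree of P in y, so all edges have exactly that height.
-- The top-degree form is thus a monomial if N is not a square, and otherwise has φ(√N) + 1
-- consecutive coefficients, too few for it to vanish at 1 as well.

open import Data.Nat as N using (ℕ; zero; _∸_; _≟_; s≤s; z<s; z≤n; s≤s⁻¹; >-nonZero) renaming (suc to S)
open import Data.Nat.Properties as NP using (*-distribˡ-+; *-identityʳ; *-mono-≤; *-monoʳ-≤; *-monoˡ-≤; *-zeroʳ; +-mono-≤; +-monoʳ-≤; +-monoˡ-≤; +-suc; <-≤-trans; <⇒≢; <⇒≤; <⇒≱; m+[n∸m]≡n; m<n⇒0<n∸m; m<n⇒m<1+n; m∸n+n≡m; m∸n≤m; m≤m*n; m≤m+n; m≤n*m; m≤n+m; n≢0⇒n>0; n≤1+n; ≤-<-trans; ≤-pred; ≤∧≢⇒<; ≮⇒≥; ≰⇒>)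
import Data.Integer.Properties as ZP
open import Data.Product using (Σ; _×_; _,_; ∃) renaming (proj₁ to fst; proj₂ to snd)
open import Data.Sum using (_⊎_) renaming (inj₁ to inl; inj₂ to inr)
open import Data.Empty using (⊥) renaming (⊥-elim to abort)
open import Relation.Binary.PropositionalEquality renaming (_≡_ to _~_; trans to &; sym to !; cong to ap; cong₂ to ap2; subst₂ to tr2; subst to tr)
open import Relation.Nullary using (¬_; yes; no; Dec)
open import Tactic.RingSolver using () renaming (solve-∀ to auto)
open import Data.List using (List; []; _∷_; length)
open import Data.List.Relation.Unary.All using (All; []; _∷_)
open import Data.Nat.Tactic.RingSolver using () renaming (solve-∀ to nsolve)
import Data.Nat.ListAction
import Data.Nat.Divisibility
open import Data.Integer as Z using () renaming (0ℤ to 0Z)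




&N : ∀ {i j k} -> i N.≤ j -> j N.≤ k -> i N.≤ k
&N = NP.≤-trans

≡N : ∀ {i j} -> i ~ j -> i N.≤ j
≡N = NP.≤-reflexive

module Rationals where
 open import Data.Rational as ℚ using (ℚ; 0ℚ; 1ℚ)
 import Data.Rational.Properties as ℚP
 import Data.Rational.Unnormalised as ℚᵘ
 import Data.Rational.Unnormalised.Properties as ℚᵘP
 open Z using (ℤ; -[1+_])
 open import Data.Maybe using (Maybe; just; nothing)
 open import Level using (0ℓ)
 open import Tactic.RingSolver.Core.AlmostCommutativeRing using (AlmostCommutativeRing; fromCommutativeRing)

 infixr 8 _^_
 infixl 6 _+_ _-_
 infixl 7 _*_
 infix 8 -_
 infix 4 _≤_ _<_ _≤?_

 -- The rationals, with opaque operations: this keeps the type checker from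
 -- unfolding the arithmetic of normalised fractions.

 opaque
  Q : Set
  Q = ℚ
  0# 1# : Q
  0# = 0ℚ
  1# = 1ℚ
  _+_ _*_ : Q -> Q -> Q
  _+_ = ℚ._+_
  _*_ = ℚ._*_
  -_ inv : Q -> Q
  -_ = ℚ.-_
  inv x with x ℚP.≟ 0ℚ
  ... | yes _ = 0ℚ
  ... | no p = (ℚ.1/ x) {{ℚ.≢-nonZero p}}
  _≤_ : Q -> Q -> Set
  _≤_ = ℚ._≤_
  Qr : AlmostCommutativeRing 0ℓ 0ℓ
  Qr = fromCommutativeRing ℚP.+-*-commutativeRing zero? where
   zero? : ∀ x -> Maybe (0ℚ ~ x)
   zero? x with 0ℚ ℚP.≟ x
   ... | yes p = just p
   ... | no _ = nothing

 _-_ : Q -> Q -> Q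
 x - y = x + - y

 _<_ : Q -> Q -> Set
 x < y = ¬ (y ≤ x)

 ι : ℕ -> Q
 ι zero = 0#
 ι (S n) = 1# + ι n

 2# 4# : Q
 2# = 1# + 1#
 4# = 2# + 2#

 opaque
  unfolding Qr
  +-assoc : ∀ x y z -> (x + y) + z ~ x + (y + z)
  +-assoc = ℚP.+-assoc
  +-comm : ∀ x y -> x + y ~ y + x
  +-comm = ℚP.+-comm
  +-idl : ∀ x -> 0# + x ~ x
  +-idl = ℚP.+-identityˡ
  +-idr : ∀ x -> x + 0# ~ x
  +-idr = ℚP.+-identityʳ
  +-inv : ∀ x -> x - x ~ 0#
  +-inv = ℚP.+-inverseʳ
  *-assoc : ∀ x y z -> (x * y) * z ~ x * (y * z)
  *-assoc = ℚP.*-assoc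
  *-comm : ∀ x y -> x * y ~ y * x
  *-comm = ℚP.*-comm
  *1l : ∀ x -> 1# * x ~ x
  *1l = ℚP.*-identityˡ
  *1r : ∀ x -> x * 1# ~ x
  *1r = ℚP.*-identityʳ
  *-0ˡ : ∀ x -> 0# * x ~ 0#
  *-0ˡ = ℚP.*-zeroˡ
  *-0ʳ : ∀ x -> x * 0# ~ 0#
  *-0ʳ = ℚP.*-zeroʳ
  *-distˡ : ∀ x y z -> x * (y + z) ~ x * y + x * z
  *-distˡ = ℚP.*-distribˡ-+
  *-distʳ : ∀ x y z -> (y + z) * x ~ y * x + z * x
  *-distʳ = ℚP.*-distribʳ-+
  r≤ : ∀ {x} -> x ≤ x
  r≤ = ℚP.≤-refl
  <& : ∀ {x y z} -> x ≤ y -> y ≤ z -> x ≤ z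
  <& = ℚP.≤-trans
  ≤-antisym : ∀ {x y} -> x ≤ y -> y ≤ x -> x ~ y
  ≤-antisym = ℚP.≤-antisym
  ≤-total : ∀ x y -> x ≤ y ⊎ y ≤ x
  ≤-total = ℚP.≤-total
  _≤?_ : ∀ x y -> Dec (x ≤ y)
  _≤?_ = ℚP._≤?_
  +m : ∀ {x y u v} -> x ≤ y -> u ≤ v -> x + u ≤ y + v
  +m = ℚP.+-mono-≤
  0≤1 : 0# ≤ 1#
  0≤1 = ℚP.nonNegative⁻¹ 1ℚ
  0<1 : 0# < 1#
  0<1 p = ℚP.<-irrefl refl (ℚP.≤-<-trans p (ℚP.positive⁻¹ 1ℚ))
  nn* : ∀ {x y} -> 0# ≤ x -> 0# ≤ y -> 0# ≤ x * y
  nn* {x} {y} p q = tr (ℚ._≤ x ℚ.* y) (ℚP.*-zeroʳ x)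
   (ℚP.*-monoˡ-≤-nonNeg x {{ℚ.nonNegative p}} q)
  inv-r : ∀ {x} -> 0# < x -> x * inv x ~ 1#
  inv-r {x} p with x ℚP.≟ 0ℚ
  ... | yes q = abort (p (ℚP.≤-reflexive q))
  ... | no q = ℚP.*-inverseʳ x {{ℚ.≢-nonZero q}}
  private
   fromℚ : ℚ -> Q
   fromℚ x = x
   ι-int : ∀ n -> ι n ~ fromℚ (Z.+ n ℚ./ 1)
   ι-int zero = refl
   ι-int (S n) = & (ap (1ℚ ℚ.+_) (ι-int n)) (ℚP.toℚᵘ-injective
    (ℚᵘP.≃-trans (ℚP.toℚᵘ-homo-+ 1ℚ (Z.+ n ℚ./ 1))
     (ℚᵘP.≃-trans (ℚᵘP.+-cong (ℚᵘP.≃-refl {ℚ.toℚᵘ 1ℚ}) (h n))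
      (ℚᵘP.≃-trans (ℚᵘ.*≡* (e n)) (ℚᵘP.≃-sym (h (S n))))))) where
    h : ∀ k -> ℚ.toℚᵘ (Z.+ k ℚ./ 1) ℚᵘ.≃ ℚᵘ.mkℚᵘ (Z.+ k) 0
    h k = ℚP.toℚᵘ-fromℚᵘ (ℚᵘ.mkℚᵘ (Z.+ k) 0)
    e : ∀ k -> (Z.+ 1 Z.* Z.+ 1 Z.+ Z.+ k Z.* Z.+ 1) Z.* Z.+ 1 ~ Z.+ S k Z.* (Z.+ 1 Z.* Z.+ 1)
    e k rewrite ZP.*-identityʳ (Z.+ k) | ZP.*-identityʳ (Z.+ S k) = refl
   abs-int : ∀ i -> i Z.≤ Z.+ Z.∣ i ∣
   abs-int (Z.+ k) = ZP.≤-refl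
   abs-int -[1+ k ] = Z.-≤+
   numerator-bound : ∀ x -> ℚᵘ.↥ (ℚ.toℚᵘ x) Z.* Z.+ 1 Z.≤ Z.+ Z.∣ ℚ.↥ x ∣ Z.* ℚᵘ.↧ (ℚ.toℚᵘ x)
   numerator-bound (ℚ.mkℚ m k _) = ZP.≤-trans (ZP.≤-reflexive (ZP.*-identityʳ m)) (ZP.≤-trans (abs-int m)
    (ZP.≤-trans (ZP.≤-reflexive (! (ZP.*-identityʳ (Z.+ Z.∣ m ∣))))
     (ZP.*-monoˡ-≤-nonNeg (Z.+ Z.∣ m ∣) (Z.+≤+ z<s))))
  arch : ∀ x -> ∃ \ n -> x ≤ ι n
  arch x = Z.∣ ℚ.↥ x ∣ , tr (x ℚ.≤_) (! (ι-int Z.∣ ℚ.↥ x ∣))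
   (ℚP.toℚᵘ-cancel-≤ (ℚᵘP.≤-trans (ℚᵘ.*≤* (numerator-bound x))
    (ℚᵘP.≤-reflexive (ℚᵘP.≃-sym (ℚP.toℚᵘ-fromℚᵘ (ℚᵘ.mkℚᵘ (Z.+ Z.∣ ℚ.↥ x ∣) 0))))))
  -- Inequalities are proved by exhibiting a nonnegative difference.
  le : ∀ {x y} e -> 0# ≤ e -> y ~ x + e -> x ≤ y
  le {x} e p eq = tr2 ℚ._≤_ (ℚP.+-identityʳ x) (! eq) (ℚP.+-monoʳ-≤ x p)

 ≤r : ∀ {x y} -> x ~ y -> x ≤ y
 ≤r refl = r≤
 *a : ∀ {x y z} -> (x * y) * z ~ x * (y * z)
 *a = *-assoc _ _ _
 =≤ : ∀ {x y z} -> x ~ y -> y ≤ z -> x ≤ z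
 =≤ refl q = q
 ≤= : ∀ {x y z} -> x ≤ y -> y ~ z -> x ≤ z
 ≤= p refl = p

 lt : ∀ {x y} -> x < y -> x ≤ y
 lt {x} {y} p with ≤-total x y
 ... | inl q = q
 ... | inr q = abort (p q)

 p≤ : ∀ {x y z} -> x < y -> y ≤ z -> x < z
 p≤ p q r = p (<& q r)

 ≤p : ∀ {x y z} -> x ≤ y -> y < z -> x < z
 ≤p p q r = q (<& r p)

 <? : ∀ x y -> x < y ⊎ y ≤ x
 <? x y with y ≤? x
 ... | yes p = inr p
 ... | no p = inl p

 diff : ∀ {x y} -> x ≤ y -> 0# ≤ y - x
 diff {x} {y} p = tr (_≤ y - x) (+-inv x) (+m p r≤)

 undiff : ∀ {x y} -> 0# ≤ y - x -> x ≤ y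
 undiff {x} {y} p = le (y - x) p (eq x y) where
  opaque
   unfolding Qr
   eq : ∀ x y -> y ~ x + (y - x)
   eq = auto Qr

 +-cancelr : ∀ {x y z} -> x + z ≤ y + z -> x ≤ y
 +-cancelr {x} {y} {z} p = undiff (tr (0# ≤_) (eq x y z) (diff p)) where
  opaque
   unfolding Qr
   eq : ∀ x y z -> y + z - (x + z) ~ y - x
   eq = auto Qr

 nn+ : ∀ {x y} -> 0# ≤ x -> 0# ≤ y -> 0# ≤ x + y
 nn+ {x} {y} p q = tr (_≤ x + y) (+-idl 0#) (+m p q)

 0≤2 : 0# ≤ 2#
 0≤2 = nn+ 0≤1 0≤1

 0≤4 : 0# ≤ 4#
 0≤4 = nn+ 0≤2 0≤2

 x≤x+y : ∀ {x y} -> 0# ≤ y -> x ≤ x + y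
 x≤x+y p = le _ p refl

 y≤x+y : ∀ {x y} -> 0# ≤ x -> y ≤ x + y
 y≤x+y {x} {y} p = le x p (+-comm x y)

 *l : ∀ {z x y} -> 0# ≤ z -> x ≤ y -> z * x ≤ z * y
 *l {z} {x} {y} p q = le (z * (y - x)) (nn* p (diff q)) (eq z x y) where
  opaque
   unfolding Qr
   eq : ∀ z x y -> z * y ~ z * x + z * (y - x)
   eq = auto Qr

 *r : ∀ {z x y} -> 0# ≤ z -> x ≤ y -> x * z ≤ y * z
 *r {z} {x} {y} p q = tr2 _≤_ (*-comm z x) (*-comm z y) (*l p q)

 *-mono : ∀ {x y u v} -> 0# ≤ x -> x ≤ y -> 0# ≤ u -> u ≤ v -> x * u ≤ y * v
 *-mono p q r s = <& (*l p s) (*r (<& r s) q)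

 inv-nn : ∀ {x} -> 0# < x -> 0# ≤ inv x
 inv-nn {x} p with ≤-total 0# (inv x)
 ... | inl q = q
 ... | inr q = abort (0<1 (tr2 _≤_ (inv-r p) (*-0ʳ x) (*l (lt p) q)))

 *x : ∀ {z x y} -> 0# < z -> z * x ≤ z * y -> x ≤ y
 *x {z} {x} {y} p q = tr2 _≤_ (h x) (h y) (*l (inv-nn p) q) where
  h : ∀ x -> inv z * (z * x) ~ x
  h x = & (! (*-assoc (inv z) z x)) (& (ap (_* x) (& (*-comm (inv z) z) (inv-r p))) (*1l x))

 pp* : ∀ {x y} -> 0# < x -> 0# < y -> 0# < x * y
 pp* {x} {y} p q r = q (*x p (tr (x * y ≤_) (! (*-0ʳ x)) r))

 pp+ : ∀ {x y} -> 0# < x -> 0# ≤ y -> 0# < x + y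
 pp+ p q = p≤ p (x≤x+y q)

 inv-pos : ∀ {x} -> 0# < x -> 0# < inv x
 inv-pos {x} p q = 0<1 (tr2 _≤_ (inv-r p) (*-0ʳ x) (*l (lt p) q))

 neg-flip : ∀ {x} -> x ≤ 0# -> 0# ≤ - x
 neg-flip {x} p = tr (0# ≤_) (+-idl (- x)) (diff p)

 neg-sq : ∀ x -> - x * - x ~ x * x
 neg-sq = eq where
  opaque
   unfolding Qr
   eq : ∀ x -> - x * - x ~ x * x
   eq = auto Qr

 nnsq : ∀ x -> 0# ≤ x * x
 nnsq x with ≤-total 0# x
 ... | inl p = nn* p p
 ... | inr p = tr (0# ≤_) (neg-sq x) (nn* (neg-flip p) (neg-flip p))

 sq-mono : ∀ {x y} -> 0# ≤ x -> x ≤ y -> x * x ≤ y * y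
 sq-mono p q = *-mono p q p q

 sq-cancel : ∀ {x y} -> 0# ≤ y -> x * x ≤ y * y -> x ≤ y
 sq-cancel {x} {y} p q with <? y x
 ... | inr r = r
 ... | inl r = abort (pp* x>0 (\ s -> r (undiff' s)) (tr (_≤ 0#) (eq x y)
  (≤= (+m (<& q (*r p (lt r))) r≤) (+-inv (x * y))))) where
  x>0 : 0# < x
  x>0 = ≤p p r
  undiff' : x - y ≤ 0# -> x ≤ y
  undiff' s = undiff (tr (0# ≤_) (eq2 x y) (neg-flip s)) where
   opaque
    unfolding Qr
    eq2 : ∀ x y -> - (x - y) ~ y - x
    eq2 = auto Qr
  opaque
   unfolding Qr
   eq : ∀ x y -> x * x - x * y ~ x * (x - y)
   eq = auto Qr

 abs : Q -> Q
 abs x with ≤-total 0# x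
 ... | inl _ = x
 ... | inr _ = - x

 abs-nn : ∀ x -> 0# ≤ abs x
 abs-nn x with ≤-total 0# x
 ... | inl p = p
 ... | inr p = neg-flip p

 abs-sq : ∀ x -> abs x * abs x ~ x * x
 abs-sq x with ≤-total 0# x
 ... | inl _ = refl
 ... | inr _ = neg-sq x

 x≤abs : ∀ x -> x ≤ abs x
 x≤abs x = sq-cancel (abs-nn x) (≤r (! (abs-sq x)))

 -x≤abs : ∀ x -> - x ≤ abs x
 -x≤abs x = sq-cancel (abs-nn x) (≤r (& (neg-sq x) (! (abs-sq x))))

 ι-nn : ∀ n -> 0# ≤ ι n
 ι-nn zero = r≤
 ι-nn (S n) = nn+ 0≤1 (ι-nn n)

 ι-+ : ∀ m n -> ι (m N.+ n) ~ ι m + ι n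
 ι-+ zero n = ! (+-idl _)
 ι-+ (S m) n = & (ap (1# +_) (ι-+ m n)) (! (+-assoc 1# (ι m) (ι n)))

 ι-* : ∀ m n -> ι (m N.* n) ~ ι m * ι n
 ι-* zero n = ! (*-0ˡ (ι n))
 ι-* (S m) n = & (ι-+ n (m N.* n)) (& (ap (ι n +_) (ι-* m n)) (eq (ι m) (ι n))) where
  opaque
   unfolding Qr
   eq : ∀ x y -> y + x * y ~ (1# + x) * y
   eq = auto Qr

 ι-mono : ∀ {m n} -> m N.≤ n -> ι m ≤ ι n
 ι-mono {m} {n} p = le (ι (n ∸ m)) (ι-nn (n ∸ m))
  (& (ap ι (! (m+[n∸m]≡n p))) (ι-+ m _))

 1≤ι : ∀ {n} -> 1 N.≤ n -> 1# ≤ ι n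
 1≤ι {n} p = =≤ (! (+-idr 1#)) (ι-mono p)

 ι-pos : ∀ {n} -> 1 N.≤ n -> 0# < ι n
 ι-pos p = p≤ 0<1 (1≤ι p)

 _^_ : Q -> ℕ -> Q
 x ^ zero = 1#
 x ^ S n = x * x ^ n

 ^n : ∀ {x} n -> 0# ≤ x -> 0# ≤ x ^ n
 ^n zero p = 0≤1
 ^n (S n) p = nn* p (^n n p)

 ^-pos : ∀ {x} n -> 0# < x -> 0# < x ^ n
 ^-pos zero p = 0<1
 ^-pos (S n) p = pp* p (^-pos n p)

 ^-+ : ∀ x m n -> x ^ (m N.+ n) ~ x ^ m * x ^ n
 ^-+ x zero n = ! (*1l _)
 ^-+ x (S m) n = & (ap (x *_) (^-+ x m n)) (! (*-assoc x _ _))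

 ^-1 : ∀ n -> 1# ^ n ~ 1#
 ^-1 zero = refl
 ^-1 (S n) = & (*1l _) (^-1 n)

 *-^ : ∀ x y n -> (x * y) ^ n ~ x ^ n * y ^ n
 *-^ x y zero = ! (*1l 1#)
 *-^ x y (S n) = & (ap (x * y *_) (*-^ x y n)) (eq x y (x ^ n) (y ^ n)) where
  opaque
   unfolding Qr
   eq : ∀ a b c d -> a * b * (c * d) ~ a * c * (b * d)
   eq = auto Qr

 ^-^ : ∀ x m n -> x ^ (m N.* n) ~ (x ^ n) ^ m
 ^-^ x zero n = refl
 ^-^ x (S m) n = & (^-+ x n (m N.* n)) (ap (x ^ n *_) (^-^ x m n))

 ^-mono : ∀ {x y} n -> 0# ≤ x -> x ≤ y -> x ^ n ≤ y ^ n
 ^-mono zero p q = r≤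
 ^-mono (S n) p q = *-mono p q (^n n p) (^-mono n p q)

 ^-≤1 : ∀ {x} n -> 0# ≤ x -> x ≤ 1# -> x ^ n ≤ 1#
 ^-≤1 {x} n p q = tr (x ^ n ≤_) (^-1 n) (^-mono n p q)

 1≤^ : ∀ {x} n -> 1# ≤ x -> 1# ≤ x ^ n
 1≤^ {x} n q = tr (_≤ x ^ n) (^-1 n) (^-mono n 0≤1 q)

 ^-anti : ∀ {x m n} -> 0# ≤ x -> x ≤ 1# -> m N.≤ n -> x ^ n ≤ x ^ m
 ^-anti {x} {m} {n} p q l = tr2 _≤_
  (& (! (^-+ x m (n ∸ m))) (ap (x ^_) (m+[n∸m]≡n l)))
  (*1r _) (*l (^n m p) (^-≤1 (n ∸ m) p q))

 ^-cancel : ∀ {x y} n -> 0# ≤ y -> x ^ S n ≤ y ^ S n -> x ≤ y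
 ^-cancel {x} {y} n p q with <? y x
 ... | inr l = l
 ... | inl l with <? 0# y
 ...   | inl y>0 = *x (^-pos n y>0) (<& (*r (<& p (lt l)) (^-mono n p (lt l)))
  (=≤ (*-comm (x ^ n) x) (≤= q (*-comm y (y ^ n)))))
 ...   | inr y≤0 = abort (^-pos (S n) (≤p p l) (≤= q (& (ap (_* y ^ n) (≤-antisym y≤0 p)) (*-0ˡ _))))

 module Fold {A : Set} (_∙_ : A -> A -> A) (ε : A)
  (assoc : ∀ x y z -> (x ∙ y) ∙ z ~ x ∙ (y ∙ z))
  (comm : ∀ x y -> x ∙ y ~ y ∙ x)
  (idˡ : ∀ x -> ε ∙ x ~ x) where
  idʳ : ∀ x -> x ∙ ε ~ x
  idʳ x = & (comm x ε) (idˡ x)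
  fold : ℕ -> (ℕ -> A) -> A
  fold zero f = ε
  fold (S n) f = fold n f ∙ f n
  cong-< : ∀ n {f g : ℕ -> A} -> (∀ k -> k N.< n -> f k ~ g k) -> fold n f ~ fold n g
  cong-< zero h = refl
  cong-< (S n) h = ap2 _∙_ (cong-< n \ k l -> h k (m<n⇒m<1+n l)) (h n NP.≤-refl)
  cong-f : ∀ n {f g : ℕ -> A} -> (∀ k -> f k ~ g k) -> fold n f ~ fold n g
  cong-f n h = cong-< n \ k _ -> h k
  front : ∀ n f -> fold (S n) f ~ f 0 ∙ fold n (\ k -> f (S k))
  front zero f = comm ε (f 0)
  front (S n) f = & (ap (_∙ f (S n)) (front n f)) (assoc _ _ _)
  split : ∀ m n f -> fold (m N.+ n) f ~ fold m f ∙ fold n (\ k -> f (m N.+ k))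
  split m zero f = & (ap (\ j -> fold j f) (NP.+-identityʳ m)) (! (idʳ _))
  split m (S n) f = & (ap (\ j -> fold j f) (+-suc m n))
   (& (ap (_∙ f (m N.+ n)) (split m n f)) (assoc _ _ _))
  swap4 : ∀ a b c d -> (a ∙ b) ∙ (c ∙ d) ~ (a ∙ c) ∙ (b ∙ d)
  swap4 a b c d = & (assoc a b (c ∙ d)) (& (ap (a ∙_)
   (& (! (assoc b c d)) (& (ap (_∙ d) (comm b c)) (assoc c b d)))) (! (assoc a c (b ∙ d))))
  distr : ∀ n f g -> fold n (\ k -> f k ∙ g k) ~ fold n f ∙ fold n g
  distr zero f g = ! (idˡ ε)
  distr (S n) f g = & (ap (_∙ (f n ∙ g n)) (distr n f g)) (swap4 _ _ _ _)
  fold-ε : ∀ n -> fold n (\ _ -> ε) ~ ε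
  fold-ε zero = refl
  fold-ε (S n) = & (idʳ _) (fold-ε n)
  exchange : ∀ m n (f : ℕ -> ℕ -> A) -> fold m (\ i -> fold n (f i)) ~ fold n (\ j -> fold m (\ i -> f i j))
  exchange zero n f = ! (fold-ε n)
  exchange (S m) n f = & (ap (_∙ fold n (f m)) (exchange m n f)) (! (distr n _ _))
  blocks : ∀ m b f -> fold (m N.* b) f ~ fold m (\ i -> fold b (\ j -> f (i N.* b N.+ j)))
  blocks zero b f = refl
  blocks (S m) b f = & (ap (\ j -> fold j f) (NP.+-comm b (m N.* b)))
   (& (split (m N.* b) b f) (ap (_∙ fold b (\ j -> f (m N.* b N.+ j))) (blocks m b f)))
  fold-none : ∀ n {f} -> (∀ k -> k N.< n -> f k ~ ε) -> fold n f ~ ε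
  fold-none n h = & (cong-< n h) (fold-ε n)
  fold-single : ∀ n k {f} -> k N.< n -> (∀ j -> j N.< n -> j ≢ k -> f j ~ ε) -> fold n f ~ f k
  fold-single (S n) k {f} l h with k ≟ n
  ... | yes refl = & (ap (_∙ f k) (fold-none n \ j l' -> h j (m<n⇒m<1+n l') (<⇒≢ l'))) (idˡ _)
  ... | no ne = & (ap2 _∙_ (fold-single n k (≤∧≢⇒< (s≤s⁻¹ l) ne) \ j l' -> h j (m<n⇒m<1+n l'))
   (h n NP.≤-refl (\ e -> ne (! e)))) (idʳ _)
  fold-hom : ∀ n f (φ : A -> A) -> φ ε ~ ε -> (∀ x y -> φ (x ∙ y) ~ φ x ∙ φ y) -> φ (fold n f) ~ fold n (\ k -> φ (f k))
  fold-hom zero f φ e h = e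
  fold-hom (S n) f φ e h = & (h _ _) (ap (_∙ φ (f n)) (fold-hom n f φ e h))

 module ΣQ = Fold _+_ 0# +-assoc +-comm +-idl
 module ΠQ = Fold _*_ 1# *-assoc *-comm *1l

 sum prod : ℕ -> (ℕ -> Q) -> Q
 sum = ΣQ.fold
 prod = ΠQ.fold

 sum-mono : ∀ n {f g} -> (∀ k -> k N.< n -> f k ≤ g k) -> sum n f ≤ sum n g
 sum-mono zero h = r≤
 sum-mono (S n) h = +m (sum-mono n \ k l -> h k (m<n⇒m<1+n l)) (h n NP.≤-refl)

 sum-nn : ∀ n {f} -> (∀ k -> 0# ≤ f k) -> 0# ≤ sum n f
 sum-nn zero h = r≤
 sum-nn (S n) h = nn+ (sum-nn n h) (h n)

 sum-*ˡ : ∀ n c f -> sum n (\ k -> c * f k) ~ c * sum n f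
 sum-*ˡ n c f = ! (ΣQ.fold-hom n f (c *_) (*-0ʳ c) (*-distˡ c))

 sum-*ʳ : ∀ n c f -> sum n (\ k -> f k * c) ~ sum n f * c
 sum-*ʳ n c f = ! (ΣQ.fold-hom n f (_* c) (*-0ˡ c) (*-distʳ c))

 sum-const : ∀ n c -> sum n (\ _ -> c) ~ ι n * c
 sum-const zero c = ! (*-0ˡ c)
 sum-const (S n) c = & (ap (_+ c) (sum-const n c)) (eq (ι n) c) where
  opaque
   unfolding Qr
   eq : ∀ x y -> x * y + y ~ (1# + x) * y
   eq = auto Qr

 sum-ext : ∀ {m n f} -> m N.≤ n -> (∀ k -> 0# ≤ f k) -> sum m f ≤ sum n f
 sum-ext {m} {n} {f} l h = le (sum (n ∸ m) (\ k -> f (m N.+ k))) (sum-nn (n ∸ m) \ k -> h _)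
  (& (ap (\ j -> sum j f) (! (m+[n∸m]≡n l))) (ΣQ.split m _ f))

 prod-nn : ∀ n {f} -> (∀ k -> 0# ≤ f k) -> 0# ≤ prod n f
 prod-nn zero h = 0≤1
 prod-nn (S n) h = nn* (prod-nn n h) (h n)

 prod-pos : ∀ n {f} -> (∀ k -> 0# < f k) -> 0# < prod n f
 prod-pos zero h = 0<1
 prod-pos (S n) h = pp* (prod-pos n h) (h n)

 prod-mono : ∀ n {f g} -> (∀ k -> 0# ≤ f k) -> (∀ k -> k N.< n -> f k ≤ g k) -> prod n f ≤ prod n g
 prod-mono zero p h = r≤
 prod-mono (S n) p h = *-mono (prod-nn n p) (prod-mono n p \ k l -> h k (m<n⇒m<1+n l)) (p n) (h n NP.≤-refl)

 prod-^ : ∀ n f c -> prod n (\ k -> f k ^ c) ~ prod n f ^ c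
 prod-^ n f c = ! (ΠQ.fold-hom n f (_^ c) (^-1 c) (\ x y -> *-^ x y c))

 prod-const : ∀ n c -> prod n (\ _ -> c) ~ c ^ n
 prod-const zero c = refl
 prod-const (S n) c = & (ap (_* c) (prod-const n c)) (*-comm _ c)

 geom : ∀ n x -> (1# - x) * sum n (x ^_) ~ 1# - x ^ n
 geom zero x = & (*-0ʳ (1# - x)) (! (+-inv 1#))
 geom (S n) x = & (*-distˡ (1# - x) _ _) (& (ap (_+ (1# - x) * x ^ n) (geom n x)) (eq x (x ^ n))) where
  opaque
   unfolding Qr
   eq : ∀ x y -> 1# - y + (1# - x) * y ~ 1# - x * y
   eq = auto Qr

 prod1+ : ∀ n {x} -> (∀ k -> 0# ≤ x k) -> 2# * sum n x ≤ 1# -> prod n (\ k -> 1# + x k) ≤ 1# + 2# * sum n x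
 prod1+ zero p h = x≤x+y (nn* 0≤2 r≤)
 prod1+ (S n) {x} p h = <&
  (*r (nn+ 0≤1 (p n)) (prod1+ n p (<& (*l 0≤2 (x≤x+y (p n))) h)))
  (le ((1# - 2# * sum n x) * x n) (nn* (diff (<& (*l 0≤2 (x≤x+y (p n))) h)) (p n)) (eq (sum n x) (x n))) where
  opaque
   unfolding Qr
   eq : ∀ s y -> 1# + 2# * (s + y) ~ (1# + 2# * s) * (1# + y) + (1# - 2# * s) * y
   eq = auto Qr

module Gauss where
 open Rationals
 open import Data.Maybe as Maybe using (Maybe)
 open import Level using (0ℓ)
 open import Algebra.Bundles using (CommutativeRing)
 open import Algebra.Structures using (IsCommutativeRing)
 import Algebra.Properties.Ring as RingProperties
 import Algebra.Solver.Ring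
 import Algebra.Solver.Ring.AlmostCommutativeRing as ACR
 open import Relation.Nullary.Decidable using (dec⇒maybe)
 open Z using (ℤ; -[1+_])
 open import Tactic.RingSolver.Core.AlmostCommutativeRing using (AlmostCommutativeRing; fromCommutativeRing)

 module IntegerSolver {A : Set} {_⊹_ _×_ : A -> A -> A} {⊝_ : A -> A} {z o : A}
  (isCR : IsCommutativeRing _~_ _⊹_ _×_ ⊝_ z o) where
  open IsCommutativeRing isCR using (+-identityˡ; +-identityʳ; zeroˡ; *-identityˡ; distribʳ; -‿inverseʳ)
   renaming (+-assoc to ⊹-assoc; +-comm to ⊹-comm)
  private
   R : CommutativeRing 0ℓ 0ℓ
   R = record { isCommutativeRing = isCR }
   open RingProperties (CommutativeRing.ring R) using (-0#≈0#; -‿involutive; -‿+-comm; -‿distribˡ-*; -‿distribʳ-*)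
  ⟦_⟧ₙ : ℕ -> A
  ⟦ zero ⟧ₙ = z
  ⟦ S zero ⟧ₙ = o
  ⟦ S (S n) ⟧ₙ = o ⊹ ⟦ S n ⟧ₙ
  ⟦⟧-suc : ∀ n -> ⟦ S n ⟧ₙ ~ o ⊹ ⟦ n ⟧ₙ
  ⟦⟧-suc zero = ! (+-identityʳ o)
  ⟦⟧-suc (S n) = refl
  ⟦_⟧ᵢ : ℤ -> A
  ⟦ Z.+ n ⟧ᵢ = ⟦ n ⟧ₙ
  ⟦ -[1+ n ] ⟧ᵢ = ⊝ ⟦ S n ⟧ₙ
  ⟦⟧-+ₙ : ∀ m n -> ⟦ m N.+ n ⟧ₙ ~ ⟦ m ⟧ₙ ⊹ ⟦ n ⟧ₙ
  ⟦⟧-+ₙ zero n = ! (+-identityˡ _)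
  ⟦⟧-+ₙ (S m) n = & (⟦⟧-suc (m N.+ n)) (& (ap (o ⊹_) (⟦⟧-+ₙ m n)) (& (! (⊹-assoc _ _ _)) (ap (_⊹ ⟦ n ⟧ₙ) (! (⟦⟧-suc m)))))
  ⟦⟧-*ₙ : ∀ m n -> ⟦ m N.* n ⟧ₙ ~ ⟦ m ⟧ₙ × ⟦ n ⟧ₙ
  ⟦⟧-*ₙ zero n = ! (zeroˡ _)
  ⟦⟧-*ₙ (S m) n = & (⟦⟧-+ₙ n (m N.* n)) (& (ap2 _⊹_ (! (*-identityˡ _)) (⟦⟧-*ₙ m n)) (& (! (distribʳ _ _ _)) (ap (_× ⟦ n ⟧ₙ) (! (⟦⟧-suc m)))))
  ⟦⟧-neg : ∀ i -> ⟦ Z.- i ⟧ᵢ ~ ⊝ ⟦ i ⟧ᵢ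
  ⟦⟧-neg (Z.+ zero) = ! -0#≈0#
  ⟦⟧-neg (Z.+ S n) = refl
  ⟦⟧-neg -[1+ n ] = ! (-‿involutive _)
  ⟦⟧-⊖ : ∀ m n -> ⟦ m Z.⊖ n ⟧ᵢ ~ ⟦ m ⟧ₙ ⊹ (⊝ ⟦ n ⟧ₙ)
  ⟦⟧-⊖ m zero = (! (& (ap (⟦ m ⟧ₙ ⊹_) -0#≈0#) (+-identityʳ _)))
  ⟦⟧-⊖ zero (S n) = ! (+-identityˡ _)
  ⟦⟧-⊖ (S m) (S n) = & (ap ⟦_⟧ᵢ (ZP.[1+m]⊖[1+n]≡m⊖n m n)) (& (⟦⟧-⊖ m n) (! (& (ap2 (\ x y -> x ⊹ (⊝ y)) (⟦⟧-suc m) (⟦⟧-suc n)) (e ⟦ m ⟧ₙ ⟦ n ⟧ₙ)))) where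
   e : ∀ x y -> (o ⊹ x) ⊹ (⊝ (o ⊹ y)) ~ x ⊹ (⊝ y)
   e x y = & (ap2 _⊹_ (⊹-comm o x) (! (-‿+-comm o y))) (& (⊹-assoc x o _)
    (ap (x ⊹_) (& (! (⊹-assoc o (⊝ o) (⊝ y))) (& (ap (_⊹ (⊝ y)) (-‿inverseʳ o)) (+-identityˡ _)))))
  ⟦⟧-+ : ∀ i j -> ⟦ i Z.+ j ⟧ᵢ ~ ⟦ i ⟧ᵢ ⊹ ⟦ j ⟧ᵢ
  ⟦⟧-+ (Z.+ m) (Z.+ n) = ⟦⟧-+ₙ m n
  ⟦⟧-+ (Z.+ m) -[1+ n ] = ⟦⟧-⊖ m (S n)
  ⟦⟧-+ -[1+ m ] (Z.+ n) = & (⟦⟧-⊖ n (S m)) (⊹-comm _ _)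
  ⟦⟧-+ -[1+ m ] -[1+ n ] = & (ap (\ k -> ⊝ ⟦ k ⟧ₙ) (ap S (! (+-suc m n)))) (& (ap ⊝_ (⟦⟧-+ₙ (S m) (S n))) (! (-‿+-comm _ _)))
  ⟦⟧-* : ∀ i j -> ⟦ i Z.* j ⟧ᵢ ~ ⟦ i ⟧ᵢ × ⟦ j ⟧ᵢ
  ⟦⟧-* (Z.+ m) (Z.+ n) = & (ap ⟦_⟧ᵢ (! (ZP.pos-* m n))) (⟦⟧-*ₙ m n)
  ⟦⟧-* (Z.+ m) -[1+ n ] = & (ap ⟦_⟧ᵢ (! (ZP.neg-distribʳ-* (Z.+ m) (Z.+ S n)))) (& (⟦⟧-neg (Z.+ m Z.* Z.+ S n))
   (& (ap ⊝_ (⟦⟧-* (Z.+ m) (Z.+ S n))) (-‿distribʳ-* _ _)))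
  ⟦⟧-* -[1+ m ] (Z.+ n) = & (ap ⟦_⟧ᵢ (! (ZP.neg-distribˡ-* (Z.+ S m) (Z.+ n)))) (& (⟦⟧-neg (Z.+ S m Z.* Z.+ n))
   (& (ap ⊝_ (⟦⟧-* (Z.+ S m) (Z.+ n))) (-‿distribˡ-* _ _)))
  ⟦⟧-* -[1+ m ] -[1+ n ] = & (⟦⟧-* (Z.+ S m) (Z.+ S n)) (& (! (-‿involutive _))
   (& (ap ⊝_ (-‿distribˡ-* _ _)) (-‿distribʳ-* _ _)))
  ring : ACR.AlmostCommutativeRing 0ℓ 0ℓ
  ring = ACR.fromCommutativeRing R
  morphism : Z.+-*-rawRing ACR.-Raw-AlmostCommutative⟶ ring
  morphism = record
   { ⟦_⟧ = ⟦_⟧ᵢ ; +-homo = ⟦⟧-+ ; *-homo = ⟦⟧-* ; -‿homo = ⟦⟧-neg ; 0-homo = refl ; 1-homo = refl }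
  open Algebra.Solver.Ring Z.+-*-rawRing ring morphism (\ i j -> Maybe.map (ap ⟦_⟧ᵢ) (dec⇒maybe (i Z.≟ j))) public
   using (solve; _:+_; _:*_; :-_; _:-_; _:=_; con; _:×_; _:^_)

 infixl 6 _+c_ _-c_
 infixl 7 _*c_
 infixr 8 _^c_
 infix 8 -c_

 record C : Set where
  no-eta-equality
  pattern
  constructor mk
  field
   re im : Q
 open C public

 C-ext : ∀ {u v} -> re u ~ re v -> im u ~ im v -> u ~ v
 C-ext {mk a b} {mk .a .b} refl refl = refl

 opaque
  _+c_ _*c_ : C -> C -> C
  u +c v = mk (re u + re v) (im u + im v)
  u *c v = mk (re u * re v - im u * im v) (re u * im v + im u * re v)
  -c_ cj : C -> C
  -c u = mk (- re u) (- im u)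
  cj u = mk (re u) (- im u)
  rl : Q -> C
  rl x = mk x 0#
  0c 1c i : C
  0c = mk 0# 0#
  1c = mk 1# 0#
  i = mk 0# 1#
  N : C -> Q
  N u = re u * re u + im u * im u

 private
  opaque
   unfolding Qr
   a1 : ∀ a b c d e f -> (a * c - b * d) * e - (a * d + b * c) * f ~ a * (c * e - d * f) - b * (c * f + d * e)
   a1 = auto Qr
   a2 : ∀ a b c d e f -> (a * c - b * d) * f + (a * d + b * c) * e ~ a * (c * f + d * e) + b * (c * e - d * f)
   a2 = auto Qr
   c1 : ∀ a b c d -> a * c - b * d ~ c * a - d * b
   c1 = auto Qr
   c2 : ∀ a b c d -> a * d + b * c ~ c * b + d * a
   c2 = auto Qr
   i1 : ∀ a b -> 1# * a - 0# * b ~ a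
   i1 = auto Qr
   i2 : ∀ a b -> 1# * b + 0# * a ~ b
   i2 = auto Qr
   d1 : ∀ a b c d e f -> (a + c) * e - (b + d) * f ~ (a * e - b * f) + (c * e - d * f)
   d1 = auto Qr
   d2 : ∀ a b c d e f -> (a + c) * f + (b + d) * e ~ (a * f + b * e) + (c * f + d * e)
   d2 = auto Qr
   n1 : ∀ a -> - a + a ~ 0#
   n1 = auto Qr
   r1 : ∀ x y -> x * y ~ x * y - 0# * 0#
   r1 = auto Qr
   r2 : ∀ x y -> 0# ~ x * 0# + 0# * y
   r2 = auto Qr
   j1 : ∀ a b c d -> a * c - b * d ~ a * c - (- b) * (- d)
   j1 = auto Qr
   j2 : ∀ a b c d -> - (a * d + b * c) ~ a * (- d) + (- b) * c
   j2 = auto Qr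
   j3 : ∀ a b -> - (a + b) ~ - a + - b
   j3 = auto Qr
   j4 : ∀ b -> - (- b) ~ b
   j4 = auto Qr
   j5 : - 0# ~ 0#
   j5 = refl
   k1 : ∀ a b -> a * a - b * (- b) ~ a * a + b * b
   k1 = auto Qr
   k2 : ∀ a b -> a * (- b) + b * a ~ 0#
   k2 = auto Qr
   N1 : ∀ a b c d -> (a * c - b * d) * (a * c - b * d) + (a * d + b * c) * (a * d + b * c) ~ (a * a + b * b) * (c * c + d * d)
   N1 = auto Qr
   N2 : ∀ a b -> (- a) * (- a) + (- b) * (- b) ~ a * a + b * b
   N2 = auto Qr
   N3 : ∀ a b -> a * a + (- b) * (- b) ~ a * a + b * b
   N3 = auto Qr
   N4 : ∀ a -> a * a + 0# * 0# ~ a * a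
   N4 = auto Qr
   m1 : ∀ a b c d x y n -> (x + y) * (x + y) * n ~ (a + c) * (a + c) + (b + d) * (b + d) +
    ((x * x * n - (a * a + b * b)) + (y * y * n - (c * c + d * d)) + 2# * (x * y * n - (a * c + b * d)))
   m1 = auto Qr
   m2 : ∀ a b c d -> (a * a + b * b) * (c * c + d * d) ~ (a * c + b * d) * (a * c + b * d) + (a * d - b * c) * (a * d - b * c)
   m2 = auto Qr
   q1 : 0# * 0# - 1# * 1# ~ - 1#
   q1 = refl
   q2 : 0# * 1# + 1# * 0# ~ - 0#
   q2 = refl
   m3 : ∀ x y n -> (x * x * n) * (y * y * n) ~ (x * y * n) * (x * y * n)
   m3 = auto Qr

 opaque
  unfolding _+c_
  +c-assoc : ∀ u v w -> (u +c v) +c w ~ u +c (v +c w)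
  +c-assoc u v w = ap2 mk (+-assoc (re u) (re v) (re w)) (+-assoc (im u) (im v) (im w))
  +c-comm : ∀ u v -> u +c v ~ v +c u
  +c-comm u v = ap2 mk (+-comm (re u) (re v)) (+-comm (im u) (im v))
  +c-idl : ∀ u -> 0c +c u ~ u
  +c-idl (mk a b) = ap2 mk (+-idl a) (+-idl b)
  *c-assoc : ∀ u v w -> (u *c v) *c w ~ u *c (v *c w)
  *c-assoc u v w = ap2 mk (a1 (re u) (im u) (re v) (im v) (re w) (im w)) (a2 (re u) (im u) (re v) (im v) (re w) (im w))
  *cc : ∀ u v -> u *c v ~ v *c u
  *cc u v = ap2 mk (c1 (re u) (im u) (re v) (im v)) (c2 (re u) (im u) (re v) (im v))
  *c1l : ∀ u -> 1c *c u ~ u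
  *c1l (mk a b) = ap2 mk (i1 a b) (i2 a b)
  private
   -c-inv : ∀ u -> -c u +c u ~ 0c
   -c-inv u = ap2 mk (n1 (re u)) (n1 (im u))
   *c-distʳ : ∀ w u v -> (u +c v) *c w ~ u *c w +c v *c w
   *c-distʳ w u v = ap2 mk (d1 (re u) (im u) (re v) (im v) (re w) (im w)) (d2 (re u) (im u) (re v) (im v) (re w) (im w))
  re-+ : ∀ u v -> re (u +c v) ~ re u + re v
  re-+ u v = refl
  im-+ : ∀ u v -> im (u +c v) ~ im u + im v
  im-+ u v = refl
  re-* : ∀ u v -> re (u *c v) ~ re u * re v - im u * im v
  re-* u v = refl
  im-* : ∀ u v -> im (u *c v) ~ re u * im v + im u * re v
  im-* u v = refl
  re-neg : ∀ u -> re (-c u) ~ - re u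
  re-neg u = refl
  im-neg : ∀ u -> im (-c u) ~ - im u
  im-neg u = refl
  re-cj : ∀ u -> re (cj u) ~ re u
  re-cj u = refl
  im-cj : ∀ u -> im (cj u) ~ - im u
  im-cj u = refl
  re-rl : ∀ x -> re (rl x) ~ x
  re-rl x = refl
  im-rl : ∀ x -> im (rl x) ~ 0#
  im-rl x = refl
  re-1 : re 1c ~ 1#
  re-1 = refl
  im-1 : im 1c ~ 0#
  im-1 = refl
  re-i : re i ~ 0#
  re-i = refl
  im-i : im i ~ 1#
  im-i = refl
  N-def : ∀ u -> N u ~ re u * re u + im u * im u
  N-def u = refl
  rl-0 : rl 0# ~ 0c
  rl-0 = refl
  rl-1 : rl 1# ~ 1c
  rl-1 = refl
  rl-+ : ∀ x y -> rl (x + y) ~ rl x +c rl y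
  rl-+ x y = ap (mk (x + y)) (! (+-idl 0#))
  rl-neg : ∀ x -> rl (- x) ~ -c rl x
  rl-neg x = ap (mk (- x)) (! j5)
  rl-* : ∀ x y -> rl (x * y) ~ rl x *c rl y
  rl-* x y = ap2 mk (r1 x y) (r2 x y)
  cj-+ : ∀ u v -> cj (u +c v) ~ cj u +c cj v
  cj-+ u v = ap (mk _) (j3 (im u) (im v))
  cj-neg : ∀ u -> cj (-c u) ~ -c cj u
  cj-neg u = refl
  cj-* : ∀ u v -> cj (u *c v) ~ cj u *c cj v
  cj-* u v = ap2 mk (j1 (re u) (im u) (re v) (im v)) (j2 (re u) (im u) (re v) (im v))
  cj-cj : ∀ u -> cj (cj u) ~ u
  cj-cj (mk a b) = ap (mk a) (j4 b)
  cj-rl : ∀ x -> cj (rl x) ~ rl x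
  cj-rl x = ap (mk x) j5
  cj-1 : cj 1c ~ 1c
  cj-1 = ap (mk 1#) j5
  u*cj : ∀ u -> u *c cj u ~ rl (N u)
  u*cj u = ap2 mk (k1 (re u) (im u)) (k2 (re u) (im u))
  N-* : ∀ u v -> N (u *c v) ~ N u * N v
  N-* u v = N1 (re u) (im u) (re v) (im v)
  N-neg : ∀ u -> N (-c u) ~ N u
  N-neg u = N2 (re u) (im u)
  N-cj : ∀ u -> N (cj u) ~ N u
  N-cj u = N3 (re u) (im u)
  N-rl : ∀ x -> N (rl x) ~ x * x
  N-rl x = N4 x
  N-0 : N 0c ~ 0#
  N-0 = & (N4 0#) (*-0ˡ 0#)
  N-1 : N 1c ~ 1#
  N-1 = & (N4 1#) (*1l 1#)
  N-i : N i ~ 1#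
  N-i = & (+-comm _ _) (& (N4 1#) (*1l 1#))
  i² : i *c i ~ -c 1c
  i² = ap2 mk q1 q2
  -- Minkowski's inequality in scaled form.
  mink : ∀ {x y n u v} -> 0# ≤ x -> 0# ≤ y -> 0# ≤ n -> N u ≤ x * x * n -> N v ≤ y * y * n →
   N (u +c v) ≤ (x + y) * (x + y) * n
  mink {x} {y} {n} {u} {v} px py pn pu pv =
   le ((x * x * n - N u) + (y * y * n - N v) + 2# * (x * y * n - dot))
    (nn+ (nn+ (diff pu) (diff pv)) (nn* 0≤2 (diff dot≤)))
    (m1 (re u) (im u) (re v) (im v) x y n) where
   dot : Q
   dot = re u * re v + im u * im v
   Nnn : ∀ w -> 0# ≤ N w
   Nnn w = nn+ (nnsq (re w)) (nnsq (im w))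
   dot≤ : dot ≤ x * y * n
   dot≤ = sq-cancel (nn* (nn* px py) pn)
    (<& (le _ (nnsq (re u * im v - im u * re v)) (m2 (re u) (im u) (re v) (im v)))
     (≤= (*-mono (Nnn u) pu (Nnn v) pv) (m3 x y n)))

 Cring : IsCommutativeRing _~_ _+c_ _*c_ -c_ 0c 1c
 Cring = record
  { isRing = record
   { +-isAbelianGroup = record
    { isGroup = record
     { isMonoid = record
      { isSemigroup = record
       { isMagma = record { isEquivalence = isEquivalence ; ∙-cong = ap2 _+c_ } ; assoc = +c-assoc }
      ; identity = +c-idl , \ u -> & (+c-comm u 0c) (+c-idl u) }
     ; inverse = -c-inv , \ u -> & (+c-comm u (-c u)) (-c-inv u)
     ; ⁻¹-cong = ap -c_ }
    ; comm = +c-comm }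
   ; *-cong = ap2 _*c_ ; *-assoc = *c-assoc ; *-identity = *c1l , (\ u -> & (*cc u 1c) (*c1l u))
   ; distrib = (\ w u v -> & (*cc w _) (& (*c-distʳ w u v) (ap2 _+c_ (*cc u w) (*cc v w)))) , *c-distʳ }
  ; *-comm = *cc }

 module CSolver = IntegerSolver Cring
 open CSolver using (solve; _:+_; _:*_; :-_; _:-_; _:=_; con)

 *c1r : ∀ u -> u *c 1c ~ u
 *c1r u = & (*cc u 1c) (*c1l u)

 _-c_ : C -> C -> C
 u -c v = u +c -c v

 N-nn : ∀ u -> 0# ≤ N u
 N-nn u = tr (0# ≤_) (! (N-def u)) (nn+ (nnsq (re u)) (nnsq (im u)))

 re²≤N : ∀ u -> re u * re u ≤ N u
 re²≤N u = le _ (nnsq (im u)) (N-def u)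

 im²≤N : ∀ u -> im u * im u ≤ N u
 im²≤N u = le _ (nnsq (re u)) (& (N-def u) (+-comm _ _))

 _^c_ : C -> ℕ -> C
 u ^c zero = 1c
 u ^c S n = u *c u ^c n

 ^c-+ : ∀ u m n -> u ^c (m N.+ n) ~ u ^c m *c u ^c n
 ^c-+ u zero n = ! (*c1l _)
 ^c-+ u (S m) n = & (ap (u *c_) (^c-+ u m n)) (! (*c-assoc u _ _))

 1^c : ∀ n -> 1c ^c n ~ 1c
 1^c zero = refl
 1^c (S n) = & (*c1l _) (1^c n)

 *c-^ : ∀ u v n -> (u *c v) ^c n ~ u ^c n *c v ^c n
 *c-^ u v zero = ! (*c1l 1c)
 *c-^ u v (S n) = & (ap (u *c v *c_) (*c-^ u v n)) (eq u v (u ^c n) (v ^c n)) where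
  eq = solve 4 (\ a b c d -> a :* b :* (c :* d) := a :* c :* (b :* d)) refl

 ^c-^ : ∀ u m n -> u ^c (m N.* n) ~ (u ^c n) ^c m
 ^c-^ u zero n = refl
 ^c-^ u (S m) n = & (^c-+ u n (m N.* n)) (ap (u ^c n *c_) (^c-^ u m n))

 N-^ : ∀ u n -> N (u ^c n) ~ N u ^ n
 N-^ u zero = N-1
 N-^ u (S n) = & (N-* u (u ^c n)) (ap (N u *_) (N-^ u n))

 cj-^ : ∀ u n -> cj (u ^c n) ~ cj u ^c n
 cj-^ u zero = cj-1
 cj-^ u (S n) = & (cj-* u _) (ap (cj u *c_) (cj-^ u n))

 rl-^ : ∀ x n -> rl (x ^ n) ~ rl x ^c n
 rl-^ x zero = rl-1
 rl-^ x (S n) = & (rl-* x _) (ap (rl x *c_) (rl-^ x n))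

 module ΣC = Fold _+c_ 0c +c-assoc +c-comm +c-idl
 module ΠC = Fold _*c_ 1c *c-assoc *cc *c1l

 sumc prodc : ℕ -> (ℕ -> C) -> C
 sumc = ΣC.fold
 prodc = ΠC.fold

 N-prod : ∀ n f -> N (prodc n f) ~ prod n (\ k -> N (f k))
 N-prod zero f = N-1
 N-prod (S n) f = & (N-* _ (f n)) (ap (_* N (f n)) (N-prod n f))

 rl-prod : ∀ n f -> rl (prod n f) ~ prodc n (\ k -> rl (f k))
 rl-prod zero f = rl-1
 rl-prod (S n) f = & (rl-* _ _) (ap (_*c rl (f n)) (rl-prod n f))

 rl-sum : ∀ n f -> rl (sum n f) ~ sumc n (\ k -> rl (f k))
 rl-sum zero f = rl-0
 rl-sum (S n) f = & (rl-+ _ _) (ap (_+c rl (f n)) (rl-sum n f))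

 cj-prod : ∀ n f -> cj (prodc n f) ~ prodc n (\ k -> cj (f k))
 cj-prod n f = ΠC.fold-hom n f cj cj-1 cj-*

 prodc-^ : ∀ n f c -> prodc n (\ k -> f k ^c c) ~ prodc n f ^c c
 prodc-^ n f c = ! (ΠC.fold-hom n f (_^c c) (1^c c) (\ x y -> *c-^ x y c))

 *c-distˡ : ∀ u v w -> u *c (v +c w) ~ u *c v +c u *c w
 *c-distˡ = fst (IsCommutativeRing.distrib Cring)
 *c-0ʳ : ∀ u -> u *c 0c ~ 0c
 *c-0ʳ = IsCommutativeRing.zeroʳ Cring
 *c-0ˡ : ∀ u -> 0c *c u ~ 0c
 *c-0ˡ = IsCommutativeRing.zeroˡ Cring
 u-u : ∀ u -> u -c u ~ 0c
 u-u = IsCommutativeRing.-‿inverseʳ Cring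
 swap-c : ∀ u v -> u -c v ~ -c (v -c u)
 swap-c = solve 2 (\ u v -> u :- v := :- (v :- u)) refl
 u-v+v : ∀ u v -> u -c v +c v ~ u
 u-v+v = solve 2 (\ u v -> u :- v :+ v := u) refl
 chain-c : ∀ u v w -> u -c w ~ (u -c v) +c (v -c w)
 chain-c = solve 3 (\ u v w -> u :- w := (u :- v) :+ (v :- w)) refl

 sumc-*ˡ : ∀ n c f -> sumc n (\ k -> c *c f k) ~ c *c sumc n f
 sumc-*ˡ n c f = ! (ΣC.fold-hom n f (c *c_) (*c-0ʳ c) (*c-distˡ c))

 infix 4 _<<_
 _<<_ : C -> Q -> Set
 u << x = 0# ≤ x × N u ≤ x * x

 <<m : ∀ {u x y} -> u << x -> x ≤ y -> u << y
 <<m (p , q) l = <& p l , <& q (sq-mono p l)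

 <<-+ : ∀ {u v x y} -> u << x -> v << y -> u +c v << x + y
 <<-+ {u} {v} {x} {y} (p , q) (r , s) = nn+ p r , tr (N (u +c v) ≤_) (*1r _)
  (mink p r 0≤1 (tr (N u ≤_) (! (*1r _)) q) (tr (N v ≤_) (! (*1r _)) s))

 <<-neg : ∀ {u x} -> u << x -> -c u << x
 <<-neg {u} (p , q) = p , tr (_≤ _) (! (N-neg u)) q

 <<-cj : ∀ {u x} -> u << x -> cj u << x
 <<-cj {u} (p , q) = p , tr (_≤ _) (! (N-cj u)) q

 <<-- : ∀ {u v x y} -> u << x -> v << y -> u -c v << x + y
 <<-- p q = <<-+ p (<<-neg q)

 swap* : ∀ a b c d -> a * b * (c * d) ~ a * c * (b * d)
 swap* = eq where
  opaque
   unfolding Qr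
   eq : ∀ a b c d -> a * b * (c * d) ~ a * c * (b * d)
   eq = auto Qr

 <<-* : ∀ {u v x y} -> u << x -> v << y -> u *c v << x * y
 <<-* {u} {v} {x} {y} (p , q) (r , s) = nn* p r , tr2 _≤_ (! (N-* u v)) (swap* x x y y) (*-mono (N-nn u) q (N-nn v) s)

 <<-rl : ∀ {x} -> 0# ≤ x -> rl x << x
 <<-rl {x} p = p , ≤r (N-rl x)

 <<-0 : ∀ {x} -> 0# ≤ x -> 0c << x
 <<-0 {x} p = p , tr (_≤ x * x) (! N-0) (nnsq x)

 <<-unit : ∀ {u} -> N u ~ 1# -> u << 1#
 <<-unit p = 0≤1 , ≤r (& p (! (*1r 1#)))

 <<-1 : 1c << 1#
 <<-1 = <<-unit N-1

 <<-^ : ∀ {u x} n -> u << x -> u ^c n << x ^ n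
 <<-^ zero p = <<-1
 <<-^ (S n) p = <<-* p (<<-^ n p)

 <<-sum : ∀ n {f x} -> (∀ k -> k N.< n -> f k << x k) -> sumc n f << sum n x
 <<-sum zero h = <<-0 r≤
 <<-sum (S n) h = <<-+ (<<-sum n \ k l -> h k (m<n⇒m<1+n l)) (h n NP.≤-refl)

 <<-re : ∀ {u x} -> u << x -> re u ≤ x
 <<-re {u} (p , q) = sq-cancel p (<& (re²≤N u) q)

 <<-im : ∀ {u x} -> u << x -> im u ≤ x
 <<-im {u} (p , q) = sq-cancel p (<& (im²≤N u) q)

 <<-swap : ∀ {u v x} -> u -c v << x -> v -c u << x
 <<-swap {u} {v} {x} p = tr (_<< x) (! (swap-c v u)) (<<-neg p)

 <<-chain : ∀ {u v w x y} -> u -c v << x -> v -c w << y -> u -c w << x + y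
 <<-chain {u} {v} {w} p q = tr (_<< _) (! (chain-c u v w)) (<<-+ p q)

 N-pos-<< : ∀ {u x} -> u << x -> N u ≤ x * x
 N-pos-<< = snd

 Rel : C -> C -> Q -> Set
 Rel u w x = 0# ≤ x × N (u -c w) ≤ x * x * N w

 rel-refl : ∀ u {x} -> 0# ≤ x -> Rel u u x
 rel-refl u {x} p = p , tr (_≤ x * x * N u) (! (& (ap N (u-u u)) N-0)) (nn* (nnsq x) (N-nn u))

 rel-mono : ∀ {u w x y} -> x ≤ y -> Rel u w x -> Rel u w y
 rel-mono {w = w} l (p , q) = <& p l , <& q (*r (N-nn w) (sq-mono p l))

 rel-N : ∀ {u w x} -> Rel u w x -> N u ≤ (x + 1#) * (x + 1#) * N w
 rel-N {u} {w} (p , q) = tr (_≤ _) (ap N (u-v+v u w))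
  (mink p 0≤1 (N-nn w) q (≤r (! (& (ap (_* N w) (*1r 1#)) (*1l _)))))

 rel-* : ∀ {u w x u' w' x'} -> Rel u w x -> Rel u' w' x' -> Rel (u *c u') (w *c w') (x * x' + x + x')
 rel-* {u} {w} {x} {u'} {w'} {x'} (p , q) (p' , q') = nn+ (nn+ (nn* p p') p) p' ,
  tr2 _≤_ (ap N (! (eq u w u' w'))) (ap ((x * x' + x + x') * (x * x' + x + x') *_) (! (N-* w w')))
  (mink (nn+ (nn* p p') p) p' nn
   (mink (nn* p p') p nn
    (tr2 _≤_ (! (N-* _ _)) (e1 x x' (N w) (N w')) (*-mono (N-nn _) q (N-nn _) q'))
    (tr2 _≤_ (! (N-* _ _)) *a (*r (N-nn w') q)))
   (tr2 _≤_ (! (N-* _ _)) (e2 x' (N w) (N w')) (*l (N-nn w) q'))) where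
  nn = nn* (N-nn w) (N-nn w')
  eq = solve 4 (\ u w u' w' -> u :* u' :- w :* w' := (u :- w) :* (u' :- w') :+ (u :- w) :* w' :+ w :* (u' :- w')) refl
  opaque
   unfolding Qr
   e1 : ∀ x y a b -> x * x * a * (y * y * b) ~ x * y * (x * y) * (a * b)
   e1 = auto Qr
   e2 : ∀ y a b -> a * (y * y * b) ~ y * y * (a * b)
   e2 = auto Qr

 rel-trans : ∀ {u v w x y} -> Rel u v x -> Rel v w y -> Rel u w (x * (y + 1#) + y)
 rel-trans {u} {v} {w} {x} {y} (p , q) r@(p' , q') = nn+ p1 p' , tr (_≤ _) (ap N (! (chain-c u v w)))
  (mink p1 p' (N-nn w) (<& q (≤= (*l (nnsq x) (rel-N r)) (eq x (y + 1#) (N w)))) q') where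
  p1 = nn* p (nn+ p' 0≤1)
  opaque
   unfolding Qr
   eq : ∀ x y n -> x * x * (y * y * n) ~ x * y * (x * y) * n
   eq = auto Qr

 rel-sym : ∀ {u w x} -> 2# * x ≤ 1# -> Rel u w x -> Rel w u (2# * x)
 rel-sym {u} {w} {x} l (p , q) = nn* 0≤2 p , <& (tr (_≤ x * x * N w) (& (! (N-neg _)) (ap N (! (swap-c w u)))) q)
  (≤= (*l (nnsq x) w≤) (e1 x (N u))) where
  opaque
   unfolding Qr
   e1 : ∀ x n -> x * x * (4# * n) ~ 2# * x * (2# * x) * n
   e1 = auto Qr
   e2 : ∀ n m k -> 4# * m ~ n + (2# * (2# * k + 2# * m - n) + (n - 4# * k))
   e2 = auto Qr
   e3 : ∀ a b c d -> 2# * ((a - c) * (a - c) + (b - d) * (b - d)) + 2# * (a * a + b * b) - (c * c + d * d)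
    ~ (2# * a - c) * (2# * a - c) + (2# * b - d) * (2# * b - d)
   e3 = auto Qr
   e4 : ∀ x n -> n - 4# * (x * x * n) ~ (1# - (2# * x) * (2# * x)) * n
   e4 = auto Qr
  k = N (u -c w)
  h : 0# ≤ 2# * k + 2# * N u - N w
  h = tr (0# ≤_) (! (& (ap2 _-_ (ap2 (\ s t -> 2# * s + 2# * t) (& (N-def _) (ap2 (\ s t -> s * s + t * t)
   (& (re-+ u _) (ap (re u +_) (re-neg w))) (& (im-+ u _) (ap (im u +_) (im-neg w))))) (N-def u)) (N-def w))
   (e3 (re u) (im u) (re w) (im w)))) (nn+ (nnsq _) (nnsq _))
  w≤ : N w ≤ 4# * N u
  w≤ = le _ (nn+ (nn* 0≤2 h) (<& (tr (0# ≤_) (! (e4 x (N w))) (nn* (diff (tr (2# * x * (2# * x) ≤_) (*1r 1#) (sq-mono (nn* 0≤2 p) l))) (N-nn w)))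
   (+m r≤ (neg-≤ (*l 0≤4 q))))) (e2 (N w) (N u) k) where
   neg-≤ : ∀ {a b} -> a ≤ b -> - b ≤ - a
   neg-≤ {a} {b} p = le (b - a) (diff p) (e a b) where
    opaque
     unfolding Qr
     e : ∀ a b -> - a ~ - b + (b - a)
     e = auto Qr

 rel-cancel : ∀ {u w z x} -> 0# < N z -> Rel (u *c z) (w *c z) x -> Rel u w x
 rel-cancel {u} {w} {z} {x} l (p , q) = p , *x l (tr2 _≤_ (& (ap N (eq u w z)) (N-* _ _))
  (& (ap (x * x *_) (N-* w z)) (e2 (x * x) (N w) (N z))) q) where
  eq = solve 3 (\ u w z -> u :* z :- w :* z := z :* (u :- w)) refl
  opaque
   unfolding Qr
   e2 : ∀ x a b -> x * (a * b) ~ b * (x * a)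
   e2 = auto Qr

 rel-prod' : ∀ n {u w : ℕ -> C} {x : ℕ -> Q} -> (∀ k -> k N.< n -> Rel (u k) (w k) (x k)) -> Rel (prodc n u) (prodc n w) (prod n (\ k -> 1# + x k) - 1#)
 rel-prod' zero h = rel-refl 1c (≤r (! (+-inv 1#)))
 rel-prod' (S n) {u} {w} {x} h = tr (Rel _ _) (eq (prod n (\ k -> 1# + x k)) (x n))
  (rel-* (rel-prod' n \ k l -> h k (m<n⇒m<1+n l)) (h n NP.≤-refl)) where
  opaque
   unfolding Qr
   eq : ∀ p x -> (p - 1#) * x + (p - 1#) + x ~ p * (1# + x) - 1#
   eq = auto Qr

 rel-prod : ∀ n {u w : ℕ -> C} {x : ℕ -> Q} {y} -> (∀ k -> 0# ≤ x k) -> (∀ k -> k N.< n -> Rel (u k) (w k) (x k)) →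
  sum n x ≤ y -> 2# * y ≤ 1# -> Rel (prodc n u) (prodc n w) (2# * y)
 rel-prod n {u} {w} {x} {y} p h q l = rel-mono (undiff (tr (0# ≤_) (eq _ (2# * y)) (diff (<& (prod1+ n p (<& (*l 0≤2 q) l))
  (+m r≤ (*l 0≤2 q)))))) (rel-prod' n h) where
  opaque
   unfolding Qr
   eq : ∀ a b -> 1# + b - a ~ b - (a - 1#)
   eq = auto Qr

 rel-cj : ∀ {u w x} -> Rel u w x -> Rel (cj u) (cj w) x
 rel-cj {u} {w} {x} (p , q) = p , tr2 _≤_ (& (! (N-cj _)) (ap N (& (cj-+ u _) (ap (cj u +c_) (cj-neg w)))))
  (ap (x * x *_) (! (N-cj w))) q

module Interpolation where
 open Rationals
 open Gauss
 open CSolver using (solve; _:+_; _:*_; :-_; _:-_; _:=_)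

 opaque
  unfolding Qr
  #c1 : ∀ c i ε -> c * ((2# * (1# + i) * ε) * (2# * (1# + i) * ε)) ~ 4# * (ε * ε) * (c * i) + (4# * (ε * ε) * (c + c * i + c * i * i))
  #c1 = auto Qr
  #c2 : ∀ ε -> (ε + ε) * (ε + ε) ~ 4# * (ε * ε)
  #c2 = auto Qr
  #c3 : ∀ M e ε -> M * (2# * e * ε) ~ M * (2# * e) * ε
  #c3 = auto Qr
  #c4 : ∀ X b ε -> ((X + b * X) + 1#) * ε ~ X * ε + b * (X * ε) + ε
  #c4 = auto Qr
  #c5 : ∀ X b ε -> ((X + b * X) + 1#) * ε ~ ε + b * (X * ε) + X * ε
  #c5 = auto Qr


 evalP : List C -> C -> C
 evalP [] s = 0c
 evalP (c ∷ cs) s = c +c s *c evalP cs s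

 quot : List C -> C -> List C
 quot [] p = []
 quot (c ∷ cs) p = evalP (c ∷ cs) p ∷ quot cs p

 quot-length : ∀ cs p -> length (quot cs p) ~ length cs
 quot-length [] p = refl
 quot-length (c ∷ cs) p = ap S (quot-length cs p)

 quot-eval : ∀ cs p s -> s *c evalP cs s -c p *c evalP cs p ~ (s -c p) *c evalP (quot cs p) s
 quot-eval [] p s = & (ap2 _-c_ (*c-0ʳ s) (*c-0ʳ p)) (& (u-u 0c) (! (*c-0ʳ (s -c p))))
 quot-eval (c ∷ cs) p s = & (e1 s p c (evalP cs s) (evalP cs p))
  (& (ap (\ x -> (s -c p) *c (c +c p *c evalP cs p) +c s *c x) (quot-eval cs p s))
   (e2 s p (c +c p *c evalP cs p) (evalP (quot cs p) s))) where
  e1 = solve 5 (\ s p c x y -> s :* (c :+ s :* x) :- p :* (c :+ p :* y) := (s :- p) :* (c :+ p :* y) :+ s :* (s :* x :- p :* y)) refl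
  e2 = solve 4 (\ s p h e -> (s :- p) :* h :+ s :* ((s :- p) :* e) := (s :- p) :* (h :+ s :* e)) refl

 evalP-at-quot : ∀ cs p {x} -> 0# ≤ x -> All (_<< x) (quot cs p) -> evalP cs p << x
 evalP-at-quot [] p z _ = <<-0 z
 evalP-at-quot (c ∷ cs) p z (q ∷ _) = q

 quot-bound : ∀ cs p {x b} -> 0# ≤ x -> p << b -> All (_<< x) (quot cs p) -> All (_<< x + b * x) cs
 quot-bound [] p z pb _ = []
 quot-bound (c ∷ cs) p z pb (q ∷ qs) =
  tr (_<< _) (e c (p *c evalP cs p)) (<<-- q (<<-* pb (evalP-at-quot cs p z qs))) ∷ quot-bound cs p z pb qs where
  e = solve 2 (\ c y -> c :+ y :- y := c) refl

 lagrange : ∀ K c b -> 0# < c -> 0# ≤ b -> ∃ \ M -> 0# ≤ M ×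
  (∀ F (pts : ℕ -> C) ε -> length F N.≤ K -> 0# ≤ ε -> (∀ k -> k N.< K -> pts k << b) →
   (∀ j k -> j N.< k -> k N.< K -> c ≤ N (pts k -c pts j)) →
   (∀ k -> k N.< K -> evalP F (pts k) << ε) -> All (_<< M * ε) F)
 lagrange zero c b c>0 b≥0 = 0# , r≤ , \ { [] _ _ _ _ _ _ _ -> [] }
 lagrange (S K) c b c>0 b≥0 with lagrange K c b c>0 b≥0
 ... | M , M0 , IH = M' , M'0 , go where
  e = 1# + inv c
  e0 : 0# ≤ e
  e0 = nn+ 0≤1 (inv-nn c>0)
  X = M * (2# * e)
  X0 : 0# ≤ X
  X0 = nn* M0 (nn* 0≤2 e0)
  M' = (X + b * X) + 1#
  M'0 : 0# ≤ M'
  M'0 = nn+ (nn+ X0 (nn* b≥0 X0)) 0≤1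
  go : ∀ F (pts : ℕ -> C) ε -> length F N.≤ S K -> 0# ≤ ε -> (∀ k -> k N.< S K -> pts k << b) →
   (∀ j k -> j N.< k -> k N.< S K -> c ≤ N (pts k -c pts j)) →
   (∀ k -> k N.< S K -> evalP F (pts k) << ε) -> All (_<< M' * ε) F
  go [] pts ε _ _ _ _ _ = []
  go (c0 ∷ cs) pts ε (s≤s l) ε≥0 pb sep small =
   <<m c0<< (le _ (nn* X0 ε≥0) (#c5 X b ε)) ∷ widen (quot-bound cs p xε (pb 0 z<s) qs) where
   p = pts 0
   xε : 0# ≤ X * ε
   xε = nn* X0 ε≥0
   small-q : ∀ k -> k N.< K -> evalP (quot cs p) (pts (S k)) << 2# * e * ε
   small-q k l' = nn* (nn* 0≤2 e0) ε≥0 , *x c>0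
    (<& (*r (N-nn _) (sep 0 (S k) z<s (s≤s l')))
     (=≤ (& (! (N-* _ _)) (ap N (& (! (quot-eval cs p (pts (S k))))
      (e6 c0 (pts (S k) *c evalP cs (pts (S k))) (p *c evalP cs p)))))
      (<& (snd (<<-- (small (S k) (s≤s l')) (small 0 z<s)))
       (le _ (nn* (nn* 0≤4 (nnsq ε)) (nn+ (nn+ (lt c>0) (nn* (lt c>0) (inv-nn c>0))) (nn* (nn* (lt c>0) (inv-nn c>0)) (inv-nn c>0))))
        (& (#c1 c (inv c) ε) (ap (_+ 4# * (ε * ε) * (c + c * inv c + c * inv c * inv c)) (& (& (ap (4# * (ε * ε) *_) (inv-r c>0)) (*1r _)) (! (#c2 ε))))))))) where
    e6 = solve 3 (\ c x y -> x :- y := (c :+ x) :- (c :+ y)) refl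
   qs : All (_<< X * ε) (quot cs p)
   qs = tr (\ y -> All (_<< y) (quot cs p)) (#c3 M e ε)
    (IH (quot cs p) (\ k -> pts (S k)) (2# * e * ε) (tr (N._≤ K) (! (quot-length cs p)) l) (nn* (nn* 0≤2 e0) ε≥0)
     (\ k l' -> pb (S k) (s≤s l')) (\ j k q r -> sep (S j) (S k) (s≤s q) (s≤s r)) small-q)
   c0<< : c0 << ε + b * (X * ε)
   c0<< = tr (_<< _) (e7 c0 (p *c evalP cs p)) (<<-- (small 0 z<s) (<<-* (pb 0 z<s) (evalP-at-quot cs p xε qs))) where
    e7 = solve 2 (\ c y -> c :+ y :- y := c) refl
   widen : ∀ {xs} -> All (_<< X * ε + b * (X * ε)) xs -> All (_<< M' * ε) xs
   widen [] = []
   widen (x ∷ xs) = <<m x (le ε ε≥0 (#c4 X b ε)) ∷ widen xs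

module Roots where
 open Rationals
 open Gauss
 open CSolver using (solve; _:+_; _:*_; :-_; _:-_; _:=_; con)
 open Z using (ℤ)
 open import Data.Nat.DivMod using (_/_; _%_; m≡m%n+[m/n]*n; m/n*n≤m; m%n<n)

 opaque
  unfolding Qr
  #d1 : ∀ y n -> y + n * y ~ (1# + n) * y
  #d1 = auto Qr
  #d3 : ∀ n s -> (1# + n) * s ~ s + n * s
  #d3 = auto Qr
  #d4 : ∀ a -> a - 0# ~ a
  #d4 = auto Qr
  #d5 : ∀ a e j -> a * (e * j) ~ e * (a * j)
  #d5 = auto Qr
  #d6 : ∀ k q j -> k * (q * (2# * j) + 2# * (2# * j)) ~ (q + 2#) * 2# * (k * j)
  #d6 = auto Qr
  #d9 : ∀ e -> 4# * e + 4# * e ~ 4# * 2# * e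
  #d9 = auto Qr
  #d10 : ∀ a b -> a ~ (a - b) + b
  #d10 = auto Qr
  #d11 : ∀ a b -> a - b ~ - b - - a
  #d11 = auto Qr
  #d14 : ∀ e -> (e + e) + (e + e) ~ 4# * e
  #d14 = auto Qr
  #d16 : ∀ e -> 2# * (e + e) ~ 4# * e
  #d16 = auto Qr
  #d18 : ∀ b -> 0# ~ - b + b
  #d18 = auto Qr
  #d19 : ∀ a b -> 0# * a - 1# * b ~ - b
  #d19 = auto Qr

 #d2 : ∀ u v -> (1c -c u) +c u *c (1c -c v) ~ 1c -c u *c v
 #d2 = solve 2 (\ u v -> (con (Z.+ 1) :- u) :+ u :* (con (Z.+ 1) :- v) := con (Z.+ 1) :- u :* v) refl
 #d7 : ∀ v b -> b *c (1c -c v) ~ b -c v *c b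
 #d7 = solve 2 (\ v b -> b :* (con (Z.+ 1) :- v) := b :- v :* b) refl
 #d8 : ∀ a b -> a *c (1c -c b) ~ a -c a *c b
 #d8 = solve 2 (\ a b -> a :* (con (Z.+ 1) :- b) := a :- a :* b) refl
 #d12 : ∀ u -> -c (-c u) ~ u
 #d12 = solve 1 (\ u -> :- (:- u) := u) refl
 #d13 : ∀ u i -> u *c (u -c i) +c i *c (u -c i) ~ u *c u +c -c (i *c i)
 #d13 = solve 2 (\ u i -> u :* (u :- i) :+ i :* (u :- i) := u :* u :+ :- (i :* i)) refl
 #d15 : ∀ u -> u *c (u +c 1c) -c (u +c 1c) ~ u *c u -c 1c
 #d15 = solve 1 (\ u -> u :* (u :+ con (Z.+ 1)) :- (u :+ con (Z.+ 1)) := u :* u :- con (Z.+ 1)) refl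
 #d17 : ∀ u w z -> u *c z ~ (u -c w) *c z +c w *c z
 #d17 = solve 3 (\ u w z -> u :* z := (u :- w) :* z :+ w :* z) refl
 #d20 : ∀ u -> -c 1c *c u ~ -c u
 #d20 = solve 1 (\ u -> :- con (Z.+ 1) :* u := :- u) refl
 #d21 : ∀ a b -> 1c -c b ~ (1c -c a *c b) +c b *c (-c (1c -c a))
 #d21 = solve 2 (\ a b -> con (Z.+ 1) :- b := (con (Z.+ 1) :- a :* b) :+ b :* (:- (con (Z.+ 1) :- a))) refl


 unit-^ : ∀ {u} n -> N u ~ 1# -> N (u ^c n) ~ 1#
 unit-^ {u} n p = & (N-^ u n) (& (ap (_^ n) p) (^-1 n))

 cj-unit : ∀ {u} -> N u ~ 1# -> u *c cj u ~ 1c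
 cj-unit {u} p = & (u*cj u) (& (ap rl p) rl-1)

 <<-unit* : ∀ {u v x} -> N u ~ 1# -> v << x -> u *c v << x
 <<-unit* {u} {v} p q = tr (_ <<_) (*1l _) (<<-* (<<-unit p) q)

 <<-unit*⁻ : ∀ {u v x} -> N u ~ 1# -> u *c v << x -> v << x
 <<-unit*⁻ {u} {v} p (q , r) = q , tr (_≤ _) (& (N-* u v) (& (ap (_* N v) p) (*1l _))) r

 private
  opaque
   unfolding Qr
   t₁ : ∀ a b c d -> 2# * ((a * a + b * b) + (c * c + d * d)) ~ ((a + c) * (a + c) + (b + d) * (b + d)) + ((a - c) * (a - c) + (b - d) * (b - d))
   t₁ = auto Qr
   t₂ : ∀ a b o z -> (o - a) * (o - a) + (z - b) * (z - b) ~ o * o - 2# * (o * a) + z * z - 2# * (z * b) + (a * a + b * b)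
   t₂ = auto Qr
   t3 : ∀ a n -> 1# * 1# - 2# * (1# * a) + 0# * 0# - 2# * (0# * n) + 1# ~ 2# * (1# - a)
   t3 = auto Qr

 opaque
  unfolding _+c_
  N-tri : ∀ u v -> N (u +c v) ≤ 2# * (N u + N v)
  N-tri u v = le _ (nn+ (nnsq (re u - re v)) (nnsq (im u - im v))) (t₁ (re u) (im u) (re v) (im v))
  N-1-unit : ∀ {u} -> N u ~ 1# -> N (1c -c u) ~ 2# * (1# - re u)
  N-1-unit {u} p = & (t₂ (re u) (im u) 1# 0#) (& (ap (1# * 1# - 2# * (1# * re u) + 0# * 0# - 2# * (0# * im u) +_) p) (t3 (re u) (im u)))

 1-^-bound : ∀ {u y} n -> N u ~ 1# -> 1c -c u << y -> 1c -c u ^c n << ι n * y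
 1-^-bound {u} {y} zero p q = tr2 _<<_ (! (u-u 1c)) (! (*-0ˡ y)) (<<-0 r≤)
 1-^-bound {u} {y} (S n) p q = tr2 _<<_ (#d2 u (u ^c n)) (#d1 y (ι n))
  (<<-+ q (<<-unit* p (1-^-bound n p q)))

 FirstQuadrant : C -> Set
 FirstQuadrant u = 0# ≤ re u × 0# ≤ im u

 1-quadrant : FirstQuadrant 1c
 1-quadrant = tr (0# ≤_) (! re-1) 0≤1 , ≤r (! im-1)

 re≤1 : ∀ {u} -> N u ~ 1# -> re u ≤ 1#
 re≤1 p = <<-re (<<-unit p)

 im≤1 : ∀ {u} -> N u ~ 1# -> im u ≤ 1#
 im≤1 p = <<-im (<<-unit p)

 -- Walking along the circle in small steps until the imaginary axis is crossed.
 module Walk (v : C) (Nv : N v ~ 1#) (re≥0 : 0# ≤ re v) (im>0 : 0# < im v) where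
  σ = im v
  State : ℕ -> Set
  State m = (∀ x -> x N.≤ S m -> FirstQuadrant (v ^c x)) × σ ≤ im (v ^c S m) × re (v ^c S m) + ι m * (σ * σ) ≤ 1#
  Found : Set
  Found = ∃ \ J -> (∀ x -> x N.≤ J -> FirstQuadrant (v ^c x)) × re (v ^c S J) ≤ 0#
  private
   opaque
    unfolding Qr
    e1 : ∀ c s a b -> b * (c * c + s * s) ~ (c * b + s * a) * c - (c * a - s * b) * s
    e1 = auto Qr
    e2 : ∀ x y -> y ~ (y - x) + x
    e2 = auto Qr
    e3 : ∀ a c s b k -> a + k * (s * s) ~ ((c * a - s * b) + (1# + k) * (s * s)) + ((1# - c) * a + s * (b - s))
    e3 = auto Qr
  start : State 0
  start = (\ { zero _ -> 1-quadrant ; (S zero) _ -> tr FirstQuadrant (! (*c1r v)) (re≥0 , lt im>0) ; (S (S _)) (s≤s ()) })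
   , ≤r (ap im (! (*c1r v)))
   , =≤ (& (ap2 _+_ (ap re (*c1r v)) (*-0ˡ _)) (+-idr _)) (re≤1 Nv)
  step : ∀ m -> State m -> re (v ^c S (S m)) ≤ 0# ⊎ State (S m)
  step m (good , s , r) with ≤-total (re (v ^c S (S m))) 0#
  ... | inl p = inl p
  ... | inr p = inr (good' , <& s im-up , <& (le _ (nn+ (nn* (diff (re≤1 Nv)) (fst g)) (nn* (lt im>0) (diff s)))
   (& (e3 a c σ b (ι m)) (ap (\ z -> (z + (1# + ι m) * (σ * σ)) + ((1# - c) * a + σ * (b - σ))) (! (re-* v w))))) r) where
   w = v ^c S m
   a = re w
   b = im w
   c = re v
   g = good (S m) NP.≤-refl
   im≥0 : 0# ≤ im (v *c w)
   im≥0 = tr (0# ≤_) (! (im-* v w)) (nn+ (nn* re≥0 (snd g)) (nn* (lt im>0) (fst g)))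
   im-up : b ≤ im (v *c w)
   im-up = <& (le _ (nn* p (lt im>0)) (& (e2 (re (v *c w) * σ) (im (v *c w) * c)) (ap (_+ re (v *c w) * σ)
    (& (ap2 (\ x y -> x * c - y * σ) (im-* v w) (re-* v w)) (& (! (e1 c σ a b))
    (& (ap (b *_) (& (! (N-def v)) Nv)) (*1r b)))))))
    (≤= (*l im≥0 (re≤1 Nv)) (*1r _))
   good' : ∀ x -> x N.≤ S (S m) -> FirstQuadrant (v ^c x)
   good' x l with x ≟ S (S m)
   ... | yes refl = p , im≥0
   ... | no ne = good x (s≤s⁻¹ (≤∧≢⇒< l ne))
  run : ∀ n -> Found ⊎ State n
  run zero = inr start
  run (S n) with run n
  ... | inl f = inl f
  ... | inr st with step n st
  ...   | inl p = inl (S n , fst st , p)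
  ...   | inr st' = inr st'
  found : Found
  found with arch (inv (σ * σ))
  ... | n , p with run (S n)
  ...   | inl f = f
  ...   | inr (good , _ , r) = abort (σ² (+-cancelr {z = 1#} (<& (+m (r≤ {σ * σ})
   (=≤ (! (inv-r σ²)) (≤= (*l (lt σ²) p) (*-comm _ _))))
   (=≤ (! (#d3 (ι n) (σ * σ))) (≤= (<& (y≤x+y (fst (good _ NP.≤-refl))) r) (! (+-idl 1#))))))) where
   σ² : 0# < σ * σ
   σ² = pp* im>0 im>0

 private
  opaque
   unfolding Qr
   f1 : ∀ k p -> (k * k - 1#) * p * ((k * k - 1#) * p) + (k + k) * p * ((k + k) * p) ~ ((k * k + 1#) * p) * ((k * k + 1#) * p)
   f1 = auto Qr
   f2 : ∀ k p -> 2# * (1# - (k * k - 1#) * p) ~ 2# * (1# - (k * k + 1#) * p) + 4# * p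
   f2 = auto Qr
   f3 : ∀ k q -> (k * k + 1#) * (q * q) ~ (k * q) * (k * q) + q * q
   f3 = auto Qr
   f4 : ∀ p -> 2# * (1# - 1#) + 4# * p ~ 4# * p
   f4 = auto Qr
   f5 : ∀ q -> 4# * (q * q) ~ 2# * q * (2# * q)
   f5 = auto Qr
   f6 : ∀ a b -> a * a + (b - 1#) * (b - 1#) ~ 2# * (1# - b) + ((a * a + b * b) - 1#)
   f6 = auto Qr
   f7 : ∀ a b y -> y * y ~ 1# - b + ((y * y - a * a) + (b - b * b) + ((a * a + b * b) - 1#))
   f7 = auto Qr
   f8 : ∀ y -> 2# * y * (2# * y) ~ 2# * (y * y) + 2# * (y * y)
   f8 = auto Qr

 -- The unit (k + i)² / (k² + 1).
 small-unit : ∀ K -> 1 N.≤ K -> ∃ \ v -> N v ~ 1# × 0# ≤ re v × 0# < im v × (1c -c v << 2# * inv (ι K))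
 small-unit K K≥1 = v , Nv , nn* (diff k²≥1) (inv-nn D>0) , pp* (pp+ k>0 (lt k>0)) (inv-pos D>0) ,
  nn* 0≤2 (inv-nn k>0) , =≤ (& (N-1-unit Nv) (& (f2 k p) (& (ap (\ z -> 2# * (1# - z) + 4# * p) Dp) (f4 p))))
   (≤= (*l 0≤4 pk≤) (f5 (inv k))) where
  k = ι K
  k>0 = ι-pos K≥1
  k²≥1 : 1# ≤ k * k
  k²≥1 = tr (_≤ k * k) (*1r 1#) (sq-mono 0≤1 (1≤ι K≥1))
  D>0 : 0# < k * k + 1#
  D>0 = pp+ (pp* k>0 k>0) 0≤1
  p = inv (k * k + 1#)
  Dp : (k * k + 1#) * p ~ 1#
  Dp = inv-r D>0
  v = mk ((k * k - 1#) * p) ((k + k) * p)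
  Nv : N v ~ 1#
  Nv = & (N-def v) (& (f1 k p) (& (ap2 _*_ Dp Dp) (*1r 1#)))
  pk≤ : p ≤ inv k * inv k
  pk≤ = *x D>0 (tr2 _≤_ (! Dp) (! (& (f3 k (inv k)) (ap (_+ inv k * inv k) (& (ap2 _*_ (inv-r k>0) (inv-r k>0)) (*1r 1#)))))
   (x≤x+y (nnsq (inv k))))

 near-i : ∀ {u y} -> N u ~ 1# -> 0# ≤ im u -> 0# ≤ re u -> re u ≤ y -> u -c i << 2# * y
 near-i {u} {y} Nu p0 q0 q = nn* 0≤2 y≥0 , =≤ eqn
  (<& (*l 0≤2 (le _ (nn+ (nn+ (diff (sq-mono q0 q)) (diff im²)) (≤r (! z0))) (f7 (re u) (im u) y)))
  (le _ (nn* 0≤2 (nnsq y)) (f8 y))) where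
  y≥0 = <& q0 q
  z0 : re u * re u + im u * im u - 1# ~ 0#
  z0 = & (ap (_- 1#) (& (! (N-def u)) Nu)) (+-inv 1#)
  im² : im u * im u ≤ im u
  im² = ≤= (*l p0 (im≤1 Nu)) (*1r _)
  eqn : N (u -c i) ~ 2# * (1# - im u)
  eqn = & (N-def _) (& (ap2 (\ a b -> a * a + b * b)
   (& (re-+ u _) (& (ap (re u +_) (& (re-neg i) (ap -_ re-i))) (#d4 (re u))))
   (& (im-+ u _) (ap (im u +_) (& (im-neg i) (ap -_ im-i)))))
   (& (f6 (re u) (im u)) (& (ap (2# * (1# - im u) +_) z0) (+-idr _))))

 record Root (q : ℕ) (ε : Q) : Set where
  field
   θ : C
   unit : N θ ~ 1#
   quarter : θ ^c q -c i << ε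
   quadrant : ∀ x -> x N.≤ q -> FirstQuadrant (θ ^c x)

 root : ∀ q ε -> 1 N.≤ q -> 0# < ε -> Root q ε
 root q ε q≥1 ε>0 with arch ((ι q + 2#) * 2# * inv ε)
 ... | n , X≤ with small-unit (S n) z<s
 ...   | v , Nv , re≥0 , im>0 , close with Walk.found v Nv re≥0 im>0
 ...     | J , good , cross = record
  { θ = v ^c w
  ; unit = unit-^ w Nv
  ; quarter = <<m (<<-chain {v = v ^c J} (tr2 _<<_ (ap (\ z -> z -c v ^c J) (& (ap (v ^c_) (NP.*-comm w q)) (^c-^ v q w))) refl step1) step2) total
  ; quadrant = \ x l -> tr FirstQuadrant (^c-^ v x w) (good (x N.* w) (&N (*-monoˡ-≤ w l)
   (&N (≡N (NP.*-comm q w)) (m/n*n≤m J q)))) } where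
  instance
   nz : N.NonZero q
   nz = >-nonZero q≥1
  w = J / q
  k = ι (S n)
  k>0 : 0# < k
  k>0 = ι-pos {S n} z<s
  y = 2# * inv k
  m = J % q
  Jeq : J ~ w N.* q N.+ m
  Jeq = & (m≡m%n+[m/n]*n J q) (NP.+-comm m _)
  step1 : v ^c (w N.* q) -c v ^c J << ι q * y
  step1 = tr (_<< _) (& (#d8 (v ^c (w N.* q)) (v ^c m)) (ap (\ z -> v ^c (w N.* q) -c z) (! (& (ap (v ^c_) Jeq) (^c-+ v (w N.* q) m)))))
   (<<-unit* (unit-^ (w N.* q) Nv) (<<m (1-^-bound m Nv close) (*r (fst close) (ι-mono (<⇒≤ (m%n<n J q))))))
  step2 : v ^c J -c i << 2# * y
  step2 = near-i (unit-^ J Nv) (snd (good J NP.≤-refl)) (fst (good J NP.≤-refl))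
   (<& (=≤ (! (+-idr _)) (+m r≤ (neg-flip cross)))
    (=≤ (& (ap (re (v ^c J) +_) (! (re-neg _))) (! (re-+ _ _)))
     (<<-re (tr (_<< y) (#d7 v (v ^c J)) (<<-unit* (unit-^ J Nv) close)))))
  total : ι q * y + 2# * y ≤ ε
  total = *x k>0 (=≤ (& (#d6 k (ι q) (inv k)) (& (ap (\ z -> (ι q + 2#) * 2# * z) (inv-r k>0)) (*1r _)))
   (=≤ (& (! (*1r _)) (& (ap ((ι q + 2#) * 2# *_) (! (inv-r ε>0))) (#d5 ((ι q + 2#) * 2#) ε (inv ε))))
    (<& (*l (lt ε>0) X≤) (≤= (*l (lt ε>0) (ι-mono (n≤1+n n))) (*-comm _ _)))))

 module Separation (q : ℕ) (q≥1 : 1 N.≤ q) where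
  y0 c0 ε0 : Q
  y0 = inv (2# * ι q)
  c0 = inv 4# * (y0 * y0)
  ε0 = inv (4# * 2#) * y0
  2q>0 : 0# < 2# * ι q
  2q>0 = pp* (p≤ 0<1 (x≤x+y 0≤1)) (ι-pos q≥1)
  y0>0 : 0# < y0
  y0>0 = inv-pos 2q>0
  4>0 : 0# < 4#
  4>0 = p≤ 0<1 (<& (x≤x+y 0≤1) (x≤x+y 0≤2))
  8>0 : 0# < 4# * 2#
  8>0 = pp* 4>0 (p≤ 0<1 (x≤x+y 0≤1))
  c0>0 : 0# < c0
  c0>0 = pp* (inv-pos 4>0) (pp* y0>0 y0>0)
  ε0>0 : 0# < ε0
  ε0>0 = pp* (inv-pos 8>0) y0>0
  private
   opaque
    unfolding Qr
    e2 : ∀ q y -> 2# * (q * y) ~ 2# * q * y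
    e2 = auto Qr
    e3 : ∀ i y -> 4# * 2# * (i * y) ~ 4# * 2# * i * y
    e3 = auto Qr
    e7 : ∀ ε n -> 2# * (2# * (4# * ε * (4# * ε) + n)) ~ (4# * 2# * ε) * (4# * 2# * ε) + 4# * n
    e7 = auto Qr
    e8 : ∀ x -> 2# * x ~ x + x
    e8 = auto Qr
    e9 : ∀ r -> 2# * (1# - r) ~ 1# + (1# - 2# * r)
    e9 = auto Qr
  qy : ι q * y0 + ι q * y0 ~ 1#
  qy = & (! (e8 _)) (& (e2 (ι q) y0) (inv-r 2q>0))
  8ε : 4# * 2# * ε0 ~ y0
  8ε = & (e3 _ y0) (& (ap (_* y0) (inv-r 8>0)) (*1l y0))
  module _ {ε} (ε≤ : ε ≤ ε0) (R : Root q ε) where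
   open Root R
   ε≥0 : 0# ≤ ε
   ε≥0 = fst quarter
   y0≤1 : y0 ≤ 1#
   y0≤1 = <& (=≤ (! (*1l y0)) (*r (lt y0>0) (1≤ι q≥1))) (≤= (x≤x+y (nn* (ι-nn q) (lt y0>0))) qy)
   8ε≤ : 4# * 2# * ε ≤ y0
   8ε≤ = ≤= (*l (lt 8>0) ε≤) 8ε
   2ε≤½ : 4# * ε ≤ 1#
   2ε≤½ = <& (<& (≤= (x≤x+y (nn* 0≤4 ε≥0)) (#d9 ε)) 8ε≤) y0≤1
   base : y0 * y0 ≤ N (1c -c θ)
   base with ≤-total (y0 * y0) (N (1c -c θ))
   ... | inl p = p
   ... | inr p = abort (0<1 (+-cancelr {z = 1#} (≤= (<& two (sq-mono (fst b) b≤1)) (& (*1r 1#) (! (+-idl 1#)))))) where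
    b : 1c -c i << ι q * y0 + ε
    b = <<-chain (1-^-bound q unit (lt y0>0 , p)) quarter
    b≤1 : ι q * y0 + ε ≤ 1#
    b≤1 = ≤= (+m r≤ (ε≤½)) qy where
     ε≤½ : ε ≤ ι q * y0
     ε≤½ = <& (<& (=≤ (! (*1l ε)) (*r ε≥0 (<& (x≤x+y 0≤1) (<& (x≤x+y 0≤2) (=≤ (! (*1r 4#)) (*l 0≤4 (x≤x+y 0≤1))))))) 8ε≤)
      (=≤ (! (*1l y0)) (*r (lt y0>0) (1≤ι q≥1)))
    two : 1# + 1# ≤ (ι q * y0 + ε) * (ι q * y0 + ε)
    two = =≤ (! n2) (snd b) where
     n2 : N (1c -c i) ~ 1# + 1#
     n2 = & (N-def _) (& (ap2 (\ a b -> a * a + b * b)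
      (& (re-+ 1c _) (ap2 _+_ re-1 (& (re-neg i) (ap -_ re-i))))
      (& (im-+ 1c _) (ap2 _+_ im-1 (& (im-neg i) (ap -_ im-i))))) g) where
      opaque
       unfolding Qr
       g : (1# - 0#) * (1# - 0#) + (0# - 1#) * (0# - 1#) ~ 1# + 1#
       g = refl
   re-down : ∀ x -> S x N.≤ q -> re (θ ^c S x) ≤ re θ
   re-down zero _ = ≤r (ap re (*c1r θ))
   re-down (S x) l = <& (=≤ (re-* θ (θ ^c S x))
    (<& (le _ (nn* im1 (snd (quadrant (S x) (<⇒≤ l)))) (#d10 _ _))
     (≤= (*r (fst (quadrant (S x) (<⇒≤ l))) (re≤1 unit)) (*1l _)))) (re-down x (<⇒≤ l)) where
    im1 : 0# ≤ im θ
    im1 = tr (\ z -> 0# ≤ im z) (*c1r θ) (snd (quadrant 1 q≥1))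
   first : ∀ x -> 1 N.≤ x -> x N.≤ q -> y0 * y0 ≤ N (1c -c θ ^c x)
   first (S x) _ l = <& base (tr2 _≤_ (! (N-1-unit unit)) (! (N-1-unit (unit-^ (S x) unit)))
    (*l 0≤2 (+m r≤ (undiff (tr (0# ≤_) (#d11 _ _) (diff (re-down x l)))))))
   half : θ ^c (q N.+ q) +c 1c << ε + ε
   half = tr (_<< _) (& (#d13 (θ ^c q) i) (ap2 _+c_ (! (^c-+ θ q q)) (& (ap -c_ i²) (#d12 1c))))
    (<<-+ (<<-unit* (unit-^ q unit) quarter) (<<-unit* N-i quarter))
   full : θ ^c (q N.+ q N.+ (q N.+ q)) -c 1c << 4# * ε
   full = tr2 _<<_ (& (#d15 (θ ^c (q N.+ q))) (ap (\ z -> z -c 1c) (! (^c-+ θ (q N.+ q) (q N.+ q))))) (#d14 ε)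
    (<<-- (<<-unit* (unit-^ (q N.+ q) unit) half) half)
   private
    far : ∀ x -> re (θ ^c x) ≤ ε + ε -> c0 ≤ N (1c -c θ ^c x)
    far x p = <& c0≤1 (tr (1# ≤_) (! (N-1-unit (unit-^ x unit))) (le _ (diff (<& (*l 0≤2 p) (=≤ (#d16 ε) 2ε≤½))) (e9 (re (θ ^c x))))) where
     c0≤1 : c0 ≤ 1#
     c0≤1 = *x 4>0 (=≤ (& (! *a) (& (ap (_* (y0 * y0)) (inv-r 4>0)) (*1l _)))
      (<& (sq-mono (lt y0>0) y0≤1) (=≤ (*1r 1#) (<& (x≤x+y 0≤1) (≤= (x≤x+y 0≤2) (! (*1r 4#)))))))
    split-re : ∀ u w z -> re (u *c z) ~ re ((u -c w) *c z) + re (w *c z)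
    split-re u w z = & (ap re (#d17 u w z)) (re-+ _ _)
    second : ∀ z -> z N.≤ q -> re (θ ^c (q N.+ z)) ≤ ε + ε
    second z l = =≤ (& (ap re (^c-+ θ q z)) (split-re (θ ^c q) i (θ ^c z)))
     (+m (<<-re (tr (_<< ε) (*cc _ _) (<<-unit* (unit-^ z unit) quarter)))
      (=≤ (& (re-* i _) (& (ap2 (\ a b -> a * re (θ ^c z) - b * im (θ ^c z)) re-i im-i) (#d19 _ _)))
       (<& (le _ (snd (quadrant z l)) (#d18 (im (θ ^c z)))) ε≥0)))
    third : ∀ z -> z N.≤ q -> re (θ ^c (q N.+ q N.+ z)) ≤ ε + ε
    third z l = =≤ (& (ap re (^c-+ θ (q N.+ q) z)) (split-re (θ ^c (q N.+ q)) (-c 1c) (θ ^c z)))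
     (≤= (+m (<<-re (tr (_<< ε + ε) (*cc _ _) (<<-unit* (unit-^ z unit) (tr (\ w -> θ ^c (q N.+ q) +c w << ε + ε) (! (#d12 1c)) half))))
      (=≤ (& (ap re (#d20 (θ ^c z))) (re-neg _))
       (le _ (fst (quadrant z l)) (#d18 (re (θ ^c z)))))) (+-idr _))
    fourth : ∀ x y -> 1 N.≤ y -> y N.≤ q -> x N.+ y ~ q N.+ q N.+ (q N.+ q) -> c0 ≤ N (1c -c θ ^c x)
    fourth x y l l' eq = *x 4>0 (=≤ (& (! *a) (& (ap (_* (y0 * y0)) (inv-r 4>0)) (*1l _)))
     (+-cancelr {z = y0 * y0} (=≤ (! (e8 _)) (<& (*l 0≤2 (<& (first y l l') bound))
      (=≤ (e7 ε n) (≤= (+m (sq-mono (nn* (lt 8>0) ε≥0) 8ε≤) r≤) (+-comm _ _))))))) where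
     n = N (1c -c θ ^c x)
     bound : N (1c -c θ ^c y) ≤ 2# * (4# * ε * (4# * ε) + n)
     bound = =≤ (ap N (#d21 (θ ^c x) (θ ^c y))) (<& (N-tri _ _)
      (*l 0≤2 (+m (snd (<<-swap (tr (\ w -> w -c 1c << 4# * ε) (& (ap (θ ^c_) (! eq)) (^c-+ θ x y)) full)))
       (≤r (& (N-* _ _) (& (ap2 _*_ (unit-^ y unit) (N-neg _)) (*1l n)))))))
   separated : ∀ x -> 1 N.≤ x -> x N.< q N.+ q N.+ (q N.+ q) -> c0 ≤ N (1c -c θ ^c x)
   separated x l l' with NP.≤-total x q
   ... | inl a = <& c0≤ (first x l a) where
    c0≤ : c0 ≤ y0 * y0
    c0≤ = *x 4>0 (=≤ (& (! *a) (ap (_* (y0 * y0)) (inv-r 4>0)))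
     (*r (nnsq y0) (<& (x≤x+y 0≤1) (x≤x+y 0≤2))))
   ... | inr a with NP.≤-total x (q N.+ q)
   ...   | inl b = far x (tr (\ k -> re (θ ^c k) ≤ ε + ε) (m+[n∸m]≡n a) (second (x ∸ q) (NP.m≤n+o⇒m∸n≤o x q b)))
   ...   | inr b with NP.≤-total x (q N.+ q N.+ q)
   ...     | inl c = far x (tr (\ k -> re (θ ^c k) ≤ ε + ε) (m+[n∸m]≡n b) (third (x ∸ (q N.+ q)) (NP.m≤n+o⇒m∸n≤o x (q N.+ q) c)))
   ...     | inr c = fourth x (q4 ∸ x) (m<n⇒0<n∸m l') (NP.m≤n+o⇒m∸n≤o q4 x (&N (≡N (! (NP.+-assoc (q N.+ q) q q))) (+-monoˡ-≤ q c)))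
    (m+[n∸m]≡n (<⇒≤ l')) where
    q4 = q N.+ q N.+ (q N.+ q)

module B5 where
 open Rationals
 open Gauss
 open CSolver using (solve; _:+_; _:*_; :-_; _:-_; _:=_; con)
 open Z using (ℤ)
 open import Algebra.Structures using (IsCommutativeRing)
 open import Defs
 open import Data.Nat.Divisibility using (_∣_; divides; _∣?_; ∣⇒≤; ∣m+n∣m⇒∣n; n∣m*n)
 open import Data.Bool using (Bool; true; false; if_then_else_; _∧_)
 open import Relation.Nullary using (does)
 open import Relation.Nullary.Decidable using (dec-true; dec-false)

 opaque
  unfolding Qr
  #e1 : ∀ x y -> - (x + y) ~ - x + - y
  #e1 = auto Qr
  #e3 : ∀ a b c -> a * b * c ~ a * c * b
  #e3 = auto Qr
  #e4 : ∀ a b x y t e -> a * x * (t + e) * (b * y) ~ a * x * (b * y) * t + a * x * (b * y) * e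
  #e4 = auto Qr
  #e5 : ∀ a b x y -> a * (x * x) * (b * (y * y)) ~ a * x * (b * y) * (x * y)
  #e5 = auto Qr
  #e6 : ∀ a b x y t e -> a * x * (t + e) * (b * y) ~ a * b * (x * y * e) + a * x * (b * y) * t
  #e6 = auto Qr
  #e10 : ∀ B D δ x y -> B * D * δ + B * (D * y) + B * x * D ~ B * D * (x + y + δ)
  #e10 = auto Qr
  #e14 : ∀ x d n -> x + n * (x + d) + d ~ (1# + n) * (x + d)
  #e14 = auto Qr
  #e15 : ∀ x -> - - x ~ x
  #e15 = auto Qr
  #e18 : ∀ m t d -> m * (t * (d + d) + d) + t * (d + d) + d ~ (1# + m) * (t * (d + d) + d)
  #e18 = auto Qr
  #e23 : ∀ a b c d y -> a * y + b * y + (1# + 0#) * y + (c * y + d * y + (1# + 0#) * y) + (1# + 0#) * y ~ (a + b + (c + d) + (1# + (1# + (1# + 0#)))) * y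
  #e23 = auto Qr

 #e2 : ∀ x y s t u -> x *c y *c (s -c t *c u) ~ x *c y *c s -c x *c t *c (y *c u)
 #e2 = solve 5 (\ x y s t u -> x :* y :* (s :- t :* u) := x :* y :* s :- x :* t :* (y :* u)) refl
 #e7 : ∀ f g s t u -> f *c g *c s -c f *c t *c (g *c u) ~ f *c g *c (s -c t *c u)
 #e7 = solve 5 (\ f g s t u -> f :* g :* s :- f :* t :* (g :* u) := f :* g :* (s :- t :* u)) refl
 #e8 : ∀ s t u v -> s -c t *c (u +c v) ~ (s -c t *c u) -c t *c v
 #e8 = solve 4 (\ s t u v -> s :- t :* (u :+ v) := (s :- t :* u) :- t :* v) refl
 #e9 : ∀ x y -> -c (x +c y) ~ -c x +c -c y
 #e9 = solve 2 (\ x y -> :- (x :+ y) := :- x :+ :- y) refl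
 #e11 : ∀ e s t v u -> (e -c s *c t) +c s *c (t -c u) +c (s -c v) *c u ~ e -c v *c u
 #e11 = solve 5 (\ e s t v u -> (e :- s :* t) :+ s :* (t :- u) :+ (s :- v) :* u := e :- v :* u) refl
 #e12 : ∀ s t v u -> (s -c v) +c (t -c u) ~ (s +c t) -c (v +c u)
 #e12 = solve 4 (\ s t v u -> (s :- v) :+ (t :- u) := (s :+ t) :- (v :+ u)) refl
 #e13 : ∀ s t v -> s *c (t -c v) ~ s *c t -c s *c v
 #e13 = solve 3 (\ s t v -> s :* (t :- v) := s :* t :- s :* v) refl
 #e16 : ∀ u -> u ~ 1c +c 0c -c (1c -c u)
 #e16 = solve 1 (\ u -> u := con (Z.+ 1) :+ con (Z.+ 0) :- (con (Z.+ 1) :- u)) refl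
 #e17 : ∀ u -> -c 1c *c u ~ -c u
 #e17 = solve 1 (\ u -> :- con (Z.+ 1) :* u := :- u) refl
 #e19 : ∀ f t u -> t *c (f *c u) ~ f *c (t *c u)
 #e19 = solve 3 (\ f t u -> t :* (f :* u) := f :* (t :* u)) refl
 #e20 : ∀ f s t u -> f *c s +c -c (t *c (f *c u)) ~ f *c (s -c t *c u)
 #e20 = solve 4 (\ f s t u -> f :* s :+ :- (t :* (f :* u)) := f :* (s :- t :* u)) refl
 #e21 : ∀ s t u v -> 0c +c s -c t *c (u +c v) ~ (s -c t *c u) -c t *c v
 #e21 = solve 4 (\ s t u v -> con (Z.+ 0) :+ s :- t :* (u :+ v) := (s :- t :* u) :- t :* v) refl
 #e22 : ∀ c s t -> (1c +c c *c s) -c (1c +c c *c t) ~ c *c (s -c t)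
 #e22 = solve 3 (\ c s t -> (con (Z.+ 1) :+ c :* s) :- (con (Z.+ 1) :+ c :* t) := c :* (s :- t)) refl


 Qring : IsCommutativeRing _~_ _+_ _*_ -_ 0# 1#
 Qring = record
  { isRing = record
   { +-isAbelianGroup = record
    { isGroup = record
     { isMonoid = record
      { isSemigroup = record
       { isMagma = record { isEquivalence = isEquivalence ; ∙-cong = ap2 _+_ } ; assoc = +-assoc }
      ; identity = +-idl , +-idr }
     ; inverse = (\ x -> & (+-comm _ x) (+-inv x)) , +-inv
     ; ⁻¹-cong = ap (\ x -> - x) }
    ; comm = +-comm }
   ; *-cong = ap2 _*_ ; *-assoc = *-assoc ; *-identity = *1l , *1r
   ; distrib = *-distˡ , *-distʳ }
  ; *-comm = *-comm }

 module Qκ = IntegerSolver Qring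

 opaque
  κ : ℤ -> Q
  κ = Qκ.⟦_⟧ᵢ
  κ-+ : ∀ x y -> κ (x Z.+ y) ~ κ x + κ y
  κ-+ = Qκ.⟦⟧-+
  κ-* : ∀ x y -> κ (x Z.* y) ~ κ x * κ y
  κ-* = Qκ.⟦⟧-*
  κ-neg : ∀ x -> κ (Z.- x) ~ - κ x
  κ-neg = Qκ.⟦⟧-neg
  κ-ι : ∀ n -> κ (Z.+ n) ~ ι n
  κ-ι zero = refl
  κ-ι (S n) = & (Qκ.⟦⟧-suc n) (ap (1# +_) (κ-ι n))

 abs-le : ∀ {x y} -> x ≤ y -> - x ≤ y -> abs x ≤ y
 abs-le {x} p q with ≤-total 0# x
 ... | inl _ = p
 ... | inr _ = q

 abs-+ : ∀ x y -> abs (x + y) ≤ abs x + abs y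
 abs-+ x y = abs-le (+m (x≤abs x) (x≤abs y)) (=≤ (#e1 x y) (+m (-x≤abs x) (-x≤abs y)))

 abs-* : ∀ x y -> abs (x * y) ≤ abs x * abs y
 abs-* x y = sq-cancel (nn* (abs-nn x) (abs-nn y)) (≤r (& (abs-sq (x * y)) (& (swap* x y x y)
  (& (ap2 _*_ (! (abs-sq x)) (! (abs-sq y))) (swap* (abs x) (abs x) (abs y) (abs y))))))

 abs-id : ∀ {x} -> 0# ≤ x -> abs x ≤ x
 abs-id {x} p = abs-le r≤ (<& (le x p (! (& (+-comm _ x) (+-inv x)))) p)

 abs-0 : abs 0# ≤ 0#
 abs-0 = abs-id r≤

 abs-sum : ∀ n f -> abs (sum n f) ≤ sum n (\ k -> abs (f k))
 abs-sum zero f = abs-0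
 abs-sum (S n) f = <& (abs-+ _ _) (+m (abs-sum n f) r≤)

 <<-rl-abs : ∀ x -> rl x << abs x
 <<-rl-abs x = abs-nn x , ≤r (& (N-rl x) (! (abs-sq x)))

 κ-sumTo : ∀ f n -> κ (sumTo f n) ~ sum (S n) (\ k -> κ (f k))
 κ-sumTo f zero = ! (+-idl _)
 κ-sumTo f (S n) = & (κ-+ _ _) (ap (_+ κ (f (S n))) (κ-sumTo f n))

 private
  sumTo-last : ∀ h n -> (∀ k -> k N.< n -> h k ~ 0Z) -> sumTo h n ~ h n
  sumTo-last h zero z = refl
  sumTo-last h (S n) z = & (ap (Z._+ h (S n)) (& (sumTo-last h n \ k l -> z k (m<n⇒m<1+n l)) (z n NP.≤-refl))) (ZP.+-identityˡ _)

 IsOneTo : ℕ -> PS -> Set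
 IsOneTo n g = g 0 ~ Z.1ℤ × (∀ k -> 1 N.≤ k -> k N.≤ n -> g k ~ 0Z)

 ⊗-one : ∀ {n f g} -> IsOneTo n g -> ∀ k -> k N.≤ n -> (f ⊗ g) k ~ f k
 ⊗-one {n} {f} {g} (g0 , gz) k l = & (sumTo-last _ k \ j j<k -> & (ap (f j Z.*_) (gz (k ∸ j) (m<n⇒0<n∸m j<k) (&N (m∸n≤m k j) l))) (ZP.*-zeroʳ (f j)))
  (& (ap (\ j -> f k Z.* g j) (NP.n∸n≡0 k)) (& (ap (f k Z.*_) g0) (ZP.*-identityʳ (f k))))

 ⊗-isOneTo : ∀ {n f g} -> IsOneTo n f -> IsOneTo n g -> IsOneTo n (f ⊗ g)
 ⊗-isOneTo {n} {f} {g} (f0 , fz) og = & (⊗-one {f = f} og 0 z≤n) f0 , \ k l l' -> & (⊗-one {f = f} og k l') (fz k l l')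

 ^PS-isOneTo : ∀ {n f} m -> IsOneTo n f -> IsOneTo n (f ^PS m)
 ^PS-isOneTo zero o = refl , \ { (S k) _ _ -> refl }
 ^PS-isOneTo {f = f} (S m) o = ⊗-isOneTo {f = f} {g = f ^PS m} o (^PS-isOneTo m o)

 oneMinusQ-isOneTo : ∀ n -> IsOneTo n (oneMinusQ (S n))
 oneMinusQ-isOneTo n = refl , h where
  h : ∀ k -> 1 N.≤ k -> k N.≤ n -> oneMinusQ (S n) k ~ 0Z
  h (S k) _ l = ap (\ b -> if b then Z.- Z.1ℤ else 0Z) (dec-false (S k ≟ S n) \ { refl -> NP.<-irrefl refl l })

 ⊗-oneMinusQ-power : ∀ c {m j} f -> m N.≤ j -> (f ⊗ (oneMinusQ (S j) ^PS c)) m ~ f m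
 ⊗-oneMinusQ-power c {m} {j} f l = ⊗-one {n = j} {f = f} (^PS-isOneTo {f = oneMinusQ (S j)} c (oneMinusQ-isOneTo j)) m l

 partialEta24-stable : ∀ m j -> partialEta24 (j N.+ m) m ~ partialEta24 m m
 partialEta24-stable m zero = refl
 partialEta24-stable m (S j) = & (⊗-oneMinusQ-power 24 (partialEta24 (j N.+ m)) (m≤n+m m j)) (partialEta24-stable m j)

 shiftPS : PS -> PS
 shiftPS f zero = 0Z
 shiftPS f (S n) = f n

 Δ-shift : ∀ M n -> n N.≤ M -> Δ n ~ shiftPS (partialEta24 M) n
 Δ-shift M zero _ = refl
 Δ-shift M (S m) l = & (partialEta24-stable m 1) (! (& (ap (\ j -> partialEta24 j m) (! (m∸n+n≡m (<⇒≤ l)))) (partialEta24-stable m (M ∸ m))))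

 dilate-mult : ∀ N f i -> 1 N.≤ N -> dilate N f (i N.* N) ~ f i
 dilate-mult (S N) f i _ with S N ∣? (i N.* S N)
 ... | yes (divides q e) = ap f (! (NP.*-cancelʳ-≡ i q (S N) e))
 ... | no n = abort (n (divides i refl))

 dilate-nonmult : ∀ N f i j -> j ≢ 0 -> j N.< N -> dilate N f (i N.* N N.+ j) ~ 0Z
 dilate-nonmult N f i zero ne _ = abort (ne refl)
 dilate-nonmult N f i (S j) _ l with N ∣? (i N.* N N.+ S j)
 ... | yes p = abort (<⇒≱ l (∣⇒≤ (∣m+n∣m⇒∣n p (n∣m*n i))))
 ... | no _ = refl

 module Triangle {A : Set} (_∙_ : A -> A -> A) (ε : A)
  (assoc : ∀ x y z -> (x ∙ y) ∙ z ~ x ∙ (y ∙ z)) (comm : ∀ x y -> x ∙ y ~ y ∙ x) (idˡ : ∀ x -> ε ∙ x ~ x) where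
  open Fold _∙_ ε assoc comm idˡ
  triangle : ∀ L (F : ℕ -> ℕ -> A) →
   fold (S L) (\ n -> fold (S n) (\ k -> F k (n ∸ k))) ~ fold (S L) (\ i -> fold (S (L ∸ i)) (F i))
  triangle zero F = refl
  triangle (S L) F = & (ap (_∙ fold (S (S L)) (\ k -> F k (S L ∸ k))) (triangle L F))
   (& (! (assoc _ _ _)) (ap2 _∙_ (& (! (distr (S L) _ _)) (cong-< (S L) \ i l -> ap2 _∙_ {x = fold (S (L ∸ i)) (F i)} refl refl ⟨trans⟩ ! (row i (s≤s⁻¹ l))))
    (last (L ∸ L) refl))) where
   _⟨trans⟩_ : ∀ {x y z : A} -> x ~ y -> y ~ z -> x ~ z
   _⟨trans⟩_ = &
   row : ∀ i -> i N.≤ L -> fold (S (S L ∸ i)) (F i) ~ fold (S (L ∸ i)) (F i) ∙ F i (S L ∸ i)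
   row i l = & (ap (\ j -> fold (S j) (F i)) (NP.+-∸-assoc 1 l)) (ap (\ j -> fold (S (L ∸ i)) (F i) ∙ F i j) (! (NP.+-∸-assoc 1 l)))
   last : ∀ j -> j ~ L ∸ L -> F (S L) j ~ fold (S j) (F (S L))
   last j e rewrite & e (NP.n∸n≡0 L) = ! (idˡ _)
  fold-dilate : ∀ N f (T : ℤ -> ℕ -> A) -> 1 N.≤ N -> (∀ n -> T 0Z n ~ ε) -> ∀ K →
   fold (S (K N.* N)) (\ n -> T (dilate N f n) n) ~ fold (S K) (\ m -> T (f m) (m N.* N))
  fold-dilate N f T l T0 K = ap2 _∙_
   (& (blocks K N _) (cong-f K \ i -> & (fold-single N 0 l \ j j<N ne -> & (ap (\ c -> T c _) (dilate-nonmult N f i j ne j<N)) (T0 _))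
    (& (ap (\ k -> T (dilate N f k) k) (NP.+-identityʳ (i N.* N))) (ap (\ c -> T c _) (dilate-mult N f i l)))))
   (ap (\ c -> T c _) (dilate-mult N f K l))

 open Triangle _+c_ 0c +c-assoc +c-comm +c-idl using () renaming (triangle to trianglec; fold-dilate to fold-dilatec)
 open Triangle _+_ 0# +-assoc +-comm +-idl using () renaming (triangle to triangleQ; fold-dilate to fold-dilateQ)

 χ : ∀ {P : Set} -> Dec P -> C -> C
 χ (yes _) u = u
 χ (no _) u = 0c

 χ-yes : ∀ {P : Set} (D : Dec P) {u} -> P -> χ D u ~ u
 χ-yes (yes _) p = refl
 χ-yes (no n) p = abort (n p)

 χ-no : ∀ {P : Set} (D : Dec P) {u} -> ¬ P -> χ D u ~ 0c
 χ-no (yes p) n = abort (n p)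
 χ-no (no _) n = refl

 opaque
  cube : ℕ -> Q
  cube d = ι (d N.* d N.* d)
  cube-def : ∀ d -> cube d ~ ι (d N.* d N.* d)
  cube-def d = refl
  cube-nn : ∀ d -> 0# ≤ cube d
  cube-nn d = ι-nn (d N.* d N.* d)
  c240 : Q
  c240 = ι 240
  c240-nn : 0# ≤ c240
  c240-nn = ι-nn 240
  1≤c240 : 1# ≤ c240
  1≤c240 = 1≤ι {240} z<s
  κ-240 : κ (Z.+ 240) ~ c240
  κ-240 = κ-ι 240

 module DivisorSums where
  divisorTerm : ℕ -> ℕ -> ℤ
  divisorTerm n d = if (does (d ∣? n) ∧ does (1 N.≤? d)) then Z.+ (d N.* d N.* d) else 0Z
  divisorTerm-0 : ∀ n -> divisorTerm n 0 ~ 0Z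
  divisorTerm-0 n = h (does (0 ∣? n) ∧ false) where
   h : ∀ b -> (if b then Z.+ 0 else 0Z) ~ 0Z
   h true = refl
   h false = refl
  κ-divisorTerm : ∀ n d -> rl (κ (divisorTerm n (S d))) ~ χ (S d ∣? n) (rl (cube (S d)))
  κ-divisorTerm n d = h (S d ∣? n) where
   val : Bool -> ℤ
   val b = if b ∧ true then Z.+ (S d N.* S d N.* S d) else 0Z
   h : Dec (S d ∣ n) -> rl (κ (divisorTerm n (S d))) ~ χ (S d ∣? n) (rl (cube (S d)))
   h (yes p) = & (ap (\ b -> rl (κ (val b))) (dec-true (S d ∣? n) p)) (& (ap rl (& (κ-ι (S d N.* S d N.* S d)) (! (cube-def (S d))))) (! (χ-yes (S d ∣? n) p)))
   h (no p) = & (ap (\ b -> rl (κ (val b))) (dec-false (S d ∣? n) p)) (& (ap rl (κ-ι 0)) (& rl-0 (! (χ-no (S d ∣? n) p))))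
  κ-divisorTerm-nn : ∀ n d -> 0# ≤ κ (divisorTerm n d)
  κ-divisorTerm-nn n d = h (does (d ∣? n) ∧ does (1 N.≤? d)) where
   h : ∀ b -> 0# ≤ κ (if b then Z.+ (d N.* d N.* d) else 0Z)
   h true = tr (0# ≤_) (! (κ-ι (d N.* d N.* d))) (ι-nn (d N.* d N.* d))
   h false = ≤r (! (κ-ι 0))
  κσ3-nn : ∀ n -> 0# ≤ κ (σ₃ n)
  κσ3-nn n = tr (0# ≤_) (! (κ-sumTo (divisorTerm n) n)) (sum-nn (S n) (κ-divisorTerm-nn n))
  cofactor : ∀ M n d u -> S n N.≤ M -> sumc M (\ m -> χ (S d N.* S m ≟ S n) u) ~ χ (S d ∣? S n) u
  cofactor M n d u l = h (S d ∣? S n) where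
   h : Dec (S d ∣ S n) -> sumc M (\ m -> χ (S d N.* S m ≟ S n) u) ~ χ (S d ∣? S n) u
   h (yes p@(divides (S q) e)) = & (ΣC.fold-single M q (&N (&N (m≤m*n (S q) (S d)) (≡N (! e))) l)
    \ m _ ne -> χ-no (S d N.* S m ≟ S n) \ e' -> ne (NP.suc-injective (NP.*-cancelˡ-≡ (S m) (S q) (S d) (& e' (& e (NP.*-comm (S q) (S d)))))))
    (& (χ-yes (S d N.* S q ≟ S n) (& (NP.*-comm (S d) (S q)) (! e))) (! (χ-yes (S d ∣? S n) p)))
   h (no p) = & (ΣC.fold-none M \ m _ -> χ-no (S d N.* S m ≟ S n) \ e -> p (divides (S m) (& (! e) (NP.*-comm (S d) (S m)))))
    (! (χ-no (S d ∣? S n) p))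
  σ3-double : ∀ M n -> S n N.≤ M -> rl (κ (σ₃ (S n))) ~ sumc M (\ d -> sumc M (\ m -> χ (S d N.* S m ≟ S n) (rl (cube (S d)))))
  σ3-double M n l = & (ap rl (& (κ-sumTo (divisorTerm (S n)) (S n)) (ΣQ.front (S n) _)))
   (& (rl-+ _ _) (& (ap2 _+c_ (& (ap (\ c -> rl (κ c)) (divisorTerm-0 (S n))) (& (ap rl (κ-ι 0)) rl-0)) (rl-sum (S n) _))
   (& (+c-idl _) (& (ΣC.cong-f (S n) (κ-divisorTerm (S n))) (& (! (& (ap (\ k -> sumc k T) (! (m+[n∸m]≡n l)))
    (& (ΣC.split (S n) (M ∸ S n) T) (& (ap (sumc (S n) T +c_) (ΣC.fold-none (M ∸ S n) \ k _ -> χ-no (S (S n N.+ k) ∣? S n) \ p -> <⇒≱ (s≤s (m≤m+n (S n) k)) (∣⇒≤ p)))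
     (& (+c-comm _ _) (+c-idl _)))))) (ΣC.cong-f M \ d -> ! (cofactor M n d (rl (cube (S d))) l))))))) where
   T : ℕ -> C
   T d = χ (S d ∣? S n) (rl (cube (S d)))
  sumc-*ʳ : ∀ n c f -> sumc n f *c c ~ sumc n (\ k -> f k *c c)
  sumc-*ʳ n c f = & (*cc _ c) (& (! (sumc-*ˡ n c f)) (ΣC.cong-f n \ k -> *cc c (f k)))
  σ3-collapse : ∀ L M (t : ℕ -> C) -> L N.≤ M -> sumc L (\ n -> rl (κ (σ₃ (S n))) *c t (S n)) ~
   sumc M (\ d -> sumc M (\ m -> χ (S d N.* S m N.≤? L) (rl (cube (S d)) *c t (S d N.* S m))))
  σ3-collapse L M t l = & (ΣC.cong-< L \ n n<L -> & (ap (_*c t (S n)) (σ3-double M n (&N n<L l)))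
   (& (sumc-*ʳ M _ _) (ΣC.cong-f M \ d -> sumc-*ʳ M _ _)))
   (& (ΣC.exchange L M _) (ΣC.cong-f M \ d -> & (ΣC.exchange L M _) (ΣC.cong-f M \ m -> col d m))) where
   col : ∀ d m -> sumc L (\ n -> χ (S d N.* S m ≟ S n) (rl (cube (S d))) *c t (S n)) ~ χ (S d N.* S m N.≤? L) (rl (cube (S d)) *c t (S d N.* S m))
   col d m = h (S d N.* S m N.≤? L) where
    k = m N.+ d N.* S m
    off : ∀ n -> n ≢ k -> χ (S d N.* S m ≟ S n) (rl (cube (S d))) *c t (S n) ~ 0c
    off n ne = & (ap (_*c t (S n)) (χ-no (S d N.* S m ≟ S n) \ e -> ne (! (NP.suc-injective e)))) (*c-0ˡ _)
    h : Dec (S d N.* S m N.≤ L) -> sumc L (\ n -> χ (S d N.* S m ≟ S n) (rl (cube (S d))) *c t (S n)) ~ χ (S d N.* S m N.≤? L) (rl (cube (S d)) *c t (S d N.* S m))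
    h (yes p) = & (ΣC.fold-single L k p \ j _ -> off j) (& (ap (_*c t (S k)) (χ-yes (S d N.* S m ≟ S k) refl)) (! (χ-yes (S d N.* S m N.≤? L) p)))
    h (no p) = & (ΣC.fold-none L \ j j<L -> off j \ { refl -> p j<L }) (! (χ-no (S d N.* S m N.≤? L) p))

 open DivisorSums using (σ3-collapse; κσ3-nn)

 -- Evaluation, truncated at L, of a power series at q = r1² z, where n ↦ z n is
 -- only approximately multiplicative.

 module Eval (r1 : Q) (r1>0 : 0# < r1) (r1≤1 : r1 ≤ 1#) (z : ℕ -> C) (z-unit : ∀ n -> N (z n) ~ 1#)
  (η : Q) (η0 : 0# ≤ η) (z-mul : ∀ m n -> z (m N.+ n) -c z m *c z n << η) (z-0 : z 0 ~ 1c) (L : ℕ) where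
  r≥0 : 0# ≤ r1
  r≥0 = lt r1>0
  ρ : Q
  ρ = r1 * r1
  w : ℕ -> C
  w n = rl (ρ ^ n) *c z n
  ev : PS -> C
  ev f = sumc (S L) (\ n -> rl (κ (f n)) *c w n)
  maj : PS -> ℕ -> Q
  maj f n = abs (κ (f n)) * r1 ^ n
  Maj : Q -> PS -> Set
  Maj B f = ∀ l -> sum (S l) (maj f) ≤ B
  δ : Q
  δ = r1 ^ L + η
  maj-nn : ∀ f n -> 0# ≤ maj f n
  maj-nn f n = nn* (abs-nn _) (^n n r≥0)
  ρ^≤ : ∀ n -> ρ ^ n ≤ r1 ^ n
  ρ^≤ n = ^-mono n (nn* r≥0 r≥0) (≤= (*l r≥0 r1≤1) (*1r r1))
  ρ-nn : ∀ n -> 0# ≤ ρ ^ n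
  ρ-nn n = ^n n (nn* r≥0 r≥0)
  δ0 : 0# ≤ δ
  δ0 = nn+ (^n L r≥0) η0
  w<< : ∀ n -> w n << r1 ^ n
  w<< n = <<m (tr (rl (ρ ^ n) *c z n <<_) (*1r _) (<<-* (<<-rl (ρ-nn n)) (<<-unit (z-unit n)))) (ρ^≤ n)
  term<< : ∀ f n -> rl (κ (f n)) *c w n << maj f n
  term<< f n = <<-* (<<-rl-abs _) (w<< n)
  w<<² : ∀ n -> w n << r1 ^ n * r1 ^ n
  w<<² n = <<m (tr (rl (ρ ^ n) *c z n <<_) (*1r _) (<<-* (<<-rl (ρ-nn n)) (<<-unit (z-unit n)))) (≤r (*-^ r1 r1 n))
  w-mul : ∀ m n -> w (m N.+ n) -c w m *c w n << r1 ^ m * r1 ^ n * η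
  w-mul m n = <<m (tr (_<< ρ ^ m * ρ ^ n * η) eq (<<-* (<<-rl (nn* (ρ-nn m) (ρ-nn n))) (z-mul m n)))
   (*r η0 (*-mono (ρ-nn m) (ρ^≤ m) (ρ-nn n) (ρ^≤ n))) where
   eq : rl (ρ ^ m * ρ ^ n) *c (z (m N.+ n) -c z m *c z n) ~ w (m N.+ n) -c w m *c w n
   eq = & (ap (_*c _) (rl-* _ _)) (& (#e2 (rl (ρ ^ m)) (rl (ρ ^ n)) (z (m N.+ n)) (z m) (z n))
    (ap (\ t -> t *c z (m N.+ n) -c w m *c w n) (& (! (rl-* _ _)) (ap rl (! (^-+ ρ m n))))))
  ev<< : ∀ {B f} -> Maj B f -> ev f << B
  ev<< {B} {f} h = <<m (<<-sum (S L) (\ k _ -> term<< f k)) (h L)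
  Maj-⊗ : ∀ {B D f g} -> Maj B f -> Maj D g -> Maj (B * D) (f ⊗ g)
  Maj-⊗ {B} {D} {f} {g} p q l = <& (sum-mono (S l) (\ n _ -> step n))
   (=≤ (triangleQ l (\ i j -> maj f i * maj g j))
    (<& (sum-mono (S l) (\ i _ -> =≤ (sum-*ˡ (S (l ∸ i)) (maj f i) (maj g))
     (*l (maj-nn f i) (q (l ∸ i)))))
     (=≤ (sum-*ʳ (S l) D (maj f)) (*r (<& (nn+ r≤ (maj-nn g 0)) (q 0)) (p l))))) where
   step : ∀ n -> maj (f ⊗ g) n ≤ sum (S n) (\ k -> maj f k * maj g (n ∸ k))
   step n = <& (*r (^n n r≥0) (=≤ (ap abs (κ-sumTo _ n)) (abs-sum (S n) _)))
    (=≤ (! (sum-*ʳ (S n) (r1 ^ n) _)) (sum-mono (S n) \ k l →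
     ≤= (*r (^n n r≥0) (=≤ (ap abs (κ-* (f k) (g (n ∸ k)))) (abs-* _ _)))
      (& (ap (abs (κ (f k)) * abs (κ (g (n ∸ k))) *_) (& (ap (r1 ^_) (! (m+[n∸m]≡n (s≤s⁻¹ l)))) (^-+ r1 k _)))
       (swap* _ _ _ _))))
  ev-⊗ : ∀ {B D f g} -> Maj B f -> Maj D g -> ev (f ⊗ g) -c ev f *c ev g << B * D * δ
  ev-⊗ {B} {D} {f} {g} p q = tr (_<< _) (! total)
   (<<m (<<-sum (S L) row<<) (=≤ (sum-*ʳ (S L) δ _) (*r δ0
    (=≤ (sum-*ʳ (S L) (sum (S L) (maj g)) (maj f))
     (*-mono (sum-nn (S L) (maj-nn f)) (p L) (sum-nn (S L) (maj-nn g)) (q L)))))) where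
   F : ℕ -> C
   F i = rl (κ (f i))
   G : ℕ -> C
   G j = rl (κ (g j))
   row : ℕ -> C
   row i = sumc (S (L ∸ i)) (\ j -> F i *c G j *c w (i N.+ j)) -c F i *c w i *c ev g
   sumc-- : ∀ n s t -> sumc n s -c sumc n t ~ sumc n (\ k -> s k -c t k)
   sumc-- n s t = & (ap (sumc n s +c_) (ΣC.fold-hom n t (\ x -> -c x) n0 #e9)) (! (ΣC.distr n s (\ k -> -c t k))) where
    n0 : -c 0c ~ 0c
    n0 = solve 0 (:- con (Z.+ 0) := con (Z.+ 0)) refl
   total : ev (f ⊗ g) -c ev f *c ev g ~ sumc (S L) row
   total = & (ap2 _-c_ (& (ΣC.cong-f (S L) expand) (trianglec L (\ i j -> F i *c G j *c w (i N.+ j))))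
    (ΣC.fold-hom (S L) (\ i -> F i *c w i) (_*c ev g) (*c-0ˡ _) (\ x y -> & (*cc _ (ev g)) (& (*c-distˡ (ev g) x y) (ap2 _+c_ (*cc (ev g) x) (*cc (ev g) y))))))
    (sumc-- (S L) _ _) where
    expand : ∀ n -> rl (κ ((f ⊗ g) n)) *c w n ~ sumc (S n) (\ k -> F k *c G (n ∸ k) *c w (k N.+ (n ∸ k)))
    expand n = & (ap (_*c w n) (& (ap rl (κ-sumTo _ n)) (rl-sum (S n) _)))
     (& (& (*cc _ _) (! (sumc-*ˡ (S n) (w n) _))) (ΣC.cong-< (S n) \ k l →
      & (*cc (w n) _) (ap2 _*c_ (& (ap rl (κ-* (f k) (g (n ∸ k)))) (rl-* _ _)) (ap w (! (m+[n∸m]≡n (s≤s⁻¹ l)))))))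
   row<< : ∀ i -> i N.< S L -> row i << maj f i * sum (S L) (maj g) * δ
   row<< i (s≤s l) = tr2 _<<_ (! row-eq) bound-eq (<<-- (<<-sum (S (L ∸ i)) (\ j _ -> near j)) (<<-sum i (\ j _ -> tail j))) where
    m = S (L ∸ i)
    m+i : m N.+ i ~ S L
    m+i = ap S (m∸n+n≡m l)
    P : Q
    P = maj f i
    a1 : ℕ -> C
    a1 j = F i *c G j *c (w (i N.+ j) -c w i *c w j)
    a2 : ℕ -> C
    a2 j = F i *c w i *c (G (m N.+ j) *c w (m N.+ j))
    row-eq : row i ~ sumc m a1 -c sumc i a2
    row-eq = & (ap (\ t -> sumc m (\ j -> F i *c G j *c w (i N.+ j)) -c F i *c w i *c t)
     (& (ap (\ n -> sumc n (\ j -> G j *c w j)) (! m+i)) (ΣC.split m i _)))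
     (& (#e8 _ (F i *c w i) _ _) (ap2 _-c_
      (& (ap (\ t -> sumc m (\ j -> F i *c G j *c w (i N.+ j)) -c t) (! (sumc-*ˡ m (F i *c w i) _)))
       (& (sumc-- m _ _) (ΣC.cong-f m \ j -> #e7 (F i) (G j) (w (i N.+ j)) (w i) (w j))))
      (! (sumc-*ˡ i (F i *c w i) _))))
    near : ∀ j -> a1 j << P * δ * maj g j
    near j = <<m (<<-* (<<-* (<<-rl-abs _) (<<-rl-abs _)) (w-mul i j))
     (le _ (nn* (nn* (nn* (abs-nn (κ (f i))) (^n i r≥0)) (nn* (abs-nn (κ (g j))) (^n j r≥0))) (^n L r≥0)) (#e6 (abs (κ (f i))) (abs (κ (g j))) (r1 ^ i) (r1 ^ j) (r1 ^ L) η))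
    tail : ∀ j -> a2 j << P * δ * maj g (m N.+ j)
    tail j = <<m (<<-* (<<-* (<<-rl-abs _) (w<<² i)) (<<-* (<<-rl-abs _) (w<<² (m N.+ j))))
     (=≤ (#e5 (abs (κ (f i))) (abs (κ (g (m N.+ j)))) (r1 ^ i) (r1 ^ (m N.+ j)))
      (<& (*l nn (=≤ (! (^-+ r1 i (m N.+ j))) (^-anti r≥0 r1≤1 i+J)))
       (le _ (nn* nn η0) (#e4 (abs (κ (f i))) (abs (κ (g (m N.+ j)))) (r1 ^ i) (r1 ^ (m N.+ j)) (r1 ^ L) η)))) where
     nn : 0# ≤ abs (κ (f i)) * r1 ^ i * (abs (κ (g (m N.+ j))) * r1 ^ (m N.+ j))
     nn = nn* (nn* (abs-nn _) (^n i r≥0)) (nn* (abs-nn _) (^n (m N.+ j) r≥0))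
     i+J : L N.≤ i N.+ (m N.+ j)
     i+J = &N (n≤1+n L) (&N (≡N (& (! m+i) (NP.+-comm m i))) (+-monoʳ-≤ i (m≤m+n m j)))
    bound-eq : sum m (\ j -> P * δ * maj g j) + sum i (\ j -> P * δ * maj g (m N.+ j)) ~ P * sum (S L) (maj g) * δ
    bound-eq = & (ap2 _+_ (sum-*ˡ m (P * δ) (maj g)) (sum-*ˡ i (P * δ) _)) (& (! (*-distˡ (P * δ) _ _))
     (& (ap (P * δ *_) (& (! (ΣQ.split m i (maj g))) (ap (\ n -> sum n (maj g)) m+i))) (#e3 P δ _)))
  record Approx (x B : Q) (f : PS) (v : C) : Set where
   constructor approx
   field
    x≥0 : 0# ≤ x
    maj≤ : Maj B f
    err : ev f -c v << B * x
    bnd : v << B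
  open Approx public
  B0 : ∀ {x B f v} -> Approx x B f v -> 0# ≤ B
  B0 a = fst (bnd a)
  Approx-mono : ∀ {x y B D f v} -> x ≤ y -> B ≤ D -> Approx x B f v -> Approx y D f v
  Approx-mono p q a = approx (<& (x≥0 a) p) (\ l -> <& (maj≤ a l) q)
   (<<m (err a) (*-mono (B0 a) q (x≥0 a) p)) (<<m (bnd a) q)
  Approx-⊗ : ∀ {x y B D f g v u} -> Approx x B f v -> Approx y D g u -> Approx (x + y + δ) (B * D) (f ⊗ g) (v *c u)
  Approx-⊗ {x} {y} {B} {D} {f} {g} {v} {u} a b = approx (nn+ (nn+ (x≥0 a) (x≥0 b)) δ0) (Maj-⊗ (maj≤ a) (maj≤ b))
   (tr2 _<<_ (#e11 (ev (f ⊗ g)) (ev f) (ev g) v u) (#e10 B D δ x y)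
    (<<-+ (<<-+ (ev-⊗ (maj≤ a) (maj≤ b)) (<<-* (ev<< (maj≤ a)) (err b))) (<<-* (err a) (bnd b))))
   (<<-* (bnd a) (bnd b))
  Approx-⊕ : ∀ {x B D f g v u} -> Approx x B f v -> Approx x D g u -> Approx x (B + D) (f ⊕ g) (v +c u)
  Approx-⊕ {x} {B} {D} {f} {g} {v} {u} a b = approx (x≥0 a)
   (\ l -> <& (≤= (sum-mono (S l) \ n _ -> ≤= (*r (^n n r≥0) (=≤ (ap abs (κ-+ (f n) (g n))) (abs-+ _ _)))
    (*-distʳ _ _ _)) (ΣQ.distr (S l) _ _)) (+m (maj≤ a l) (maj≤ b l)))
   (tr2 _<<_ (& (#e12 (ev f) (ev g) v u) (ap (\ t -> t -c (v +c u)) (! ev-⊕))) (! (*-distʳ x B D)) (<<-+ (err a) (err b)))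
   (<<-+ (bnd a) (bnd b)) where
   ev-⊕ : ev (f ⊕ g) ~ ev f +c ev g
   ev-⊕ = & (ΣC.cong-f (S L) \ n -> & (ap (_*c w n) (& (ap rl (κ-+ (f n) (g n))) (rl-+ _ _)))
    (& (*cc _ _) (& (*c-distˡ (w n) _ _) (ap2 _+c_ (*cc (w n) _) (*cc (w n) _))))) (ΣC.distr (S L) _ _)
  Approx-scale : ∀ {x B f v} c -> Approx x B f v -> Approx x (abs (κ c) * B) (scalePS c f) (rl (κ c) *c v)
  Approx-scale {x} {B} {f} {v} c a = approx (x≥0 a)
   (\ l -> <& (sum-mono (S l) \ n _ -> ≤= (*r (^n n r≥0) (=≤ (ap abs (κ-* c (f n))) (abs-* _ _)))
    *a) (=≤ (sum-*ˡ (S l) _ _) (*l (abs-nn _) (maj≤ a l))))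
   (tr2 _<<_ (& (#e13 (rl (κ c)) (ev f) v) (ap (\ t -> t -c rl (κ c) *c v) (! ev-scale))) (! (*-assoc _ B x)) (<<-* (<<-rl-abs _) (err a)))
   (<<-* (<<-rl-abs _) (bnd a)) where
   ev-scale : ev (scalePS c f) ~ rl (κ c) *c ev f
   ev-scale = & (ΣC.cong-f (S L) \ n -> & (ap (_*c w n) (& (ap rl (κ-* c (f n))) (rl-* _ _))) (*c-assoc _ _ _)) (sumc-*ˡ (S L) _ _)
  κ1 : κ Z.1ℤ ~ 1#
  κ1 = & (κ-ι 1) (+-idr 1#)
  κ0 : κ 0Z ~ 0#
  κ0 = κ-ι 0
  abs-κ1 : abs (κ Z.1ℤ) ≤ 1#
  abs-κ1 = =≤ (ap abs κ1) (abs-id 0≤1)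
  maj-0 : ∀ f n -> f n ~ 0Z -> maj f n ~ 0#
  maj-0 f n e = & (ap (\ c -> abs (κ c) * r1 ^ n) e) (& (ap (\ c -> abs c * r1 ^ n) κ0) (& (ap (_* r1 ^ n) (≤-antisym abs-0 (abs-nn 0#))) (*-0ˡ _)))
  term-0 : ∀ c n -> c ~ 0Z -> rl (κ c) *c w n ~ 0c
  term-0 c n e = & (ap (\ t -> rl t *c w n) (& (ap κ e) κ0)) (& (ap (_*c w n) rl-0) (*c-0ˡ _))
  w-0 : w 0 ~ 1c
  w-0 = & (ap2 _*c_ rl-1 z-0) (*c1l 1c)
  term-1 : ∀ c n -> c ~ Z.1ℤ -> rl (κ c) *c w n ~ w n
  term-1 c n e = & (ap (\ t -> rl t *c w n) (& (ap κ e) κ1)) (& (ap (_*c w n) rl-1) (*c1l _))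
  Approx-one : Approx 0# 1# onePS 1c
  Approx-one = approx r≤
   (\ l -> =≤ (& (ΣQ.front l _) (& (ap (maj onePS 0 +_) (ΣQ.fold-none l \ k _ -> maj-0 onePS (S k) refl)) (+-idr _)))
    (=≤ (*1r _) abs-κ1))
   (tr (_<< _) (! (& (ap (\ t -> t -c 1c) (& (ΣC.front L _) (& (ap2 _+c_ (& (term-1 _ 0 refl) w-0) (ΣC.fold-none L \ k _ -> term-0 _ (S k) refl)) (& (+c-comm _ _) (+c-idl _))))) (u-u 1c)))
    (<<-0 (≤r (! (*-0ʳ 1#)))))
   <<-1
  Approx-^ : ∀ {x B f v} n -> Approx x B f v -> Approx (ι n * (x + δ)) (B ^ n) (f ^PS n) (v ^c n)
  Approx-^ {x} zero a = Approx-mono (≤r (! (*-0ˡ _))) r≤ Approx-one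
  Approx-^ {x} {B} {f} {v} (S n) a = tr (\ t -> Approx t _ _ _) (#e14 x δ (ι n)) (Approx-⊗ a (Approx-^ n a))
  Approx-oneMinusQ : ∀ k -> Approx δ (1# + r1 ^ S k) (oneMinusQ (S k)) (1c -c w (S k))
  Approx-oneMinusQ k = approx δ0 mj er (<<-- <<-1 (w<< (S k))) where
   g = oneMinusQ (S k)
   off : ∀ j -> j ≢ k -> g (S j) ~ 0Z
   off j ne = ap (\ b -> if b then Z.- Z.1ℤ else 0Z) (dec-false (S j ≟ S k) \ e -> ne (NP.suc-injective e))
   on : g (S k) ~ Z.-1ℤ
   on = ap (\ b -> if b then Z.- Z.1ℤ else 0Z) (dec-true (S k ≟ S k) refl)
   κm : κ (g (S k)) ~ - 1#
   κm = & (ap κ on) (& (κ-neg Z.1ℤ) (ap (\ x -> - x) κ1))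
   tail-maj : ∀ l -> sum l (\ j -> maj g (S j)) ≤ r1 ^ S k
   tail-maj l with k N.<? l
   ... | yes p = =≤ (ΣQ.fold-single l k p \ j _ ne -> maj-0 g (S j) (off j ne))
    (≤= (*r (^n (S k) r≥0) (=≤ (ap abs κm) (abs-le (<& (le 1# 0≤1 (! (& (+-comm _ _) (+-inv 1#)))) 0≤1) (≤r nn1))))
     (*1l _)) where
    nn1 : - - 1# ~ 1#
    nn1 = #e15 1#
   ... | no n = =≤ (ΣQ.fold-none l \ j j<l -> maj-0 g (S j) (off j \ e -> n (tr (N._< l) e j<l))) (^n (S k) r≥0)
   mj : Maj (1# + r1 ^ S k) g
   mj l = =≤ (ΣQ.front l _) (+m (=≤ (*1r _) abs-κ1) (tail-maj l))
   head : rl (κ (g 0)) *c w 0 ~ 1c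
   head = & (term-1 _ 0 refl) w-0
   T : ℕ -> C
   T j = rl (κ (g (S j))) *c w (S j)
   evg : ∀ {t} -> sumc L T ~ t -> ev g ~ 1c +c t
   evg e = & (ΣC.front L _) (ap2 _+c_ head e)
   T-on : T k ~ -c w (S k)
   T-on = & (ap (\ t -> rl t *c w (S k)) κm) (& (ap (_*c w (S k)) (& (rl-neg 1#) (ap (\ t -> -c t) rl-1))) (#e17 (w (S k))))
   er : ev g -c (1c -c w (S k)) << (1# + r1 ^ S k) * δ
   er with k N.<? L
   ... | yes p = tr (_<< (1# + r1 ^ S k) * δ) (! (& (ap (\ t -> t -c (1c -c w (S k)))
    (evg (& (ΣC.fold-single L k p \ j _ ne -> term-0 _ (S j) (off j ne)) T-on))) (u-u _)))
    (<<-0 (nn* (nn+ 0≤1 (^n (S k) r≥0)) δ0))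
   ... | no n = <<m (tr (_<< r1 ^ S k * r1 ^ S k) (& (#e16 (w (S k))) (ap (\ t -> t -c (1c -c w (S k)))
    (! (evg (ΣC.fold-none L \ j j<L -> term-0 _ (S j) (off j \ e -> n (tr (N._< L) e j<L))))))) (w<<² (S k)))
    (*-mono (^n (S k) r≥0) (y≤x+y 0≤1) (^n (S k) r≥0) (<& (^-anti r≥0 r1≤1 (&N (≮⇒≥ n) (n≤1+n k))) (x≤x+y η0)))
  etaErr : Q
  etaErr = ι 24 * (δ + δ) + δ
  etaMaj : ℕ -> Q
  etaMaj m = prod m (\ n -> (1# + r1 ^ S n) ^ 24)
  etaVal : ℕ -> C
  etaVal m = prodc m (\ n -> (1c -c w (S n)) ^c 24)
  Approx-etaStep : ∀ c m k {B f v} -> Approx (ι m * (ι c * (δ + δ) + δ)) B f v →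
   Approx (ι (S m) * (ι c * (δ + δ) + δ)) (B * (1# + r1 ^ S k) ^ c) (f ⊗ (oneMinusQ (S k) ^PS c)) (v *c (1c -c w (S k)) ^c c)
  Approx-etaStep c m k a = Approx-mono (≤r (#e18 (ι m) (ι c) δ)) r≤ (Approx-⊗ a (Approx-^ c (Approx-oneMinusQ k)))
  Approx-partialEta : ∀ m -> Approx (ι m * etaErr) (etaMaj m) (partialEta24 m) (etaVal m)
  Approx-partialEta zero = Approx-mono (≤r (! (*-0ˡ etaErr))) r≤ Approx-one
  Approx-partialEta (S m) = Approx-etaStep 24 m m (Approx-partialEta m)
  r1^suc≤ : ∀ n -> r1 ^ S n ≤ r1 ^ n
  r1^suc≤ n = ^-anti r≥0 r1≤1 (n≤1+n n)
  maj-shift : ∀ f n -> maj (shiftPS f) (S n) ≤ maj f n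
  maj-shift f n = *l (abs-nn _) (r1^suc≤ n)
  Approx-shift : ∀ {x B f v} -> Approx x B f v -> Approx (x + δ) B (shiftPS f) (w 1 *c v)
  Approx-shift {x} {B} {f} {v} a = approx (nn+ (x≥0 a) δ0)
   (\ l -> =≤ (& (ΣQ.front l _) (& (ap (_+ sum l (\ k -> maj (shiftPS f) (S k))) (maj-0 (shiftPS f) 0 refl)) (+-idl _)))
    (<& (sum-mono l \ n _ -> maj-shift f n) (<& (sum-ext (n≤1+n l) (maj-nn f)) (maj≤ a l))))
   (tr2 _<<_ (& (h _ (w 1 *c ev f) (w 1) v (ev f) refl) refl) (! (& (*-distˡ B x δ) (+-comm _ _)))
    (<<-+ main (<<m (<<-* (w<< 1) (err a)) (≤= (*r (nn* (B0 a) (x≥0 a)) (^-≤1 1 r≥0 r1≤1)) (*1l _)))))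
   (<<m (<<-* (w<< 1) (bnd a)) (≤= (*r (B0 a) (^-≤1 1 r≥0 r1≤1)) (*1l B))) where
   h : ∀ s p q v e -> p ~ q *c e -> (s -c p) +c q *c (e -c v) ~ s -c q *c v
   h s .(q *c e) q v e refl = solve 4 (\ s q v e -> (s :- q :* e) :+ q :* (e :- v) := s :- q :* v) refl s q v e
   F : ℕ -> C
   F n = rl (κ (f n))
   main : ev (shiftPS f) -c w 1 *c ev f << B * δ
   main = tr (_<< B * δ) (! eq) (<<m (<<-- (<<-sum L \ n _ -> near n) last)
    (<& (+m (≤r (sum-*ʳ L δ (maj f))) r≤) (=≤ (! (*-distʳ δ (sum L (maj f)) (maj f L))) (*r δ0 (maj≤ a L))))) where
    near : ∀ n -> F n *c (w (1 N.+ n) -c w 1 *c w n) << maj f n * δ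
    near n = <<m (<<-* (<<-rl-abs _) (w-mul 1 n)) (≤= (*l (abs-nn _) (*-mono (nn* (^n 1 r≥0) (^n n r≥0))
     (≤= (*r (^n n r≥0) (^-≤1 1 r≥0 r1≤1)) (*1l _)) η0 (y≤x+y (^n L r≥0)))) (! *a))
    last : F L *c (w 1 *c w L) << maj f L * δ
    last = <<m (<<-* (<<-rl-abs _) (<<-* (w<< 1) (w<<² L))) (≤= (*l (abs-nn _)
     (<& (*r (nn* (^n L r≥0) (^n L r≥0)) (^-≤1 1 r≥0 r1≤1)) (=≤ (*1l _) (*l (^n L r≥0) (x≤x+y η0)))))
     (! *a))
    h4 : ∀ s t -> s -c t ~ s +c -c t
    h4 s t = refl
    n0 : -c 0c ~ 0c
    n0 = solve 0 (:- con (Z.+ 0) := con (Z.+ 0)) refl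
    eq : ev (shiftPS f) -c w 1 *c ev f ~ sumc L (\ n -> F n *c (w (1 N.+ n) -c w 1 *c w n)) -c F L *c (w 1 *c w L)
    eq = & (ap (\ t -> t -c w 1 *c ev f) (& (ΣC.front L _) (ap (_+c sumc L (\ n -> F n *c w (S n))) (term-0 _ 0 refl))))
     (& (#e21 _ (w 1) _ _) (ap2 _-c_ (& (ap (\ t -> sumc L (\ n -> F n *c w (S n)) +c -c t) (! (sumc-*ˡ L (w 1) _)))
      (& (ap (sumc L (\ n -> F n *c w (S n)) +c_) (ΣC.fold-hom L _ (\ x -> -c x) n0 #e9)) (& (! (ΣC.distr L _ _))
       (ΣC.cong-f L \ n -> #e20 (F n) (w (S n)) (w 1) (w n))))) (#e19 (F L) (w 1) (w L))))
  Approx-Δ : ∀ {B} M -> L N.≤ M -> (∀ m -> etaMaj m ≤ B) -> Approx (ι M * etaErr + δ) B Δ (w 1 *c etaVal M)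
  Approx-Δ {B} M l h = approx (x≥0 a) mj (tr (\ t -> t -c w 1 *c etaVal M << B * (ι M * etaErr + δ)) evs (err a)) (bnd a) where
   a = Approx-mono r≤ (h M) (Approx-shift (Approx-partialEta M))
   evs : ev (shiftPS (partialEta24 M)) ~ ev Δ
   evs = ΣC.cong-< (S L) \ n n≤L -> ap (\ c -> rl (κ c) *c w n) (! (Δ-shift M n (&N (s≤s⁻¹ n≤L) l)))
   mj : Maj B Δ
   mj k = =≤ (ΣQ.cong-< (S k) \ n n≤k -> ap (\ c -> abs (κ c) * r1 ^ n) (Δ-shift k n (s≤s⁻¹ n≤k)))
    (<& (maj≤ (Approx-shift (Approx-partialEta k)) k) (h k))
  e4Sum : ℕ -> Q
  e4Sum M = sum M (\ d -> sum M (\ m -> cube (S d) * r1 ^ (S d N.* S m)))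
  e4Val : ℕ -> C
  e4Val M = 1c +c rl (c240) *c sumc M (\ d -> sumc M (\ m -> rl (cube (S d)) *c w (S d N.* S m)))
  private
   240σ : ∀ n t -> rl (κ (E₄ (S n))) *c t ~ rl (c240) *c (rl (κ (σ₃ (S n))) *c t)
   240σ n t = & (ap (_*c t) (& (ap rl (& (κ-* (Z.+ 240) (σ₃ (S n))) (ap (_* κ (σ₃ (S n))) (κ-240)))) (rl-* _ _))) (*c-assoc _ _ _)
  Approx-E4 : ∀ {SS} M -> L N.≤ M -> (∀ m -> e4Sum m ≤ SS) -> Approx δ (1# + c240 * SS) E₄ (e4Val M)
  Approx-E4 {SS} M l h = approx δ0 mj er (<<-+ <<-1 (<<-* (<<-rl c240-nn) (<<m (<<-sum M \ d _ -> <<-sum M \ m _ -> <<-* (<<-rl (cube-nn (S d))) (w<< (S d N.* S m))) (h M)))) where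
   S≥0 : 0# ≤ SS
   S≥0 = h 0
   u : ℕ -> ℕ -> C
   u d m = rl (cube (S d)) *c w (S d N.* S m)
   v : ℕ -> ℕ -> C
   v d m = χ (S d N.* S m N.≤? L) (u d m)
   evE : ev E₄ ~ 1c +c rl (c240) *c sumc M (\ d -> sumc M (v d))
   evE = & (ΣC.front L _) (ap2 _+c_ (& (term-1 _ 0 refl) w-0) (& (ΣC.cong-f L \ n -> 240σ n (w (S n)))
    (& (sumc-*ˡ L (rl (c240)) _) (ap (rl (c240) *c_) (σ3-collapse L M w l)))))
   uv : ∀ d m -> v d m -c u d m << cube (S d) * r1 ^ (S d N.* S m) * r1 ^ L
   uv d m = go (S d N.* S m N.≤? L) where
    k = S d N.* S m
    go : (D : Dec (k N.≤ L)) -> χ D (u d m) -c u d m << cube (S d) * r1 ^ k * r1 ^ L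
    go (yes _) = tr (_<< cube (S d) * r1 ^ k * r1 ^ L) (! (u-u (u d m))) (<<-0 (nn* (nn* (cube-nn (S d)) (^n k r≥0)) (^n L r≥0)))
    go (no n) = tr (_<< cube (S d) * r1 ^ k * r1 ^ L) (! (+c-idl _)) (<<-neg (<<m (<<-* (<<-rl (cube-nn (S d))) (w<<² k))
     (=≤ (! *a) (*l (nn* (cube-nn (S d)) (^n k r≥0)) (^-anti r≥0 r1≤1 (<⇒≤ (≰⇒> n)))))))
   sub-sum : ∀ n (s t : ℕ -> C) -> sumc n s -c sumc n t ~ sumc n (\ k -> s k -c t k)
   sub-sum n s t = & (ap (sumc n s +c_) (ΣC.fold-hom n t (\ x -> -c x) (solve 0 (:- con (Z.+ 0) := con (Z.+ 0)) refl) (solve 2 (\ x y -> :- (x :+ y) := :- x :+ :- y) refl)))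
    (! (ΣC.distr n s (\ k -> -c t k)))
   er : ev E₄ -c e4Val M << (1# + c240 * SS) * δ
   er = tr (_<< (1# + c240 * SS) * δ) (! (& (ap (\ t -> t -c e4Val M) evE) (& (#e22 (rl (c240)) _ _)
    (ap (rl (c240) *c_) (& (sub-sum M _ _) (ΣC.cong-f M \ d -> sub-sum M _ _))))))
    (<<m (<<-* (<<-rl c240-nn) (<<-sum M \ d _ -> <<-sum M \ m _ -> uv d m))
     (<& (*l c240-nn (=≤ (& (ΣQ.cong-f M \ d -> sum-*ʳ M (r1 ^ L) _) (sum-*ʳ M (r1 ^ L) _)) (*-mono (e4-nn M) (h M) (^n L r≥0) (x≤x+y η0))))
      (=≤ (! (*-assoc (c240) SS δ)) (*r δ0 (y≤x+y 0≤1))))) where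
    e4-nn : ∀ M -> 0# ≤ e4Sum M
    e4-nn M = sum-nn M \ d -> sum-nn M \ m -> nn* (cube-nn (S d)) (^n (S d N.* S m) r≥0)
   mj : Maj (1# + c240 * SS) E₄
   mj k = =≤ (ΣQ.front k _) (+m (=≤ (*1r _) abs-κ1)
    (<& (sum-mono k \ n _ -> ≤= (*r (^n (S n) r≥0) (=≤ (ap abs (& (κ-* (Z.+ 240) (σ₃ (S n))) (ap (_* κ (σ₃ (S n))) (κ-240))))
     (abs-id (nn* c240-nn (κσ3-nn (S n)))))) *a)
     (=≤ (sum-*ˡ k (c240) _) (*l c240-nn (<& (real k) (h k)))))) where
    real : ∀ k -> sum k (\ n -> κ (σ₃ (S n)) * r1 ^ S n) ≤ e4Sum k
    real k = =≤ (& (! (re-rl _)) (ap re (& (rl-sum k _) (& (ΣC.cong-f k \ n -> rl-* _ _) (σ3-collapse k k (\ n -> rl (r1 ^ n)) NP.≤-refl)))))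
     (re-sum k (\ d -> sum k (\ m -> cube (S d) * r1 ^ (S d N.* S m))) \ d -> re-sum k (\ m -> cube (S d) * r1 ^ (S d N.* S m)) \ m -> re-χ (S d N.* S m N.≤? k) d m) where
     re-sum : ∀ n {f} g -> (∀ j -> re (f j) ≤ g j) -> re (sumc n f) ≤ sum n g
     re-sum zero g p = ≤r (& (ap re (! rl-0)) (re-rl 0#))
     re-sum (S n) g p = =≤ (re-+ _ _) (+m (re-sum n g p) (p n))
     re-χ : ∀ {P : Set} (D : Dec P) d m -> re (χ D (rl (cube (S d)) *c rl (r1 ^ (S d N.* S m)))) ≤ cube (S d) * r1 ^ (S d N.* S m)
     re-χ (yes _) d m = ≤r (& (ap re (! (rl-* _ _))) (re-rl _))
     re-χ (no _) d m = =≤ (& (ap re (! rl-0)) (re-rl 0#)) (nn* (cube-nn (S d)) (^n (S d N.* S m) r≥0))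
  Approx-sumPS : ∀ {x} n {F : ℕ -> PS} {v : ℕ -> C} {B : ℕ -> Q} -> (∀ k -> k N.≤ n -> Approx x (B k) (F k) (v k)) →
   Approx x (sum (S n) B) (sumPS F n) (sumc (S n) v)
  Approx-sumPS {x} zero {F} {v} {B} h = tr2 (\ b u -> Approx x b (F 0) u) (! (+-idl (B 0))) (! (+c-idl (v 0))) (h 0 z≤n)
  Approx-sumPS (S n) h = Approx-⊕ (Approx-sumPS n \ k l -> h k (NP.m≤n⇒m≤1+n l)) (h (S n) NP.≤-refl)
  module _ (P : Poly2) (M : ℕ) {x B1 B2 B3 B4 e b e' b'}
   (aE : Approx x B1 E₄ e) (aΔ : Approx x B2 Δ b) (aE' : Approx x B3 (dilate M E₄) e') (aΔ' : Approx x B4 (dilate M Δ) b') where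
   private
    D = bound P
   clearedMaj : Q
   clearedMaj = sum (S D) (\ j -> sum (S D) (\ k -> abs (κ (coeff P j k)) *
    ((B1 ^ (3 N.* j) * B2 ^ (D ∸ j)) * (B3 ^ (3 N.* k) * B4 ^ (D ∸ k)))))
   clearedVal : C
   clearedVal = sumc (S D) (\ j -> sumc (S D) (\ k -> rl (κ (coeff P j k)) *c
    ((e ^c (3 N.* j) *c b ^c (D ∸ j)) *c (e' ^c (3 N.* k) *c b' ^c (D ∸ k)))))
   Approx-cleared : Approx (ι (8 N.* D N.+ 3) * (x + δ)) clearedMaj (clearedEval P M) clearedVal
   Approx-cleared = Approx-sumPS D \ j j≤ -> Approx-sumPS D \ k k≤ -> Approx-scale (coeff P j k)
    (Approx-mono (bound-x j k j≤ k≤) r≤ (Approx-⊗ (Approx-⊗ (Approx-^ (3 N.* j) aE) (Approx-^ (D ∸ j) aΔ)) (Approx-⊗ (Approx-^ (3 N.* k) aE') (Approx-^ (D ∸ k) aΔ')))) where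
    y = x + δ
    y≥0 : 0# ≤ y
    y≥0 = nn+ (x≥0 aE) δ0
    one : δ ≤ ι 1 * y
    one = ≤= (y≤x+y (x≥0 aE)) (! (& (ap (_* y) (+-idr 1#)) (*1l y)))
    count : ∀ j k -> j N.≤ D -> k N.≤ D -> 3 N.* j N.+ (D ∸ j) N.+ (3 N.* k N.+ (D ∸ k)) N.+ 3 N.≤ 8 N.* D N.+ 3
    count j k p q = +-monoˡ-≤ 3 (&N (+-mono-≤ (half j p) (half k q)) (≡N (! (NP.*-distribʳ-+ D 4 4)))) where
     half : ∀ j -> j N.≤ D -> 3 N.* j N.+ (D ∸ j) N.≤ 4 N.* D
     half j p = &N (+-mono-≤ (*-monoʳ-≤ 3 p) (m∸n≤m D j)) (≡N (NP.+-comm (3 N.* D) D))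
    bound-x : ∀ j k -> j N.≤ D -> k N.≤ D -> _ ≤ ι (8 N.* D N.+ 3) * y
    bound-x j k p q = <& (+m (+m (+m r≤ one) (+m r≤ one)) one) (=≤ (& (#e23 (ι (3 N.* j)) (ι (D ∸ j)) (ι (3 N.* k)) (ι (D ∸ k)) y)
     (ap (_* y) (! (& (ι-+ (3 N.* j N.+ (D ∸ j) N.+ (3 N.* k N.+ (D ∸ k))) 3) (ap (_+ ι 3) (& (ι-+ (3 N.* j N.+ (D ∸ j)) _) (ap2 _+_ (ι-+ (3 N.* j) _) (ι-+ (3 N.* k) _))))))))
     (*r y≥0 (ι-mono (count j k p q))))
   vanishing-<< : (∀ m -> clearedEval P M m ~ 0Z) -> clearedVal << clearedMaj * (ι (8 N.* D N.+ 3) * (x + δ))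
   vanishing-<< z = tr (_<< clearedMaj * (ι (8 N.* D N.+ 3) * (x + δ))) (& (ap -c_ (& (ap (\ t -> t -c clearedVal) (ΣC.fold-none (S L) \ n _ -> term-0 _ n (z n))) (+c-idl _)))
    (solve 1 (\ u -> :- (:- u) := u) refl clearedVal)) (<<-neg (err Approx-cleared))

 module DilateEval (r1 : Q) (r1>0 : 0# < r1) (r1≤1 : r1 ≤ 1#) (z : ℕ -> C) (z-unit : ∀ n -> N (z n) ~ 1#)
  (η : Q) (η0 : 0# ≤ η) (z-mul : ∀ m n -> z (m N.+ n) -c z m *c z n << η) (z-0 : z 0 ~ 1c)
  (M : ℕ) (M≥1 : 1 N.≤ M) (z-M : ∀ n -> z (n N.* M) ~ 1c) (K : ℕ) where
  module E = Eval r1 r1>0 r1≤1 z z-unit η η0 z-mul z-0 (K N.* M)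
  module E' = Eval (r1 ^ M) (^-pos M r1>0) (^-≤1 M (lt r1>0) r1≤1) (\ _ -> 1c) (\ _ -> N-1) 0# r≤
   (\ _ _ -> tr (_<< 0#) (! (& (ap (\ t -> 1c -c t) (*c1l 1c)) (u-u 1c))) (<<-0 r≤)) refl K
  Approx-dilate : ∀ {x B f v} -> E'.Approx x B f v -> E.Approx x B (dilate M f) v
  Approx-dilate {x} {B} {f} {v} a = E.approx (E'.x≥0 a) mj (tr (\ t -> t -c v << B * x) (! evs) (E'.err a)) (E'.bnd a) where
   evs : E.ev (dilate M f) ~ E'.ev f
   evs = & (fold-dilatec M f (\ c n -> rl (κ c) *c E.w n) M≥1 (\ n -> E.term-0 _ n refl) K)
    (ΣC.cong-f (S K) \ m -> ap (rl (κ (f m)) *c_) (ap2 _*c_ (ap rl (& (^-^ _ m M) (ap (_^ m) (*-^ r1 r1 M)))) (z-M m)))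
   mj : E.Maj B (dilate M f)
   mj l = <& (sum-ext (s≤s (m≤m*n l M {{>-nonZero M≥1}})) (E.maj-nn (dilate M f)))
    (=≤ (& (fold-dilateQ M f (\ c n -> abs (κ c) * r1 ^ n) M≥1 (\ n -> E.maj-0 (\ _ -> 0Z) n refl) l)
     (ΣQ.cong-f (S l) \ m -> ap (abs (κ (f m)) *_) (^-^ r1 m M))) (E'.maj≤ a l))

module B6 where
 open Rationals
 open Gauss
 open CSolver using (solve; _:*_; :-_; _:-_; _:=_)

 opaque
  unfolding Qr
  #f2 : ∀ x e -> x - - e ~ e - - x
  #f2 = auto Qr
  #f3 : ∀ x -> - (2# * x) ~ 2# * - x
  #f3 = auto Qr
  #f4 : ∀ t y -> 4# * (t * y) ~ 2# * (2# * t * y)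
  #f4 = auto Qr
  #f5 : ∀ y -> 1# ~ - y + (1# + y)
  #f5 = auto Qr
  #f6 : ∀ n m k -> 2# * k ~ - (n * m) + (n * (m - - k) + (2# - n) * k)
  #f6 = auto Qr
  #f7 : ∀ x z -> x ~ z + - (z - x)
  #f7 = auto Qr
  #f8 : ∀ p q r s -> r * - q + s * p ~ s * p - r * q
  #f8 = auto Qr
  #f9 : ∀ a -> a + - 0# ~ a
  #f9 = auto Qr
  #f10 : ∀ b -> 0# * 0# + b * b ~ b * b
  #f10 = auto Qr
  #f11 : ∀ m -> m * m + m * m ~ 2# * (m * m)
  #f11 = auto Qr
  #f12 : ∀ c m -> c * c * (2# * (m * m)) ~ 2# * (c * c * (m * m))
  #f12 = auto Qr
  #f13 : ∀ x -> 1# - - x ~ x - - 1#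
  #f13 = auto Qr
  #f14 : ∀ x z -> z - x ~ - x - - z
  #f14 = auto Qr
  #f15 : ∀ n y m -> n * (y * m) ~ y * (n * m)
  #f15 = auto Qr
  #f17 : ∀ c a b -> c * b + 0# * a ~ c * b
  #f17 = auto Qr
  #f18 : ∀ c a b -> c * a - 0# * b ~ c * a
  #f18 = auto Qr
  #f19 : ∀ k c x -> k * k * (2# * (c * x) * (2# * (c * x))) ~ c * c * (2# * k * (2# * k) * (x * x))
  #f19 = auto Qr
  #f20 : ∀ c x -> c * c * (x * x) ~ (c * x) * (c * x)
  #f20 = auto Qr

 #f1 : ∀ a b c d -> a *c b *c (c *c d) ~ a *c c *c (b *c d)
 #f1 = solve 4 (\ a b c d -> a :* b :* (c :* d) := a :* c :* (b :* d)) refl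
 #f16 : ∀ c u v -> c *c u -c c *c v ~ c *c (u -c v)
 #f16 = solve 3 (\ c u v -> c :* u :- c :* v := c :* (u :- v)) refl

 -- Asymptotics of families indexed by T (where q = ζ (1 - 1/T)²) and by a stage s (which controls
 -- truncation and the quality of the approximate roots of unity); s tends to infinity before T does.

 Ev : (ℕ -> ℕ -> Set) -> Set
 Ev P = ∃ \ T₀ -> ∀ T -> T₀ N.≤ T -> ∃ \ s0 -> ∀ s -> s0 N.≤ s -> P T s

 Evm : ∀ {P R : ℕ -> ℕ -> Set} -> (∀ T s -> P T s -> R T s) -> Ev P -> Ev R
 Evm f (T₀ , h) = T₀ , \ T l -> fst (h T l) , \ s l' -> f T s (snd (h T l) s l')

 Ev-∧ : ∀ {P R : ℕ -> ℕ -> Set} -> Ev P -> Ev R -> Ev (\ T s -> P T s × R T s)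
 Ev-∧ (T₀ , h) (T1 , k) = T₀ N.⊔ T1 , \ T l →
  let (s0 , h') = h T (&N (NP.m≤m⊔n T₀ T1) l) ; (s1 , k') = k T (&N (NP.m≤n⊔m T₀ T1) l)
  in s0 N.⊔ s1 , \ s l' -> h' s (&N (NP.m≤m⊔n s0 s1) l') , k' s (&N (NP.m≤n⊔m s0 s1) l')

 Evm2 : ∀ {P R SS : ℕ -> ℕ -> Set} -> (∀ T s -> P T s -> R T s -> SS T s) -> Ev P -> Ev R -> Ev SS
 Evm2 f p r = Evm (\ T s (x , y) -> f T s x y) (Ev-∧ p r)

 Ev! : ∀ {P : ℕ -> ℕ -> Set} -> (∀ T s -> P T s) -> Ev P
 Ev! h = 0 , \ T _ -> 0 , \ s _ -> h T s

 Ev-T≥ : ∀ n -> Ev (\ T s -> n N.≤ T)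
 Ev-T≥ n = n , \ T l -> 0 , \ s _ -> l

 Ev-all< : ∀ {P : ℕ -> ℕ -> ℕ -> Set} K -> (∀ k -> k N.< K -> Ev (P k)) -> Ev (\ T s -> ∀ k -> k N.< K -> P k T s)
 Ev-all< zero h = Ev! \ T s k ()
 Ev-all< {P} (S K) h = Evm2 comb (Ev-all< K \ k l -> h k (m<n⇒m<1+n l)) (h K NP.≤-refl) where
  comb : ∀ T s -> (∀ k -> k N.< K -> P k T s) -> P K T s -> ∀ k -> k N.< S K -> P k T s
  comb T s f x k l with k ≟ K
  ... | yes refl = x
  ... | no ne = f k (≤∧≢⇒< (s≤s⁻¹ l) ne)

 tε : ℕ -> ℕ -> Q
 tε c T = ι c * inv (ι T)

 inv-ι-nn : ∀ T -> 0# ≤ inv (ι T)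
 inv-ι-nn zero = ≤r (! inv-0) where
  opaque
   unfolding Qr
   inv-0 : inv 0# ~ 0#
   inv-0 = refl
 inv-ι-nn (S T) = inv-nn (ι-pos {S T} z<s)

 tε-nn : ∀ c T -> 0# ≤ tε c T
 tε-nn c T = nn* (ι-nn c) (inv-ι-nn T)

 tε-+ : ∀ c d T -> tε (c N.+ d) T ~ tε c T + tε d T
 tε-+ c d T = & (ap (_* inv (ι T)) (ι-+ c d)) (*-distʳ _ _ _)

 tε-* : ∀ c d T -> ι d * tε c T ~ tε (d N.* c) T
 tε-* c d T = & (! *a) (ap (_* inv (ι T)) (! (ι-* d c)))

 tε-mono : ∀ {c d} T -> c N.≤ d -> tε c T ≤ tε d T
 tε-mono T l = *r (inv-ι-nn T) (ι-mono l)

 tε≤1 : ∀ {c T} -> c N.≤ T -> 1 N.≤ T -> tε c T ≤ 1#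
 tε≤1 {c} {T} l l' = ≤= (*r (inv-ι-nn T) (ι-mono l)) (inv-r (ι-pos l'))

 2tε : ∀ c T -> 2# * tε c T ~ tε (2 N.* c) T
 2tε c T = & (ap (_* tε c T) (! (ap (1# +_) (+-idr 1#)))) (tε-* c 2 T)

 Ev-small : ∀ c -> Ev (\ T s -> 2# * tε c T ≤ 1#)
 Ev-small c = Evm (\ T s l -> =≤ (2tε c T) (tε≤1 (&N (n≤1+n (2 N.* c)) l) (&N z<s l))) (Ev-T≥ (S (2 N.* c)))

 Ev-≤1 : ∀ c -> Ev (\ T s -> tε c T ≤ 1#)
 Ev-≤1 c = Evm (\ T s l -> <& (=≤ (! (*1l _)) (*r (tε-nn c T) (x≤x+y 0≤1))) l) (Ev-small c)

 infix 4 _≈_ _||_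
 _≈_ : (ℕ -> ℕ -> C) -> (ℕ -> ℕ -> C) -> Set
 u ≈ v = ∃ \ c -> Ev (\ T s -> Rel (u T s) (v T s) (tε c T))

 ≈-refl : ∀ u -> u ≈ u
 ≈-refl u = 0 , Ev! \ T s -> rel-refl (u T s) (tε-nn 0 T)

 ≈-≡ : ∀ {u v} -> (∀ T s -> u T s ~ v T s) -> u ≈ v
 ≈-≡ {u} h = 0 , Ev! \ T s -> tr (\ w -> Rel (u T s) w (tε 0 T)) (h T s) (rel-refl (u T s) (tε-nn 0 T))

 ≈-sym : ∀ {u v} -> u ≈ v -> v ≈ u
 ≈-sym (c , p) = 2 N.* c , Evm2 (\ T s l r -> rel-mono (≤r (2tε c T)) (rel-sym l r)) (Ev-small c) p

 ≈t : ∀ {u v w} -> u ≈ v -> v ≈ w -> u ≈ w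
 ≈t {u} {v} {w} (c , p) (d , q) = 2 N.* c N.+ d , Evm2 (\ T s l (r , r') -> rel-mono (≤= (+m (≤= (*l (tε-nn c T) (+m l r≤))
  (& (*-comm _ _) (2tε c T))) r≤) (! (tε-+ (2 N.* c) d T))) (rel-trans r r')) (Ev-≤1 d) (Ev-∧ p q)

 infixl 7 _⊡_
 _⊡_ : (ℕ -> ℕ -> C) -> (ℕ -> ℕ -> C) -> ℕ -> ℕ -> C
 (u ⊡ v) T s = u T s *c v T s

 ≈-* : ∀ {u v u' v'} -> u ≈ v -> u' ≈ v' -> u ⊡ u' ≈ v ⊡ v'
 ≈-* (c , p) (d , q) = c N.+ c N.+ d , Evm2 (\ T s l (r , r') -> rel-mono (≤= (+m (+m (≤= (*l (tε-nn c T) l) (*1r _)) r≤) r≤)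
  (& (ap (_+ tε d T) (! (tε-+ c c T))) (! (tε-+ (c N.+ c) d T)))) (rel-* r r')) (Ev-≤1 d) (Ev-∧ p q)

 ≈-^ : ∀ {u v} n -> u ≈ v -> (\ T s -> u T s ^c n) ≈ (\ T s -> v T s ^c n)
 ≈-^ zero p = ≈-refl _
 ≈-^ (S n) p = ≈-* p (≈-^ n p)

 ≈-cancel : ∀ {u v w} -> Ev (\ T s -> 0# < N (w T s)) -> u ⊡ w ≈ v ⊡ w -> u ≈ v
 ≈-cancel nz (c , p) = c , Evm2 (\ T s l r -> rel-cancel l r) nz p

 ≈-cj : ∀ {u v} -> u ≈ v -> (\ T s -> cj (u T s)) ≈ (\ T s -> cj (v T s))
 ≈-cj (c , p) = c , Evm (\ T s -> rel-cj) p

 _||_ : (ℕ -> ℕ -> C) -> (ℕ -> ℕ -> C) -> Set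
 u || ω = Σ (ℕ -> ℕ -> Q) \ l -> Ev (\ T s -> 0# < l T s) × (u ≈ (\ T s -> rl (l T s) *c ω T s))

 ||-≈ : ∀ {u v ω} -> u ≈ v -> v || ω -> u || ω
 ||-≈ p (l , l>0 , q) = l , l>0 , ≈t p q

 ||-≈ʳ : ∀ {u ω ω'} -> u || ω -> ω ≈ ω' -> u || ω'
 ||-≈ʳ (l , l>0 , q) p = l , l>0 , ≈t q (≈-* (≈-refl _) p)

 ||-refl : ∀ u -> u || u
 ||-refl u = (\ _ _ -> 1#) , Ev! (\ _ _ -> 0<1) , ≈-≡ \ T s -> ! (& (ap (_*c u T s) rl-1) (*c1l _))

 ||-* : ∀ {u ω u' ω'} -> u || ω -> u' || ω' -> u ⊡ u' || ω ⊡ ω'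
 ||-* {ω = ω} {ω' = ω'} (l , l>0 , p) (m , m>0 , q) = (\ T s -> l T s * m T s) , Evm2 (\ T s -> pp*) l>0 m>0 ,
  ≈t (≈-* p q) (≈-≡ \ T s -> & (#f1 (rl (l T s)) (ω T s) (rl (m T s)) (ω' T s)) (ap (_*c (ω T s *c ω' T s)) (! (rl-* _ _))))

 ||-^ : ∀ {u ω} n -> u || ω -> (\ T s -> u T s ^c n) || (\ T s -> ω T s ^c n)
 ||-^ zero p = ||-refl _
 ||-^ (S n) p = ||-* p (||-^ n p)

 ||-prod : ∀ n {u ω : ℕ -> ℕ -> ℕ -> C} -> (∀ k -> k N.< n -> u k || ω k) -> (\ T s -> prodc n (\ k -> u k T s)) || (\ T s -> prodc n (\ k -> ω k T s))
 ||-prod zero h = ||-refl _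
 ||-prod (S n) h = ||-* (||-prod n \ k l -> h k (m<n⇒m<1+n l)) (h n NP.≤-refl)

 ||-pos : ∀ {l : ℕ -> ℕ -> Q} -> Ev (\ T s -> 0# < l T s) -> (\ T s -> rl (l T s)) || (\ _ _ -> 1c)
 ||-pos {l} p = l , p , ≈-≡ \ T s -> ! (*c1r _)

 ||-cj : ∀ {u ω} -> u || ω -> (\ T s -> cj (u T s)) || (\ T s -> cj (ω T s))
 ||-cj (l , l>0 , p) = l , l>0 , ≈t (≈-cj p) (≈-≡ \ T s -> & (cj-* _ _) (ap (_*c _) (cj-rl _)))

 -- A complex number D, most of whose powers up to the a-th lie close to the right half plane and whose
 -- a-th power is nearly a positive real, is itself nearly a positive real.

 module Principal where
  private
   opaque
    unfolding Qr
    h1 : ∀ a b -> a + b ~ b - - a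
    h1 = auto Qr
    h2 : ∀ p α q β c y t -> p * α + q * β ~ - ((1# + 2#) * (t + c) * y) +
     ((α - - (c * y)) * (p - - (2# * y)) + 2# * y * (t - α) + c * y * (1# - p) + 2# * (c * y) * (1# - y) + q * (β - - (t * y)) + t * y * (1# - q))
    h2 = auto Qr
    h3 : ∀ e x p -> 2# * e ~ 2# * (x * p) + ((e - x) * (p - - 1#) + (x - - e) * (1# - p))
    h3 = auto Qr
    h4 : ∀ x -> 1# ~ 4# * (x * x) + (1# - 2# * x) * (1# - - (2# * x))
    h4 = auto Qr
    h5 : ∀ e x -> 4# * (4# * (x * x + e * e)) ~ 4# * (4# * (x * x)) + 4# * e * (4# * e)
    h5 = auto Qr
    h6 : ∀ p r q s -> (p * r - q * s) * - q + (p * s + q * r) * p ~ (p * p + q * q) * s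
    h6 = auto Qr
    h7 : ∀ q -> q ~ 1# * q
    h7 = auto Qr
    h8 : ∀ e c y -> 2# * e + 4# * (c * y) ~ 2# * (e + 2# * (c * y))
    h8 = auto Qr
    h9 : ∀ t c y -> 2# * (t * y) + 4# * (c * y) ~ (2# * t + 4# * c) * y
    h9 = auto Qr
  re-of-close : ∀ {F v y z} -> N v ≤ z * z -> 0# ≤ y -> 0# ≤ z -> N (F -c v) ≤ y * y * N v -> 0# ≤ re F -> - (z * y) ≤ re v
  re-of-close {F} {v} {y} {z} nv y≥0 z≥0 p q = undiff (tr (0# ≤_) (h1 _ _) (<& q (=≤ (& (ap re (! (u-v+v F v))) (re-+ _ _))
   (+m (<<-re (nn* z≥0 y≥0 , <& p (≤= (*l (nnsq y) nv) (& (*-comm _ _) (swap* z z y y))))) r≤))))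
  -- a real number of absolute value nearly one that is not too negative is positive
  large-re : ∀ {x e} -> 0# ≤ e -> 4# * e ≤ 1# -> - e ≤ x -> 1# ≤ x * x + e * e -> 1# ≤ 2# * x
  large-re {x} {e} e0 e≤ p q with ≤-total 1# (2# * x)
  ... | inl r = r
  ... | inr r = abort (absurd (=≤ (! (*1r s16)) (<& (*l (lt s16>0) q) (=≤ (& *a (h5 e x))
   (+m (*l 0≤4 4x²) (≤= (sq-mono (nn* 0≤4 e0) e≤) (*1r 1#))))))) where
   s16 = 4# * 4#
   4>0 : 0# < 4#
   4>0 = p≤ 0<1 (<& (x≤x+y 0≤1) (x≤x+y 0≤2))
   s16>0 : 0# < s16
   s16>0 = pp* 4>0 4>0
   -1≤ : - (2# * x) ≤ 1#
   -1≤ = <& (=≤ (#f3 x) (*l 0≤2 (<& (undiff (tr (0# ≤_) (#f2 x e) (diff p))) r≤))) (<& (≤= (x≤x+y (nn* 0≤2 e0)) (! (*-distʳ e 2# 2#))) e≤)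
   4x² : 4# * (x * x) ≤ 1#
   4x² = le _ (nn* (diff r) (diff -1≤)) (h4 x)
   absurd : ¬ (s16 ≤ 4# * 1# + 1#)
   absurd r = 0<1 (+-cancelr {z = 4# + (1# + (4# + 4# + (1# + 1#)))} (=≤ g (<& r (le _ (nn+ 0≤4 (nn+ 0≤4 (nn+ 0≤1 0≤1))) g2)))) where
    opaque
     unfolding Qr
     g : 1# + (4# + (1# + (4# + 4# + (1# + 1#)))) ~ 4# * 4#
     g = refl
     g2 : 0# + (4# + (1# + (4# + 4# + (1# + 1#)))) ~ 4# * 1# + 1# + (4# + (4# + (1# + 1#)))
     g2 = refl
  ic : ℕ -> Q
  ic zero = 0#
  ic (S l) = (1# + 2#) * (2# ^ l + ic l)
  ic-nn : ∀ l -> 0# ≤ ic l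
  ic-nn zero = r≤
  ic-nn (S l) = nn* (nn+ 0≤1 0≤2) (nn+ (^n l 0≤2) (ic-nn l))
  Kc : ℕ -> Q
  Kc a' = 2# * 2# ^ S a' + 4# * ic a'
  two^≥ : ∀ a' -> 2# ≤ 2# ^ S a'
  two^≥ a' = =≤ (! (*1r 2#)) (*l 0≤2 (1≤^ a' (x≤x+y 0≤1)))
  Kc≥ : ∀ a' -> 2# * 2# ^ S a' ≤ Kc a'
  Kc≥ a' = x≤x+y (nn* 0≤4 (ic-nn a'))
  module Normalised (a' : ℕ) (a'1 : 1 N.≤ a') (V : C) (y : Q) (y≥0 : 0# ≤ y) (Ky : 2# * (Kc a' * y) ≤ 1#)
   (p≤1 : re V ≤ 1#) (-1≤p : - 1# ≤ re V) (q≤1 : im V ≤ 1#) (N≥1 : 1# ≤ N V) (N≤2 : N V ≤ 2#)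
   (reB : ∀ j -> 1 N.≤ j -> j N.≤ a' -> - (2# ^ j * y) ≤ re (V ^c j))
   (last-re : - (2# ^ S a' * y) ≤ re (V ^c S a')) (last-im : im (V ^c S a') ≤ 2# ^ S a' * y) (last-im' : - (2# ^ S a' * y) ≤ im (V ^c S a')) where
   p = re V
   q = im V
   e = 2# ^ S a' * y
   e0 : 0# ≤ e
   e0 = nn* (^n (S a') 0≤2) y≥0
   e≤¼ : 4# * e ≤ 1#
   e≤¼ = <& (=≤ (#f4 _ y) (*l 0≤2 (*r y≥0 (Kc≥ a')))) Ky
   y≤1 : y ≤ 1#
   y≤1 = <& (<& (=≤ (! (*1l y)) (*r y≥0 (<& (x≤x+y 0≤1) (two^≥ a')))) (=≤ (! (*1l e))
    (*r e0 (<& (x≤x+y 0≤1) (x≤x+y 0≤2))))) e≤¼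
   V<< : ∀ l -> V ^c l << 2# ^ l
   V<< l = <<-^ l (0≤2 , <& N≤2 (=≤ (! (*1r 2#)) (*l 0≤2 (x≤x+y 0≤1))))
   re-0 : - (2# ^ 0 * y) ≤ re (V ^c 0)
   re-0 = ≤= (=≤ (ap (\ t -> - t) (*1l y)) (le (1# + y) (nn+ 0≤1 y≥0) (#f5 y))) (! re-1)
   reB0 : ∀ j -> j N.≤ a' -> - (2# ^ j * y) ≤ re (V ^c j)
   reB0 zero _ = re-0
   reB0 (S j) l = reB (S j) z<s l
   p≥ : - (2# * y) ≤ p
   p≥ = tr2 _≤_ (ap (\ t -> - (t * y)) (*1r 2#)) (ap re (*c1r V)) (reB 1 NP.≤-refl a'1)
   module _ (q≥0 : 0# ≤ q) where
    imB : ∀ l -> l N.≤ a' -> - (ic l * y) ≤ im (V ^c l)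
    imB zero _ = ≤r (& g (! im-1)) where
     g : - (0# * y) ~ 0#
     g = & (ap (\ t -> - t) (*-0ˡ y)) g' where
      opaque
       unfolding Qr
       g' : - 0# ~ 0#
       g' = refl
    imB (S l) b = ≤= (le _ (nn+ (nn+ (nn+ (nn+ (nn+ (nn* (diff (imB l (<⇒≤ b))) (diff p≥)) (nn* (nn* 0≤2 y≥0) (diff (<<-im (V<< l))))) (nn* (nn* (ic-nn l) y≥0) (diff p≤1)))
     (nn* (nn* 0≤2 (nn* (ic-nn l) y≥0)) (diff y≤1))) (nn* q≥0 (diff (reB0 l (<⇒≤ b))))) (nn* (nn* (^n l 0≤2) y≥0) (diff q≤1)))
     (h2 p (im (V ^c l)) q (re (V ^c l)) (ic l) y (2# ^ l))) (! (im-* V (V ^c l)))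
    im-small : q ≤ Kc a' * y
    im-small = ≤= (<& (=≤ (h7 q) (*r q≥0 (large-re e0 e≤¼ last-re N≥)))
     (=≤ (*-assoc 2# _ q) (*l 0≤2 rq≤))) (& (! (h8 e (ic a') y)) (h9 (2# ^ S a') (ic a') y)) where
     w = V ^c a'
     r = re (V ^c S a')
     s = im (V ^c S a')
     s²≤ : s * s ≤ e * e
     s²≤ = =≤ (! (abs-sq s)) (sq-mono (abs-nn s) (abs≤ last-im last-im')) where
      abs≤ : ∀ {x z} -> x ≤ z -> - z ≤ x -> abs x ≤ z
      abs≤ {x} {z} u v with ≤-total 0# x
      ... | inl _ = u
      ... | inr _ = undiff (tr (0# ≤_) (#f2 x z) (diff v))
     N≥ : 1# ≤ r * r + e * e
     N≥ = <& (1≤^ (S a') N≥1) (=≤ (& (! (N-^ V (S a'))) (N-def _)) (+m r≤ s²≤))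
     key : N V * im w ~ s * p - r * q
     key = & (ap (_* im w) (N-def V)) (& (! (h6 p (re w) q (im w))) (& (ap2 (\ a b -> a * - q + b * p) (! (re-* V w)) (! (im-* V w))) (#f8 p q r s)))
     sp≤ : s * p ≤ e
     sp≤ = *x (p≤ 0<1 (x≤x+y 0≤1)) (le _ (nn+ (nn* (diff last-im) (diff -1≤p)) (nn* (diff last-im') (diff p≤1))) (h3 e s p))
     rq≤ : r * q ≤ e + 2# * (ic a' * y)
     rq≤ = =≤ (#f7 (r * q) (s * p)) (+m sp≤ (=≤ (ap (\ t -> - t) (! key))
      (<& (neg-bound (ic-nn a') y≥0 (N-nn V) N≤2 (imB a' NP.≤-refl)) r≤))) where
      neg-bound : ∀ {c y n m} -> 0# ≤ c -> 0# ≤ y -> 0# ≤ n -> n ≤ 2# -> - (c * y) ≤ m -> - (n * m) ≤ 2# * (c * y)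
      neg-bound {c} {y} {n} {m} c≥0 y≥0 n≥0 n≤2 m≥ = le _ (nn+ (nn* n≥0 (diff m≥)) (nn* (diff n≤2) (nn* c≥0 y≥0))) (#f6 n m (c * y))
  private
   im-diff : ∀ u x -> im (u -c rl x) ~ im u
   im-diff u x = & (im-+ u _) (& (ap (im u +_) (& (im-neg _) (ap (\ t -> - t) (im-rl x)))) (#f9 (im u)))
  rel-re : ∀ {u x} -> 0# ≤ x -> im u * im u ≤ x * x * (re u * re u) -> Rel u (rl (re u)) x
  rel-re {u} {x} x≥0 p = x≥0 , =≤ (& (N-def _) (& (ap2 (\ a b -> a * a + b * b) re0 (im-diff u (re u))) (#f10 (im u))))
   (≤= p (ap (x * x *_) (! (N-rl (re u))))) where
   re0 : re (u -c rl (re u)) ~ 0#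
   re0 = & (re-+ u _) (& (ap (re u +_) (& (re-neg _) (ap (\ t -> - t) (re-rl _)))) (+-inv (re u)))
  normaliser : ∀ D -> 0# < N D -> ∃ \ c -> 0# < c × 1# ≤ c * c * N D × c * c * N D ≤ 2# × (c * re D) * (c * re D) ≤ 1# × (c * im D) * (c * im D) ≤ 1#
  normaliser D nz = choose (≤-total (re D * re D) (im D * im D)) where
   go : ∀ m -> 0# ≤ m -> m * m ≤ N D -> re D * re D ≤ m * m -> im D * im D ≤ m * m →
    ∃ \ c -> 0# < c × 1# ≤ c * c * N D × c * c * N D ≤ 2# × (c * re D) * (c * re D) ≤ 1# × (c * im D) * (c * im D) ≤ 1#
   go m m≥0 m² r i≤ = inv m , inv-pos m>0 , =≤ (! one) (*l (nnsq (inv m)) m²) ,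
    ≤= (*l (nnsq (inv m)) N≤) (& (#f12 (inv m) m) (& (ap (2# *_) one) (*1r 2#))) , comp r , comp i≤ where
    N≤ : N D ≤ 2# * (m * m)
    N≤ = =≤ (N-def D) (≤= (+m r i≤) (#f11 m))
    m>0 : 0# < m
    m>0 z = nz (<& N≤ (≤= (*l 0≤2 (≤= (*l m≥0 z) (*-0ʳ m))) (*-0ʳ 2#)))
    one : inv m * inv m * (m * m) ~ 1#
    one = & (swap* _ _ _ _) (& (ap2 _*_ (& (*-comm _ _) (inv-r m>0)) (& (*-comm _ _) (inv-r m>0))) (*1r 1#))
    comp : ∀ {x} -> x * x ≤ m * m -> (inv m * x) * (inv m * x) ≤ 1#
    comp {x} p = =≤ (swap* _ _ _ _) (≤= (*l (nnsq (inv m)) p) one)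
   choose : re D * re D ≤ im D * im D ⊎ im D * im D ≤ re D * re D →
    ∃ \ c -> 0# < c × 1# ≤ c * c * N D × c * c * N D ≤ 2# × (c * re D) * (c * re D) ≤ 1# × (c * im D) * (c * im D) ≤ 1#
   choose (inl l) = go (abs (im D)) (abs-nn _) (=≤ (abs-sq (im D)) (im²≤N D)) (≤= l (! (abs-sq (im D)))) (≤r (! (abs-sq (im D))))
   choose (inr l) = go (abs (re D)) (abs-nn _) (=≤ (abs-sq (re D)) (re²≤N D)) (≤r (! (abs-sq (re D)))) (≤= l (! (abs-sq (re D))))
  sq≤1 : ∀ {x} -> x * x ≤ 1# -> x ≤ 1#
  sq≤1 p = sq-cancel 0≤1 (≤= p (! (*1r 1#)))
  -sq≤1 : ∀ {x} -> x * x ≤ 1# -> - 1# ≤ x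
  -sq≤1 {x} p = undiff (tr (0# ≤_) (#f13 x) (diff (sq≤1 (=≤ (neg-sq x) p))))
  module _ (a' : ℕ) (a'1 : 1 N.≤ a') (V : C) (y : Q) (y≥0 : 0# ≤ y) (Ky : 4# * (Kc a' * y) ≤ 1#)
   (p² : re V * re V ≤ 1#) (q² : im V * im V ≤ 1#) (N≥1 : 1# ≤ N V) (N≤2 : N V ≤ 2#)
   (reB : ∀ j -> 1 N.≤ j -> j N.≤ a' -> - (2# ^ j * y) ≤ re (V ^c j))
   (last-re : - (2# ^ S a' * y) ≤ re (V ^c S a')) (last-im : im (V ^c S a') ≤ 2# ^ S a' * y) (last-im' : - (2# ^ S a' * y) ≤ im (V ^c S a')) where
   private
    k = Kc a' * y
    k≥0 : 0# ≤ k
    k≥0 = nn* (nn+ (nn* 0≤2 (^n (S a') 0≤2)) (nn* 0≤4 (ic-nn a'))) y≥0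
    Ky' : 2# * k ≤ 1#
    Ky' = <& (≤= (x≤x+y (nn* 0≤2 k≥0)) (! (*-distʳ k 2# 2#))) Ky
    flip- : ∀ {x z} -> - z ≤ x -> - x ≤ z
    flip- {x} {z} p = undiff (tr (0# ≤_) (#f2 x z) (diff p))
    neg≤ : ∀ {x z} -> x ≤ z -> - z ≤ - x
    neg≤ {x} {z} p = undiff (tr (0# ≤_) (#f14 x z) (diff p))
    cjre : ∀ j -> re (cj V ^c j) ~ re (V ^c j)
    cjre j = & (ap re (! (cj-^ V j))) (re-cj _)
    cjim : ∀ j -> im (cj V ^c j) ~ - im (V ^c j)
    cjim j = & (ap im (! (cj-^ V j))) (im-cj _)
   im²-small : im V * im V ≤ k * k
   im²-small with ≤-total 0# (im V)
   ... | inl q≥0 = sq-mono q≥0 (Normalised.im-small a' a'1 V y y≥0 Ky' (sq≤1 p²) (-sq≤1 p²) (sq≤1 q²) N≥1 N≤2 reB last-re last-im last-im' q≥0)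
   ... | inr q≤0 = =≤ (& (! (neg-sq (im V))) (ap2 _*_ (! (im-cj V)) (! (im-cj V)))) (sq-mono q≥0
    (Normalised.im-small a' a'1 (cj V) y y≥0 Ky' (=≤ (re-cj V) (sq≤1 p²)) (≤= (-sq≤1 p²) (! (re-cj V)))
     (=≤ (im-cj V) (sq≤1 (=≤ (neg-sq _) q²))) (tr (1# ≤_) (! (N-cj V)) N≥1) (tr (_≤ 2#) (! (N-cj V)) N≤2)
     (\ j l l' -> ≤= (reB j l l') (! (cjre j))) (≤= last-re (! (cjre (S a'))))
     (=≤ (cjim (S a')) (flip- last-im')) (≤= (neg≤ last-im) (! (cjim (S a')))) q≥0)) where
    q≥0 : 0# ≤ im (cj V)
    q≥0 = tr (0# ≤_) (! (im-cj V)) (neg-flip q≤0)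
   re-large : 1# ≤ 2# * re V
   re-large = large-re k≥0 Ky (<& (neg≤ 2y≤) (tr2 _≤_ (ap (\ t -> - (t * y)) (*1r 2#)) (ap re (*c1r V)) (reB 1 NP.≤-refl a'1)))
    (<& N≥1 (=≤ (N-def V) (+m r≤ im²-small))) where
    2y≤ : 2# * y ≤ k
    2y≤ = *r y≥0 (<& (two^≥ a') (<& (=≤ (! (*1l _)) (*r (^n (S a') 0≤2) (x≤x+y 0≤1))) (Kc≥ a')))
  principal : ∀ a' -> 1 N.≤ a' -> ∀ D y -> 0# ≤ y -> 4# * (Kc a' * y) ≤ 1# -> 0# < N D →
   (∀ j -> 1 N.≤ j -> j N.≤ a' -> ∃ \ F -> 0# ≤ re F × N (F -c D ^c j) ≤ y * y * N (D ^c j)) →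
   (∃ \ l -> 0# ≤ l × N (rl l -c D ^c S a') ≤ y * y * N (D ^c S a')) →
   0# < re D × Rel D (rl (re D)) (2# * (Kc a' * y))
  principal a' a'1 D y y≥0 Ky nz Fs (l , l≥0 , lc) with normaliser D nz
  ... | c , c>0 , N≥ , N≤ , p² , q² = reD>0 , rel-re (nn* 0≤2 k≥0)
   (*x (pp* c>0 c>0) (=≤ (#f20 c (im D)) (=≤ (ap2 _*_ (! imV) (! imV)) (<& im² (=≤ (! (*1r (k * k)))
    (≤= (*l (nnsq k) (=≤ (! (*1r 1#)) (sq-mono 0≤1 re≥))) (& (ap (\ t -> k * k * (2# * t * (2# * t))) reV) (#f19 k c (re D))))))))) where
   k = Kc a' * y
   k≥0 : 0# ≤ k
   k≥0 = nn* (nn+ (nn* 0≤2 (^n (S a') 0≤2)) (nn* 0≤4 (ic-nn a'))) y≥0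
   V = rl c *c D
   re-rl* : ∀ c u -> re (rl c *c u) ~ c * re u
   re-rl* c u = & (re-* _ u) (& (ap2 (\ a b -> a * re u - b * im u) (re-rl c) (im-rl c)) (#f18 c _ _))
   im-rl* : ∀ c u -> im (rl c *c u) ~ c * im u
   im-rl* c u = & (im-* _ u) (& (ap2 (\ a b -> a * im u + b * re u) (re-rl c) (im-rl c)) (#f17 c _ _))
   reV = re-rl* c D
   imV = im-rl* c D
   NV : N V ~ c * c * N D
   NV = & (N-* _ D) (ap (_* N D) (N-rl c))
   V^ : ∀ j -> V ^c j ~ rl (c ^ j) *c D ^c j
   V^ j = & (*c-^ (rl c) D j) (ap (_*c D ^c j) (! (rl-^ c j)))
   N≤' : N V ≤ 2#
   N≤' = =≤ NV N≤
   V<< : ∀ j -> V ^c j << 2# ^ j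
   V<< j = <<-^ j (0≤2 , <& N≤' (=≤ (! (*1r 2#)) (*l 0≤2 (x≤x+y 0≤1))))
   transfer : ∀ j {F} -> N (F -c D ^c j) ≤ y * y * N (D ^c j) -> N (rl (c ^ j) *c F -c V ^c j) ≤ y * y * N (V ^c j)
   transfer j {F} p = =≤ (& (ap N (& (ap (\ t -> rl (c ^ j) *c F -c t) (V^ j)) (#f16 (rl (c ^ j)) F (D ^c j)))) (N-* _ _))
    (≤= (*l (N-nn _) p) (& (#f15 _ _ _) (ap (y * y *_) (& (! (N-* _ _)) (ap N (! (V^ j)))))))
   reB : ∀ j -> 1 N.≤ j -> j N.≤ a' -> - (2# ^ j * y) ≤ re (V ^c j)
   reB j l1 l2 with Fs j l1 l2
   ... | F , F≥ , cl = re-of-close (snd (V<< j)) y≥0 (^n j 0≤2) (transfer j cl) (tr (0# ≤_) (! (re-rl* _ F)) (nn* (^n j (lt c>0)) F≥))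
   lastc : N (rl (c ^ S a') *c rl l -c V ^c S a') ≤ y * y * N (V ^c S a')
   lastc = transfer (S a') lc
   last<< : V ^c S a' -c rl (c ^ S a' * l) << 2# ^ S a' * y
   last<< = <<-swap (nn* (^n (S a') 0≤2) y≥0 , =≤ (ap (\ t -> N (t -c V ^c S a')) (rl-* _ l)) (<& lastc (≤= (*l (nnsq y) (snd (V<< (S a')))) (& (*-comm _ _) (swap* _ _ _ _)))))
   lre : - (2# ^ S a' * y) ≤ re (V ^c S a')
   lre = re-of-close (snd (V<< (S a'))) y≥0 (^n (S a') 0≤2) lastc (tr (0# ≤_) (& (! (re-rl _)) (ap re (rl-* _ l))) (nn* (^n (S a') (lt c>0)) l≥0))
   lim : im (V ^c S a') ≤ 2# ^ S a' * y
   lim = =≤ (! (im-diff _ _)) (<<-im last<<)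
   lim' : - (2# ^ S a' * y) ≤ im (V ^c S a')
   lim' = undiff (tr (0# ≤_) (#f2 _ _) (diff (=≤ (! (& (im-neg _) (ap (\ t -> - t) (im-diff _ _)))) (<<-im (<<-neg last<<)))))
   im² : im V * im V ≤ k * k
   im² = im²-small a' a'1 V y y≥0 Ky (=≤ (ap2 _*_ reV reV) p²) (=≤ (ap2 _*_ imV imV) q²) (tr (1# ≤_) (! NV) N≥) N≤' reB lre lim lim'
   re≥ : 1# ≤ 2# * re V
   re≥ = re-large a' a'1 V y y≥0 Ky (=≤ (ap2 _*_ reV reV) p²) (=≤ (ap2 _*_ imV imV) q²) (tr (1# ≤_) (! NV) N≥) N≤' reB lre lim lim'
   reD>0 : 0# < re D
   reD>0 z = 0<1 (<& re≥ (≤= (*l 0≤2 (=≤ reV (≤= (*l (lt c>0) z) (*-0ʳ c)))) (*-0ʳ 2#)))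

module B7 where
 open Rationals
 open Gauss
 open Roots
 open B6
 open CSolver using (solve; _:+_; _:*_; :-_; _:-_; _:=_; con)
 open Z using (ℤ)

 opaque
  unfolding Qr
  #g2 : ∀ ρ r -> ρ * (r * (r * ρ)) ~ r * ρ * (r * ρ)
  #g2 = auto Qr
  #g3 : ∀ x -> 1# ~ 1# - x + x
  #g3 = auto Qr
  #g4 : ∀ ρ r -> ρ * (1# - r) * (1# - r) ~ ρ + r * (r * ρ) - (r * ρ + r * ρ)
  #g4 = auto Qr
  #g5 : ∀ x c n -> x * x * (c * n * (c * n)) ~ x * c * (x * c) * (n * n)
  #g5 = auto Qr
  #g6 : ∀ c n -> c * (4# * n) ~ 4# * (c * n)
  #g6 = auto Qr
  #g12 : ∀ x -> 0# - - x ~ x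
  #g12 = auto Qr
  #g13 : ∀ y a b -> y * b + 0# * a ~ y * b
  #g13 = auto Qr
  #g14 : ∀ y a b -> y * a - 0# * b ~ y * a
  #g14 = auto Qr

 #g1 : ∀ a b c -> a *c b *c c ~ a *c c *c b
 #g1 = solve 3 (\ a b c -> a :* b :* c := a :* c :* b) refl
 #g7 : ∀ z x y w -> (1c -c x *c z) *c (1c -c y *c z) -c (1c -c w *c z) *c (1c -c w *c z) ~ -c ((x +c y -c (w +c w)) *c z) +c (x *c y -c w *c w) *c (z *c z)
 #g7 = solve 4 (\ z x y w -> (con (Z.+ 1) :- x :* z) :* (con (Z.+ 1) :- y :* z) :- (con (Z.+ 1) :- w :* z) :* (con (Z.+ 1) :- w :* z) := :- ((x :+ y :- (w :+ w)) :* z) :+ (x :* y :- w :* w) :* (z :* z)) refl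
 #g8 : ∀ y c ρ z -> y *c (1c -c ρ *c c *c z) ~ y *c (1c +c -c c) +c y *c c *c (1c -c ρ *c z)
 #g8 = solve 4 (\ y c ρ z -> y :* (con (Z.+ 1) :- ρ :* c :* z) := y :* (con (Z.+ 1) :+ :- c) :+ y :* c :* (con (Z.+ 1) :- ρ :* z)) refl
 #g9 : ∀ ρ p z G -> (1c -c ρ *c p *c z) *c G ~ p *c ((1c -c ρ *c z) *c G) +c (1c +c -c p) *c G
 #g9 = solve 4 (\ ρ p z G -> (con (Z.+ 1) :- ρ :* p :* z) :* G := p :* ((con (Z.+ 1) :- ρ :* z) :* G) :+ (con (Z.+ 1) :+ :- p) :* G) refl
 #g10 : ∀ x y p n m G -> x *c (p *c n +c (1c +c -c p) *c G) +c y *c m *c G ~ x *c (p *c n) +c (x *c (1c +c -c p) +c y *c m) *c G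
 #g10 = solve 6 (\ x y p n m G -> x :* (p :* n :+ (con (Z.+ 1) :+ :- p) :* G) :+ y :* m :* G := x :* (p :* n) :+ (x :* (con (Z.+ 1) :+ :- p) :+ y :* m) :* G) refl
 #g11 : ∀ g₁ g2 x y g3 -> g₁ *c g2 *c (x +c y *c g3) ~ x *c (g₁ *c g2) +c y *c (g₁ *c g3) *c g2
 #g11 = solve 5 (\ g₁ g2 x y g3 -> g₁ :* g2 :* (x :+ y :* g3) := x :* (g₁ :* g2) :+ y :* (g₁ :* g3) :* g2) refl

 infix 4 _≍_
 _≍_ : (ℕ -> ℕ -> Q) -> (ℕ -> ℕ -> Q) -> Set
 x ≍ y = ∃ \ K -> Ev (\ T s -> x T s ≤ ι K * y T s × y T s ≤ ι K * x T s)

 ≍-refl : ∀ {x} -> x ≍ x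
 ≍-refl = 1 , Ev! \ T s -> ≤r (h _) , ≤r (h _) where
  h : ∀ x -> x ~ ι 1 * x
  h x = ! (& (ap (_* x) (+-idr 1#)) (*1l x))

 ≍-sym : ∀ {x y} -> x ≍ y -> y ≍ x
 ≍-sym (K , p) = K , Evm (\ T s (a , b) -> b , a) p

 ≍t : ∀ {x y z} -> x ≍ y -> y ≍ z -> x ≍ z
 ≍t {x} {y} {z} (K , p) (L , q) = K N.* L , Evm2 (\ T s (a , b) (c , d) -> <& a (≤= (*l (ι-nn K) c) (h K L _)) ,
  <& d (≤= (*l (ι-nn L) b) (& (h L K (x T s)) (ap (\ k -> ι k * x T s) (NP.*-comm L K))))) p q where
  h : ∀ K L x -> ι K * (ι L * x) ~ ι (K N.* L) * x
  h K L x = & (! *a) (ap (_* x) (! (ι-* K L)))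

 ≍-* : ∀ {x y u v} -> Ev (\ T s -> 0# ≤ x T s × 0# ≤ u T s) -> Ev (\ T s -> 0# ≤ y T s × 0# ≤ v T s) -> x ≍ y -> u ≍ v -> (\ T s -> x T s * u T s) ≍ (\ T s -> y T s * v T s)
 ≍-* nn nn' (K , p) (L , q) = K N.* L , Evm2 (\ { T s ((x≥0 , u≥0) , y≥0 , v≥0) ((a , b) , c , d) →
  ≤= (*-mono x≥0 a u≥0 c) (h K L _ _) , ≤= (*-mono y≥0 b v≥0 d) (h K L _ _) }) (Ev-∧ nn nn') (Ev-∧ p q) where
  h : ∀ K L x y -> ι K * x * (ι L * y) ~ ι (K N.* L) * (x * y)
  h K L x y = & (swap* _ _ _ _) (ap (_* (x * y)) (! (ι-* K L)))

 ≍-^ : ∀ {x y} n -> (∀ T s -> 0# ≤ x T s) -> (∀ T s -> 0# ≤ y T s) -> x ≍ y -> (\ T s -> x T s ^ n) ≍ (\ T s -> y T s ^ n)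
 ≍-^ zero p q r = ≍-refl
 ≍-^ (S n) p q r = ≍-* (Ev! \ T s -> p T s , ^n n (p T s)) (Ev! \ T s -> q T s , ^n n (q T s)) r (≍-^ n p q r)

 ι≤^ : ∀ K n -> ι K ≤ ι (S K) ^ S n
 ι≤^ K n = <& (ι-mono (n≤1+n K)) (=≤ (! (*1r _)) (*l (ι-nn (S K)) (1≤^ n (1≤ι {S K} z<s))))

 ≍-root : ∀ {x y} n -> (∀ T s -> 0# ≤ x T s) -> (∀ T s -> 0# ≤ y T s) -> (\ T s -> x T s ^ S n) ≍ (\ T s -> y T s ^ S n) -> x ≍ y
 ≍-root {x} {y} n p q (K , r) = S K , Evm (\ T s (a , b) -> half (p T s) (q T s) a , half (q T s) (p T s) b) r where
  half : ∀ {x y} -> 0# ≤ x -> 0# ≤ y -> x ^ S n ≤ ι K * y ^ S n -> x ≤ ι (S K) * y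
  half {x} {y} x≥0 y≥0 l = ^-cancel n (nn* (ι-nn (S K)) y≥0) (<& l (≤= (*r (^n (S n) y≥0) (ι≤^ K n)) (! (*-^ (ι (S K)) y (S n)))))

 ≍-cancel : ∀ {x y z : ℕ -> ℕ -> Q} -> Ev (\ T s -> 0# < z T s) -> (\ T s -> x T s * z T s) ≍ (\ T s -> y T s * z T s) -> x ≍ y
 ≍-cancel z>0 (K , p) = K , Evm2 (\ T s z (a , b) -> half z a , half z b) z>0 p where
  half : ∀ {x y z} -> 0# < z -> x * z ≤ ι K * (y * z) -> x ≤ ι K * y
  half {x} {y} {z} z>0 l = *x z>0 (=≤ (*-comm z x) (≤= l (& (! *a) (*-comm _ z))))

 ≈⇒≍ : ∀ {u v} -> u ≈ v -> (\ T s -> N (u T s)) ≍ (\ T s -> N (v T s))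
 ≈⇒≍ p = 4 , Ev-∧ (half p) (half (≈-sym p)) where
  half : ∀ {u v} -> u ≈ v -> Ev (\ T s -> N (u T s) ≤ ι 4 * N (v T s))
  half {u} {v} (c , p) = Evm2 (\ T s l r -> <& (rel-N r) (*r (N-nn (v T s)) (≤= (sq-mono (nn+ (tε-nn c T) 0≤1) (+m l r≤)) g))) (Ev-≤1 c) p where
   opaque
    unfolding Qr
    g : (1# + 1#) * (1# + 1#) ~ ι 4
    g = refl

 ||-div : ∀ {u ω} {l : ℕ -> ℕ -> Q} -> Ev (\ T s -> 0# < l T s) -> (\ T s -> rl (l T s) *c u T s) || ω -> u || ω
 ||-div {u} {ω} {l} l>0 (m , m>0 , p) = (\ T s -> inv (l T s) * m T s) , Evm2 (\ T s a b -> pp* (inv-pos a) b) l>0 m>0 ,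
  fst (fin p) , snd (fin p) where
  fin : (\ T s -> rl (l T s) *c u T s) ≈ (\ T s -> rl (m T s) *c ω T s) -> u ≈ (\ T s -> rl (inv (l T s) * m T s) *c ω T s)
  fin (c , p) = c , Evm2 (\ T s a r -> rel-cancel {z = rl (l T s)} (tr (0# <_) (! (N-rl _)) (pp* a a))
   (tr2 (\ x y -> Rel x y (tε c T)) (*cc _ _) (& (ap (_*c ω T s) (& (ap rl (h a)) (& (rl-* _ _) (*cc _ _)))) (#g1 (rl (inv (l T s) * m T s)) (rl (l T s)) (ω T s))) r)) l>0 p where
   h : ∀ {l m} -> 0# < l -> m ~ l * (inv l * m)
   h {l} {m} a = & (! (*1l m)) (& (ap (_* m) (! (inv-r a))) *a)

 ||-≡ˡ : ∀ {u v ω} -> (∀ T s -> u T s ~ v T s) -> v || ω -> u || ω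
 ||-≡ˡ h p = ||-≈ (≈-≡ h) p

 ||-≡ʳ : ∀ {u ω ω'} -> u || ω -> (∀ T s -> ω T s ~ ω' T s) -> u || ω'
 ||-≡ʳ p h = ||-≈ʳ p (≈-≡ h)

 -- Factors 1 - ρζ and their products along arithmetic progressions of exponents.

 g : C -> Q -> C
 g ζ ρ = 1c -c rl ρ *c ζ

 private
  opaque
   unfolding Qr
   k1 : ∀ ρ a b -> (1# - ρ * a) * (1# - ρ * a) + (ρ * b) * (ρ * b) ~ (1# - ρ) * (1# - ρ) + 2# * ρ * (1# - a) + ρ * ρ * ((a * a + b * b) - 1#)
   k1 = auto Qr
   k2 : ∀ ρ n -> 4# * ((1# - ρ) * (1# - ρ) + ρ * n) ~ n + ((4# - n) * ((1# - ρ) * (1# - ρ)) + n * (ρ * ρ + 2# * ρ))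
   k2 = auto Qr
   k3 : ∀ ρ a b -> (1# - (ρ * a - 0# * b)) * (1# - (ρ * a - 0# * b)) + (0# - (ρ * b + 0# * a)) * (0# - (ρ * b + 0# * a)) ~ (1# - ρ * a) * (1# - ρ * a) + (ρ * b) * (ρ * b)
   k3 = auto Qr
   k4 : ∀ ρ a -> 2# * ρ * a ~ ρ * (2# * a)
   k4 = auto Qr

 N-g : ∀ {ζ} -> N ζ ~ 1# -> ∀ ρ -> N (g ζ ρ) ~ (1# - ρ) * (1# - ρ) + ρ * N (1c -c ζ)
 N-g {ζ} u ρ = & (N-def _) (& (ap2 (\ a b -> a * a + b * b)
  (& (re-+ _ _) (ap2 _+_ re-1 (& (re-neg _) (ap (\ t -> - t) (& (re-* _ ζ) (ap2 (\ a b -> a * re ζ - b * im ζ) (re-rl ρ) (im-rl ρ)))))))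
  (& (im-+ _ _) (ap2 _+_ im-1 (& (im-neg _) (ap (\ t -> - t) (& (im-* _ ζ) (ap2 (\ a b -> a * im ζ + b * re ζ) (re-rl ρ) (im-rl ρ))))))))
  (& (k3 ρ (re ζ) (im ζ)) (& (k1 ρ (re ζ) (im ζ)) (& (ap2 (\ x y -> (1# - ρ) * (1# - ρ) + x + ρ * ρ * y)
   (& (k4 ρ _) (ap (ρ *_) (! (N-1-unit u)))) (& (ap (_- 1#) (& (! (N-def ζ)) u)) (+-inv 1#))) (& (ap ((1# - ρ) * (1# - ρ) + ρ * N (1c -c ζ) +_) (*-0ʳ (ρ * ρ))) (+-idr _))))))

 N-1-≤4 : ∀ {ζ} -> N ζ ~ 1# -> N (1c -c ζ) ≤ 4#
 N-1-≤4 {ζ} u = ≤= (snd (<<-- <<-1 (<<-unit u))) e where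
  opaque
   unfolding Qr
   e : (1# + 1#) * (1# + 1#) ~ 4#
   e = refl

 N-g-lower : ∀ {ζ} -> N ζ ~ 1# -> ∀ {ρ} -> 0# ≤ ρ -> N (1c -c ζ) ≤ 4# * N (g ζ ρ)
 N-g-lower {ζ} u {ρ} p = le _ (nn+ (nn* (diff (N-1-≤4 u)) (nnsq _)) (nn* (N-nn _) (nn+ (nn* p p) (nn* 0≤2 p))))
  (& (ap (4# *_) (N-g u ρ)) (k2 ρ (N (1c -c ζ))))

 τ : C -> Q -> ℕ -> ℕ -> ℕ -> C
 τ ζ r a l m = prodc m (\ n -> g ζ (r ^ (n N.* a N.+ l)))

 module _ {ζ r} (u : N ζ ~ 1#) (r>0 : 0# < r) (r≤1 : r ≤ 1#) where
  private
   t = 1# - r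
   t≥0 : 0# ≤ t
   t≥0 = diff r≤1
  τ-second-difference : ∀ {c} -> 0# ≤ c -> 4# ≤ c * N (1c -c ζ) -> 2# * (t * c) ≤ 1# -> ∀ a l m -> 1 N.≤ a →
   Rel (τ ζ r a l m *c τ ζ r a (S (S l)) m) (τ ζ r a (S l) m *c τ ζ r a (S l) m) (2# * (t * c))
  τ-second-difference {c} c≥0 c≥ small a l m a≥1 = tr2 (\ x y -> Rel x y (2# * (t * c))) (ΠC.distr m _ _) (ΠC.distr m _ _)
   (rel-prod m (\ n -> nn* (nn* (nn* (^n (n N.* a N.+ l) r≥0) t≥0) t≥0) c≥0) (\ n _ -> factor n) total small) where
   r≥0 = lt r>0
   1≤cN : ∀ {ρ} -> 0# ≤ ρ -> 1# ≤ c * N (g ζ ρ)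
   1≤cN {ρ} p = *x (p≤ 0<1 (<& (x≤x+y 0≤1) (x≤x+y 0≤2))) (=≤ (*1r 4#) (<& c≥ (≤= (*l c≥0 (N-g-lower u p)) (#g6 c _))))
   factor : ∀ n -> Rel (g ζ (r ^ (n N.* a N.+ l)) *c g ζ (r ^ (n N.* a N.+ S (S l)))) (g ζ (r ^ (n N.* a N.+ S l)) *c g ζ (r ^ (n N.* a N.+ S l))) (r ^ (n N.* a N.+ l) * t * t * c)
   factor n = nn* (nn* (nn* ρ0 t≥0) t≥0) c≥0 , =≤ (& (ap N eq) (& (N-neg _) (& (N-* _ ζ) (& (ap2 _*_ (N-rl _) u) (*1r _)))))
    (≤= (=≤ (! (*1r _)) (*l (nnsq (ρ * t * t)) (=≤ (! (*1r 1#)) (sq-mono 0≤1 (1≤cN (^n (n N.* a N.+ S l) r≥0))))))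
     (& (#g5 (ρ * t * t) c _) (ap (_ *_) (! (N-* _ _))))) where
    ρ = r ^ (n N.* a N.+ l)
    ρ0 = ^n (n N.* a N.+ l) r≥0
    pw : ∀ j -> r ^ (n N.* a N.+ S j) ~ r * r ^ (n N.* a N.+ j)
    pw j = ap (r ^_) (+-suc (n N.* a) j)
    x = rl ρ
    y = rl (r ^ (n N.* a N.+ S (S l)))
    w = rl (r ^ (n N.* a N.+ S l))
    xy : x *c y -c w *c w ~ 0c
    xy = & (ap2 _-c_ (& (! (rl-* _ _)) (ap rl (& (ap (ρ *_) (& (pw (S l)) (ap (r *_) (pw l)))) (& (#g2 ρ r) (ap2 _*_ (! (pw l)) (! (pw l))))))) (! (rl-* _ _))) (u-u _)
    lin : x +c y -c (w +c w) ~ rl (ρ * t * t)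
    lin = & (ap2 _-c_ (! (rl-+ _ _)) (! (rl-+ _ _))) (& (ap (rl (ρ + r ^ (n N.* a N.+ S (S l))) +c_) (! (rl-neg _))) (& (! (rl-+ _ _)) (ap rl (& (ap2 (\ y w -> ρ + y - (w + w)) (& (pw (S l)) (ap (r *_) (pw l))) (pw l)) (! (#g4 ρ r))))))
    eq : g ζ ρ *c g ζ (r ^ (n N.* a N.+ S (S l))) -c g ζ (r ^ (n N.* a N.+ S l)) *c g ζ (r ^ (n N.* a N.+ S l)) ~ -c (rl (ρ * t * t) *c ζ)
    eq = & (#g7 ζ x y w) (& (ap2 (\ p q -> -c (p *c ζ) +c q *c (ζ *c ζ)) lin xy) (& (ap (-c (rl (ρ * t * t) *c ζ) +c_) (*c-0ˡ _)) (& (+c-comm _ _) (+c-idl _))))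
   total : sum m (\ n -> r ^ (n N.* a N.+ l) * t * t * c) ≤ t * c
   total = <& (sum-mono m \ n _ -> *r c≥0 (*r t≥0 (*r t≥0 (^-anti r≥0 r≤1 (&N (m≤m*n n a {{>-nonZero a≥1}}) (m≤m+n (n N.* a) l))))))
    (=≤ (& (sum-*ʳ m c _) (ap (_* c) (& (sum-*ʳ m t _) (ap (_* t) (& (sum-*ʳ m t (r ^_)) (& (*-comm _ t) (geom m r)))))))
     (*r c≥0 (≤= (*r t≥0 (le _ (^n m r≥0) (#g3 (r ^ m)))) (*1l t))))

 τ-end : ∀ ζ r a m -> τ ζ r a a m *c (1c -c ζ) ~ τ ζ r a 0 m *c g ζ (r ^ (m N.* a))
 τ-end ζ r a m = & (*cc _ _) (& (ap2 _*c_ (! g1) (ΠC.cong-f m \ n -> ap (\ k -> g ζ (r ^ k)) (& (NP.+-comm (n N.* a) a) (! (NP.+-identityʳ _)))))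
  (& (! (ΠC.front m (\ n -> g ζ (r ^ (n N.* a N.+ 0))))) (ap (\ k -> τ ζ r a 0 m *c g ζ (r ^ k)) (NP.+-identityʳ (m N.* a))))) where
  g1 : g ζ 1# ~ 1c -c ζ
  g1 = ap (\ t -> 1c -c t) (& (ap (_*c ζ) rl-1) (*c1l ζ))

 -- The products τ_l · conj τ_0 stay in the cone spanned by 1 and 1 - conj ζ.

 module Cone {ζ r} (u : N ζ ~ 1#) (r>0 : 0# < r) (r≤1 : r ≤ 1#) (a l : ℕ) (l≤a : l N.≤ a) where
  private
   r≥0 = lt r>0
   ζ' = cj ζ
   p = r ^ l
   R = r ^ a
   R/p = r ^ (a ∸ l)
  SS : ℕ -> Q -> C
  SS zero ρ = 1c
  SS (S m) ρ = g ζ (ρ * p) *c g ζ' ρ *c SS m (ρ * R)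
  InCone : Q -> C -> Set
  InCone ρ v = Σ Q \ x -> Σ Q \ y -> 0# ≤ x × 0# ≤ y × v ~ rl x +c rl y *c g ζ' ρ
  private
   gg : ∀ ρ -> g ζ ρ *c g ζ' ρ ~ rl (N (g ζ ρ))
   gg ρ = & (ap (g ζ ρ *c_) (! (& (cj-+ 1c _) (ap2 _+c_ cj-1 (& (cj-neg _) (ap (\ t -> -c t) (& (cj-* _ ζ) (ap (_*c ζ') (cj-rl ρ))))))))) (u*cj _)
   lin : ∀ x y ζ -> x *c (1c -c y *c ζ) ~ x -c x *c y *c ζ
   lin = solve 3 (\ x y ζ -> x :* (con (Z.+ 1) :- y :* ζ) := x :- x :* y :* ζ) refl
   widen : ∀ {ρ σ c v} -> 0# ≤ c -> c ≤ 1# -> σ ~ ρ * c -> InCone σ v -> InCone ρ v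
   widen {ρ} {σ} {c} c≥0 c≤1 refl (x , y , x≥0 , y≥0 , refl) = x + y * (1# - c) , y * c , nn+ x≥0 (nn* y≥0 (diff c≤1)) , nn* y≥0 c≥0 ,
    & (ap (rl x +c_) (& (ap (\ t -> rl y *c (1c -c t *c ζ')) (rl-* ρ c)) (#g8 (rl y) (rl c) (rl ρ) ζ')))
     (& (! (+c-assoc _ _ _)) (ap2 _+c_ (! (& (rl-+ x _) (ap (rl x +c_) (& (rl-* y _) (ap (rl y *c_) (& (rl-+ 1# _) (ap2 _+c_ rl-1 (rl-neg c)))))))) (ap (_*c g ζ' ρ) (! (rl-* y c)))))
  in-cone : ∀ m ρ -> 0# ≤ ρ -> InCone ρ (SS m ρ)
  in-cone zero ρ _ = 1# , 0# , 0≤1 , r≤ , ! (& (ap2 _+c_ rl-1 (& (ap (_*c g ζ' ρ) rl-0) (*c-0ˡ _))) (& (+c-comm _ _) (+c-idl _)))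
  in-cone (S m) ρ ρ0 with widen {ρ = ρ * p} (^n (a ∸ l) r≥0) (^-≤1 (a ∸ l) r≥0 r≤1)
   (& (ap (\ k -> ρ * r ^ k) (! (m+[n∸m]≡n l≤a))) (& (ap (ρ *_) (^-+ r l _)) (! *a))) (in-cone m (ρ * R) (nn* ρ0 (^n a r≥0)))
  ... | x , y , x≥0 , y≥0 , eq = x * (p * N (g ζ ρ)) , x * (1# - p) + y * N (g ζ (ρ * p)) ,
   nn* x≥0 (nn* (^n l r≥0) (N-nn _)) , nn+ (nn* x≥0 (diff (^-≤1 l r≥0 r≤1))) (nn* y≥0 (N-nn _)) ,
   & (ap (g ζ (ρ * p) *c g ζ' ρ *c_) eq) (& (#g11 (g ζ (ρ * p)) (g ζ' ρ) (rl x) (rl y) (g ζ' (ρ * p)))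
    (& (ap2 (\ s t -> rl x *c s +c rl y *c t *c g ζ' ρ) mix (gg (ρ * p)))
     (& (#g10 (rl x) (rl y) (rl p) (rl (N (g ζ ρ))) (rl (N (g ζ (ρ * p)))) (g ζ' ρ))
      (ap2 (\ s t -> s +c t *c g ζ' ρ) (! (& (rl-* x _) (ap (rl x *c_) (rl-* p _))))
       (! (& (rl-+ _ _) (ap2 _+c_ (& (rl-* x _) (ap (rl x *c_) (& (rl-+ 1# _) (ap2 _+c_ rl-1 (rl-neg p))))) (rl-* y _)))))))) where
   mix : g ζ (ρ * p) *c g ζ' ρ ~ rl p *c rl (N (g ζ ρ)) +c (1c +c -c rl p) *c g ζ' ρ
   mix = & (ap (\ t -> (1c -c t *c ζ) *c g ζ' ρ) (rl-* ρ p)) (& (#g9 (rl ρ) (rl p) ζ (g ζ' ρ)) (ap (\ t -> rl p *c t +c (1c +c -c rl p) *c g ζ' ρ) (gg ρ)))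
  private
   cj-g : ∀ ρ -> cj (g ζ ρ) ~ g ζ' ρ
   cj-g ρ = & (cj-+ 1c _) (ap2 _+c_ cj-1 (& (cj-neg _) (ap (\ t -> -c t) (& (cj-* _ ζ) (ap (_*c ζ') (cj-rl ρ))))))
  S-τ : ∀ m ρ -> SS m ρ ~ prodc m (\ n -> g ζ (ρ * r ^ (n N.* a N.+ l)) *c g ζ' (ρ * r ^ (n N.* a N.+ 0)))
  S-τ zero ρ = refl
  S-τ (S m) ρ = ! (& (ΠC.front m _) (ap2 _*c_ (ap (\ t -> g ζ (ρ * p) *c g ζ' t) (*1r ρ))
   (& (ΠC.cong-f m \ n -> ap2 (\ s t -> g ζ s *c g ζ' t) (sh n l) (sh n 0)) (! (S-τ m (ρ * R)))))) where
   sh : ∀ n j -> ρ * r ^ (S n N.* a N.+ j) ~ ρ * R * r ^ (n N.* a N.+ j)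
   sh n j = & (ap (\ k -> ρ * r ^ k) (NP.+-assoc a (n N.* a) j)) (& (ap (ρ *_) (^-+ r a _)) (! *a))
  quadrant : ∀ m -> 0# ≤ im ζ -> FirstQuadrant (τ ζ r a l m *c cj (τ ζ r a 0 m))
  quadrant m im≥0 with in-cone m 1# 0≤1
  ... | x , y , x≥0 , y≥0 , eq = tr FirstQuadrant (& (! eq) S≡)
   ( tr (0# ≤_) (! (& (re-+ _ _) (ap2 _+_ (re-rl x) (& (re-* _ _) (& (ap2 (\ a b -> a * re G - b * im G) (re-rl y) (im-rl y)) (& (#g14 y (re G) (im G)) (ap (y *_) reG))))))) (nn+ x≥0 (nn* y≥0 (diff (re≤1 u))))
   , tr (0# ≤_) (! (& (im-+ _ _) (ap2 _+_ (im-rl x) (& (im-* _ _) (& (ap2 (\ a b -> a * im G + b * re G) (re-rl y) (im-rl y)) (& (#g13 y (re G) (im G)) (ap (y *_) imG))))))) (nn+ r≤ (nn* y≥0 im≥0))) where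
   G = g ζ' 1#
   G1 : G ~ 1c -c ζ'
   G1 = ap (\ t -> 1c -c t) (& (ap (_*c ζ') rl-1) (*c1l ζ'))
   reG : re G ~ 1# - re ζ
   reG = & (ap re G1) (& (re-+ _ _) (ap2 _+_ re-1 (& (re-neg _) (ap (\ t -> - t) (re-cj ζ)))))
   imG : im G ~ im ζ
   imG = & (ap im G1) (& (im-+ _ _) (& (ap2 _+_ im-1 (& (im-neg _) (ap (\ t -> - t) (im-cj ζ)))) (#g12 (im ζ))))
   S≡ : SS m 1# ~ τ ζ r a l m *c cj (τ ζ r a 0 m)
   S≡ = & (S-τ m 1#) (& (ΠC.cong-f m \ n -> ap2 (\ s t -> g ζ s *c g ζ' t) (*1l _) (*1l _)) (& (ΠC.distr m _ _)
    (ap (τ ζ r a l m *c_) (& (ΠC.cong-f m \ n -> ! (cj-g _)) (! (cj-prod m _))))))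

module B8 where
 open Rationals
 open Gauss
 open Roots
 open B6
 open B7
 open CSolver using (solve; _:*_; :-_; _:-_; _:=_; con)
 open Z using (ℤ)

 opaque
  unfolding Qr
  #h1 : ∀ x -> 1# - (1# - x) ~ x
  #h1 = auto Qr
  #h2 : ∀ x -> - (1# - x) ~ x - 1#
  #h2 = auto Qr
  #h3 : ∀ x -> 1# ~ 1# - x + x
  #h3 = auto Qr
  #h4 : ∀ x y -> y - x ~ - x - - y
  #h4 = auto Qr
  #h11 : ∀ n k x -> n * k * x ~ k * (x * n)
  #h11 = auto Qr
  #h15 : ∀ a b c d -> a * c - b * - d ~ a * c + b * d
  #h15 = auto Qr
  #h16 : ∀ n a b -> n * a - 0# * b ~ n * a
  #h16 = auto Qr
  #h18 : ∀ x -> 2# * x + 2# * x ~ 2# * (2# * x)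
  #h18 = auto Qr

 #h5 : ∀ a b c -> a *c (b *c c) ~ a *c c *c b
 #h5 = solve 3 (\ a b c -> a :* (b :* c) := a :* c :* b) refl
 #h6 : ∀ a b -> a *c a *c b ~ a *c (a *c b)
 #h6 = solve 2 (\ a b -> a :* a :* b := a :* (a :* b)) refl
 #h7 : ∀ a b c -> a *c b *c c ~ c *c a *c b
 #h7 = solve 3 (\ a b c -> a :* b :* c := c :* a :* b) refl
 #h8 : ∀ a b c -> a *c b *c c ~ b *c (a *c c)
 #h8 = solve 3 (\ a b c -> a :* b :* c := b :* (a :* c)) refl
 #h9 : ∀ a b c -> a *c (b *c c) ~ a *c b *c c
 #h9 = solve 3 (\ a b c -> a :* (b :* c) := a :* b :* c) refl
 #h10 : ∀ x z -> 1c -c x *c z -c 1c ~ -c (x *c z)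
 #h10 = solve 2 (\ x z -> con (Z.+ 1) :- x :* z :- con (Z.+ 1) := :- (x :* z)) refl
 #h12 : ∀ p u q c θ -> p *c u *c (q *c c *c θ) ~ p *c q *c θ *c (u *c c)
 #h12 = solve 5 (\ p u q c θ -> p :* u :* (q :* c :* θ) := p :* q :* θ :* (u :* c)) refl
 #h13 : ∀ p q t c θ -> p *c q *c (t *c c *c θ) ~ t *c p *c (q *c c *c θ)
 #h13 = solve 5 (\ p q t c θ -> p :* q :* (t :* c :* θ) := t :* p :* (q :* c :* θ)) refl
 #h14 : ∀ n t c θ m -> n *c (t *c c *c θ) *c m ~ m *c n *c (t *c c *c θ)
 #h14 = solve 5 (\ n t c θ m -> n :* (t :* c :* θ) :* m := m :* n :* (t :* c :* θ)) refl
 #h17 : ∀ z θ n t c θ' -> z *c θ *c (n *c (t *c c *c θ')) ~ t *c z *c (c *c n) *c (θ *c θ')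
 #h17 = solve 6 (\ z θ n t c θ' -> z :* θ :* (n :* (t :* c :* θ')) := t :* z :* (c :* n) :* (θ :* θ')) refl
 #h19 : ∀ a b c -> a *c b *c c ~ a *c c *c b
 #h19 = solve 3 (\ a b c -> a :* b :* c := a :* c :* b) refl

 r0 : ℕ -> Q
 r0 T = 1# - inv (ι T)

 rT : ℕ -> Q
 rT T = r0 T * r0 T

 module _ {T : ℕ} (2T : 2 N.≤ T) where
  private
   ιT>0 : 0# < ι T
   ιT>0 = ι-pos (&N z<s 2T)
   x = inv (ι T)
   x≥0 : 0# ≤ x
   x≥0 = inv-nn ιT>0
   x≤½ : x + x ≤ 1#
   x≤½ = *x ιT>0 (=≤ (& (*-distˡ _ x x) (ap2 _+_ (inv-r ιT>0) (inv-r ιT>0))) (=≤ (ap (1# +_) (! (+-idr 1#))) (≤= (ι-mono 2T) (! (*1r _)))))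
   opaque
    unfolding Qr
    e1 : ∀ x -> 1# - x ~ x + (1# - (x + x))
    e1 = auto Qr
    e2 : ∀ x -> 1# ~ 1# - x + x
    e2 = auto Qr
    e3 : ∀ x -> x + x ~ 1# - (1# - x) * (1# - x) + x * x
    e3 = auto Qr
  r0>0 : 0# < r0 T
  r0>0 = p≤ (inv-pos ιT>0) (le _ (diff x≤½) (e1 x))
  r0≤1 : r0 T ≤ 1#
  r0≤1 = le _ x≥0 (e2 x)
  r>0 : 0# < rT T
  r>0 = pp* r0>0 r0>0
  r≤r0 : rT T ≤ r0 T
  r≤r0 = ≤= (*l (lt r0>0) r0≤1) (*1r _)
  r≤1 : rT T ≤ 1#
  r≤1 = <& r≤r0 r0≤1
  1-r≤ : 1# - rT T ≤ tε 2 T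
  1-r≤ = ≤= (le (x * x) (nn* x≥0 x≥0) (e3 x)) (! (& (*-distʳ x 1# (1# + 0#)) (ap2 _+_ (*1l x) (& (ap (_* x) (+-idr 1#)) (*1l x)))))
  1-r0 : 1# - r0 T ~ x
  1-r0 = #h1 x

 -- x^n ≤ 1 / (n (1 - x))
 power-decay : ∀ {x} n -> 0# ≤ x -> x < 1# -> ι n * x ^ n ≤ inv (1# - x)
 power-decay {x} n p q = *x d>0 (<& (*l (lt d>0) (=≤ (! (sum-const n (x ^ n))) (sum-mono n \ k l -> ^-anti p (lt q) (<⇒≤ l))))
  (=≤ (geom n x) (≤= (le (x ^ n) (^n n p) (#h3 (x ^ n))) (! (inv-r d>0))))) where
  d>0 : 0# < 1# - x
  d>0 z = q (undiff (≤= (neg-flip z) (#h2 x)))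

 power-small : ∀ {x ε} -> 0# ≤ x -> x < 1# -> 0# < ε -> ∃ \ n₀ -> ∀ n -> n₀ N.≤ n -> x ^ n ≤ ε
 power-small {x} {ε} p q ε>0 with arch (inv (1# - x) * inv ε)
 ... | k , h = S k , \ n l -> *x (ι-pos {n} (&N z<s l)) (<& (power-decay n p q)
  (=≤ (& (! (*1r _)) (& (ap (inv (1# - x) *_) (! (& (*-comm _ _) (inv-r ε>0)))) (! *a)))
   (*r (lt ε>0) (<& h (ι-mono (&N (n≤1+n k) l))))))

 r<1 : ∀ {T} -> 2 N.≤ T -> rT T < 1#
 r<1 {T} l = ≤p (r≤r0 l) (\ z -> inv-pos (ι-pos (&N z<s l)) (=≤ (! (1-r0 l)) (≤= (+m r≤ (neg≤ z)) (+-inv 1#)))) where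
  neg≤ : ∀ {x y} -> x ≤ y -> - y ≤ - x
  neg≤ {x} {y} p = undiff (tr (0# ≤_) (#h4 x y) (diff p))

 tε>0 : ∀ {c T} -> 1 N.≤ c -> 1 N.≤ T -> 0# < tε c T
 tε>0 l l' = pp* (ι-pos l) (inv-pos (ι-pos l'))

 module Tau (a' : ℕ) (a'1 : 1 N.≤ a') (m : ℕ -> ℕ) (m≥ : ∀ s -> s N.≤ m s)
  (ζ Θ : ℕ -> C) (ζ-unit : ∀ s -> N (ζ s) ~ 1#) (Θ-unit : ∀ s -> N (Θ s) ~ 1#)
  (c0 : Q) (c0>0 : 0# < c0) (sep : ∀ s -> c0 ≤ N (1c -c ζ s)) (im≥0 : ∀ s -> 0# ≤ im (ζ s))
  (Θ-quadrant : ∀ s l -> l N.≤ S a' -> FirstQuadrant (Θ s ^c l))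
  (Θ-end : (\ (T s : ℕ) -> (1c -c ζ s) *c Θ s ^c S a') || (\ _ _ -> 1c)) where
  a = S a'
  a≥1 : 1 N.≤ a
  a≥1 = s≤s z≤n
  t : ℕ -> ℕ -> ℕ -> C
  t l T s = τ (ζ s) (rT T) a l (m s)
  g≠0 : ∀ s {ρ} -> 0# ≤ ρ -> 0# < N (g (ζ s) ρ)
  g≠0 s {ρ} p z = c0>0 (<& (sep s) (<& (N-g-lower (ζ-unit s) p) (≤= (*l 0≤4 z) (*-0ʳ 4#))))
  t≠0 : ∀ l -> Ev (\ T s -> 0# < N (t l T s))
  t≠0 l = Evm (\ T s 2T -> tr (0# <_) (! (N-prod (m s) _)) (prod-pos (m s) \ n -> g≠0 s (^n (n N.* a N.+ l) (lt (r>0 2T))))) (Ev-T≥ 2)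
  second-difference : ∀ l -> t l ⊡ t (S (S l)) ≈ t (S l) ⊡ t (S l)
  second-difference l with arch (4# * inv c0)
  ... | k , h = 2 N.* (k N.* 2) , Evm2 (\ T s 2T small -> rel-mono (≤= (*l 0≤2 (bnd T 2T)) (2tε (k N.* 2) T))
   (τ-second-difference (ζ-unit s) (r>0 2T) (r≤1 2T) {ι k} (ι-nn k)
    (=≤ (& (! (*1r 4#)) (& (ap (4# *_) (! (& (*-comm _ _) (inv-r c0>0)))) (! *a))) (*-mono (nn* 0≤4 (inv-nn c0>0)) h (lt c0>0) (sep s)))
    (<& (*l 0≤2 (bnd T 2T)) small) a l (m s) a≥1)) (Ev-T≥ 2) (Ev-small (k N.* 2)) where
   bnd : ∀ T -> 2 N.≤ T -> (1# - rT T) * ι k ≤ tε (k N.* 2) T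
   bnd T 2T = ≤= (*r (ι-nn k) (1-r≤ 2T)) (& (*-comm _ _) (tε-* 2 k T))
  ratio : ∀ l -> t (S l) ⊡ t 0 ≈ t l ⊡ t 1
  ratio zero = ≈-≡ \ T s -> *cc _ _
  ratio (S l) = ≈-cancel (t≠0 l) (≈t (≈-≡ \ T s -> #h7 (t (S (S l)) T s) (t 0 T s) (t l T s))
   (≈t (≈-* (second-difference l) (≈-refl (t 0))) (≈t (≈-≡ \ T s -> #h6 (t (S l) T s) (t 0 T s))
    (≈t (≈-* (≈-refl (t (S l))) (ratio l)) (≈-≡ \ T s -> #h5 (t (S l) T s) (t l T s) (t 1 T s))))))
  powers : ∀ l -> (\ T s -> t l T s *c t 0 T s ^c l) ≈ (\ T s -> t 1 T s ^c l *c t 0 T s)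
  powers zero = ≈-≡ \ T s -> *cc _ _
  powers (S l) = ≈t (≈-≡ \ T s -> #h9 (t (S l) T s) (t 0 T s) (t 0 T s ^c l)) (≈t (≈-* (ratio l) (≈-refl _))
   (≈t (≈-≡ \ T s -> #h8 (t l T s) (t 1 T s) (t 0 T s ^c l)) (≈t (≈-* (≈-refl (t 1)) (powers l)) (≈-≡ \ T s -> ! (*c-assoc _ _ _)))))
  tail≈1 : (\ T s -> g (ζ s) (rT T ^ (m s N.* a))) ≈ (\ _ _ -> 1c)
  tail≈1 = 1 , 2 , \ T 2T -> let (n₀ , h) = power-small (lt (r>0 2T)) (r<1 2T) (tε>0 {1} {T} NP.≤-refl (&N z<s 2T)) in
   n₀ , \ s l -> tε-nn 1 T , =≤ (& (ap N (#h10 (rl (rT T ^ (m s N.* a))) (ζ s))) (& (N-neg _) (& (N-* _ _) (& (ap2 _*_ (N-rl _) (ζ-unit s)) (*1r _)))))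
    (≤= (sq-mono (^n (m s N.* a) (lt (r>0 2T))) (h (m s N.* a) (&N l (&N (m≥ s) (m≤m*n (m s) a {{>-nonZero a≥1}})))))
     (! (& (ap (tε 1 T * tε 1 T *_) N-1) (*1r _))))
  t-end : (\ T s -> t a T s *c (1c -c ζ s)) ≈ t 0
  t-end = ≈t (≈-≡ \ T s -> τ-end (ζ s) (rT T) a (m s)) (≈t (≈-* (≈-refl (t 0)) tail≈1) (≈-≡ \ T s -> *c1r _))
  ≍-≡ : ∀ {x y : ℕ -> ℕ -> Q} -> (∀ T s -> x T s ~ y T s) -> x ≍ y
  ≍-≡ {x} {y} h = 1 , Ev! \ T s -> ≤r (& (h T s) (one (y T s))) , ≤r (& (! (h T s)) (one (x T s))) where
   one : ∀ x -> x ~ ι 1 * x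
   one x = ! (& (ap (_* x) (+-idr 1#)) (*1l x))
  size-end : (\ T s -> N (t a T s)) ≍ (\ T s -> N (t 0 T s))
  size-end = ≍t ≍ζ (≍t (≍-≡ \ T s -> ! (N-* _ _)) (≈⇒≍ t-end)) where
   ≍ζ : (\ T s -> N (t a T s)) ≍ (\ T s -> N (t a T s) * N (1c -c ζ s))
   ≍ζ with arch (inv c0)
   ... | k , h = k N.+ 4 , Ev! \ T s -> lower (N-nn (t a T s)) s , upper (N-nn (t a T s)) s where
    lower : ∀ {x} -> 0# ≤ x -> ∀ s -> x ≤ ι (k N.+ 4) * (x * N (1c -c ζ s))
    lower {x} x≥0 s = =≤ (& (! (*1l x)) (ap (_* x) (! (inv-r c0>0)))) (≤= (*r x≥0 (*-mono (lt c0>0) (sep s) (inv-nn c0>0) (<& h (ι-mono (m≤m+n k 4)))))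
     (#h11 (N (1c -c ζ s)) (ι (k N.+ 4)) x))
    upper : ∀ {x} -> 0# ≤ x -> ∀ s -> x * N (1c -c ζ s) ≤ ι (k N.+ 4) * x
    upper {x} x≥0 s = ≤= (*l x≥0 (<& (N-1-≤4 (ζ-unit s)) (=≤ four (ι-mono (m≤n+m 4 k))))) (*-comm x _) where
     opaque
      unfolding Qr
      four : 4# ~ ι 4
      four = refl
  N0 : ℕ -> ℕ -> Q
  N0 T s = N (t 0 T s)
  N0-nn : ∀ T s -> 0# ≤ N0 T s
  N0-nn T s = N-nn (t 0 T s)
  size-powers : ∀ l -> (\ T s -> N (t l T s) * N0 T s ^ l) ≍ (\ T s -> N (t 1 T s) ^ l * N0 T s)
  size-powers l = ≍t (≍-≡ \ T s -> ! (& (N-* _ _) (ap (N (t l T s) *_) (N-^ (t 0 T s) l))))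
   (≍t (≈⇒≍ (powers l)) (≍-≡ \ T s -> & (N-* _ _) (ap (_* N0 T s) (N-^ (t 1 T s) l))))
  N0^>0 : ∀ l -> Ev (\ T s -> 0# < N0 T s ^ l)
  N0^>0 l = Evm (\ T s p -> ^-pos l p) (t≠0 0)
  size-1 : (\ T s -> N (t 1 T s)) ≍ N0
  size-1 = ≍-root a' (\ T s -> N-nn _) N0-nn (≍-cancel (t≠0 0) (≍t (≍-sym (size-powers a))
   (≍t (≍-* (Ev! \ T s -> N-nn _ , ^n a (N0-nn T s)) (Ev! \ T s -> N0-nn T s , ^n a (N0-nn T s)) size-end ≍-refl)
    (≍-≡ \ T s -> *-comm (N0 T s) (N0 T s ^ a)))))
  size : ∀ l -> (\ T s -> N (t l T s)) ≍ N0
  size l = ≍-cancel (N0^>0 l) (≍t (size-powers l) (≍t (≍-* (Ev! \ T s -> ^n l (N-nn _) , N0-nn T s) (Ev! \ T s -> ^n l (N0-nn T s) , N0-nn T s)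
   (≍-^ l (\ T s -> N-nn _) N0-nn size-1) ≍-refl) (≍-≡ \ T s -> *-comm (N0 T s ^ l) (N0 T s))))
  D : ℕ -> ℕ -> C
  D T s = t 1 T s *c cj (t 0 T s) *c cj (Θ s)
  F : ℕ -> ℕ -> ℕ -> C
  F j T s = rl (N0 T s ^ j) *c (t (S j) T s *c cj (t 0 T s) *c cj (Θ s ^c S j))
  F≈D : ∀ j -> F j ≈ (\ T s -> D T s ^c S j)
  F≈D j = ≈-cancel {w = \ T s -> rl (N0 T s)} (Evm (\ T s p -> tr (0# <_) (! (N-rl _)) (pp* p p)) (t≠0 0))
   (≈t (≈-≡ lhs) (≈t (≈-* (powers (S j)) (≈-refl (\ T s -> cj (t 0 T s) ^c S j *c cj (t 0 T s) *c cj (Θ s) ^c S j))) (≈-≡ rhs))) where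
   lhs : ∀ T s -> F j T s *c rl (N0 T s) ~ t (S j) T s *c t 0 T s ^c S j *c (cj (t 0 T s) ^c S j *c cj (t 0 T s) *c cj (Θ s) ^c S j)
   lhs T s = & (#h14 (rl (N0 T s ^ j)) (t (S j) T s) (cj (t 0 T s)) (cj (Θ s ^c S j)) (rl (N0 T s)))
    (& (ap2 (\ x y -> x *c (t (S j) T s *c cj (t 0 T s) *c y)) (& (! (rl-* _ _)) (& (rl-^ (N0 T s) (S j)) (& (ap (_^c S j) (! (u*cj (t 0 T s)))) (*c-^ _ _ (S j))))) (cj-^ (Θ s) (S j)))
     (#h13 (t 0 T s ^c S j) (cj (t 0 T s) ^c S j) (t (S j) T s) (cj (t 0 T s)) (cj (Θ s) ^c S j)))
   rhs : ∀ T s -> t 1 T s ^c S j *c t 0 T s *c (cj (t 0 T s) ^c S j *c cj (t 0 T s) *c cj (Θ s) ^c S j) ~ D T s ^c S j *c rl (N0 T s)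
   rhs T s = & (#h12 (t 1 T s ^c S j) (t 0 T s) (cj (t 0 T s) ^c S j) (cj (t 0 T s)) (cj (Θ s) ^c S j))
    (ap2 _*c_ (! (& (*c-^ _ (cj (Θ s)) (S j)) (ap (_*c cj (Θ s) ^c S j) (*c-^ _ _ (S j))))) (u*cj (t 0 T s)))
  F-re : ∀ j -> j N.≤ a' -> Ev (\ T s -> 0# ≤ re (F j T s))
  F-re j l = Evm (\ T s 2T -> ≤= (nn* (^n j (N0-nn T s)) (nn+ (nn* (fst (qt T s 2T)) (fst (Θ-quadrant s (S j) (s≤s l)))) (nn* (snd (qt T s 2T)) (snd (Θ-quadrant s (S j) (s≤s l))))))
   (! (& (& (re-* _ _) (& (ap2 (\ a b -> a * re (w T s) - b * im (w T s)) (re-rl _) (im-rl _)) (#h16 _ _ _))) (ap (N0 T s ^ j *_)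
    (& (re-* _ _) (& (ap2 (\ a b -> re (ψ T s) * a - im (ψ T s) * b) (re-cj _) (im-cj _)) (#h15 _ _ _ _))))))) (Ev-T≥ 2) where
   ψ w : ℕ -> ℕ -> C
   ψ T s = t (S j) T s *c cj (t 0 T s)
   w T s = ψ T s *c cj (Θ s ^c S j)
   qt : ∀ T s -> 2 N.≤ T -> FirstQuadrant (ψ T s)
   qt T s 2T = Cone.quadrant (ζ-unit s) (r>0 2T) (r≤1 2T) a (S j) (s≤s l) (m s) (im≥0 s)
  F-end : F a' || (\ _ _ -> 1c)
  F-end = ||-div′ Θ-end where
   Θc : ∀ s -> Θ s ^c a *c cj (Θ s ^c a) ~ 1c
   Θc s = cj-unit (unit-^ a (Θ-unit s))
   ||-div′ : (\ (T s : ℕ) -> (1c -c ζ s) *c Θ s ^c a) || (\ _ _ -> 1c) -> F a' || (\ _ _ -> 1c)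
   ||-div′ (l , l>0 , p) = ||-div {l = l} l>0 (||-≈ (≈t (≈-* (≈-sym (≈t p (≈-≡ \ T s -> *c1r _))) (≈-refl (F a')))
    (≈t (≈-≡ \ T s -> & (#h17 (1c -c ζ s) (Θ s ^c a) (rl (N0 T s ^ a')) (t a T s) (cj (t 0 T s)) (cj (Θ s ^c a))) (& (ap (t a T s *c (1c -c ζ s) *c (cj (t 0 T s) *c rl (N0 T s ^ a')) *c_) (Θc s)) (*c1r _)))
     (≈t (≈-* t-end (≈-refl (\ T s -> cj (t 0 T s) *c rl (N0 T s ^ a')))) (≈-≡ \ T s -> & (! (*c-assoc _ _ _)) (& (ap (_*c rl (N0 T s ^ a')) (u*cj _)) (! (rl-* _ _)))))))
    (||-pos (Evm (\ T s q -> pp* q (^-pos a' q)) (t≠0 0))))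
  private
   common : ∀ K {u v : ℕ -> ℕ -> ℕ -> C} -> (∀ j -> j N.< K -> u j ≈ v j) -> ∃ \ c -> Ev (\ T s -> ∀ j -> j N.< K -> Rel (u j T s) (v j T s) (tε c T))
   common zero h = 0 , Ev! \ T s j ()
   common (S K) {u} {v} h with common K {u} {v} (\ j l -> h j (m<n⇒m<1+n l)) | h K NP.≤-refl
   ... | c , p | d , q = c N.+ d , Evm2 comb p q where
    comb : ∀ T s -> (∀ j -> j N.< K -> Rel (u j T s) (v j T s) (tε c T)) -> Rel (u K T s) (v K T s) (tε d T) -> ∀ j -> j N.< S K -> Rel (u j T s) (v j T s) (tε (c N.+ d) T)
    comb T s f x j l with j ≟ K
    ... | yes refl = rel-mono (tε-mono T (m≤n+m d c)) x
    ... | no ne = rel-mono (tε-mono T (m≤m+n c d)) (f j (≤∧≢⇒< (s≤s⁻¹ l) ne))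
  D≠0 : Ev (\ T s -> 0# < N (D T s))
  D≠0 = Evm2 (\ T s p q -> tr (0# <_) (! (& (N-* _ _) (& (ap2 _*_ (& (N-* _ _) (ap (N (t 1 T s) *_) (N-cj _))) (& (N-cj _) (Θ-unit s))) (*1r _)))) (pp* p q)) (t≠0 1) (t≠0 0)
  D-positive : D || (\ _ _ -> 1c)
  D-positive = go F-end where
   go : F a' || (\ _ _ -> 1c) -> D || (\ _ _ -> 1c)
   go (l , l>0 , p) = go′ (common a' {F} {\ j T s -> D T s ^c S j} (\ j _ -> F≈D j)) (≈t (≈-sym (≈t p (≈-≡ \ T s -> *c1r _))) (F≈D a')) (arch K) where
    K = Principal.Kc a'
    go′ : (∃ \ c -> Ev (\ T s -> ∀ j -> j N.< a' -> Rel (F j T s) (D T s ^c S j) (tε c T))) -> (\ T s -> rl (l T s)) ≈ (\ T s -> D T s ^c a) -> (∃ \ n -> K ≤ ι n) -> D || (\ _ _ -> 1c)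
    go′ (c , P) (d , R) (n , Kc≤) = (\ T s -> re (D T s)) , Evm (\ T s -> fst) res ,
     (2 N.* (n N.* e)) , Evm (\ T s x -> tr (\ z -> Rel (D T s) z (tε (2 N.* (n N.* e)) T)) (! (*c1r _)) (rel-mono (≤= (*l 0≤2 (Ky≤ T)) (2tε (n N.* e) T)) (snd x))) res where
     e = c N.+ d
     Ky≤ : ∀ T -> K * tε e T ≤ tε (n N.* e) T
     Ky≤ T = ≤= (*r (tε-nn e T) Kc≤) (tε-* e n T)
     point : ∀ T s -> ((∀ j -> j N.< a' -> 0# ≤ re (F j T s)) × 0# < N (D T s)) × (∀ j -> j N.< a' -> Rel (F j T s) (D T s ^c S j) (tε c T)) →
      (Rel (rl (l T s)) (D T s ^c a) (tε d T) × 0# < l T s) × 2# * tε (2 N.* (n N.* e)) T ≤ 1# →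
      0# < re (D T s) × Rel (D T s) (rl (re (D T s))) (2# * (K * tε e T))
     point T s ((Fre , nz) , rels) ((last , l>0) , small) = Principal.principal a' a'1 (D T s) (tε e T) (tε-nn e T)
      (<& (≤= (*l 0≤4 (Ky≤ T)) (& (*-distʳ _ 2# 2#) (& (#h18 _) (ap (2# *_) (2tε (n N.* e) T))))) small) nz
      (\ { (S j) _ j≤ -> F j T s , Fre j j≤ , snd (rel-mono (tε-mono T (m≤m+n c d)) (rels j j≤)) })
      (l T s , lt l>0 , snd (rel-mono (tε-mono T (m≤n+m d c)) last))
     res = Evm2 point (Ev-∧ (Ev-∧ (Ev-all< a' \ j j<a' -> F-re j (<⇒≤ j<a')) D≠0) P) (Ev-∧ (Ev-∧ R l>0) (Ev-small (2 N.* (n N.* e))))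
  direction : ∀ j -> t j || (\ T s -> Θ s ^c j *c t 0 T s)
  direction j = ||-div {l = \ T s -> N0 T s ^ j} (Evm (\ T s -> ^-pos j) (t≠0 0))
   (||-≈ (≈t (≈-≡ lhs) (≈t (≈-* (powers j) (≈-refl (\ T s -> cj (t 0 T s) ^c j))) (≈-≡ rhs)))
    (||-≡ʳ (||-* (||-^ j (||-* D-positive (||-refl (\ T s -> Θ s)))) (||-refl (t 0))) \ T s -> ap (\ z -> z ^c j *c t 0 T s) (*c1l _))) where
   lhs : ∀ T s -> rl (N0 T s ^ j) *c t j T s ~ t j T s *c t 0 T s ^c j *c cj (t 0 T s) ^c j
   lhs T s = & (*cc _ _) (& (ap (t j T s *c_) (& (rl-^ (N0 T s) j) (& (ap (_^c j) (! (u*cj (t 0 T s)))) (*c-^ _ _ j)))) (! (*c-assoc _ _ _)))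
   rhs : ∀ T s -> t 1 T s ^c j *c t 0 T s *c cj (t 0 T s) ^c j ~ (D T s *c Θ s) ^c j *c t 0 T s
   rhs T s = & (#h19 (t 1 T s ^c j) (t 0 T s) (cj (t 0 T s) ^c j)) (ap (_*c t 0 T s) (& (! (*c-^ _ _ j)) (ap (_^c j)
    (! (& (*c-assoc _ _ _) (& (ap (t 1 T s *c cj (t 0 T s) *c_) (& (*cc _ _) (cj-unit (Θ-unit s)))) (*c1r _)))))))

module B10 where
 open Rationals
 open Z using (ℤ)
 open import Data.Nat.DivMod using (_/_; _%_; m≡m%n+[m/n]*n; m%n<n; m<n⇒m%n≡m; %-distribˡ-*; m%n%n≡m%n)
 open import Data.Integer.Tactic.RingSolver using () renaming (solve-∀ to zsolve)

 #i1 : ∀ x -> x Z.* (x Z.- Z.+ 1) Z.+ Z.+ 2 Z.* x ~ (Z.+ 1 Z.+ x) Z.* ((Z.+ 1 Z.+ x) Z.- Z.+ 1)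
 #i1 = zsolve
 #i2 : ∀ x -> (x Z.- Z.+ 1) Z.* x Z.* (Z.+ 2 Z.* x Z.- Z.+ 1) Z.+ Z.+ 6 Z.* (x Z.* x) ~ ((Z.+ 1 Z.+ x) Z.- Z.+ 1) Z.* (Z.+ 1 Z.+ x) Z.* (Z.+ 2 Z.* (Z.+ 1 Z.+ x) Z.- Z.+ 1)
 #i2 = zsolve
 #i3 : ∀ h i m -> h Z.* i Z.* (h Z.* i) Z.+ m Z.* m ~ h Z.* h Z.* (i Z.* i) Z.+ m Z.* m
 #i3 = zsolve
 #i4 : ∀ m a k -> Z.+ 2 Z.* (m Z.+ a Z.* k) Z.* m Z.+ a Z.* a Z.* (k Z.* k) ~ (m Z.+ a Z.* k) Z.* (m Z.+ a Z.* k) Z.+ m Z.* m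
 #i4 = zsolve
 #i5 : ∀ h i m a k -> Z.+ 2 Z.* h Z.* (i Z.* m) Z.+ a Z.* a Z.* (k Z.* k) ~ Z.+ 2 Z.* (h Z.* i) Z.* m Z.+ a Z.* a Z.* (k Z.* k)
 #i5 = zsolve
 #i6 : ∀ x y -> x Z.* y Z.+ y ~ (x Z.+ Z.+ 1) Z.* y
 #i6 = zsolve
 #i7 : ∀ r c d a -> r Z.+ c Z.* a ~ (r Z.+ d Z.* a) Z.+ a Z.* (c Z.- d)
 #i7 = zsolve
 #i8 : ∀ h a k -> (h Z.* h Z.+ Z.+ 1) Z.* ((a Z.- Z.+ 1) Z.* a Z.* (Z.+ 2 Z.* a Z.- Z.+ 1)) Z.- Z.+ 6 Z.* (a Z.* a Z.* k) ~ a Z.* ((h Z.* h Z.+ Z.+ 1) Z.* ((a Z.- Z.+ 1) Z.* (Z.+ 2 Z.* a Z.- Z.+ 1)) Z.- Z.+ 6 Z.* a Z.* k)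
 #i8 = zsolve
 #i9 : ∀ h s a k -> Z.+ 6 Z.* ((h Z.* h Z.+ Z.+ 1) Z.* s) Z.- Z.+ 6 Z.* (a Z.* a Z.* k) ~ (h Z.* h Z.+ Z.+ 1) Z.* (Z.+ 6 Z.* s) Z.- Z.+ 6 Z.* (a Z.* a Z.* k)
 #i9 = zsolve
 #i10 : ∀ h s a k -> Z.+ 12 Z.* h Z.* s ~ Z.+ 6 Z.* (Z.+ 2 Z.* h Z.* s Z.+ a Z.* a Z.* k) Z.- Z.+ 6 Z.* (a Z.* a Z.* k)
 #i10 = zsolve
 #i11 : ∀ h h' s a d -> h Z.* h' Z.* (Z.+ 12 Z.* s) Z.- a Z.* d Z.* (Z.+ 12 Z.* s) ~ h' Z.* (Z.+ 12 Z.* h Z.* s) Z.- a Z.* d Z.* (Z.+ 12 Z.* s)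
 #i11 = zsolve
 #i12 : ∀ s a d -> Z.+ 12 Z.* s ~ (Z.+ 1 Z.+ a Z.* d) Z.* (Z.+ 12 Z.* s) Z.- a Z.* d Z.* (Z.+ 12 Z.* s)
 #i12 = zsolve
 #i13 : ∀ h' a B d s -> h' Z.* (a Z.* B) Z.- a Z.* d Z.* (Z.+ 12 Z.* s) ~ a Z.* (h' Z.* B Z.- d Z.* (Z.+ 12 Z.* s))
 #i13 = zsolve
 #i14 : ∀ h h' a d Y -> a Z.* (h Z.* (Z.+ 1 Z.+ a Z.* d) Z.+ h' Z.+ a Z.* Y) ~ a Z.* (h Z.+ h') Z.+ a Z.* a Z.* (h Z.* d Z.+ Y)
 #i14 = zsolve
 #i15 : ∀ h h' a k d W -> a Z.* (h' Z.* ((h Z.* h Z.+ Z.+ 1) Z.* ((a Z.- Z.+ 1) Z.* (Z.+ 2 Z.* a Z.- Z.+ 1)) Z.- Z.+ 6 Z.* a Z.* k) Z.- d Z.* (a Z.* W)) ~ a Z.* (h Z.* (h Z.* h') Z.+ h' Z.+ a Z.* (h' Z.* (h Z.* h Z.+ Z.+ 1) Z.* (Z.+ 2 Z.* a Z.- Z.+ 3) Z.- Z.+ 6 Z.* h' Z.* k Z.- d Z.* W))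
 #i15 = zsolve
 #i16 : ∀ x y -> x ~ (x Z.+ y) Z.- y
 #i16 = zsolve
 #i17 : ∀ w s m -> w Z.* s Z.+ Z.- (Z.+ 4) Z.* m ~ w Z.* s Z.- Z.+ 4 Z.* m
 #i17 = zsolve
 #i18 : ∀ i w m -> i Z.* (w Z.- Z.+ 4 Z.* m) ~ w Z.* i Z.+ Z.- (Z.+ 4) Z.* (i Z.* m)
 #i18 = zsolve
 #i19 : ∀ A X u v x y -> Z.+ 12 Z.* (Z.+ 8 Z.* (A Z.* A) Z.+ Z.+ 2 Z.* A) Z.* (A Z.* (A Z.- Z.+ 1)) Z.- Z.+ 8 Z.* (A Z.* (u Z.+ v) Z.+ A Z.* A Z.* X) Z.+ Z.+ 8 Z.* A Z.* (u Z.+ v) Z.- Z.+ 8 Z.* (A Z.* A) Z.* (x Z.+ y) ~ Z.+ 8 Z.* (A Z.* A) Z.* (Z.+ 3 Z.* (Z.+ 4 Z.* A Z.+ Z.+ 1) Z.* (A Z.- Z.+ 1) Z.- X Z.- x Z.- y)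
 #i19 = zsolve
 #i20 : ∀ A s m u v x y -> Z.+ 8 Z.* A Z.* (u Z.- x Z.* A) Z.+ Z.+ 24 Z.* ((Z.+ 8 Z.* (A Z.* A) Z.+ Z.+ 2 Z.* A) Z.* s Z.- Z.+ 4 Z.* m) Z.+ Z.+ 8 Z.* A Z.* (v Z.- y Z.* A) ~ Z.+ 12 Z.* (Z.+ 8 Z.* (A Z.* A) Z.+ Z.+ 2 Z.* A) Z.* (Z.+ 2 Z.* s) Z.- Z.+ 8 Z.* (Z.+ 12 Z.* m) Z.+ Z.+ 8 Z.* A Z.* (u Z.+ v) Z.- Z.+ 8 Z.* (A Z.* A) Z.* (x Z.+ y)
 #i20 = zsolve

 module ΣZ = Fold Z._+_ 0Z ZP.+-assoc ZP.+-comm ZP.+-identityˡ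

 sumZ : ℕ -> (ℕ -> ℤ) -> ℤ
 sumZ = ΣZ.fold

 module ΣN = Fold N._+_ 0 NP.+-assoc NP.+-comm NP.+-identityˡ

 sumN : ℕ -> (ℕ -> ℕ) -> ℕ
 sumN = ΣN.fold

 sumZ-*ˡ : ∀ n c f -> sumZ n (\ k -> c Z.* f k) ~ c Z.* sumZ n f
 sumZ-*ˡ n c f = ! (ΣZ.fold-hom n f (\ z -> c Z.* z) (ZP.*-zeroʳ c) (ZP.*-distribˡ-+ c))

 module Permute {A : Set} (_∙_ : A -> A -> A) (ε : A)
  (assoc : ∀ x y z -> (x ∙ y) ∙ z ~ x ∙ (y ∙ z)) (comm : ∀ x y -> x ∙ y ~ y ∙ x) (idˡ : ∀ x -> ε ∙ x ~ x) where
  open Fold _∙_ ε assoc comm idˡ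
  private
   at : ∀ {P : Set} -> Dec P -> A -> A
   at (yes _) x = x
   at (no _) x = ε
   at-yes : ∀ {P : Set} (D : Dec P) {x} -> P -> at D x ~ x
   at-yes (yes _) p = refl
   at-yes (no n) p = abort (n p)
   at-no : ∀ {P : Set} (D : Dec P) {x} -> ¬ P -> at D x ~ ε
   at-no (yes p) n = abort (n p)
   at-no (no _) n = refl
  permute : ∀ n (f f' : ℕ -> ℕ) (G : ℕ -> A) -> (∀ k -> k N.< n -> f k N.< n) -> (∀ k -> k N.< n -> f' k N.< n) →
   (∀ k -> k N.< n -> f (f' k) ~ k) -> (∀ k -> k N.< n -> f' (f k) ~ k) -> fold n (\ k -> G (f k)) ~ fold n G
  permute n f f' G f< f'< ff' f'f = & (cong-< n \ k l -> ! (& (fold-single n (f k) (f< k l) \ j _ ne -> at-no (f k ≟ j) \ e -> ne (! e)) (at-yes (f k ≟ f k) refl)))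
   (& (exchange n n _) (cong-< n \ j l -> & (fold-single n (f' j) (f'< j l) \ k k<n ne -> at-no (f k ≟ j) \ e -> ne (& (! (f'f k k<n)) (ap f' e))) (at-yes (f (f' j) ≟ j) (ff' j l))))

 open Permute Z._+_ 0Z ZP.+-assoc ZP.+-comm ZP.+-identityˡ using () renaming (permute to permuteZ)

 module Residues (a' h h' : ℕ) (hh' : (h N.* h') % S a' ~ 1 % S a') where
  a = S a'
  mul-inverse : ∀ g g' -> (g N.* g') % a ~ 1 % a -> ∀ k -> k N.< a -> (g N.* ((g' N.* k) % a)) % a ~ k
  mul-inverse g g' e k l = & (%-distribˡ-* g ((g' N.* k) % a) a) (& (ap (\ x -> ((g % a) N.* x) % a) (m%n%n≡m%n (g' N.* k) a))
   (& (! (%-distribˡ-* g (g' N.* k) a)) (& (ap (_% a) (! (NP.*-assoc g g' k))) (& (%-distribˡ-* (g N.* g') k a) (& (ap (\ x -> (x N.* (k % a)) % a) e)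
    (& (! (%-distribˡ-* 1 k a)) (& (ap (_% a) (NP.*-identityˡ k)) (m<n⇒m%n≡m l))))))))
  h'h : (h' N.* h) % a ~ 1 % a
  h'h = & (ap (_% a) (NP.*-comm h' h)) hh'
  μ : ℕ -> ℕ
  μ k = (h N.* k) % a
  μ< : ∀ k -> μ k N.< a
  μ< k = m%n<n (h N.* k) a
  μ-injective : ∀ {j k} -> j N.< a -> k N.< a -> μ j ~ μ k -> j ~ k
  μ-injective {j} {k} p q e = & (! (mul-inverse h' h h'h j p)) (& (ap (\ x -> (h' N.* x) % a) e) (mul-inverse h' h h'h k q))
  μ≢0 : ∀ {k} -> 1 N.≤ k -> k N.< a -> μ k ≢ 0
  μ≢0 {k} p q e = <⇒≢ p (! (μ-injective q z<s (& e (! (ap (_% a) (*-zeroʳ h))))))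

 -- 8a² + 2a - 4x, an angle in units of 1/(8a²) turns
 angle : ℕ -> ℕ -> ℕ
 angle a x = (8 N.* (a N.* a) N.+ 2 N.* a) ∸ 4 N.* x

 angle-+ : ∀ {a x} -> x N.≤ a -> angle a x N.+ 4 N.* x ~ 8 N.* (a N.* a) N.+ 2 N.* a
 angle-+ {zero} z≤n = refl
 angle-+ {S a'} {x} l = m∸n+n≡m angle-≥ where
  a = S a'
  angle-≥ : 4 N.* x N.≤ 8 N.* (a N.* a) N.+ 2 N.* a
  angle-≥ = &N (*-mono-≤ {4} {8} (s≤s (s≤s (s≤s z<s))) (&N l (m≤m*n a a))) (m≤m+n _ (2 N.* a))

 -- Dedekind's congruence: 12 ∑ i (h i mod a) ≡ a (h + h') modulo a².
 module Dedekind (a' h h' : ℕ) (hh' : (h N.* h') % S a' ~ 1 % S a') where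
  open Residues a' h h' hh'
  private
   Z : ℕ -> ℤ
   Z n = Z.+ n
   k : ℕ -> ℕ
   k i = (h N.* i) / a
   hi : ∀ i -> Z h Z.* Z i ~ Z (μ i) Z.+ Z a Z.* Z (k i)
   hi i = & (! (ZP.pos-* h i)) (& (ap Z (m≡m%n+[m/n]*n (h N.* i) a)) (& (ZP.pos-+ (μ i) _) (ap (\ z -> Z (μ i) Z.+ z) (& (ZP.pos-* (k i) a) (ZP.*-comm (Z (k i)) (Z a))))))
   S1 S2 Sμ Sk : ℤ
   S1 = sumZ a Z
   S2 = sumZ a (\ i -> Z i Z.* Z i)
   Sμ = sumZ a (\ i -> Z i Z.* Z (μ i))
   Sk = sumZ a (\ i -> Z (k i) Z.* Z (k i))
   Sμμ : sumZ a (\ i -> Z (μ i) Z.* Z (μ i)) ~ S2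
   Sμμ = permuteZ a μ (\ j -> (h' N.* j) % a) (\ j -> Z j Z.* Z j) (\ j _ -> μ< j) (\ j _ -> m%n<n (h' N.* j) a) (mul-inverse h h' hh') (mul-inverse h' h h'h)
   2S1 : ∀ n -> Z 2 Z.* sumZ n Z ~ Z n Z.* (Z n Z.- Z 1)
   2S1 zero = refl
   2S1 (S n) = & (ZP.*-distribˡ-+ (Z 2) (sumZ n Z) (Z n)) (& (ap (Z._+ Z 2 Z.* Z n) (2S1 n)) (& (#i1 (Z n)) (ap2 (\ x y -> x Z.* (y Z.- Z 1)) (! (ZP.pos-+ 1 n)) (! (ZP.pos-+ 1 n)))))
   6S2 : ∀ n -> Z 6 Z.* sumZ n (\ i -> Z i Z.* Z i) ~ (Z n Z.- Z 1) Z.* Z n Z.* (Z 2 Z.* Z n Z.- Z 1)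
   6S2 zero = refl
   6S2 (S n) = & (ZP.*-distribˡ-+ (Z 6) (sumZ n (\ i -> Z i Z.* Z i)) (Z n Z.* Z n)) (& (ap (Z._+ Z 6 Z.* (Z n Z.* Z n)) (6S2 n)) (& (#i2 (Z n)) (ap (\ y -> (y Z.- Z 1) Z.* y Z.* (Z 2 Z.* y Z.- Z 1)) (! (ZP.pos-+ 1 n)))))
   key : Z 2 Z.* Z h Z.* Sμ Z.+ Z a Z.* Z a Z.* Sk ~ (Z h Z.* Z h Z.+ Z 1) Z.* S2
   key = & (ap2 Z._+_ (! (sumZ-*ˡ a (Z 2 Z.* Z h) _)) (! (sumZ-*ˡ a (Z a Z.* Z a) _))) (& (! (ΣZ.distr a _ _)) (& (ΣZ.cong-f a pointwise) (& (ΣZ.distr a _ _)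
    (& (ap2 Z._+_ (sumZ-*ˡ a (Z h Z.* Z h) _) Sμμ) (#i6 (Z h Z.* Z h) S2))))) where
    alg : ∀ h i m a k -> h Z.* i ~ m Z.+ a Z.* k -> Z.+ 2 Z.* h Z.* (i Z.* m) Z.+ a Z.* a Z.* (k Z.* k) ~ h Z.* h Z.* (i Z.* i) Z.+ m Z.* m
    alg h i m a k eq = & (#i5 h i m a k) (& (ap (\ x -> Z.+ 2 Z.* x Z.* m Z.+ a Z.* a Z.* (k Z.* k)) eq) (& (#i4 m a k) (& (ap (\ x -> x Z.* x Z.+ m Z.* m) (! eq)) (#i3 h i m))))
    pointwise : ∀ i -> Z 2 Z.* Z h Z.* (Z i Z.* Z (μ i)) Z.+ Z a Z.* Z a Z.* (Z (k i) Z.* Z (k i)) ~ Z h Z.* Z h Z.* (Z i Z.* Z i) Z.+ Z (μ i) Z.* Z (μ i)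
    pointwise i = alg (Z h) (Z i) (Z (μ i)) (Z a) (Z (k i)) (hi i)
   c : ℤ
   c = Z ((h N.* h') / a)
   c1 : ℤ
   c1 = Z (1 / a)
   unit-eq : Z h Z.* Z h' ~ Z 1 Z.+ Z a Z.* (c Z.- c1)
   unit-eq = & (! (ZP.pos-* h h')) (& (ap Z (& (m≡m%n+[m/n]*n (h N.* h') a) (ap (N._+ (h N.* h') / a N.* a) hh')))
    (& (& (ZP.pos-+ (1 % a) _) (ap (\ z -> Z (1 % a) Z.+ z) (ZP.pos-* ((h N.* h') / a) a)))
     (& (#i7 (Z (1 % a)) c c1 (Z a)) (ap (\ x -> x Z.+ Z a Z.* (c Z.- c1)) (! (& (ap Z (m≡m%n+[m/n]*n 1 a)) (& (ZP.pos-+ (1 % a) _) (ap (\ z -> Z (1 % a) Z.+ z) (ZP.pos-* (1 / a) a)))))))))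
   twelve : Z 12 Z.* Z h Z.* Sμ ~ Z a Z.* ((Z h Z.* Z h Z.+ Z 1) Z.* ((Z a Z.- Z 1) Z.* (Z 2 Z.* Z a Z.- Z 1)) Z.- Z 6 Z.* Z a Z.* Sk)
   twelve = & (#i10 (Z h) Sμ (Z a) Sk) (& (ap (\ x -> Z 6 Z.* x Z.- Z 6 Z.* (Z a Z.* Z a Z.* Sk)) key) (& (#i9 (Z h) S2 (Z a) Sk) (& (ap (\ x -> (Z h Z.* Z h Z.+ Z 1) Z.* x Z.- Z 6 Z.* (Z a Z.* Z a Z.* Sk)) (6S2 a)) (#i8 (Z h) (Z a) Sk))))
   -- solving for 12 Sμ modulo a², in two steps since h is inverted only modulo a
   B : ℤ
   B = (Z h Z.* Z h Z.+ Z 1) Z.* ((Z a Z.- Z 1) Z.* (Z 2 Z.* Z a Z.- Z 1)) Z.- Z 6 Z.* Z a Z.* Sk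
   d : ℤ
   d = c Z.- c1
   first : Z 12 Z.* Sμ ~ Z a Z.* (Z h' Z.* B Z.- d Z.* (Z 12 Z.* Sμ))
   first = & (e1 (Z h) (Z h') Sμ (Z a) d unit-eq) (& (ap (\ x -> Z h' Z.* x Z.- Z a Z.* d Z.* (Z 12 Z.* Sμ)) twelve) (#i13 (Z h') (Z a) B d Sμ)) where
    e1 : ∀ h h' s a d -> h Z.* h' ~ Z.+ 1 Z.+ a Z.* d -> Z.+ 12 Z.* s ~ h' Z.* (Z.+ 12 Z.* h Z.* s) Z.- a Z.* d Z.* (Z.+ 12 Z.* s)
    e1 h h' s a d eq = & (#i12 s a d) (& (ap (\ y -> y Z.* (Z.+ 12 Z.* s) Z.- a Z.* d Z.* (Z.+ 12 Z.* s)) (! eq)) (#i11 h h' s a d))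
   W : ℤ
   W = Z h' Z.* B Z.- d Z.* (Z 12 Z.* Sμ)
  congruence : ∃ \ X -> Z 12 Z.* Sμ ~ Z a Z.* (Z h Z.+ Z h') Z.+ Z a Z.* Z a Z.* X
  congruence = X , & first (& (ap (\ y -> Z a Z.* (Z h' Z.* B Z.- d Z.* y)) first) (& (#i15 (Z h) (Z h') (Z a) Sk d W) (& (ap (\ y -> Z a Z.* (Z h Z.* y Z.+ Z h' Z.+ Z a Z.* (Z h' Z.* (Z h Z.* Z h Z.+ Z 1) Z.* (Z 2 Z.* Z a Z.- Z 3) Z.- Z 6 Z.* Z h' Z.* Sk Z.- d Z.* W))) unit-eq) (#i14 (Z h) (Z h') (Z a) d (Z h' Z.* (Z h Z.* Z h Z.+ Z 1) Z.* (Z 2 Z.* Z a Z.- Z 3) Z.- Z 6 Z.* Z h' Z.* Sk Z.- d Z.* W))))) where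
   X = Z h Z.* d Z.+ (Z h' Z.* (Z h Z.* Z h Z.+ Z 1) Z.* (Z 2 Z.* Z a Z.- Z 3) Z.- Z 6 Z.* Z h' Z.* Sk Z.- d Z.* W)
  S1-formula : Z 2 Z.* S1 ~ Z a Z.* (Z a Z.- Z 1)
  S1-formula = 2S1 a
  private
   Z-% : ∀ n -> Z (n % a) ~ Z n Z.- Z (n / a) Z.* Z a
   Z-% n = & (#i16 (Z (n % a)) (Z (n / a) Z.* Z a)) (ap (\ z -> z Z.- Z (n / a) Z.* Z a) (! (& (ap Z (m≡m%n+[m/n]*n n a)) (& (ZP.pos-+ (n % a) _) (ap (\ z -> Z (n % a) Z.+ z) (ZP.pos-* (n / a) a))))))
  private
   Zangle : ∀ {x} -> x N.< a -> Z (angle a x) ~ (Z 8 Z.* (Z a Z.* Z a) Z.+ Z 2 Z.* Z a) Z.- Z 4 Z.* Z x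
   Zangle {x} l = & (& (#i16 (Z (angle a x)) (Z (4 N.* x))) (ap (\ z -> z Z.- Z (4 N.* x)) (& (! (ZP.pos-+ (angle a x) (4 N.* x))) (ap Z (angle-+ (<⇒≤ l)))))) (ap2 Z._-_ (& (ZP.pos-+ (8 N.* (a N.* a)) (2 N.* a)) (ap2 Z._+_ (& (ZP.pos-* 8 (a N.* a)) (ap (\ z -> Z 8 Z.* z) (ZP.pos-* a a))) (ZP.pos-* 2 a))) (ZP.pos-* 4 x))
   Zsum : ∀ n (f : ℕ -> ℕ) -> Z (sumN n f) ~ sumZ n (\ i -> Z (f i))
   Zsum zero f = refl
   Zsum (S n) f = & (ZP.pos-+ (sumN n f) (f n)) (ap (\ z -> z Z.+ Z (f n)) (Zsum n f))
   Zsum-angle : sumZ a (\ i -> Z (i N.* angle a (μ i))) ~ (Z 8 Z.* (Z a Z.* Z a) Z.+ Z 2 Z.* Z a) Z.* S1 Z.- Z 4 Z.* Sμ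
   Zsum-angle = & (ΣZ.cong-f a \ i -> & (ZP.pos-* i (angle a (μ i))) (& (ap (\ z -> Z i Z.* z) (Zangle (μ< i))) (#i18 (Z i) (Z 8 Z.* (Z a Z.* Z a) Z.+ Z 2 Z.* Z a) (Z (μ i)))))
    (& (ΣZ.distr a (\ i -> (Z 8 Z.* (Z a Z.* Z a) Z.+ Z 2 Z.* Z a) Z.* Z i) (\ i -> (Z.- Z 4) Z.* (Z i Z.* Z (μ i)))) (& (ap2 Z._+_ (sumZ-*ˡ a (Z 8 Z.* (Z a Z.* Z a) Z.+ Z 2 Z.* Z a) Z) (sumZ-*ˡ a (Z.- Z 4) (\ i -> Z i Z.* Z (μ i)))) (#i17 (Z 8 Z.* (Z a Z.* Z a) Z.+ Z 2 Z.* Z a) S1 Sμ)))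
  total-angle : ∃ \ k -> 8 N.* a N.* (h % a) N.+ 24 N.* sumN a (\ i -> i N.* angle a (μ i)) N.+ 8 N.* a N.* (h' % a) ~ 8 N.* (a N.* a) N.* k
  total-angle = go congruence where
   go : (∃ \ X -> Z 12 Z.* Sμ ~ Z a Z.* (Z h Z.+ Z h') Z.+ Z a Z.* Z a Z.* X) -> _
   go (X , p) = Z.∣ Y ∣ , & (ap Z.∣_∣ eq) (ZP.abs-* (Z (8 N.* (a N.* a))) Y) where
    A = Z a
    Y = Z 3 Z.* (Z 4 Z.* A Z.+ Z 1) Z.* (A Z.- Z 1) Z.- X Z.- Z (h / a) Z.- Z (h' / a)
    p8 : ∀ n -> Z (8 N.* a N.* (n % a)) ~ Z 8 Z.* A Z.* (Z n Z.- Z (n / a) Z.* A)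
    p8 n = & (ZP.pos-* (8 N.* a) (n % a)) (ap2 Z._*_ (ZP.pos-* 8 a) (Z-% n))
    eq : Z (8 N.* a N.* (h % a) N.+ 24 N.* sumN a (\ i -> i N.* angle a (μ i)) N.+ 8 N.* a N.* (h' % a)) ~ Z (8 N.* (a N.* a)) Z.* Y
    eq = & (ZP.pos-+ (8 N.* a N.* (h % a) N.+ 24 N.* sumN a (\ i -> i N.* angle a (μ i))) (8 N.* a N.* (h' % a))) (& (ap2 Z._+_ (& (ZP.pos-+ (8 N.* a N.* (h % a)) (24 N.* sumN a (\ i -> i N.* angle a (μ i)))) (ap2 Z._+_ (p8 h)
     (& (ZP.pos-* 24 (sumN a (\ i -> i N.* angle a (μ i)))) (ap (\ z -> Z 24 Z.* z) (& (Zsum a (\ i -> i N.* angle a (μ i))) Zsum-angle))))) (p8 h'))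
     (& (#i20 A S1 Sμ (Z h) (Z h') (Z (h / a)) (Z (h' / a))) (& (ap2 (\ s m -> Z 12 Z.* (Z 8 Z.* (A Z.* A) Z.+ Z 2 Z.* A) Z.* s Z.- Z 8 Z.* m Z.+ Z 8 Z.* A Z.* (Z h Z.+ Z h') Z.- Z 8 Z.* (A Z.* A) Z.* (Z (h / a) Z.+ Z (h' / a))) S1-formula p)
     (& (#i19 A X (Z h) (Z h') (Z (h / a)) (Z (h' / a))) (ap (\ z -> z Z.* Y) (! (& (ZP.pos-* 8 (a N.* a)) (ap (\ z -> Z 8 Z.* z) (ZP.pos-* a a)))))))))

module B9 where
 open Rationals
 open Gauss
 open Interpolation
 open Roots
 open B6
 open B7
 open B8
 open CSolver using (solve; _:+_; _:*_; :-_; _:-_; _:=_; con)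
 open Z using (ℤ)
 open import Data.Nat.DivMod using (_/_; _%_; m≡m%n+[m/n]*n; m%n<n; %-distribˡ-+; m/n*n≤m)

 opaque
  unfolding Qr
  #j1 : ∀ x p -> 1# - x + x * (1# - p) ~ 1# - x * p
  #j1 = auto Qr
  #j2 : ∀ x g -> (1# - x) * (1# + x * g) ~ 1# - x + x * ((1# - x) * g)
  #j2 = auto Qr
  #j5 : ∀ p f g u v -> p * g * (f * u) * v ~ p * f * g * (u * v)
  #j5 = auto Qr
  #j6 : ∀ g -> 1# * 1# * g ~ 1# * g
  #j6 = auto Qr
  #j11 : ∀ y n -> y + 1# * (n * y) ~ (1# + n) * y
  #j11 = auto Qr
  #j12 : ∀ n e x -> n * (e * (x * x)) ~ n * x * (e * x)
  #j12 = auto Qr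
  #j20 : ∀ x -> x + (x + (x + x)) ~ 4# * x
  #j20 = auto Qr

 #j3 : ∀ x p -> 1c -c x +c x *c (1c -c p) ~ 1c -c x *c p
 #j3 = solve 2 (\ x p -> con (Z.+ 1) :- x :+ x :* (con (Z.+ 1) :- p) := con (Z.+ 1) :- x :* p) refl
 #j4 : ∀ x g -> (1c -c x) *c (1c +c x *c g) ~ 1c -c x +c x *c ((1c -c x) *c g)
 #j4 = solve 2 (\ x g -> (con (Z.+ 1) :- x) :* (con (Z.+ 1) :+ x :* g) := con (Z.+ 1) :- x :+ x :* ((con (Z.+ 1) :- x) :* g)) refl
 #j7 : ∀ z p c x e -> p -c x *c (z *c p) +c x *c ((c +c x *c e) *c (1c -c x *c z)) ~ (p +c x *c (c +c x *c e)) *c (1c -c x *c z)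
 #j7 = solve 5 (\ z p c x e -> p :- x :* (z :* p) :+ x :* ((c :+ x :* e) :* (con (Z.+ 1) :- x :* z)) := (p :+ x :* (c :+ x :* e)) :* (con (Z.+ 1) :- x :* z)) refl
 #j8 : ∀ z p c x e -> p +c x *c (c -c z *c p +c x *c e) ~ p -c x *c (z *c p) +c x *c (c +c x *c e)
 #j8 = solve 5 (\ z p c x e -> p :+ x :* (c :- z :* p :+ x :* e) := p :- x :* (z :* p) :+ x :* (c :+ x :* e)) refl
 #j9 : ∀ z p x -> p +c x *c ((-c (z *c p)) +c x *c 0c) ~ (p +c x *c 0c) *c (1c -c x *c z)
 #j9 = solve 3 (\ z p x -> p :+ x :* ((:- (z :* p)) :+ x :* con (Z.+ 0)) := (p :+ x :* con (Z.+ 0)) :* (con (Z.+ 1) :- x :* z)) refl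
 #j10 : ∀ c x e g -> c -c 1c +c x *c (e -c g) ~ c +c x *c e -c (1c +c x *c g)
 #j10 = solve 4 (\ c x e g -> c :- con (Z.+ 1) :+ x :* (e :- g) := c :+ x :* e :- (con (Z.+ 1) :+ x :* g)) refl
 #j13 : ∀ x -> 8 N.* x ~ 2 N.* x N.+ 2 N.* x N.+ (2 N.* x N.+ 2 N.* x)
 #j13 = nsolve
 #j14 : ∀ x y -> x *c (y -c 1c) ~ x *c y -c x
 #j14 = solve 2 (\ x y -> x :* (y :- con (Z.+ 1)) := x :* y :- x) refl
 #j15 : ∀ c x y -> c *c (x *c y) ~ x *c (y *c c)
 #j15 = solve 3 (\ c x y -> c :* (x :* y) := x :* (y :* c)) refl
 #j16 : ∀ x y -> x *c (1c -c y) ~ x -c x *c y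
 #j16 = solve 2 (\ x y -> x :* (con (Z.+ 1) :- y) := x :- x :* y) refl
 #j17 : ∀ a -> 8 N.* a N.* a ~ 8 N.* (a N.* a) N.* 1
 #j17 = nsolve
 #j18 : ∀ u v -> u *c v -c u ~ u *c (-c (1c -c v))
 #j18 = solve 2 (\ u v -> u :* v :- u := u :* (:- (con (Z.+ 1) :- v))) refl
 #j19 : ∀ u v -> -c (u -c v) ~ v -c u
 #j19 = solve 2 (\ u v -> :- (u :- v) := v :- u) refl
 #j21 : ∀ u v p q -> u *c (v -c q) +c q *c (u -c p) ~ u *c v -c p *c q
 #j21 = solve 4 (\ u v p q -> u :* (v :- q) :+ q :* (u :- p) := u :* v :- p :* q) refl
 #j22 : ∀ a z c -> 8 N.* a N.* (z N.+ c N.* a) ~ 8 N.* a N.* z N.+ 8 N.* (a N.* a) N.* c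
 #j22 = nsolve

 Vanishing : (ℕ -> Q) -> Set
 Vanishing x = ∀ y -> 0# < y -> ∃ \ s0 -> ∀ s -> s0 N.≤ s -> x s ≤ y

 1/ : ℕ -> Q
 1/ s = inv (ι (S s))

 1/-nn : ∀ s -> 0# ≤ 1/ s
 1/-nn s = inv-nn (ι-pos {S s} z<s)

 ι*1/ : ∀ s -> ι (S s) * 1/ s ~ 1#
 ι*1/ s = inv-r (ι-pos {S s} z<s)

 1/≤1 : ∀ s -> 1/ s ≤ 1#
 1/≤1 s = =≤ (! (*1l _)) (≤= (*r (1/-nn s) (1≤ι {S s} z<s)) (ι*1/ s))

 vanishing-1/ : ∀ c -> Vanishing (\ s -> c * 1/ s)
 vanishing-1/ c y y>0 with arch (c * inv y)
 ... | n , h = n , \ s l -> ≤= (*r (1/-nn s) (=≤ (& (! (*1r c)) (& (ap (c *_) (! (& (*-comm _ _) (inv-r y>0)))) (! *a)))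
  (≤= (*r (lt y>0) (<& h (ι-mono {n} {S s} (&N l (n≤1+n s))))) (*-comm _ _)))) (& *a (& (ap (y *_) (ι*1/ s)) (*1r y)))

 vanishing-mono : ∀ {x y} -> (∀ s -> x s ≤ y s) -> Vanishing y -> Vanishing x
 vanishing-mono h v ε ε>0 = fst (v ε ε>0) , \ s l -> <& (h s) (snd (v ε ε>0) s l)

 ≈-vanishing : ∀ {u v} x -> Vanishing x -> (∀ T s -> 2 N.≤ T -> x s ≤ 1# -> Rel (u T s) (v T s) (x s)) -> u ≈ v
 ≈-vanishing x vx h = 1 , 2 , \ T 2T -> let 1T = &N z<s 2T ; (s0 , k) = vx (tε 1 T) (tε>0 NP.≤-refl 1T) in
  s0 , \ s l -> rel-mono (k s l) (h T s 2T (<& (k s l) (tε≤1 1T 1T)))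

 <<⇒Rel : ∀ {u w x} -> 1# ≤ N w -> u -c w << x -> Rel u w x
 <<⇒Rel {x = x} h (p , q) = p , <& q (=≤ (! (*1r _)) (*l (nnsq x) h))

 τ-cj : ∀ ζ r a l m -> τ (cj ζ) r a l m ~ cj (τ ζ r a l m)
 τ-cj ζ r a l m = & (ΠC.cong-f m \ n -> ! (gc (r ^ (n N.* a N.+ l)))) (! (cj-prod m _)) where
  gc : ∀ ρ -> cj (g ζ ρ) ~ g (cj ζ) ρ
  gc ρ = & (cj-+ 1c (-c (rl ρ *c ζ))) (ap2 _+c_ cj-1 (& (cj-neg _) (ap -c_ (& (cj-* _ ζ) (ap (_*c cj ζ) (cj-rl ρ))))))

 ≍-prod : ∀ n {x y : ℕ -> ℕ -> ℕ -> Q} -> (∀ k T s -> 0# ≤ x k T s) -> (∀ k T s -> 0# ≤ y k T s) -> (∀ k -> k N.< n -> x k ≍ y k) -> (\ T s -> prod n (\ k -> x k T s)) ≍ (\ T s -> prod n (\ k -> y k T s))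
 ≍-prod zero p q h = ≍-refl
 ≍-prod (S n) p q h = ≍-* (Ev! \ T s -> prod-nn n (\ k -> p k T s) , p n T s) (Ev! \ T s -> prod-nn n (\ k -> q k T s) , q n T s) (≍-prod n p q \ k l -> h k (m<n⇒m<1+n l)) (h n NP.≤-refl)

 geo : ℕ -> Q -> Q
 geo zero x = 0#
 geo (S n) x = 1# + x * geo n x

 geoc : ℕ -> C -> C
 geoc zero x = 0c
 geoc (S n) x = 1c +c x *c geoc n x

 rl-geo : ∀ n x -> rl (geo n x) ~ geoc n (rl x)
 rl-geo zero x = rl-0
 rl-geo (S n) x = & (rl-+ 1# _) (ap2 _+c_ rl-1 (& (rl-* x _) (ap (rl x *c_) (rl-geo n x))))

 geo-nn : ∀ n {x} -> 0# ≤ x -> 0# ≤ geo n x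
 geo-nn zero p = r≤
 geo-nn (S n) p = nn+ 0≤1 (nn* p (geo-nn n p))

 1≤geo : ∀ n {x} -> 0# ≤ x -> 1# ≤ geo (S n) x
 1≤geo n p = x≤x+y (nn* p (geo-nn n p))

 geo≤ : ∀ n {x} -> 0# ≤ x -> x ≤ 1# -> geo n x ≤ ι n
 geo≤ zero p q = r≤
 geo≤ (S n) p q = +m r≤ (≤= (*-mono p q (geo-nn n p) (geo≤ n p q)) (*1l _))

 geo-1 : ∀ n -> geo n 1# ~ ι n
 geo-1 zero = refl
 geo-1 (S n) = ap (1# +_) (& (*1l _) (geo-1 n))

 geo-telescope : ∀ n x -> (1# - x) * geo n x ~ 1# - x ^ n
 geo-telescope zero x = & (*-0ʳ _) (! (+-inv 1#))
 geo-telescope (S n) x = & (#j2 x (geo n x)) (& (ap (\ y -> 1# - x + x * y) (geo-telescope n x)) (#j1 x (x ^ n)))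

 geoc-telescope : ∀ n x -> (1c -c x) *c geoc n x ~ 1c -c x ^c n
 geoc-telescope zero x = & (*c-0ʳ _) (! (u-u 1c))
 geoc-telescope (S n) x = & (#j4 x (geoc n x)) (& (ap (\ y -> 1c -c x +c x *c y) (geoc-telescope n x)) (#j3 x (x ^c n)))

 -- The Euler product ∏ (1 - xⁿ), truncated.
 F : ℕ -> Q -> Q
 F m x = prod m (\ n -> 1# - x ^ S n)

 F-geo : ∀ a m x -> prod m (\ n -> geo a (x ^ n)) * F m x * geo a (x ^ m) ~ ι a * F m (x ^ a)
 F-geo a zero x = & (#j6 (geo a 1#)) (& (ap (1# *_) (geo-1 a)) (*-comm 1# _))
 F-geo a (S m) x = & (#j5 (prod m (\ n -> geo a (x ^ n))) (F m x) (geo a (x ^ m)) (1# - x ^ S m) (geo a (x ^ S m)))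
  (& (ap2 _*_ (F-geo a m x) (& (geo-telescope a (x ^ S m)) (ap (\ y -> 1# - y) (& (! (^-^ x a (S m))) (& (ap (x ^_) (NP.*-comm a (S m))) (^-^ x (S m) a)))))) *a)

 -- coefficients of (p + x L(x))(1 - z x) apart from the constant term
 mulT : C -> C -> List C -> List C
 mulT z p [] = (-c (z *c p)) ∷ []
 mulT z p (c ∷ cs) = (c -c z *c p) ∷ mulT z c cs

 mulT-eval : ∀ z p cs x -> p +c x *c evalP (mulT z p cs) x ~ (p +c x *c evalP cs x) *c (1c -c x *c z)
 mulT-eval z p [] x = #j9 z p x
 mulT-eval z p (c ∷ cs) x = & (#j8 z p c x (evalP (mulT z c cs) x)) (& (ap (\ y -> p -c x *c (z *c p) +c x *c y) (mulT-eval z c cs x)) (#j7 z p c x (evalP cs x)))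

 mulT-length : ∀ z p cs -> length (mulT z p cs) ~ S (length cs)
 mulT-length z p [] = refl
 mulT-length z p (c ∷ cs) = ap S (mulT-length z c cs)

 linear-product : (ℕ -> C) -> ℕ -> List C
 linear-product z zero = []
 linear-product z (S n) = mulT (z n) 1c (linear-product z n)

 linear-product-eval : ∀ z n x -> 1c +c x *c evalP (linear-product z n) x ~ prodc n (\ j -> 1c -c x *c z j)
 linear-product-eval z zero x = & (ap (1c +c_) (*c-0ʳ x)) (& (+c-comm 1c 0c) (+c-idl 1c))
 linear-product-eval z (S n) x = & (mulT-eval (z n) 1c (linear-product z n) x) (ap (_*c (1c -c x *c z n)) (linear-product-eval z n x))

 linear-product-length : ∀ z n -> length (linear-product z n) ~ n
 linear-product-length z zero = refl
 linear-product-length z (S n) = & (mulT-length (z n) 1c (linear-product z n)) (ap S (linear-product-length z n))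

 decrement : List C -> List C
 decrement [] = []
 decrement (c ∷ cs) = (c -c 1c) ∷ decrement cs

 decrement-length : ∀ cs -> length (decrement cs) ~ length cs
 decrement-length [] = refl
 decrement-length (c ∷ cs) = ap S (decrement-length cs)

 decrement-eval : ∀ cs x -> evalP (decrement cs) x ~ evalP cs x -c geoc (length cs) x
 decrement-eval [] x = ! (u-u 0c)
 decrement-eval (c ∷ cs) x = & (ap (\ y -> c -c 1c +c x *c y) (decrement-eval cs x)) (#j10 c x (evalP cs x) (geoc (length cs) x))

 evalP-<< : ∀ {cs x y} -> 0# ≤ y -> All (_<< y) cs -> x << 1# -> evalP cs x << ι (length cs) * y
 evalP-<< {y = y} p [] q = <<-0 (≤r (! (*-0ˡ y)))
 evalP-<< {c ∷ cs} {y = y} p (h ∷ hs) q = <<m (<<-+ h (<<-* q (evalP-<< p hs q))) (≤r (#j11 y (ι (length cs))))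

 prodc-zero : ∀ n k {f} -> k N.< n -> f k ~ 0c -> prodc n f ~ 0c
 prodc-zero (S n) k {f} l z with k ≟ n
 ... | yes refl = & (ap (prodc n f *c_) z) (*c-0ʳ _)
 ... | no ne = & (ap (_*c f n) (prodc-zero n k (≤∧≢⇒< (s≤s⁻¹ l) ne) z)) (*c-0ˡ _)

 -- An approximate table of the a-th roots of unity, symmetric under conjugation, read off from
 -- the powers of an approximate 8a²-th root of unity.
 module Table (a' d' : ℕ) where
  a = S a'
  d = S d'
  q = 2 N.* (a N.* a)
  P = 8 N.* (a N.* a)
  m : ℕ -> ℕ
  m s = d N.* s
  q≥1 : 1 N.≤ q
  q≥1 = s≤s z≤n
  open Separation q q≥1 public using (c0; c0>0; ε0; ε0>0)
  open Separation q q≥1 using (full; separated)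
  tol : ℕ -> Q
  tol s = ε0 * (1/ s * 1/ s)
  tol-nn : ∀ s -> 0# ≤ tol s
  tol-nn s = nn* (lt ε0>0) (nnsq (1/ s))
  tol≤ : ∀ s -> tol s ≤ ε0 * 1/ s
  tol≤ s = *l (lt ε0>0) (≤= (*l (1/-nn s) (1/≤1 s)) (*1r _))
  tol≤ε0 : ∀ s -> tol s ≤ ε0
  tol≤ε0 s = <& (tol≤ s) (≤= (*l (lt ε0>0) (1/≤1 s)) (*1r _))
  s*tol≤ : ∀ s -> ι s * tol s ≤ ε0 * 1/ s
  s*tol≤ s = ≤= (*r (tol-nn s) (ι-mono {s} {S s} (n≤1+n s))) (& (#j12 (ι (S s)) ε0 (1/ s)) (& (ap (_* (ε0 * 1/ s)) (ι*1/ s)) (*1l _)))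
  vanishing-tol : ∀ c -> 0# ≤ c -> Vanishing (\ s -> c * tol s)
  vanishing-tol c p = vanishing-mono (\ s -> ≤= (*l p (tol≤ s)) (! *a)) (vanishing-1/ (c * ε0))
  opaque
   R : ∀ s -> Root q (tol s)
   R s = root q (tol s) q≥1 (pp* ε0>0 (pp* (inv-pos (ι-pos {S s} z<s)) (inv-pos (ι-pos {S s} z<s))))
   pw : ℕ -> ℕ -> C
   pw s x = Root.θ (R s) ^c x
   pw-0 : ∀ s -> pw s 0 ~ 1c
   pw-0 s = refl
   pw-unit : ∀ s x -> N (pw s x) ~ 1#
   pw-unit s x = unit-^ x (Root.unit (R s))
   pw-+ : ∀ s x y -> pw s (x N.+ y) ~ pw s x *c pw s y
   pw-+ s = ^c-+ (Root.θ (R s))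
   pw-^ : ∀ s l x -> pw s x ^c l ~ pw s (l N.* x)
   pw-^ s l x = ! (^c-^ (Root.θ (R s)) l x)
   pw-quarter : ∀ s -> pw s q -c i << tol s
   pw-quarter s = Root.quarter (R s)
   pw-full : ∀ s -> pw s (q N.+ q N.+ (q N.+ q)) -c 1c << 4# * tol s
   pw-full s = full (tol≤ε0 s) (R s)
   pw-quadrant : ∀ s x -> x N.≤ q -> FirstQuadrant (pw s x)
   pw-quadrant s = Root.quadrant (R s)
   pw-separated′ : ∀ s x -> 1 N.≤ x -> x N.< q N.+ q N.+ (q N.+ q) -> c0 ≤ N (1c -c pw s x)
   pw-separated′ s = separated (tol≤ε0 s) (R s)
  private
   P≡ : P ~ q N.+ q N.+ (q N.+ q)
   P≡ = #j13 (a N.* a)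
  pw-period : ∀ s k -> 1c -c pw s (P N.* k) << ι k * (4# * tol s)
  pw-period s k = tr (\ u -> 1c -c u << ι k * (4# * tol s)) (& (pw-^ s k P) (ap (pw s) (NP.*-comm k P))) (1-^-bound k (pw-unit s P)
   (tr (\ n -> 1c -c pw s n << 4# * tol s) (! P≡) (<<-swap (pw-full s))))
  pw-shift : ∀ s x k -> pw s (x N.+ P N.* k) -c pw s x << ι k * (4# * tol s)
  pw-shift s x k = tr (_<< ι k * (4# * tol s)) (& (#j14 (pw s x) (pw s (P N.* k))) (ap (\ u -> u -c pw s x) (! (pw-+ s x (P N.* k))))) (<<-unit* (pw-unit s x) (<<-swap (pw-period s k)))
  pw-cj : ∀ s {x y} k -> x N.+ y ~ P N.* k -> cj (pw s y) -c pw s x << ι k * (4# * tol s)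
  pw-cj s {x} {y} k e = tr (_<< ι k * (4# * tol s)) (& (#j16 (cj (pw s y)) (pw s (P N.* k))) (ap (\ u -> cj (pw s y) -c u) (& (ap (cj (pw s y) *c_) (& (ap (pw s) (! e)) (pw-+ s x y)))
   (& (#j15 (cj (pw s y)) (pw s x) (pw s y)) (& (ap (pw s x *c_) (cj-unit (pw-unit s y))) (*c1r _)))))) (<<-unit* (& (N-cj _) (pw-unit s y)) (pw-period s k))
  pw-im : ∀ s x -> x N.≤ q N.+ q -> 0# ≤ im (pw s x)
  pw-im s x l with NP.≤-total x q
  ... | inl p = snd (pw-quadrant s x p)
  ... | inr p = tr (0# ≤_) (& (! (im-* _ _)) (ap im (& (! (pw-+ s q (x ∸ q))) (ap (pw s) (m+[n∸m]≡n p)))))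
   (nn+ (nn* (fst A) (snd B)) (nn* (snd A) (fst B))) where
   A = pw-quadrant s q NP.≤-refl
   B = pw-quadrant s (x ∸ q) (NP.m≤n+o⇒m∸n≤o x q l)
  pw-separated : ∀ s x -> 1 N.≤ x -> x N.< P -> c0 ≤ N (1c -c pw s x)
  pw-separated s x p l = pw-separated′ s x p (tr (x N.<_) P≡ l)
  pick : ∀ {A : Set} -> Dec A -> C -> C -> C
  pick (yes _) u v = u
  pick (no _) u v = v
  pick-yes : ∀ {A : Set} (D : Dec A) {u v} -> A -> pick D u v ~ u
  pick-yes (yes _) x = refl
  pick-yes (no n) x = abort (n x)
  pick-no : ∀ {A : Set} (D : Dec A) {u v} -> ¬ A -> pick D u v ~ v
  pick-no (yes x) n = abort (n x)
  pick-no (no _) n = refl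
  Low : ℕ -> Set
  Low x = 2 N.* x N.≤ a
  zt : ℕ -> ℕ -> C
  zt s x = pick (2 N.* x N.≤? a) (pw s (8 N.* a N.* x)) (cj (pw s (8 N.* a N.* (a ∸ x))))
  zt-low : ∀ s x -> Low x -> zt s x ~ pw s (8 N.* a N.* x)
  zt-low s x l = pick-yes (2 N.* x N.≤? a) l
  zt-high : ∀ s x -> ¬ Low x -> zt s x ~ cj (pw s (8 N.* a N.* (a ∸ x)))
  zt-high s x l = pick-no (2 N.* x N.≤? a) l
  low-or-high : ∀ x -> Low x ⊎ ¬ Low x
  low-or-high x with 2 N.* x N.≤? a
  ... | yes p = inl p
  ... | no n = inr n
  zt-unit : ∀ s x -> N (zt s x) ~ 1#
  zt-unit s x with low-or-high x
  ... | inl p = & (ap N (zt-low s x p)) (pw-unit s _)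
  ... | inr p = & (ap N (zt-high s x p)) (& (N-cj _) (pw-unit s _))
  low-conj : ∀ x -> ¬ Low x -> x N.< a -> Low (a ∸ x)
  low-conj x n l = &N (≡N (NP.*-distribˡ-∸ 2 a x)) (NP.m≤n+o⇒m∸n≤o (2 N.* a) (2 N.* x) (&N (≡N (ap (a N.+_) (NP.+-identityʳ a))) (+-monoˡ-≤ a (<⇒≤ (≰⇒> n)))))
  sum-P : ∀ {x} -> x N.≤ a -> 8 N.* a N.* x N.+ 8 N.* a N.* (a ∸ x) ~ P N.* 1
  sum-P {x} l = & (! (*-distribˡ-+ (8 N.* a) x _)) (& (ap (8 N.* a N.*_) (m+[n∸m]≡n l)) (#j17 a))
  private
   ι1* : ∀ x -> ι 1 * x ~ x
   ι1* x = & (ap (_* x) (+-idr 1#)) (*1l x)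
   4tol0 : ∀ s -> 0# ≤ 4# * tol s
   4tol0 s = nn* 0≤4 (tol-nn s)
  zt-close : ∀ s {x} -> x N.≤ a -> zt s x -c pw s (8 N.* a N.* x) << 4# * tol s
  zt-close s {x} l with low-or-high x
  ... | inl p = tr (_<< 4# * tol s) (! (& (ap (\ u -> u -c pw s (8 N.* a N.* x)) (zt-low s x p)) (u-u _))) (<<-0 (4tol0 s))
  ... | inr p = tr2 _<<_ (ap (\ u -> u -c pw s (8 N.* a N.* x)) (! (zt-high s x p))) (ι1* _) (pw-cj s 1 (sum-P l))
  zt-0 : ∀ s -> zt s 0 ~ 1c
  zt-0 s = & (zt-low s 0 z≤n) (& (ap (pw s) (*-zeroʳ (8 N.* a))) (pw-0 s))
  private
   8a*<P : ∀ {x} -> x N.< a -> 8 N.* a N.* x N.< P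
   8a*<P {x} l = <-≤-trans (NP.*-monoʳ-< (8 N.* a) l) (≡N (NP.*-assoc 8 a a))
   1≤8a* : ∀ {x} -> 1 N.≤ x -> 1 N.≤ 8 N.* a N.* x
   1≤8a* l = &N l (m≤n*m _ (8 N.* a))
   factor : ∀ u v w -> u *c v ~ w -> N u ~ 1# -> N (w -c u) ~ N (1c -c v)
   factor u v w e nu = & (ap (\ w -> N (w -c u)) (! e)) (& (ap N (#j18 u v)) (& (N-* u _) (& (ap2 _*_ nu (N-neg _)) (*1l _))))
   pw-diff : ∀ s {x y} -> x N.< y -> y N.< x N.+ P -> c0 ≤ N (pw s y -c pw s x)
   pw-diff s {x} {y} l l' = ≤= (pw-separated s (y ∸ x) (m<n⇒0<n∸m l) (&N (≡N (! (NP.+-∸-assoc 1 (<⇒≤ l)))) (NP.m≤n+o⇒m∸n≤o (S y) x l')))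
    (! (factor (pw s x) (pw s (y ∸ x)) (pw s y) (& (! (pw-+ s x _)) (ap (pw s) (m+[n∸m]≡n (<⇒≤ l)))) (pw-unit s x)))
   8a-mono : ∀ {x y} -> x N.< y -> 8 N.* a N.* x N.< 8 N.* a N.* y
   8a-mono = NP.*-monoʳ-< (8 N.* a)
  zt-separated : ∀ s {x y} -> x N.< y -> y N.< a -> c0 ≤ N (zt s y -c zt s x)
  zt-separated s {x} {y} x<y y<a with low-or-high x | low-or-high y
  ... | inl p | inl q = tr (c0 ≤_) (! (ap2 (\ u v -> N (u -c v)) (zt-low s y q) (zt-low s x p))) (pw-diff s (8a-mono x<y) (<-≤-trans (8a*<P y<a) (m≤n+m P _)))
  ... | inr p | inl q = abort (p (&N (*-monoʳ-≤ 2 (<⇒≤ x<y)) q))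
  ... | inr p | inr q = ≤= (pw-diff s {8 N.* a N.* (a ∸ y)} {8 N.* a N.* (a ∸ x)} (8a-mono (NP.∸-monoʳ-< x<y (<⇒≤ y<a))) (<-≤-trans (8a*<P (≤∧≢⇒< (m∸n≤m a x) (x≢ x p))) (m≤n+m P _)))
   (& (! (N-neg _)) (& (! (N-cj _)) (& (ap N (& (ap cj (h _ _)) (& (cj-+ _ _) (ap (cj _ +c_) (cj-neg _))))) (! (ap2 (\ u v -> N (u -c v)) (zt-high s y q) (zt-high s x p)))))) where
   h : ∀ u v -> -c (u -c v) ~ v -c u
   h = solve 2 (\ u v -> :- (u :- v) := v :- u) refl
   x≢ : ∀ x -> ¬ Low x -> a ∸ x ≢ a
   x≢ zero p _ = p z≤n
   x≢ (S x) p e = <⇒≢ (s≤s (m∸n≤m a' x)) e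
  ... | inl p | inr q = ≤= (pw-separated s (8 N.* a N.* x N.+ 8 N.* a N.* (a ∸ y)) (&N (1≤8a* {a ∸ y} (m<n⇒0<n∸m y<a)) (m≤n+m (8 N.* a N.* (a ∸ y)) (8 N.* a N.* x)))
   (tr (N._< P) (*-distribˡ-+ (8 N.* a) x _) (8a*<P (<-≤-trans (NP.+-monoˡ-< (a ∸ y) x<y) (≡N (m+[n∸m]≡n (<⇒≤ y<a)))))))
   (& (! (factor cy (pw s _) (pw s (8 N.* a N.* x)) e (& (N-cj _) (pw-unit s _)))) (& (! (N-neg _)) (& (ap N (#j19 _ _)) (! (ap2 (\ u v -> N (u -c v)) (zt-high s y q) (zt-low s x p)))))) where
   cy = cj (pw s (8 N.* a N.* (a ∸ y)))
   e : cy *c pw s (8 N.* a N.* x N.+ 8 N.* a N.* (a ∸ y)) ~ pw s (8 N.* a N.* x)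
   e = & (ap (cy *c_) (pw-+ s _ _)) (& (#j15 cy (pw s (8 N.* a N.* x)) (pw s (8 N.* a N.* (a ∸ y)))) (& (ap (pw s (8 N.* a N.* x) *c_) (cj-unit (pw-unit s _))) (*c1r _)))
  zt-≠1 : ∀ s {x} -> 1 N.≤ x -> x N.< a -> c0 ≤ N (1c -c zt s x)
  zt-≠1 s {x} p l = tr (c0 ≤_) (& (ap (\ u -> N (zt s x -c u)) (zt-0 s)) (& (ap N (swap-c _ _)) (N-neg _))) (zt-separated s p l)
  ζt : ℕ -> ℕ -> C
  ζt s n = zt s (n % a)
  ζt-mul : ∀ s k n -> ζt s (k N.+ n) -c ζt s k *c ζt s n << 4# * (4# * tol s)
  ζt-mul s k n = <<m (<<-chain (zt-close s (<⇒≤ (m%n<n (k N.+ n) a))) (<<-chain (<<-swap shift) (<<-swap prods))) (≤r (#j20 (4# * tol s))) where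
   x = k % a
   y = n % a
   z = (k N.+ n) % a
   A = 8 N.* a
   carry = (x N.+ y) / a
   carry≤ : carry N.≤ 1
   carry≤ = ≤-pred (NP.*-cancelʳ-< a carry 2 (≤-<-trans (m/n*n≤m (x N.+ y) a) (<-≤-trans (NP.+-mono-< (m%n<n k a) (m%n<n n a)) (≡N (ap (a N.+_) (! (NP.+-identityʳ a)))))))
   eq : A N.* x N.+ A N.* y ~ A N.* z N.+ P N.* carry
   eq = & (! (*-distribˡ-+ A x y)) (& (ap (A N.*_) (& (m≡m%n+[m/n]*n (x N.+ y) a) (ap (N._+ carry N.* a) (! (%-distribˡ-+ k n a))))) (#j22 a z carry))
   shift : pw s (A N.* x) *c pw s (A N.* y) -c pw s (A N.* z) << 4# * tol s
   shift = <<m (tr (\ u -> u -c pw s (A N.* z) << ι carry * (4# * tol s)) (& (ap (pw s) (! eq)) (pw-+ s _ _)) (pw-shift s (A N.* z) carry))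
    (≤= (*r (4tol0 s) (ι-mono carry≤)) (ι1* _))
   prods : zt s x *c zt s y -c pw s (A N.* x) *c pw s (A N.* y) << 4# * tol s + 4# * tol s
   prods = tr (_<< 4# * tol s + 4# * tol s) (#j21 (zt s x) (zt s y) (pw s (A N.* x)) (pw s (A N.* y))) (<<-+ (<<-unit* (zt-unit s x) (zt-close s (<⇒≤ (m%n<n n a)))) (<<-unit* (pw-unit s (A N.* y)) (zt-close s (<⇒≤ (m%n<n k a)))))

module B11 where
 open Rationals
 open Gauss
 open Interpolation
 open Roots
 open B6
 open B7
 open B8
 open B9
 open B10
 open CSolver using (solve; _:+_; _:*_; :-_; _:-_; _:=_; con)
 open Z using (ℤ)
 open import Data.Nat.DivMod using (_%_; m%n<n)

 opaque
  unfolding Qr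
  #k4 : ∀ x -> 2# * x * 1# + 0# * 0# ~ x - - x
  #k4 = auto Qr
  #k5 : ∀ r x -> 2# * x * 0# - 0# * 1# ~ r - r
  #k5 = auto Qr
  #k15 : ∀ b M a t k -> 1# * (b * (M * (a * (4# * t) * k))) ~ b * (M * (a * 4# * k)) * t
  #k15 = auto Qr
  #k16 : ∀ c k x -> c * (k * k) * (x * x) ~ c * (x * k * (x * k))
  #k16 = auto Qr
  #k19 : ∀ d s K t -> d * s * (K * t) ~ K * (d * (s * t))
  #k19 = auto Qr
  #k20 : ∀ K d e x -> 2# * (K * (d * (e * x))) ~ 2# * K * d * e * x
  #k20 = auto Qr

 #k1 : ∀ a x -> 4 N.* a N.* x ~ 2 N.* (a N.* (2 N.* x))
 #k1 = nsolve
 #k2 : ∀ a f x -> a N.* (2 N.* f) N.+ 4 N.* a N.* x ~ 2 N.* (a N.* (2 N.* x N.+ f))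
 #k2 = nsolve
 #k3 : ∀ a x -> 8 N.* a N.* x ~ 4 N.* a N.* x N.+ 4 N.* a N.* x
 #k3 = nsolve
 #k6 : ∀ r i z -> -c (r *c i) *c z ~ r *c (-c i *c z)
 #k6 = solve 3 (\ r i z -> :- (r :* i) :* z := r :* (:- i :* z)) refl
 #k7 : ∀ p c e -> (p *c c -c p *c p) *c e ~ -c (p -c c) *c (e *c p)
 #k7 = solve 3 (\ p c e -> (p :* c :- p :* p) :* e := :- (p :- c) :* (e :* p)) refl
 #k8 : ∀ u -> -c (-c u) ~ u
 #k8 = solve 1 (\ u -> :- (:- u) := u) refl
 #k9 : ∀ i p -> -c i *c (p -c i) ~ -c i *c p -c (-c (i *c i))
 #k9 = solve 2 (\ i p -> :- i :* (p :- i) := :- i :* p :- (:- (i :* i))) refl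
 #k10 : ∀ A x f -> 8 N.* A N.+ 2 N.* (2 N.* x N.+ f) ~ 2 N.* f N.+ 8 N.* A N.+ 4 N.* x
 #k10 = nsolve
 #k11 : ∀ y f -> 2 N.* y N.+ f ~ y N.+ f N.+ y
 #k11 = nsolve
 #k12 : ∀ y f -> 2 N.* (2 N.* y N.+ f) N.+ 2 N.* f ~ 4 N.* (y N.+ f)
 #k12 = nsolve
 #k13 : ∀ P a f -> P N.+ 2 N.* a N.+ 2 N.* f ~ P N.+ (2 N.* a N.+ 2 N.* f)
 #k13 = nsolve
 #k14 : ∀ u v w -> u N.+ v N.+ w ~ u N.+ w N.+ v
 #k14 = nsolve
 #k17 : ∀ a x -> a N.* (8 N.* a N.* x) ~ 8 N.* (a N.* a) N.* x
 #k17 = nsolve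
 #k18 : ∀ x e g -> x *c (e -c g) ~ 1c +c x *c e -c (1c +c x *c g)
 #k18 = solve 3 (\ x e g -> x :* (e :- g) := con (Z.+ 1) :+ x :* e :- (con (Z.+ 1) :+ x :* g)) refl
 #k21 : ∀ l v k w -> l *c (v *c (k *c w)) ~ l *c k *c (v *c w)
 #k21 = solve 4 (\ l v k w -> l :* (v :* (k :* w)) := l :* k :* (v :* w)) refl

 open Permute _*c_ 1c *c-assoc *cc *c1l using () renaming (permute to permutec)

 module Directions (a' d' : ℕ) where
  open Table a' d'
  private
   ι1* : ∀ x -> ι 1 * x ~ x
   ι1* x = & (ap (_* x) (+-idr 1#)) (*1l x)
  close⇒≈ : ∀ (u v : ℕ -> ℕ -> C) k -> (∀ T s -> N (v T s) ~ 1#) -> (∀ T s -> u T s -c v T s << ι k * (4# * tol s)) -> u ≈ v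
  close⇒≈ u v k vu h = ≈-vanishing (\ s -> ι k * 4# * tol s) (vanishing-tol (ι k * 4#) (nn* (ι-nn k) 0≤4)) \ T s _ _ -> <<⇒Rel (≤r (! (vu T s))) (<<m (h T s) (≤r (! *a)))
  pw-shift-≈ : ∀ x k -> (\ T s -> pw s (x N.+ P N.* k)) ≈ (\ _ s -> pw s x)
  pw-shift-≈ x k = close⇒≈ _ _ k (\ T s -> pw-unit s x) \ T s -> pw-shift s x k
  pw-cj-≈ : ∀ {x y} k -> x N.+ y ~ P N.* k -> (\ (T s : ℕ) -> cj (pw s y)) ≈ (\ _ s -> pw s x)
  pw-cj-≈ {x} k e = close⇒≈ _ _ k (\ T s -> pw-unit s x) \ T s -> pw-cj s k e
  t : ℕ -> ℕ -> ℕ -> ℕ -> C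
  t x l T s = τ (zt s x) (rT T) a l (m s)
  module LowClass (x : ℕ) (x≥1 : 1 N.≤ x) (low : Low x) where
   f = a ∸ 2 N.* x
   y = 4 N.* a N.* x
   a≡ : a ~ 2 N.* x N.+ f
   a≡ = ! (m+[n∸m]≡n low)
   x<a : x N.< a
   x<a = <-≤-trans (<-≤-trans (NP.m<m+n x {x N.+ 0} (&N x≥1 (m≤m+n x 0))) NP.≤-refl) low
   a'1 : 1 N.≤ a'
   a'1 = ≤-pred (&N (*-monoʳ-≤ 2 x≥1) low)
   y≤q : y N.≤ q
   y≤q = &N (≡N (#k1 a x)) (*-monoʳ-≤ 2 (*-monoʳ-≤ a low))
   end-exponent : a N.* (2 N.* f) N.+ y ~ q
   end-exponent = & (#k2 a f x) (ap (\ z -> 2 N.* (a N.* z)) (! a≡))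
   ζ≡ : ∀ s -> zt s x ~ pw s y *c pw s y
   ζ≡ s = & (zt-low s x low) (& (ap (pw s) (#k3 a x)) (pw-+ s y y))
   im-pos : ∀ s -> 0# < im (pw s y)
   im-pos s z = c0>0 (≤= (zt-≠1 s x≥1 x<a) (& (ap (\ u -> N (1c -c u)) (ζ≡ s)) N≡)) where
    p = pw s y
    im0 : im p ~ 0#
    im0 = ≤-antisym z (snd (pw-quadrant s y y≤q))
    p≡cj : p ~ cj p
    p≡cj = C-ext (! (re-cj p)) (& im0 (& (! neg0) (& (ap (\ t -> - t) (! im0)) (! (im-cj p))))) where
     opaque
      unfolding Qr
      neg0 : - 0# ~ 0#
      neg0 = refl
    N≡ : N (1c -c p *c p) ~ 0#
    N≡ = & (ap (\ u -> N (1c -c u)) (& (ap (p *c_) p≡cj) (cj-unit (pw-unit s y)))) (& (ap N (u-u 1c)) N-0)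
   Θ : ℕ -> C
   Θ s = pw s (2 N.* f)
   Θ-end : (\ (T s : ℕ) -> (1c -c zt s x) *c Θ s ^c a) || (\ _ _ -> 1c)
   Θ-end = ||-≡ˡ shape (||-≡ʳ (||-* (||-pos {\ _ s -> 2# * im (pw s y)} (Ev! \ T s -> pp* 2>0 (im-pos s))) (||-≈ quarter≈ (||-refl (\ _ _ -> 1c)))) \ T s -> *c1l 1c) where
    2>0 : 0# < 2#
    2>0 = p≤ 0<1 (x≤x+y 0≤1)
    quarter≈ : (\ (T s : ℕ) -> -c i *c pw s q) ≈ (\ _ _ -> 1c)
    quarter≈ = ≈-vanishing (\ s -> 1# * tol s) (vanishing-tol 1# 0≤1) \ T s _ _ -> <<⇒Rel (≤r (! N-1)) (<<m (tr (_<< tol s) (& (#k9 i (pw s q)) (ap (\ u -> -c i *c pw s q -c u) (& (ap -c_ i²) (#k8 1c))))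
     (<<-unit* (& (N-neg i) N-i) (pw-quarter s))) (≤r (! (*1l _))))
    shape : ∀ T s -> (1c -c zt s x) *c Θ s ^c a ~ rl (2# * im (pw s y)) *c (-c i *c pw s q)
    shape T s = & (ap2 (\ u v -> (1c -c u) *c v) (ζ≡ s) (pw-^ s a (2 N.* f))) (& (ap (\ u -> (u -c p *c p) *c e) (! (cj-unit (pw-unit s y)))) (& (#k7 p (cj p) e)
     (& (ap2 (\ u v -> -c u *c v) (p-cj p) (& (! (pw-+ s _ y)) (ap (pw s) end-exponent))) (#k6 (rl (2# * im p)) i (pw s q))))) where
     p = pw s y
     e = pw s (a N.* (2 N.* f))
     p-cj : ∀ u -> u -c cj u ~ rl (2# * im u) *c i
     p-cj u = C-ext (& (re-+ u _) (& (ap (re u +_) (& (re-neg _) (ap (\ t -> - t) (re-cj u)))) (! (& (re-* _ i) (& (ap2 (\ a b -> a * b - im (rl (2# * im u)) * im i) (re-rl _) re-i) (& (ap2 (\ a b -> 2# * im u * 0# - a * b) (im-rl _) im-i) (#k5 (re u) (im u))))))))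
      (& (im-+ u _) (& (ap (im u +_) (& (im-neg _) (ap (\ t -> - t) (im-cj u)))) (! (& (im-* _ i) (& (ap2 (\ a b -> a * im i + b * re i) (re-rl _) (im-rl _)) (& (ap2 (\ a b -> 2# * im u * a + 0# * b) im-i re-i) (#k4 (im u))))))))
   private
    8≡ : ∀ a x -> 8 N.* a N.* x ~ 4 N.* a N.* x N.+ 4 N.* a N.* x
    8≡ = nsolve
    q≡ : ∀ a -> a N.* (2 N.* a) ~ 2 N.* (a N.* a)
    q≡ = nsolve
   open Tau a' a'1 m (\ s -> m≤n*m s d) (\ s -> zt s x) Θ (\ s -> zt-unit s x) (\ s -> pw-unit s _) c0 c0>0 (\ s -> zt-≠1 s x≥1 x<a)
    (\ s -> tr (\ u -> 0# ≤ im u) (! (zt-low s x low)) (pw-im s _ (&N (≡N (8≡ a x)) (+-mono-≤ y≤q y≤q))))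
    (\ s l l≤ -> tr FirstQuadrant (! (pw-^ s l _)) (pw-quadrant s _ (&N (*-mono-≤ l≤ (*-monoʳ-≤ 2 (m∸n≤m a (2 N.* x)))) (≡N (q≡ a))))) Θ-end public using (size; t≠0) renaming (direction to raw)
   direction : ∀ l -> t x l || (\ T s -> pw s (l N.* (2 N.* f)) *c t x 0 T s)
   direction l = ||-≡ʳ (raw l) \ T s -> ap (_*c t x 0 T s) (pw-^ s l _)
   angle≡ : angle a x ~ 2 N.* f N.+ P
   angle≡ = NP.+-cancelʳ-≡ (4 N.* x) _ _ (& (angle-+ (<⇒≤ x<a)) (& (ap (\ z -> 8 N.* (a N.* a) N.+ 2 N.* z) a≡) (#k10 (a N.* a) x f)))
  class-direction : ∀ x l -> 1 N.≤ x -> x N.< a -> t x l || (\ T s -> pw s (l N.* angle a x) *c t x 0 T s)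
  class-direction x l x≥1 x<a with low-or-high x
  ... | inl low = ||-≈ʳ (L.direction l) (≈-* (≈-sym (≈t (≈-≡ \ T s -> ap (pw s) e) (pw-shift-≈ (l N.* (2 N.* L.f)) l))) (≈-refl (t x 0))) where
   module L = LowClass x x≥1 low
   e : l N.* angle a x ~ l N.* (2 N.* L.f) N.+ P N.* l
   e = & (ap (l N.*_) L.angle≡) (& (*-distribˡ-+ l (2 N.* L.f) P) (ap (l N.* (2 N.* L.f) N.+_) (NP.*-comm l P)))
  ... | inr high = ||-≡ˡ (\ T s -> tcj l T s) (||-≈ʳ (||-cj (L.direction l)) (≈t (≈-≡ \ T s -> cj-* _ _) (≈-* (pw-cj-≈ l e) (≈-≡ \ T s -> ! (tcj 0 T s))))) where
   y = a ∸ x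
   module L = LowClass y (m<n⇒0<n∸m x<a) (low-conj x high x<a)
   tcj : ∀ l T s -> t x l T s ~ cj (t y l T s)
   tcj l T s = & (ap (\ u -> τ u (rT T) a l (m s)) (& (zt-high s x high) (ap cj (! (zt-low s y (low-conj x high x<a)))))) (τ-cj (zt s y) (rT T) a l (m s))
   e1 : angle a x N.+ 2 N.* L.f ~ P
   e1 = NP.+-cancelʳ-≡ (4 N.* x) _ _ (& (#k14 (angle a x) (2 N.* L.f) (4 N.* x)) (& (ap (N._+ 2 N.* L.f) (angle-+ (<⇒≤ x<a)))
    (& (#k13 P a L.f) (ap (P N.+_) (& (ap (\ z -> 2 N.* z N.+ 2 N.* L.f) L.a≡) (& (#k12 y L.f) (ap (4 N.*_) x≡))))))) where
    x≡ : y N.+ L.f ~ x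
    x≡ = NP.+-cancelʳ-≡ y _ _ (& (! (#k11 y L.f)) (& (! L.a≡) (! (m+[n∸m]≡n (<⇒≤ x<a)))))
   e : l N.* angle a x N.+ l N.* (2 N.* L.f) ~ P N.* l
   e = & (! (*-distribˡ-+ l (angle a x) (2 N.* L.f))) (& (ap (l N.*_) e1) (NP.*-comm l P))
  ≍-≡ : ∀ {x y : ℕ -> ℕ -> Q} -> (∀ T s -> x T s ~ y T s) -> x ≍ y
  ≍-≡ {x} {y} h = 1 , Ev! \ T s -> ≤r (& (h T s) (! (ι1* _))) , ≤r (& (! (h T s)) (! (ι1* _)))
  class-size : ∀ x l -> 1 N.≤ x -> x N.< a -> (\ T s -> N (t x l T s)) ≍ (\ T s -> N (t x 0 T s))
  class-size x l x≥1 x<a with low-or-high x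
  ... | inl low = LowClass.size x x≥1 low l
  ... | inr high = ≍t (≍-≡ (tcj l)) (≍t (LowClass.size y (m<n⇒0<n∸m x<a) (low-conj x high x<a) l) (≍-≡ \ T s -> ! (tcj 0 T s))) where
   y = a ∸ x
   tcj : ∀ l T s -> N (t x l T s) ~ N (t y l T s)
   tcj l T s = & (ap N (& (ap (\ u -> τ u (rT T) a l (m s)) (& (zt-high s x high) (ap cj (! (zt-low s y (low-conj x high x<a)))))) (τ-cj (zt s y) (rT T) a l (m s)))) (N-cj _)
  -- ∏_{0<x<a} (1 - ζˣ R) = 1 + R + … + R^{a-1} approximately, by interpolation at the a - 1 roots.
  cyclotomic : ∃ \ K -> 0# ≤ K × (∀ s ρ -> 0# ≤ ρ -> ρ ≤ 1# -> Rel (prodc a' (\ j -> g (zt s (S j)) ρ)) (rl (geo a ρ)) (K * tol s))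
  cyclotomic = go (lagrange a' c0 1# c0>0 0≤1) (arch (inv c0)) where
   go : _ -> (∃ \ n -> inv c0 ≤ ι n) -> _
   go (M , M0 , lag) (k , k≥) = K , K0 , \ s ρ ρ0 ρ≤1 -> <<⇒Rel (=≤ (! (*1r 1#)) (≤= (sq-mono 0≤1 (1≤geo a' ρ0)) (! (N-rl _)))) (at s ρ ρ0 ρ≤1) where
    y : ℕ -> Q
    y s = ι a * (4# * tol s) * ι (S k)
    y≥0 : ∀ s -> 0# ≤ y s
    y≥0 s = nn* (nn* (ι-nn a) (nn* 0≤4 (tol-nn s))) (ι-nn (S k))
    K = ι a' * (M * (ι a * 4# * ι (S k)))
    K0 : 0# ≤ K
    K0 = nn* (ι-nn a') (nn* M0 (nn* (nn* (ι-nn a) 0≤4) (ι-nn (S k))))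
    module _ (s : ℕ) where
     z : ℕ -> C
     z j = zt s (S j)
     L = linear-product z a'
     B = decrement L
     B-length : length B ~ a'
     B-length = & (decrement-length L) (linear-product-length z a')
     B-eval : ∀ x -> x *c evalP B x ~ prodc a' (\ j -> 1c -c x *c z j) -c geoc a x
     B-eval x = & (ap (x *c_) (& (decrement-eval L x) (ap (\ n -> evalP L x -c geoc n x) (linear-product-length z a'))))
      (& (#k18 x (evalP L x) (geoc a' x)) (ap (\ u -> u -c geoc a x) (linear-product-eval z a' x)))
     pts : ℕ -> C
     pts j = cj (z j)
     pts-unit : ∀ j -> N (pts j) ~ 1#
     pts-unit j = & (N-cj _) (zt-unit s (S j))
     power : ∀ j -> S j N.< a -> 1c -c pts j ^c a << ι a * (4# * tol s)
     power j l with low-or-high (S j)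
     ... | inl low = tr (_<< ι a * (4# * tol s)) (& (cj-+ 1c _) (ap2 _+c_ cj-1 (& (cj-neg _) (ap -c_ (& (ap cj eq) (cj-^ (z j) a))))))
      (<<-cj (<<m (pw-period s (S j)) (*r (nn* 0≤4 (tol-nn s)) (ι-mono (<⇒≤ l))))) where
      h : ∀ a x -> a N.* (8 N.* a N.* x) ~ 8 N.* (a N.* a) N.* x
      h = nsolve
      eq : pw s (P N.* S j) ~ z j ^c a
      eq = ! (& (ap (_^c a) (zt-low s (S j) low)) (& (pw-^ s a _) (ap (pw s) (h a (S j)))))
     ... | inr high = tr (\ u -> 1c -c u << ι a * (4# * tol s)) eq (<<m (pw-period s (a ∸ S j)) (*r (nn* 0≤4 (tol-nn s)) (ι-mono (m∸n≤m a (S j))))) where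
      eq : pw s (P N.* (a ∸ S j)) ~ pts j ^c a
      eq = ! (& (ap (_^c a) (& (ap cj (zt-high s (S j) high)) (cj-cj _))) (& (pw-^ s a _) (ap (pw s) (#k17 a (a ∸ S j)))))
     geo-small : ∀ j -> j N.< a' -> geoc a (pts j) << y s
     geo-small j l = y≥0 s , *x c0>0 (<& (<& (*r (N-nn G) (tr (c0 ≤_) N≡ (zt-≠1 s z<s (s≤s l)))) (=≤ (& (! (N-* _ G)) (ap N (geoc-telescope a (pts j)))) (N-pos-<< (power j (s≤s l)))))
      (=≤ (& (! (*1l _)) (ap (_* (X * X)) (! (inv-r c0>0)))) (≤= (*r (nnsq X) (*l (lt c0>0) ik≤)) (#k16 c0 (ι (S k)) X)))) where
      G = geoc a (pts j)
      X = ι a * (4# * tol s)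
      N≡ : N (1c -c z j) ~ N (1c -c pts j)
      N≡ = & (! (N-cj _)) (ap N (& (cj-+ 1c _) (ap2 _+c_ cj-1 (cj-neg _))))
      ik≤ : inv c0 ≤ ι (S k) * ι (S k)
      ik≤ = <& k≥ (<& (ι-mono {k} {S k} (n≤1+n k)) (=≤ (! (*1l _)) (*r (ι-nn (S k)) (1≤ι {S k} z<s))))
     roots : ∀ j -> j N.< a' -> evalP B (pts j) << y s
     roots j l = <<-unit*⁻ (pts-unit j) (tr (_<< y s) (! (& (B-eval (pts j)) (& (ap (\ u -> u -c geoc a (pts j)) (prodc-zero a' j l (& (ap (\ u -> 1c -c u) (& (*cc _ _) (cj-unit (zt-unit s (S j))))) (u-u 1c)))) (+c-idl _)))) (<<-neg (geo-small j l)))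
     sep : ∀ j k -> j N.< k -> k N.< a' -> c0 ≤ N (pts k -c pts j)
     sep j k j<k k<a' = ≤= (zt-separated s {S j} {S k} (s≤s j<k) (s≤s k<a')) (& (! (N-cj _)) (ap N (& (cj-+ _ _) (ap (pts k +c_) (cj-neg _)))))
     coeffs : All (_<< M * y s) B
     coeffs = lag B pts (y s) (≡N B-length) (y≥0 s) (\ j _ -> <<-unit (pts-unit j)) sep roots
     at : ∀ ρ -> 0# ≤ ρ -> ρ ≤ 1# -> prodc a' (\ j -> g (zt s (S j)) ρ) -c rl (geo a ρ) << K * tol s
     at ρ ρ0 ρ≤1 = tr (_<< K * tol s) (& (B-eval (rl ρ)) (ap (\ u -> prodc a' (\ j -> g (zt s (S j)) ρ) -c u) (! (rl-geo a ρ))))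
      (<<m (<<-* ρ<< (evalP-<< (nn* M0 (y≥0 s)) coeffs ρ<<)) (≤r (& (ap (\ n -> 1# * (ι n * (M * y s))) B-length) (#k15 (ι a') M (ι a) (tol s) (ι (S k)))))) where
      ρ<< : rl ρ << 1#
      ρ<< = <<m (<<-rl ρ0) ρ≤1
  D : ℕ -> ℕ -> Q
  D T s = prod (m s) (\ n -> geo a (rT T ^ (n N.* a N.+ 0)))
  base : ℕ -> ℕ -> ℕ -> C
  base zero T s = 1c
  base (S j) T s = t (S j) 0 T s
  base≈ : (\ T s -> prodc a (\ k -> base k T s)) ≈ (\ T s -> rl (D T s))
  base≈ = go cyclotomic where
   go : _ -> _
   go (K , K0 , cyc) = ≈-vanishing (\ s -> 2# * (K * (ι d * (ε0 * 1/ s)))) (vanishing-mono (\ s -> ≤r (#k20 K (ι d) ε0 (1/ s))) (vanishing-1/ (2# * K * ι d * ε0))) \ T s 2T small →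
    tr2 (\ u v -> Rel u v (2# * (K * (ι d * (ε0 * 1/ s))))) (! (& (ΠC.front a' (\ k -> base k T s)) (& (*c1l _) (ΠC.exchange a' (m s) (\ j n -> g (zt s (S j)) (rT T ^ (n N.* a N.+ 0))))))) (! (rl-prod (m s) _))
     (rel-prod (m s) {x = \ _ -> K * tol s} (\ _ -> nn* K0 (tol-nn s)) (\ n _ -> cyc s _ (^n (n N.* a N.+ 0) (lt (r>0 2T))) (^-≤1 (n N.* a N.+ 0) (lt (r>0 2T)) (r≤1 2T)))
      (=≤ (& (sum-const (m s) _) (& (ap (_* (K * tol s)) (ι-* d s)) (#k19 (ι d) (ι s) K (tol s)))) (*l K0 (*l (ι-nn d) (s*tol≤ s)))) small)
  D>0 : ∀ T s -> 2 N.≤ T -> 0# < D T s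
  D>0 T s 2T = prod-pos (m s) \ n -> p≤ 0<1 (1≤geo a' (^n (n N.* a N.+ 0) (lt (r>0 2T))))
  private
   prod-pw : ∀ s n f -> prodc n (\ k -> pw s (f k)) ~ pw s (sumN n f)
   prod-pw s zero f = ! (pw-0 s)
   prod-pw s (S n) f = & (ap (_*c pw s (f n)) (prod-pw s n f)) (! (pw-+ s _ (f n)))
   base-suc : ∀ {x} -> 1 N.≤ x -> ∀ T s -> base x T s ~ t x 0 T s
   base-suc {S x} _ T s = refl
  module Class (h h' : ℕ) (hh' : (h N.* h') % S a' ~ 1 % S a') where
   open Residues a' h h' hh' using (μ; μ<; μ≢0; mul-inverse; h'h)
   G : ℕ -> ℕ -> ℕ -> C
   G zero T s = 1c
   G (S j) T s = t (μ (S j)) (S j) T s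
   private
    μ0 : μ 0 ~ 0
    μ0 = ap (_% a) (*-zeroʳ h)
    μ1 : ∀ {j} -> S j N.< a -> 1 N.≤ μ (S j)
    μ1 l = n≢0⇒n>0 (μ≢0 z<s l)
    each : ∀ k -> k N.< a -> G k || (\ T s -> pw s (k N.* angle a (μ k)) *c base (μ k) T s)
    each zero _ = ||-≡ʳ (||-refl (G zero)) \ T s -> ! (& (ap2 _*c_ (pw-0 s) (ap (\ x -> base x T s) μ0)) (*c1l 1c))
    each (S j) l = ||-≡ʳ (class-direction (μ (S j)) (S j) (μ1 l) (μ< (S j))) \ T s -> ap (pw s (S j N.* angle a (μ (S j))) *c_) (! (base-suc (μ1 l) T s))
    sizes : ∀ k -> k N.< a -> (\ T s -> N (G k T s)) ≍ (\ T s -> N (base (μ k) T s))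
    sizes zero _ = ≍-≡ \ T s -> ap (\ x -> N (base x T s)) (! μ0)
    sizes (S j) l = ≍t (class-size (μ (S j)) (S j) (μ1 l) (μ< (S j))) (≍-≡ \ T s -> ap N (! (base-suc (μ1 l) T s)))
    permuted : ∀ T s -> prodc a (\ k -> base (μ k) T s) ~ prodc a (\ k -> base k T s)
    permuted T s = permutec a μ (\ j -> (h' N.* j) % a) (\ k -> base k T s) (\ j _ -> μ< j) (\ j _ -> m%n<n (h' N.* j) a) (mul-inverse h h' hh') (mul-inverse h' h h'h)
   angles : ℕ
   angles = sumN a (\ k -> k N.* angle a (μ k))
   product-direction : (\ T s -> prodc a (\ k -> G k T s)) || (\ _ s -> pw s angles)
   product-direction = ||-≡ʳ (||-≈ʳ (||-prod a each) (≈t (≈-≡ \ T s -> & (ΠC.distr a _ _) (ap2 _*c_ (prod-pw s a _) (permuted T s))) (≈-* (≈-refl (\ _ s -> pw s angles)) base≈)) ⊙ pos) \ T s -> *c1r _ where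
    _⊙_ : ∀ {u : ℕ -> ℕ -> C} {v w ω : ℕ -> ℕ -> C} -> u || (v ⊡ w) -> w || ω -> u || (v ⊡ ω)
    _⊙_ {u} {v} {w} {ω} (l , l>0 , p) (k , k>0 , q) = (\ T s -> l T s * k T s) , Evm2 (\ T s -> pp*) l>0 k>0 ,
     ≈t p (≈t (≈-* (≈-refl (\ T s -> rl (l T s))) (≈-* (≈-refl v) q)) (≈-≡ \ T s -> & (#k21 (rl (l T s)) (v T s) (rl (k T s)) (ω T s)) (ap (_*c (v T s *c ω T s)) (! (rl-* _ _)))))
    pos : (\ T s -> rl (D T s)) || (\ _ _ -> 1c)
    pos = ||-pos (Evm (\ T s -> D>0 T s) (Ev-T≥ 2))
   product-size : (\ T s -> N (prodc a (\ k -> G k T s))) ≍ (\ T s -> D T s * D T s)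
   product-size = ≍t (≍-≡ \ T s -> N-prod a _) (≍t (≍-prod a (\ k T s -> N-nn (G k T s)) (\ k T s -> N-nn (base (μ k) T s)) sizes)
    (≍t (≍-≡ \ T s -> & (! (N-prod a _)) (ap N (permuted T s))) (≍t (≈⇒≍ base≈) (≍-≡ \ T s -> N-rl _))))

module B12 where
 open Rationals
 open Gauss
 open Interpolation
 open Roots
 open B6
 open B7
 open B8
 open B9
 open B10
 open B11
 open CSolver using (solve; _:*_; _:=_)
 open import Data.Nat.DivMod using (_%_; m%n<n; [m+kn]%n≡m%n; m*n%n≡0)

 opaque
  unfolding Qr
  #l1 : ∀ y -> 1# ~ 1# - y + y
  #l1 = auto Qr

 #l2 : ∀ h i a j -> h N.* S (i N.* a N.+ j) ~ h N.* S j N.+ h N.* i N.* a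
 #l2 = nsolve
 #l3 : ∀ r z e y -> r *c z *c e *c y ~ r *c (z *c e) *c y
 #l3 = solve 4 (\ r z e y -> r :* z :* e :* y := r :* (z :* e) :* y) refl

 ^-<1 : ∀ {x} n -> 0# ≤ x -> x < 1# -> x ^ S n < 1#
 ^-<1 {x} n p q r = q (<& r (≤= (*l p (^-≤1 n p (lt q))) (*1r x)))

 F>0 : ∀ m {x} -> 0# ≤ x -> x < 1# -> 0# < F m x
 F>0 m {x} p q = prod-pos m \ n z -> ^-<1 n p q (undiff′ z) where
  undiff′ : ∀ {y} -> 1# - y ≤ 0# -> 1# ≤ y
  undiff′ {y} z = =≤ (#l1 y) (≤= (+m z r≤) (+-idl y))

 rl-F : ∀ m x -> prodc m (\ n -> 1c -c rl (x ^ S n)) ~ rl (F m x)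
 rl-F m x = & (ΠC.cong-f m \ n -> ! (& (rl-+ 1# (- x ^ S n)) (ap2 _+c_ rl-1 (rl-neg _)))) (! (rl-prod m _))

 geo-F : ∀ a' m {x} -> 0# < x -> x < 1# -> let X = prod m (\ n -> geo (S a') (x ^ n)) * F m x in
  X ≤ ι (S a') * F m (x ^ S a') × F m (x ^ S a') ≤ ι (S a') * X
 geo-F a' m {x} x>0 x<1 = =≤ (! (*1r X)) (≤= (*l X0 (1≤geo a' x^≥0)) eq) ,
  <& (=≤ (! (*1l _)) (≤= (*r Fa0 (1≤ι {S a'} z<s)) (! eq))) (≤= (*l X0 (geo≤ (S a') x^≥0 (^-≤1 m (lt x>0) (lt x<1)))) (*-comm X _)) where
  X = prod m (\ n -> geo (S a') (x ^ n)) * F m x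
  x^≥0 : 0# ≤ x ^ m
  x^≥0 = ^n m (lt x>0)
  eq : X * geo (S a') (x ^ m) ~ ι (S a') * F m (x ^ S a')
  eq = F-geo (S a') m x
  X0 : 0# ≤ X
  X0 = nn* (prod-nn m \ n -> <& 0≤1 (1≤geo a' (^n n (lt x>0)))) (lt (F>0 m (lt x>0) x<1))
  Fa0 : 0# ≤ F m (x ^ S a')
  Fa0 = lt (F>0 m (^n (S a') (lt x>0)) (^-<1 a' (lt x>0) x<1))

 r≥½ : ∀ {T} -> 4 N.≤ T -> 1# ≤ ι 2 * rT T
 r≥½ {T} l = undiff (tr (0# ≤_) (h (rT T)) (diff (<& (*l 0≤2 (1-r≤ {T} (&N (s≤s z<s) l))) (=≤ (2tε 2 T) (tε≤1 l (&N z<s l)))))) where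
  opaque
   unfolding Qr
   h : ∀ r -> 1# - 2# * (1# - r) ~ ι 2 * r - 1#
   h r = & (h′ r) (ap (\ z -> z * r - 1#) two) where
    two : 2# ~ ι 2
    two = refl
    h′ : ∀ r -> 1# - 2# * (1# - r) ~ 2# * r - 1#
    h′ = auto Qr

 r²-bounds : ∀ {T} -> 4 N.≤ T -> rT T ^ 1 * rT T ^ 1 ≤ ι 4 * 1# × 1# ≤ ι 4 * (rT T ^ 1 * rT T ^ 1)
 r²-bounds {T} l = tr (\ y -> y * y ≤ ι 4 * 1# × 1# ≤ ι 4 * (y * y)) (! (*1r y)) (upper , lower) where
  2T : 2 N.≤ T
  2T = &N (s≤s z<s) l
  y = rT T
  y≥0 : 0# ≤ y
  y≥0 = lt (r>0 2T)
  upper : y * y ≤ ι 4 * 1#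
  upper = <& (*-mono y≥0 (r≤1 2T) y≥0 (r≤1 2T)) (*r 0≤1 (1≤ι {4} z<s))
  four : ι 2 * ι 2 ~ ι 4
  four = ! (ι-* 2 2)
  lower : 1# ≤ ι 4 * (y * y)
  lower = ≤= (=≤ (! (*1r 1#)) (sq-mono 0≤1 (r≥½ l))) (& (swap* (ι 2) y (ι 2) y) (ap (_* (y * y)) four))

 module Beta (a' d' h h' : ℕ) (hh' : (h N.* h') % S a' ~ 1 % S a') where
  open Table a' d' public
  open Directions a' d' public
  open Class h h' hh' public
  open Residues a' h h' hh' public using (μ; μ<; mul-inverse; h'h)
  w : ℕ -> ℕ -> ℕ -> C
  w T s n = rl (rT T ^ n) *c ζt s (h N.* n)
  eta : ℕ -> ℕ -> ℕ -> C
  eta c T s = prodc (m s N.* a) (\ n -> (1c -c w T s (S n)) ^c c)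
  eta-classes : ∀ c T s -> eta c T s ~ (prodc a (\ k -> G k T s) *c rl (F (m s) (rT T ^ a))) ^c c
  eta-classes c T s = & (prodc-^ (m s N.* a) _ c) (ap (_^c c) (& (ΠC.blocks (m s) a _) (& (ΠC.exchange (m s) a _) (ap2 _*c_
   (& (ΠC.cong-< a' \ j j<a' -> ΠC.cong-f (m s) \ i -> ap (\ u -> 1c -c u) (ap2 (\ n u -> rl (rT T ^ n) *c u) (! (+-suc (i N.* a) j)) (ap (zt s) (residue i j))))
    (! (& (ΠC.front a' (\ k -> G k T s)) (*c1l _))))
   (& (ΠC.cong-f (m s) \ i -> ap (\ u -> 1c -c u) (& (ap2 (\ x u -> rl x *c u) (& (ap (rT T ^_) (last i)) (^-^ (rT T) (S i) a)) (& (ap (zt s) (residue0 i)) (zt-0 s))) (*c1r _)))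
    (rl-F (m s) (rT T ^ a))))))) where
   last : ∀ i -> S (i N.* a N.+ a') ~ S i N.* a
   last i = & (! (+-suc (i N.* a) a')) (NP.+-comm (i N.* a) a)
   residue : ∀ i j -> (h N.* S (i N.* a N.+ j)) % a ~ μ (S j)
   residue i j = & (ap (_% a) (#l2 h i a j)) ([m+kn]%n≡m%n (h N.* S j) (h N.* i) a)
   residue0 : ∀ i -> (h N.* S (i N.* a N.+ a')) % a ~ 0
   residue0 i = & (ap (_% a) (& (ap (h N.*_) (last i)) (! (NP.*-assoc h (S i) a)))) (m*n%n≡0 (h N.* S i) a)
  -- Δ at ζʰ r, truncated, with the exponent 24 generalised
  β : ℕ -> ℕ -> ℕ -> C
  β c T s = w T s 1 *c eta c T s
  private
   ra>0 : ∀ {T} -> 2 N.≤ T -> 0# < rT T ^ a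
   ra>0 2T = ^-pos a (r>0 2T)
   ra<1 : ∀ {T} -> 2 N.≤ T -> rT T ^ a < 1#
   ra<1 2T = ^-<1 a' (lt (r>0 2T)) (r<1 2T)
   root≈ : ∀ x -> x N.≤ a -> (\ (T s : ℕ) -> zt s x) ≈ (\ _ s -> pw s (8 N.* a N.* x))
   root≈ x l = close⇒≈ _ _ 1 (\ T s -> pw-unit s _) \ T s -> <<m (zt-close s l) (≤r (! (& (ap (_* (4# * tol s)) (+-idr 1#)) (*1l _))))
  -- Dedekind's congruence makes the argument of Δ at ζʰ r equal to that of ζ^{-h'}.
  β-direction : ∀ c -> c ~ 24 -> (\ T s -> β c T s *c ζt s h') || (\ _ _ -> 1c)
  β-direction c c≡ = ||-≈ʳ (||-≡ʳ (||-≡ˡ (\ T s -> #l3 (rl (rT T ^ 1)) (ζt s (h N.* 1)) (eta c T s) (ζt s h')) (||-* (||-* (||-pos {\ T s -> rT T ^ 1} (Evm (\ T s 2T -> ^-pos 1 (r>0 2T)) (Ev-T≥ 2)))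
   (||-* (||-refl (\ _ s -> ζt s (h N.* 1))) (||-≡ˡ (\ T s -> eta-classes c T s) (||-^ c (||-* product-direction (||-pos (Evm (\ T s 2T -> F>0 (m s) (lt (ra>0 2T)) (ra<1 2T)) (Ev-T≥ 2)))))))) (||-refl (\ _ s -> ζt s h'))))
   \ T s -> tidy (ζt s (h N.* 1)) (pw s angles) (ζt s h') c)
   (≈t (≈-* (≈-* (≈t (≈-≡ \ T s -> ap (\ n -> ζt s n) (*-identityʳ h)) (root≈ (h % a) (<⇒≤ (m%n<n h a)))) (≈-refl (\ _ s -> pw s angles ^c c))) (root≈ (h' % a) (<⇒≤ (m%n<n h' a))))
    (≈t (≈-≡ \ T s -> & (ap (\ u -> pw s (8 N.* a N.* (h % a)) *c u *c pw s (8 N.* a N.* (h' % a))) (pw-^ s c angles)) (& (ap (_*c pw s (8 N.* a N.* (h' % a))) (! (pw-+ s _ _))) (& (! (pw-+ s _ _)) (ap (pw s) (snd TA)))))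
     (close⇒≈ _ (\ _ _ -> 1c) (fst TA) (\ _ _ -> N-1) \ T s -> <<-swap (pw-period s (fst TA))))) where
   TA : ∃ \ k -> 8 N.* a N.* (h % a) N.+ c N.* angles N.+ 8 N.* a N.* (h' % a) ~ P N.* k
   TA = tr (\ c -> ∃ \ k -> 8 N.* a N.* (h % a) N.+ c N.* angles N.+ 8 N.* a N.* (h' % a) ~ P N.* k) (! c≡) (Dedekind.total-angle a' h h' hh')
   tidy : ∀ z p y c -> 1c *c (z *c (p *c 1c) ^c c) *c y ~ z *c p ^c c *c y
   tidy z p y c = & (ap (_*c y) (*c1l _)) (ap (\ u -> z *c u ^c c *c y) (*c1r p))
  Fa : ℕ -> ℕ -> Q
  Fa T s = F (m s) ((rT T ^ a) ^ a)
  private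
   Fr : ℕ -> ℕ -> Q
   Fr T s = F (m s) (rT T ^ a)
   D≡ : ∀ T s -> D T s ~ prod (m s) (\ n -> geo a ((rT T ^ a) ^ n))
   D≡ T s = ΠQ.cong-f (m s) \ n -> ap (geo a) (& (ap (rT T ^_) (NP.+-identityʳ (n N.* a))) (^-^ (rT T) n a))
   DF≍ : (\ T s -> D T s * Fr T s) ≍ Fa
   DF≍ = a , Evm (\ T s 2T -> tr (\ p -> p * Fr T s ≤ ι a * Fa T s × Fa T s ≤ ι a * (p * Fr T s)) (! (D≡ T s)) (geo-F a' (m s) (ra>0 2T) (ra<1 2T))) (Ev-T≥ 2)
   r²≍1 : (\ (T s : ℕ) -> rT T ^ 1 * rT T ^ 1) ≍ (\ _ _ -> 1#)
   r²≍1 = 4 , Evm (\ T s -> r²-bounds) (Ev-T≥ 4)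
  β-size : ∀ c -> (\ T s -> N (β c T s)) ≍ (\ T s -> (Fa T s * Fa T s) ^ c)
  β-size c = ≍t (≍-≡ \ T s -> & (N-* _ _) (ap2 _*_ (& (N-* _ _) (& (ap2 _*_ (N-rl _) (zt-unit s _)) (*1r _))) (& (ap N (eta-classes c T s)) (& (N-^ _ c) (ap (_^ c) (& (N-* _ _) (ap (N (prodc a (\ k -> G k T s)) *_) (N-rl _))))))))
   (≍t (≍-* (Ev! \ T s -> nnsq _ , ^n c (nn* (N-nn _) (nnsq _))) (Ev! \ T s -> 0≤1 , ^n c (nnsq (Fa T s))) r²≍1
    (≍-^ c (\ T s -> nn* (N-nn _) (nnsq _)) (\ T s -> nnsq (Fa T s)) (≍t (≍-* (Ev! \ T s -> N-nn _ , nnsq _) (Ev! \ T s -> nnsq _ , nnsq _) product-size ≍-refl)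
     (≍t (≍-≡ \ T s -> swap* _ _ _ _) (≍-* dfnn fann DF≍ DF≍)))))
    (≍-≡ \ T s -> *1l _)) where
   dfnn : Ev (\ T s -> 0# ≤ D T s * Fr T s × 0# ≤ D T s * Fr T s)
   dfnn = Evm (\ T s 2T -> let p = nn* (lt (D>0 T s 2T)) (lt (F>0 (m s) (lt (ra>0 2T)) (ra<1 2T))) in p , p) (Ev-T≥ 2)
   fann : Ev (\ T s -> 0# ≤ Fa T s × 0# ≤ Fa T s)
   fann = Evm (\ T s 2T -> let p = lt (F>0 (m s) (^n a (lt (ra>0 2T))) (^-<1 a' (lt (ra>0 2T)) (ra<1 2T))) in p , p) (Ev-T≥ 2)

module B13 where
 open Rationals
 open Gauss
 open Roots
 open B5 using (cube; cube-def; cube-nn; abs-le; <<-rl-abs)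
 open B6
 open B7
 open B8
 open B9
 open B11
 open B12
 open CSolver using (solve; _:+_; _:*_; :-_; _:-_; _:=_)

 opaque
  unfolding Qr
  #m2 : ∀ x y -> y ~ x + - (x - y)
  #m2 = auto Qr
  #m3 : ∀ x SS b c p -> (1# - x) * (SS + (b + c) * p) + (b + c) * (x * p) ~ (1# - x) * SS + b * p + c * p
  #m3 = auto Qr
  #m4 : ∀ b x -> (1# - x) * (0# + b * 1#) + b * (x * 1#) ~ 0# + b * 1#
  #m4 = auto Qr
  #m5 : ∀ p -> 1# ~ 1# - p + p
  #m5 = auto Qr
  #m6 : ∀ y s -> y * (y * (2# * s)) ~ 2# * (y * (y * s))
  #m6 = auto Qr
  #m7 : ∀ x -> (1# + (1# + x)) * (1# + (1# + (1# + x))) ~ (1# + x) * (1# + (1# + x)) + 2# * (1# + (1# + x))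
  #m7 = auto Qr
  #m8 : ∀ x y -> x ~ x - y + y
  #m8 = auto Qr
  #m9 : ∀ A B -> 0# ~ A - B + (B - A)
  #m9 = auto Qr
  #m10 : ∀ a b ρ p -> ρ * p * (4# * a + (1# - ρ) * (2# * b)) ~ ρ * (4# * (a * p) + 2# * ((1# - ρ) * (b * p)))
  #m10 = auto Qr
  #m11 : ∀ A B ρ p -> - (A * (ρ * p) - B * (ρ * (ρ * p))) ~ ρ * p * ((B - A) - (1# - ρ) * B)
  #m11 = auto Qr
  #m12 : ∀ A B ρ p -> A * (ρ * p) - B * (ρ * (ρ * p)) ~ ρ * p * ((A - B) + (1# - ρ) * B)
  #m12 = auto Qr
  #m13 : ∀ ρ -> (1# + 0#) * (1# + 0#) * (1# + 0#) * (ρ * 1#) ~ ρ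
  #m13 = auto Qr
  #m14 : ∀ n t -> (1# - t) * (1# - n * t) ~ 1# - (1# + n) * t + n * (t * t)
  #m14 = auto Qr
  #m15 : ∀ t -> 1# - 0# * t ~ 1#
  #m15 = auto Qr
  #m16 : ∀ n t y -> y * (1# + n * t) ~ (1# - t) * y * (1# + (1# + n) * t) + y * ((1# + n) * (t * t))
  #m16 = auto Qr
  #m17 : ∀ t -> 1# * (1# + 0# * t) ~ 1#
  #m17 = auto Qr
  #m18 : ∀ n -> 2# * ((1# + n) * (1# + (1# + n))) * 1# ~ 2# * ((1# + n) * (1# + n)) * 1# + 1# * 1# * (1# + (1# + n)) + n
  #m18 = auto Qr
  #m19 : ∀ A B x -> A * A * B * (2# * x) ~ 2# * (A * B) * (A * x)
  #m19 = auto Qr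
  #m20 : ∀ A B x y -> A * A * B * (2# * y + x * x) ~ 2# * (A * A) * (B * y) + A * x * (A * x) * B
  #m20 = auto Qr
  #m21 : ∀ a s b -> a + (s + b) ~ a + b + s
  #m21 = auto Qr
  #m22 : ∀ y s g -> y * (y * (y * (y * (y * 1#)))) * (s * g) ~ y * (y * (y * (y * s))) * (y * g)
  #m22 = auto Qr

 #m1 : ∀ f Z z SS f' -> f *c Z +c SS +c f *c z ~ f' *c (Z +c z) +c (SS +c (f -c f') *c (Z +c z))
 #m1 = solve 5 (\ f Z z SS f' -> f :* Z :+ SS :+ f :* z := f' :* (Z :+ z) :+ (SS :+ (f :- f') :* (Z :+ z))) refl

 abel-summation : ∀ n (f : ℕ -> Q) z -> sumc n (\ k -> rl (f k) *c z k) ~ rl (f n) *c sumc n z +c sumc n (\ k -> rl (f k - f (S k)) *c sumc (S k) z)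
 abel-summation zero f z = ! (& (ap (_+c 0c) (*c-0ʳ _)) (+c-idl 0c))
 abel-summation (S n) f z = & (ap (_+c rl (f n) *c z n) (abel-summation n f z)) (& (#m1 (rl (f n)) (sumc n z) (z n) (sumc n (\ k -> rl (f k - f (S k)) *c sumc (S k) z)) (rl (f (S n))))
  (ap (\ u -> rl (f (S n)) *c sumc (S n) z +c (sumc n (\ k -> rl (f k - f (S k)) *c sumc (S k) z) +c u *c sumc (S n) z)) (! (& (rl-+ (f n) _) (ap (rl (f n) +c_) (rl-neg _))))))

 abel-bound : ∀ n {f v : ℕ -> Q} {z B} -> (∀ k -> 0# ≤ f k) -> (∀ k -> abs (f k - f (S k)) ≤ v k) -> (∀ k -> k N.≤ n -> sumc k z << B) →
  sumc n (\ k -> rl (f k) *c z k) << (f 0 + sum n v + sum n v) * B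
 abel-bound n {f} {v} {z} {B} f≥0 fv h = tr (_<< (f 0 + sum n v + sum n v) * B) (! (abel-summation n f z))
  (<<m (<<-+ (<<-* (<<-rl (f≥0 n)) (h n NP.≤-refl)) (<<-sum n \ k l -> <<-* (<<m (<<-rl-abs _) (fv k)) (h (S k) l)))
   (≤= (+m (*r B0 (last n)) (≤r (sum-*ʳ n B v))) (! (*-distʳ B _ _)))) where
  B0 : 0# ≤ B
  B0 = fst (h n NP.≤-refl)
  last : ∀ n -> f n ≤ f 0 + sum n v
  last zero = ≤r (! (+-idr _))
  last (S n) = ≤= (=≤ (#m2 (f n) (f (S n))) (+m (last n) (<& (-x≤abs _) (fv n)))) (+-assoc _ _ _)

 weighted-step : ∀ (b c : ℕ -> Q) {x} -> 0# ≤ x -> (∀ k -> 0# ≤ b k) -> b 0 ~ c 0 -> (∀ k -> b (S k) ~ b k + c (S k)) -> ∀ n →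
  (1# - x) * sum n (\ k -> b k * x ^ k) ≤ sum n (\ k -> c k * x ^ k)
 weighted-step b c {x} x≥0 b≥0 b0 bs zero = ≤r (*-0ʳ _)
 weighted-step b c {x} x≥0 b≥0 b0 bs (S n) = le _ (nn* (b≥0 n) (^n (S n) x≥0)) (! (exact n)) where
  exact : ∀ n -> (1# - x) * sum (S n) (\ k -> b k * x ^ k) + b n * x ^ S n ~ sum (S n) (\ k -> c k * x ^ k)
  exact zero = & (#m4 (b 0) x) (ap (\ y -> 0# + y * 1#) b0)
  exact (S n) = & (ap (\ y -> (1# - x) * (sum (S n) (\ k -> b k * x ^ k) + y * x ^ S n) + y * x ^ S (S n)) (bs n))
   (& (#m3 x (sum (S n) (\ k -> b k * x ^ k)) (b n) (c (S n)) (x ^ S n)) (ap (_+ c (S n) * x ^ S n) (exact n)))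

 3# 6# : Q
 3# = 1# + 2#
 6# = 4# + 2#

 rise2 rise3 : ℕ -> Q
 rise2 k = ι (S k) * ι (S (S k))
 rise3 k = rise2 k * ι (S (S (S k)))

 rise2-nn : ∀ k -> 0# ≤ rise2 k
 rise2-nn k = nn* (ι-nn (S k)) (ι-nn (S (S k)))

 rise3-nn : ∀ k -> 0# ≤ rise3 k
 rise3-nn k = nn* (rise2-nn k) (ι-nn (S (S (S k))))

 0≤3 : 0# ≤ 3#
 0≤3 = nn+ 0≤1 0≤2

 module _ {x} (x≥0 : 0# ≤ x) (x≤1 : x ≤ 1#) where
  private
   y = 1# - x
   y≥0 : 0# ≤ y
   y≥0 = diff x≤1
  level1 : ∀ n -> y * (y * sum n (\ k -> ι (S k) * x ^ k)) ≤ 1#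
  level1 n = <& (*l y≥0 (weighted-step (\ k -> ι (S k)) (\ _ -> 1#) x≥0 (\ k -> ι-nn (S k)) (+-idr 1#) (\ k -> +-comm 1# (ι (S k))) n))
   (=≤ (& (ap (y *_) (ΣQ.cong-f n \ k -> *1l _)) (geom n x)) (le _ (^n n x≥0) (#m5 (x ^ n))))
  level2 : ∀ n -> y * (y * (y * sum n (\ k -> rise2 k * x ^ k))) ≤ 2#
  level2 n = <& (*l y≥0 (*l y≥0 (weighted-step rise2 (\ k -> 2# * ι (S k)) x≥0 rise2-nn h0 (\ k -> #m7 (ι k)) n)))
   (=≤ (& (ap (\ z -> y * (y * z)) (& (ΣQ.cong-f n \ k -> *-assoc 2# _ _) (sum-*ˡ n 2# _))) (#m6 y _)) (≤= (*l 0≤2 (level1 n)) (*1r 2#))) where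
   opaque
    unfolding Qr
    h0 : (1# + 0#) * (1# + (1# + 0#)) ~ 2# * (1# + 0#)
    h0 = refl
  level3 : ∀ n -> y * (y * (y * (y * sum n (\ k -> rise3 k * x ^ k)))) ≤ 6#
  level3 n = <& (*l y≥0 (*l y≥0 (*l y≥0 (weighted-step rise3 (\ k -> 3# * rise2 k) x≥0 rise3-nn h0 (\ k -> h1 (ι k)) n))))
   (=≤ (& (ap (\ z -> y * (y * (y * z))) (& (ΣQ.cong-f n \ k -> *-assoc 3# _ _) (sum-*ˡ n 3# _))) (h2 y _)) (≤= (*l 0≤3 (level2 n)) h3)) where
   opaque
    unfolding Qr
    h0 : (1# + 0#) * (1# + (1# + 0#)) * (1# + (1# + (1# + 0#))) ~ 3# * ((1# + 0#) * (1# + (1# + 0#)))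
    h0 = refl
    h1 : ∀ x -> (1# + (1# + x)) * (1# + (1# + (1# + x))) * (1# + (1# + (1# + (1# + x)))) ~ (1# + x) * (1# + (1# + x)) * (1# + (1# + (1# + x))) + 3# * ((1# + (1# + x)) * (1# + (1# + (1# + x))))
    h1 = auto Qr
    h2 : ∀ y s -> y * (y * (y * (3# * s))) ~ 3# * (y * (y * (y * s)))
    h2 = auto Qr
    h3 : 3# * 2# ~ 6#
    h3 = refl

 cube-ι : ∀ k -> cube k ~ ι k * ι k * ι k
 cube-ι k = & (cube-def k) (& (ι-* (k N.* k) k) (ap (_* ι k) (ι-* k k)))

 cube-mono : ∀ {j k} -> j N.≤ k -> cube j ≤ cube k
 cube-mono {j} {k} l = tr2 _≤_ (! (cube-def j)) (! (cube-def k)) (ι-mono (*-mono-≤ (*-mono-≤ l l) l))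

 cube≤rise : ∀ k -> cube (S k) ≤ rise3 k
 cube≤rise k = le (4# + 1# + (4# + 4#) * ι k + 3# * (ι k * ι k)) (nn+ (nn+ (nn+ 0≤4 0≤1) (nn* (nn+ 0≤4 0≤4) (ι-nn k))) (nn* 0≤3 (nnsq _))) (& (h (ι k)) (ap (_+ (4# + 1# + (4# + 4#) * ι k + 3# * (ι k * ι k))) (! (cube-ι (S k))))) where
  opaque
   unfolding Qr
   h : ∀ x -> (1# + x) * (1# + (1# + x)) * (1# + (1# + (1# + x))) ~ (1# + x) * (1# + x) * (1# + x) + (4# + 1# + (4# + 4#) * x + 3# * (x * x))
   h = auto Qr

 cube≤2rise : ∀ k -> cube (S (S k)) ≤ 2# * rise3 k
 cube≤2rise k = le e (nn+ (nn+ (nn+ 0≤4 (nn* (nn+ (nn+ 0≤4 0≤4) 0≤2) (ι-nn k))) (nn* (nn+ 0≤4 0≤2) (nnsq _))) (nn* (nnsq _) (ι-nn k))) (& (h (ι k)) (ap (_+ e) (! (cube-ι (S (S k)))))) where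
  e = 4# + (4# + 4# + 2#) * ι k + 6# * (ι k * ι k) + ι k * ι k * ι k
  opaque
   unfolding Qr
   h : ∀ x -> 2# * ((1# + x) * (1# + (1# + x)) * (1# + (1# + (1# + x)))) ~ (1# + (1# + x)) * (1# + (1# + x)) * (1# + (1# + x)) + (4# + (4# + 4# + 2#) * x + 6# * (x * x) + x * x * x)
   h = auto Qr

 cube-diff : ∀ k -> cube (S (S k)) - cube (S k) ≤ 4# * rise2 k
 cube-diff k = le e (nn+ (nn+ 0≤1 (nn* 0≤3 (ι-nn k))) (nnsq _)) (& (h (ι k)) (ap (_+ e) (ap2 _-_ (! (cube-ι (S (S k)))) (! (cube-ι (S k)))))) where
  e = 1# + 3# * ι k + ι k * ι k
  opaque
   unfolding Qr
   h : ∀ x -> 4# * ((1# + x) * (1# + (1# + x))) ~ (1# + (1# + x)) * (1# + (1# + x)) * (1# + (1# + x)) - (1# + x) * (1# + x) * (1# + x) + (1# + 3# * x + x * x)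
   h = auto Qr

 module Variation {ρ} (ρ0 : 0# ≤ ρ) (ρ≤1 : ρ ≤ 1#) where
  f v : ℕ -> Q
  f k = cube (S k) * ρ ^ S k
  v k = ρ * (4# * (rise2 k * ρ ^ k) + 2# * ((1# - ρ) * (rise3 k * ρ ^ k)))
  f-nn : ∀ k -> 0# ≤ f k
  f-nn k = nn* (cube-nn (S k)) (^n (S k) ρ0)
  private
   δ0 : 0# ≤ 1# - ρ
   δ0 = diff ρ≤1
  f-v : ∀ k -> abs (f k - f (S k)) ≤ v k
  f-v k = abs-le (=≤ (#m12 A B ρ p) (≤= (*l P0 up) (#m10 (rise2 k) (rise3 k) ρ p)))
   (=≤ (#m11 A B ρ p) (≤= (*l P0 down) (#m10 (rise2 k) (rise3 k) ρ p))) where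
   A = cube (S k)
   B = cube (S (S k))
   p = ρ ^ k
   P0 : 0# ≤ ρ * p
   P0 = nn* ρ0 (^n k ρ0)
   A≤B : A ≤ B
   A≤B = cube-mono {S k} {S (S k)} (n≤1+n (S k))
   up : (A - B) + (1# - ρ) * B ≤ 4# * rise2 k + (1# - ρ) * (2# * rise3 k)
   up = +m (<& (le (B - A) (diff A≤B) (#m9 A B)) (nn* 0≤4 (rise2-nn k))) (*l δ0 (cube≤2rise k))
   down : (B - A) - (1# - ρ) * B ≤ 4# * rise2 k + (1# - ρ) * (2# * rise3 k)
   down = <& (le ((1# - ρ) * B) (nn* δ0 (cube-nn (S (S k)))) (#m8 (B - A) ((1# - ρ) * B))) (<& (cube-diff k) (x≤x+y (nn* δ0 (nn* 0≤2 (rise3-nn k)))))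
  c41 : Q
  c41 = 1# + (4# * 2# + 2# * 6#) + (4# * 2# + 2# * 6#)
  variation : ∀ n -> (1# - ρ) * ((1# - ρ) * ((1# - ρ) * (f 0 + sum n v + sum n v))) ≤ c41 * ρ
  variation n = =≤ (& (ap (\ z -> y * (y * (y * (f 0 + z + z)))) Σv) (h (f 0) ρ y S2 S3))
   (≤= (+m (+m f0 both) both) (h2 ρ)) where
   y = 1# - ρ
   S2 = sum n (\ k -> rise2 k * ρ ^ k)
   S3 = sum n (\ k -> rise3 k * ρ ^ k)
   Σv : sum n v ~ ρ * (4# * S2 + 2# * (y * S3))
   Σv = & (sum-*ˡ n ρ _) (ap (ρ *_) (& (ΣQ.distr n _ _) (ap2 _+_ (sum-*ˡ n 4# _) (& (sum-*ˡ n 2# _) (ap (2# *_) (sum-*ˡ n y _))))))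
   y≤1 : y ≤ 1#
   y≤1 = le ρ ρ0 (#m5 ρ)
   shrink : ∀ {z} -> 0# ≤ z -> y * z ≤ z
   shrink z≥0 = ≤= (*r z≥0 y≤1) (*1l _)
   f0≡ : f 0 ~ ρ
   f0≡ = & (ap (_* (ρ * 1#)) (cube-ι 1)) (#m13 ρ)
   f0 : y * (y * (y * f 0)) ≤ ρ
   f0 = <& (shrink (nn* δ0 (nn* δ0 (f-nn 0)))) (<& (shrink (nn* δ0 (f-nn 0))) (≤= (shrink (f-nn 0)) f0≡))
   both : ρ * (4# * (y * (y * (y * S2))) + 2# * (y * (y * (y * (y * S3))))) ≤ ρ * (4# * 2# + 2# * 6#)
   both = *l ρ0 (+m (*l 0≤4 (level2 ρ0 ρ≤1 n)) (*l 0≤2 (level3 ρ0 ρ≤1 n)))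
   opaque
    unfolding Qr
    h : ∀ f ρ y a b -> let w = ρ * (4# * a + 2# * (y * b)); u = ρ * (4# * (y * (y * (y * a))) + 2# * (y * (y * (y * (y * b))))) in y * (y * (y * (f + w + w))) ~ y * (y * (y * f)) + u + u
    h = auto Qr
    h2 : ∀ ρ -> ρ + ρ * (4# * 2# + 2# * 6#) + ρ * (4# * 2# + 2# * 6#) ~ (1# + (4# * 2# + 2# * 6#) + (4# * 2# + 2# * 6#)) * ρ
    h2 = auto Qr

 bernoulli : ∀ {t} n -> 0# ≤ t -> t ≤ 1# -> 1# - ι n * t ≤ (1# - t) ^ n
 bernoulli {t} zero p q = ≤r (#m15 t)
 bernoulli {t} (S n) p q = <& (le (ι n * (t * t)) (nn* (ι-nn n) (nnsq t)) (#m14 (ι n) t)) (*l (diff q) (bernoulli n p q))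

 decay : ∀ {t} n -> 0# ≤ t -> t ≤ 1# -> (1# - t) ^ n * (1# + ι n * t) ≤ 1#
 decay {t} zero p q = ≤r (#m17 t)
 decay {t} (S n) p q = <& (le ((1# - t) ^ n * (ι (S n) * (t * t))) (nn* (^n n (diff q)) (nn* (ι-nn (S n)) (nnsq t))) (#m16 (ι n) t ((1# - t) ^ n))) (decay n p q)

 inverse-squares : ∀ n -> sum n (\ k -> 1/ k * 1/ k) ≤ 2#
 inverse-squares n = <& (le (2# * 1/ n) (nn* 0≤2 (1/-nn n)) (+-comm (2# * 1/ n) (sum n (\ k -> 1/ k * 1/ k)))) (bound n) where
  bound : ∀ n -> 2# * 1/ n + sum n (\ k -> 1/ k * 1/ k) ≤ 2#
  bound zero = ≤r (& (+-idr _) (& (ap (2# *_) (& (! (*1l _)) (& (ap (_* 1/ 0) (! (+-idr 1#))) (ι*1/ 0)))) (*1r 2#)))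
  bound (S n) = <& (=≤ (#m21 (2# * 1/ (S n)) (sum n (\ k -> 1/ k * 1/ k)) (1/ n * 1/ n)) (+m step r≤)) (bound n) where
   A = ι (S n)
   B = ι (S (S n))
   x = 1/ n
   y = 1/ (S n)
   step : 2# * y + x * x ≤ 2# * x
   step = *x {A * A * B} (pp* (pp* (ι-pos {S n} z<s) (ι-pos {S n} z<s)) (ι-pos {S (S n)} z<s))
    (=≤ (& (#m20 A B x y) (ap2 (\ u v -> 2# * (A * A) * u + v * v * B) (ι*1/ (S n)) (ι*1/ n))) (≤= (le (ι n) (ι-nn n) (#m18 (ι n))) (! (& (#m19 A B x) (ap (2# * (A * B) *_) (ι*1/ n))))))

 e4Sum-≤ : ∀ {x T} -> 1 N.≤ T -> 0# ≤ x -> x ≤ 1# -> inv (ι T) ≤ 1# - x -> ∀ M →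
  sum M (\ d -> sum M (\ m -> cube (S d) * x ^ (S d N.* S m))) ≤ 6# * ι T ^ 5
 e4Sum-≤ {x} {T} 1T x≥0 x≤1 t≤ M = <& (sum-mono M \ d _ -> ≤= (sum-mono M \ m _ -> ≤= (*-mono (cube-nn (S d)) (cube≤rise d) (^n (S d N.* S m) x≥0)
  (≤= (^-anti x≥0 x≤1 (exps d m)) (^-+ x d m))) (! *a)) (sum-*ˡ M (rise3 d * x ^ d) (x ^_)))
  (=≤ (sum-*ʳ M G (\ d -> rise3 d * x ^ d)) final) where
  y = 1# - x
  t = inv (ι T)
  G = sum M (x ^_)
  SS = sum M (\ d -> rise3 d * x ^ d)
  exps : ∀ d m -> d N.+ m N.≤ S d N.* S m
  exps d m = &N (&N (≡N (NP.+-comm d m)) (+-mono-≤ {m} {S m} (n≤1+n m) (m≤m*n d (S m)))) NP.≤-refl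
  y≥0 : 0# ≤ y
  y≥0 = diff x≤1
  t>0 : 0# < t
  t>0 = inv-pos (ι-pos 1T)
  G≤ : y * G ≤ 1#
  G≤ = =≤ (geom M x) (le _ (^n M x≥0) (#m5 (x ^ M)))
  S≥0 : 0# ≤ SS
  S≥0 = sum-nn M \ d -> nn* (rise3-nn d) (^n d x≥0)
  G0 : 0# ≤ G
  G0 = sum-nn M \ d -> ^n d x≥0
  T^5t^5 : ι T ^ 5 * t ^ 5 ~ 1#
  T^5t^5 = & (! (*-^ (ι T) t 5)) (& (ap (_^ 5) (inv-r (ι-pos 1T))) (^-1 5))
  t^5SG : t ^ 5 * (SS * G) ≤ 6#
  t^5SG = <& (*r (nn* S≥0 G0) (^-mono 5 (lt t>0) t≤)) (=≤ (e y SS G) (≤= (*-mono (nn* y≥0 (nn* y≥0 (nn* y≥0 (nn* y≥0 S≥0)))) (level3 x≥0 x≤1 M) (nn* y≥0 G0) G≤) (*1r 6#))) where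
   e : ∀ y s g -> y ^ 5 * (s * g) ~ y * (y * (y * (y * s))) * (y * g)
   e = #m22
  final : SS * G ≤ 6# * ι T ^ 5
  final = =≤ (& (! (*1l _)) (& (ap (_* (SS * G)) (! T^5t^5)) *a)) (≤= (*l (^n 5 (ι-nn T)) t^5SG) (*-comm _ _))

module B14 where
 open Rationals
 open Gauss
 open Interpolation
 open Roots
 open B5 using (cube; cube-nn; c240; c240-nn; 1≤c240)
 open B6
 open B7
 open B8
 open B9
 open B10
 open B11
 open B12
 open B13
 open CSolver using (solve; _:+_; _:*_; :-_; _:-_; _:=_; con)
 open Z using (ℤ)
 open import Data.Nat.DivMod using (_/_; _%_; m≡m%n+[m/n]*n; m%n<n; %-distribˡ-*; m%n%n≡m%n; m*n%n≡0; m/n*n≤m)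

 opaque
  unfolding Qr
  #n1 : ∀ u n t V -> u * u * (n * t * (n * t) * t * V) ~ u * (n * t) * (u * (n * t) * (t * V))
  #n1 = auto Qr
  #n2 : ∀ x z -> 1# - x ~ 1# - z + (z - x)
  #n2 = auto Qr
  #n3 : ∀ u n t -> 1# - u * (1# + n * t) ~ 1# - u - u * (n * t)
  #n3 = auto Qr
  #n4 : ∀ T t n k V -> T * t * (T * t) * (T * t) * (n * k * (n * k)) * V ~ T * T * T * (n * t * (n * t) * t * V) * (k * k)
  #n4 = auto Qr
  #n6 : ∀ x z -> 1# - z ~ 1# - x + (x - z)
  #n6 = auto Qr
  #n8 : ∀ x f r -> x * (f * r) ~ f * (x * r)
  #n8 = auto Qr
  #n9 : ∀ x -> x * (x * (x * (x * 1#))) ~ x * (x * x * x)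
  #n9 = auto Qr
  #n12 : ∀ n x -> n * x + x ~ (1# + n) * x
  #n12 = auto Qr
  #n15 : ∀ x s t -> x * s * (4# * (4# * t)) ~ x * (4# * 4# * (s * t))
  #n15 = auto Qr
  #n16 : ∀ c k w -> c * (k * k) * (w * w) ~ c * (w * k * (w * k))
  #n16 = auto Qr
  #n21 : ∀ x t -> x * (x * (x * (x * 1#))) * t ~ x * x * x * (x * t)
  #n21 = auto Qr
  #n22 : ∀ K c X t -> K * (c * X * t) ~ K * c * t * X
  #n22 = auto Qr
  #n23 : ∀ c b T w -> c * (b * (T * T * T) * 2# * w) ~ c * (b * 2# * w) * (T * T * T)
  #n23 = auto Qr

 #n5 : ∀ x y u v -> x +c y -c (u +c v) ~ x -c u +c (y -c v)
 #n5 = solve 4 (\ x y u v -> x :+ y :- (u :+ v) := x :- u :+ (y :- v)) refl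
 #n7 : ∀ a D -> 4 N.* ((D N.+ D) N.* a) ~ 8 N.* a N.* D
 #n7 = nsolve
 #n10 : ∀ a D -> D N.* (8 N.* a) N.+ D N.* (8 N.* a) ~ 16 N.* a N.* D
 #n10 = nsolve
 #n11 : ∀ a -> 8 N.* a N.+ 8 N.* a ~ 16 N.* a
 #n11 = nsolve
 #n13 : ∀ g Z u v -> (1c -c g) *c (Z +c u) -c (g -c v) ~ (1c -c g) *c Z -c (g -c u) +c (v -c g *c u)
 #n13 = solve 4 (\ g Z u v -> (con (Z.+ 1) :- g) :* (Z :+ u) :- (g :- v) := (con (Z.+ 1) :- g) :* Z :- (g :- u) :+ (v :- g :* u)) refl
 #n14 : ∀ g -> (1c -c g) *c 0c -c (g -c g) ~ 0c
 #n14 = solve 1 (\ g -> (con (Z.+ 1) :- g) :* con (Z.+ 0) :- (g :- g) := con (Z.+ 0)) refl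
 #n17 : ∀ d s a -> d N.* s N.* a ~ d N.* a N.* s
 #n17 = nsolve
 #n18 : ∀ h j x a -> h N.* (j N.* (x N.* a)) ~ h N.* j N.* x N.* a
 #n18 = nsolve
 #n19 : ∀ h j k -> h N.* (j N.* k) ~ h N.* k N.* j
 #n19 = nsolve
 #n20 : ∀ u -> u -c 0c ~ u
 #n20 = solve 1 (\ u -> u :- con (Z.+ 0) := u) refl

 whenD : ∀ {A : Set} -> Dec A -> Q -> Q
 whenD (yes _) x = x
 whenD (no _) x = 0#

 whenD-bounds : ∀ {A : Set} (D : Dec A) {x} -> 0# ≤ x -> 0# ≤ whenD D x × whenD D x ≤ x
 whenD-bounds (yes _) p = p , r≤
 whenD-bounds (no _) p = r≤ , p

 cubic-decay : ∀ {T} -> 2 N.≤ T -> ∀ m V c -> 0# ≤ V -> let y = 1# - rT T ^ S m in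
  y * (y * (y * V)) ≤ c * rT T ^ S m -> V ≤ c * (ι T * ι T * ι T) * (1/ m * 1/ m)
 cubic-decay {T} 2T m V c V≥0 p = =≤ (& (! (*1l V)) (ap (_* V) (! one))) (=≤ (#n4 (ι T) t n (1/ m) V) (≤= (*r (nnsq (1/ m)) (*l (nn* (nn* (ι-nn T) (ι-nn T)) (ι-nn T)) ntV))
  (ap (_* (1/ m * 1/ m)) (*-comm _ c)))) where
  1T : 1 N.≤ T
  1T = &N z<s 2T
  t = inv (ι T)
  n = ι (S m)
  u = r0 T ^ S m
  ρ = rT T ^ S m
  t>0 : 0# < t
  t>0 = inv-pos (ι-pos 1T)
  t≤1 : t ≤ 1#
  t≤1 = =≤ (! (*1l t)) (≤= (*r (lt t>0) (1≤ι 1T)) (inv-r (ι-pos 1T)))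
  one : ι T * t * (ι T * t) * (ι T * t) * (n * 1/ m * (n * 1/ m)) ~ 1#
  one = & (ap2 (\ x z -> x * x * x * (z * z)) (inv-r (ι-pos 1T)) (ι*1/ m)) e where
   opaque
    unfolding Qr
    e : 1# * 1# * 1# * (1# * 1#) ~ 1#
    e = refl
  u>0 : 0# < u
  u>0 = ^-pos (S m) (r0>0 2T)
  ρ≡ : ρ ~ u * u
  ρ≡ = *-^ (r0 T) (r0 T) (S m)
  ynt : u * (n * t) ≤ 1# - u
  ynt = undiff (tr (0# ≤_) (#n3 u n t) (diff (decay (S m) (lt t>0) t≤1)))
  comp : ∀ {x z} -> x ≤ z -> 1# - z ≤ 1# - x
  comp {x} {z} q = le (z - x) (diff q) (#n2 x z)
  ρ≤u : ρ ≤ u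
  ρ≤u = =≤ ρ≡ (≤= (*l (lt u>0) (^-≤1 (S m) (lt (r0>0 2T)) (r0≤1 2T))) (*1r u))
  u≤r0 : u ≤ r0 T
  u≤r0 = ≤= (*l (lt (r0>0 2T)) (^-≤1 m (lt (r0>0 2T)) (r0≤1 2T))) (*1r _)
  t≤y : t ≤ 1# - ρ
  t≤y = =≤ (! (1-r0 2T)) (comp (<& ρ≤u u≤r0))
  big : u * (n * t) ≤ 1# - ρ
  big = <& ynt (comp ρ≤u)
  unt0 : 0# ≤ u * (n * t)
  unt0 = nn* (lt u>0) (nn* (ι-nn (S m)) (lt t>0))
  ntV : n * t * (n * t) * t * V ≤ c
  ntV = *x (pp* u>0 u>0) (=≤ (#n1 u n t V) (<& (*-mono unt0 big (nn* unt0 (nn* (lt t>0) V≥0)) (*-mono unt0 big (nn* (lt t>0) V≥0) (*r V≥0 t≤y))) (≤= p (& (ap (c *_) ρ≡) (*-comm c _)))))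

 sub-sumc : ∀ n (f g : ℕ -> C) -> sumc n f -c sumc n g ~ sumc n (\ k -> f k -c g k)
 sub-sumc zero f g = u-u 0c
 sub-sumc (S n) f g = & (#n5 (sumc n f) (f n) (sumc n g) (g n)) (ap (_+c (f n -c g n)) (sub-sumc n f g))

 module MainTerm (a' d' : ℕ) where
  open Table a' d'
  Mx : ℕ -> ℕ
  Mx s = m s N.* a
  row : ℕ -> ℕ -> ℕ -> Q
  row T s k = sum (Mx s) (\ j -> cube (S j) * rT T ^ (S j N.* S k))
  part : ℕ -> ℕ -> ℕ -> Q
  part T s k = whenD (S k % a ≟ 0) (row T s k)
  main : ℕ -> ℕ -> Q
  main T s = 1# + c240 * sum (Mx s) (part T s)
  module _ {T} (2T : 2 N.≤ T) where
   private
    1T : 1 N.≤ T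
    1T = &N z<s 2T
    r≥0 : 0# ≤ rT T
    r≥0 = lt (r>0 2T)
   row-nn : ∀ s k -> 0# ≤ row T s k
   row-nn s k = sum-nn (Mx s) \ j -> nn* (cube-nn (S j)) (^n (S j N.* S k) r≥0)
   part-nn : ∀ s k -> 0# ≤ part T s k
   part-nn s k = fst (whenD-bounds (S k % a ≟ 0) (row-nn s k))
   1≤main : ∀ s -> 1# ≤ main T s
   1≤main s = x≤x+y (nn* c240-nn (sum-nn (Mx s) (part-nn s)))
   main≤ : ∀ s -> main T s ≤ 1# + c240 * (6# * ι T ^ 5)
   main≤ s = +m r≤ (*l c240-nn (<& (sum-mono (Mx s) \ k _ -> snd (whenD-bounds (S k % a ≟ 0) (row-nn s k))) (=≤ (ΣQ.exchange (Mx s) (Mx s) _)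
    (e4Sum-≤ 1T r≥0 (r≤1 2T) (=≤ (! (1-r0 2T)) (le (r0 T - rT T) (diff (r≤r0 2T)) (#n6 (r0 T) (rT T)))) (Mx s)))))
   c16 : ℕ
   c16 = 16 N.* a
   row-large : ∀ s D -> D N.+ D N.≤ Mx s -> 8 N.* a N.* D N.≤ T -> ι D * cube D ≤ ι 4 * row T s a'
   row-large s D M≥ le8 = <& (=≤ (! (*1r _)) (≤= (*l (nn* (ι-nn D) (cube-nn D)) 4ρ) (#n8 (ι D * cube D) (ι 4) ρ2))) (*l (ι-nn 4) block) where
    n = (D N.+ D) N.* a
    ρ2 = rT T ^ n
    t = inv (ι T)
    block : ι D * cube D * ρ2 ≤ row T s a'
    block = <& (=≤ (& *a (! (sum-const D (cube D * ρ2)))) (sum-mono D \ k k<D -> *-mono (cube-nn D) (cube-mono (&N (m≤m+n D k) (n≤1+n (D N.+ k)))) (^n n r≥0)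
     (^-anti r≥0 (r≤1 2T) (*-monoˡ-≤ a (&N (≡N (! (+-suc D k))) (+-monoʳ-≤ D k<D))))))
     (<& (≤= (y≤x+y (sum-nn D \ k -> nn* (cube-nn (S k)) (^n (S k N.* a) r≥0))) (! (ΣQ.split D D _))) (sum-ext M≥ \ k -> nn* (cube-nn (S k)) (^n (S k N.* a) r≥0)))
    4n≤T : 4 N.* n N.≤ T
    4n≤T = &N (≡N (#n7 a D)) le8
    nt : ι 2 * (ι n * t) ≤ 1#
    nt = ≤= (=≤ (& (! *a) (ap (_* t) (! (ι-* 2 n)))) (*r (inv-nn (ι-pos 1T)) (ι-mono (&N (*-monoˡ-≤ n {2} {4} (s≤s z<s)) 4n≤T)))) (inv-r (ι-pos 1T))
    half : 1# ≤ ι 2 * r0 T ^ n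
    half = <& (undiff (tr (0# ≤_) (h (ι n * t)) (diff nt))) (*l (ι-nn 2) (bernoulli n (inv-nn (ι-pos 1T)) t≤1)) where
     t≤1 : t ≤ 1#
     t≤1 = =≤ (! (*1l t)) (≤= (*r (inv-nn (ι-pos 1T)) (1≤ι 1T)) (inv-r (ι-pos 1T)))
     opaque
      unfolding Qr
      h : ∀ x -> 1# - ι 2 * x ~ ι 2 * (1# - x) - 1#
      h = \ x -> & (h′ x) refl where
       h′ : ∀ x -> 1# - (1# + (1# + 0#)) * x ~ (1# + (1# + 0#)) * (1# - x) - 1#
       h′ = auto Qr
    4ρ : 1# ≤ ι 4 * ρ2
    4ρ = ≤= (=≤ (! (*1r 1#)) (sq-mono 0≤1 half)) (& (swap* (ι 2) (r0 T ^ n) (ι 2) (r0 T ^ n)) (ap2 _*_ (! (ι-* 2 2)) (! (*-^ (r0 T) (r0 T) n))))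
   main-large : ∀ s -> T N.≤ s -> c16 N.≤ T -> ι T ^ 4 ≤ ι c16 ^ 4 * ι 4 * main T s
   main-large s T≤s l = <& (^-mono 4 (ι-nn T) (≤= (ι-mono T≤) (ι-* c16 D))) (=≤ (& (*-^ (ι c16) (ι D) 4) (ap (ι c16 ^ 4 *_) D⁴))
    (≤= (*l (^n 4 (ι-nn c16)) (<& (row-large s D M≥ 8D≤) (*l (ι-nn 4) row≤main))) (! *a))) where
    D = T / (8 N.* a)
    8D≤ : 8 N.* a N.* D N.≤ T
    8D≤ = &N (≡N (NP.*-comm (8 N.* a) D)) (m/n*n≤m T (8 N.* a))
    T<′ : T N.≤ 8 N.* a N.+ D N.* (8 N.* a)
    T<′ = &N (≡N (m≡m%n+[m/n]*n T (8 N.* a))) (+-monoˡ-≤ (D N.* (8 N.* a)) (<⇒≤ (m%n<n T (8 N.* a))))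
    8a≤ : 8 N.* a N.≤ D N.* (8 N.* a)
    8a≤ = NP.+-cancelˡ-≤ (8 N.* a) _ _ (&N (≡N (#n11 a)) (&N l T<′))
    T≤ : T N.≤ c16 N.* D
    T≤ = &N T<′ (&N (+-monoˡ-≤ (D N.* (8 N.* a)) 8a≤) (≡N (#n10 a D)))
    s≤M : s N.≤ Mx s
    s≤M = &N (m≤n*m s d) (m≤m*n (m s) a)
    M≥ : D N.+ D N.≤ Mx s
    M≥ = &N (&N (≡N (ap (D N.+_) (! (NP.+-identityʳ D)))) (*-monoˡ-≤ D {2} {8 N.* a} (&N {j = 8} (s≤s z<s) (m≤m*n 8 a)))) (&N 8D≤ (&N T≤s s≤M))
    D⁴ : ι D ^ 4 ~ ι D * cube D
    D⁴ = & (e (ι D)) (ap (ι D *_) (! (cube-ι D))) where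
     e : ∀ x -> x ^ 4 ~ x * (x * x * x)
     e = #n9
    a'<M : S a' N.≤ Mx s
    a'<M = m≤n*m a (m s) {{>-nonZero (&N (&N 1T T≤s) (m≤n*m s d))}}
    part-a' : part T s a' ~ row T s a'
    part-a' = whenD-yes (S a' % a ≟ 0) (& (ap (_% a) (! (NP.*-identityˡ a))) (m*n%n≡0 1 a)) where
     whenD-yes : ∀ {A : Set} (D : Dec A) {x} -> A -> whenD D x ~ x
     whenD-yes (yes _) _ = refl
     whenD-yes (no n) p = abort (n p)
    row≤main : row T s a' ≤ main T s
    row≤main = <& (=≤ (! part-a') (<& (y≤x+y (sum-nn a' (part-nn s))) (sum-ext a'<M (part-nn s)))) (<& (=≤ (! (*1l _)) (*r (sum-nn (Mx s) (part-nn s)) 1≤c240)) (y≤x+y 0≤1))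

 -- E₄ at ζʰ r: the terms with a ∣ m dominate, the remaining ones oscillate in d.
 module Eisenstein (a' d' h h' : ℕ) (hh' : (h N.* h') % S a' ~ 1 % S a') where
  open Beta a' d' h h' hh'
  open MainTerm a' d'
  e : ℕ -> ℕ -> C
  e T s = 1c +c rl c240 *c sumc (Mx s) (\ j -> sumc (Mx s) (\ k -> rl (cube (S j)) *c w T s (S j N.* S k)))
  rowc : ℕ -> ℕ -> ℕ -> C
  rowc T s k = sumc (Mx s) (\ j -> rl (cube (S j)) *c w T s (S j N.* S k))
  vanish-% : ∀ x -> (h N.* x) % a ~ 0 -> x % a ~ 0
  vanish-% x p = & (! (mul-inverse h' h h'h (x % a) (m%n<n x a))) (& (ap (\ z -> (h' N.* z) % a) (& (%-distribˡ-* h (x % a) a) (& (ap (\ z -> ((h % a) N.* z) % a) (m%n%n≡m%n x a)) (& (! (%-distribˡ-* h x a)) p)))) (ap (_% a) (*-zeroʳ h')))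
  W : Q
  W = 2# + ι (d N.* a) * (4# * 4# * ε0)
  W0 : 0# ≤ W
  W0 = nn+ 0≤2 (nn* (ι-nn (d N.* a)) (nn* (nn* 0≤4 0≤4) (lt ε0>0)))
  kc : ℕ
  kc = S (fst (arch (inv c0)))
  inv-c0≤ : inv c0 ≤ ι kc * ι kc
  inv-c0≤ = <& (snd (arch (inv c0))) (<& (ι-mono {fst (arch (inv c0))} {kc} (n≤1+n _)) (=≤ (! (*1l _)) (*r (ι-nn kc) (1≤ι {kc} z<s))))
  module Oscillating (s k : ℕ) (k≢ : S k % a ≢ 0) where
   gk = h N.* S k
   z : ℕ -> C
   z j = ζt s (gk N.* S j)
   η = 4# * (4# * tol s)
   η0 : 0# ≤ η
   η0 = nn* 0≤4 (nn* 0≤4 (tol-nn s))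
   telescope : ∀ n -> (1c -c ζt s gk) *c sumc n z -c (ζt s gk -c ζt s (gk N.* S n)) << ι n * η
   telescope zero = tr (_<< 0# * η) (! (& (ap (\ x -> (1c -c ζt s gk) *c 0c -c (ζt s gk -c ζt s x)) (*-identityʳ gk)) (#n14 (ζt s gk)))) (<<-0 (≤r (! (*-0ˡ η))))
   telescope (S n) = tr (_<< ι (S n) * η) (! (#n13 (ζt s gk) (sumc n z) (z n) (ζt s (gk N.* S (S n)))))
    (<<m (<<-+ (telescope n) (tr (\ x -> ζt s x -c ζt s gk *c z n << η) (! (NP.*-suc gk (S n))) (ζt-mul s gk (gk N.* S n)))) (≤r (#n12 (ι n) η)))
   partial : ∀ n -> n N.≤ Mx s -> sumc n z << W * ι kc
   partial n l = nn* W0 (ι-nn kc) , *x c0>0 (<& (<& (*r (N-nn Z) sep) (=≤ (! (N-* _ Z)) (snd big)))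
    (=≤ (& (! (*1l _)) (ap (_* (W * W)) (! (inv-r c0>0)))) (≤= (*r (nnsq W) (*l (lt c0>0) inv-c0≤)) (#n16 c0 (ι kc) W)))) where
    Z = sumc n z
    sep : c0 ≤ N (1c -c ζt s gk)
    sep = zt-≠1 s (n≢0⇒n>0 \ p -> k≢ (vanish-% (S k) p)) (m%n<n gk a)
    sum-tol : ι n * η ≤ ι (d N.* a) * (4# * 4# * ε0)
    sum-tol = <& (*r η0 (ι-mono l)) (=≤ (& (ap (_* η) (& (ap ι (#n17 d s a)) (ι-* (d N.* a) s))) (#n15 (ι (d N.* a)) (ι s) (tol s)))
     (*l (ι-nn (d N.* a)) (*l (nn* 0≤4 0≤4) (<& (s*tol≤ s) (≤= (*l (lt ε0>0) (1/≤1 s)) (*1r _))))))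
    big : (1c -c ζt s gk) *c Z << W
    big = tr (_<< W) (u-v+v _ _) (<<m (<<-+ (telescope n) (<<-- (<<-unit (zt-unit s (gk % a))) (<<-unit (zt-unit s ((gk N.* S n) % a)))))
     (≤= (+m sum-tol r≤) (+-comm _ _)))
  c4 : Q
  c4 = Variation.c41 0≤1 r≤
  c40 : 0# ≤ c4
  c40 = nn+ (nn+ 0≤1 x) x where
   x : 0# ≤ 4# * 2# + 2# * 6#
   x = nn+ (nn* 0≤4 0≤2) (nn* 0≤2 (nn+ 0≤4 0≤2))
  row-close : ∀ {T} -> 2 N.≤ T -> ∀ s k -> rowc T s k -c rl (part T s k) << c4 * (ι T * ι T * ι T) * (1/ k * 1/ k) * (W * ι kc)
  row-close {T} 2T s k = go (S k % a ≟ 0) where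
   B0 : 0# ≤ c4 * (ι T * ι T * ι T) * (1/ k * 1/ k) * (W * ι kc)
   B0 = nn* (nn* (nn* c40 (nn* (nn* (ι-nn T) (ι-nn T)) (ι-nn T))) (nnsq _)) (nn* W0 (ι-nn kc))
   go : (D : Dec (S k % a ~ 0)) -> rowc T s k -c rl (whenD D (row T s k)) << c4 * (ι T * ι T * ι T) * (1/ k * 1/ k) * (W * ι kc)
   go (yes p) = tr (_<< c4 * (ι T * ι T * ι T) * (1/ k * 1/ k) * (W * ι kc)) (! (& (ap (\ u -> rowc T s k -c u) real) (u-u _))) (<<-0 B0) where
    res : ∀ j -> (h N.* (S j N.* S k)) % a ~ 0
    res j = & (ap (\ x -> (h N.* (S j N.* x)) % a) (& (m≡m%n+[m/n]*n (S k) a) (ap (N._+ S k / a N.* a) p))) (& (ap (_% a) (#n18 h (S j) (S k / a) a)) (m*n%n≡0 (h N.* S j N.* (S k / a)) a))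
    real : rl (row T s k) ~ rowc T s k
    real = & (rl-sum (Mx s) _) (ΣC.cong-f (Mx s) \ j -> & (rl-* _ _) (ap (rl (cube (S j)) *c_) (! (& (ap (\ x -> rl (rT T ^ (S j N.* S k)) *c x) (& (ap (zt s) (res j)) (zt-0 s))) (*c1r _)))))
   go (no p) = tr (_<< c4 * (ι T * ι T * ι T) * (1/ k * 1/ k) * (W * ι kc)) (! (& (ap2 _-c_ shape rl-0) (#n20 _)))
    (<<m (abel-bound (Mx s) V.f-nn V.f-v partial) (*r (nn* W0 (ι-nn kc)) (cubic-decay 2T k (V.f 0 + sum (Mx s) V.v + sum (Mx s) V.v) c4 (nn+ (nn+ (V.f-nn 0) vv) vv) (V.variation (Mx s))))) where
    module V = Variation {rT T ^ S k} (^n (S k) (lt (r>0 2T))) (^-≤1 (S k) (lt (r>0 2T)) (r≤1 2T))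
    open Oscillating s k p using (gk; z; partial)
    vv : 0# ≤ sum (Mx s) V.v
    vv = sum-nn (Mx s) \ j -> <& (abs-nn _) (V.f-v j)
    shape : rowc T s k ~ sumc (Mx s) (\ j -> rl (V.f j) *c z j)
    shape = ΣC.cong-f (Mx s) \ j -> & (! (*c-assoc _ _ _)) (ap2 _*c_ (& (ap (\ x -> rl (cube (S j)) *c rl x) (^-^ (rT T) (S j) (S k))) (! (rl-* _ _))) (ap (ζt s) (#n19 h (S j) (S k))))
  e≈main : e ≈ (\ T s -> rl (main T s))
  e≈main = go (arch (K * (ι c ^ 4 * ι 4))) where
   c = 16 N.* a
   K = c240 * (c4 * 2# * (W * ι kc))
   K0 : 0# ≤ K
   K0 = nn* c240-nn (nn* (nn* c40 0≤2) (nn* W0 (ι-nn kc)))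
   close : ∀ {T} -> 2 N.≤ T -> ∀ s -> e T s -c rl (main T s) << K * (ι T * ι T * ι T)
   close {T} 2T s = tr (_<< K * (ι T * ι T * ι T)) (! eq) (<<m (<<-* (<<-rl c240-nn) (<<-sum (Mx s) \ k _ -> row-close 2T s k))
    (≤= (*l c240-nn (=≤ (& (sum-*ʳ (Mx s) (W * ι kc) _) (ap (_* (W * ι kc)) (sum-*ˡ (Mx s) (c4 * (ι T * ι T * ι T)) _))) (*r (nn* W0 (ι-nn kc)) (*l (nn* c40 (nn* (nn* (ι-nn T) (ι-nn T)) (ι-nn T))) (inverse-squares (Mx s)))))) (#n23 c240 c4 (ι T) (W * ι kc)))) where
    eq : e T s -c rl (main T s) ~ rl c240 *c sumc (Mx s) (\ k -> rowc T s k -c rl (part T s k))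
    eq = & (ap2 (\ u v -> 1c +c rl c240 *c u -c v) (ΣC.exchange (Mx s) (Mx s) _) (& (rl-+ 1# _) (ap2 _+c_ rl-1 (& (rl-* c240 _) (ap (rl c240 *c_) (rl-sum (Mx s) _))))))
     (& (v (rl c240) _ _) (ap (rl c240 *c_) (sub-sumc (Mx s) (rowc T s) (\ k -> rl (part T s k))))) where
     v : ∀ c x y -> 1c +c c *c x -c (1c +c c *c y) ~ c *c (x -c y)
     v = solve 3 (\ c x y -> con (Z.+ 1) :+ c :* x :- (con (Z.+ 1) :+ c :* y) := c :* (x :- y)) refl
   go : (∃ \ n -> K * (ι c ^ 4 * ι 4) ≤ ι n) -> e ≈ (\ T s -> rl (main T s))
   go (n , K≤) = n , 2 N.+ c , \ T l -> T , \ s T≤s -> point T s (&N (m≤m+n 2 c) l) (&N (m≤n+m c 2) l) T≤s where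
    point : ∀ T s -> 2 N.≤ T -> c N.≤ T -> T N.≤ s -> Rel (e T s) (rl (main T s)) (tε n T)
    point T s 2T c≤T T≤s = tε-nn n T , ≤= (N-pos-<< (<<m (close 2T s) bound)) (& (swap* _ _ _ _) (ap (tε n T * tε n T *_) (! (N-rl _)))) where
     1T = &N {1} z<s 2T
     T⁻ = inv (ι T)
     t≥0 : 0# ≤ T⁻
     t≥0 = inv-nn (ι-pos 1T)
     X = main T s
     X0 : 0# ≤ X
     X0 = <& 0≤1 (1≤main 2T s)
     T³ : ι T * ι T * ι T ~ ι T ^ 4 * T⁻
     T³ = ! (& (qq (ι T) T⁻) (& (ap (ι T * ι T * ι T *_) (inv-r (ι-pos 1T))) (*1r _))) where
      qq : ∀ x t -> x ^ 4 * t ~ x * x * x * (x * t)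
      qq = #n21
     bound : K * (ι T * ι T * ι T) ≤ tε n T * X
     bound = =≤ (ap (K *_) T³) (<& (*l K0 (*r t≥0 (main-large 2T s T≤s c≤T))) (=≤ (#n22 K (ι c ^ 4 * ι 4) X T⁻) (*r X0 (*r t≥0 K≤))))

module B15 where
 open Rationals
 open Gauss
 open B6
 open B7
 open B8
 open B9
 open B13

 opaque
  unfolding Qr
  #o1 : ∀ x z -> 1# - x ~ 1# - z + (z - x)
  #o1 = auto Qr
  #o2 : ∀ x -> 1# ~ 1# - x + x
  #o2 = auto Qr
  #o3 : ∀ x -> 1# - (1# - x) ~ x
  #o3 = auto Qr
  #o4 : ∀ a b -> a - (1# - b) ~ b - (1# - a)
  #o4 = auto Qr
  #o5 : ∀ k y i -> k * (y * i) ~ y * (k * i)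
  #o5 = auto Qr
  #o6 : ∀ y K p s -> y * (2# * (K * p * s)) ~ 2# * K * p * (y * s)
  #o6 = auto Qr
  #o7 : ∀ K p -> (1# + K * p) * (1# - p) ~ 1# + p * (K * (1# - p) - 1#)
  #o7 = auto Qr

 private
  1- : ∀ {x z} -> x ≤ z -> 1# - z ≤ 1# - x
  1- {x} {z} q = le (z - x) (diff q) (#o1 x z)
  1-nn≤1 : ∀ {x} n -> 0# ≤ x -> x ≤ 1# -> 0# ≤ 1# - x ^ n × 1# - x ^ n ≤ 1#
  1-nn≤1 {x} n p q = diff (^-≤1 n p q) , le (x ^ n) (^n n p) (#o2 (x ^ n))

 F-nn : ∀ m {x} -> 0# ≤ x -> x ≤ 1# -> 0# ≤ F m x
 F-nn m p q = prod-nn m \ n -> fst (1-nn≤1 (S n) p q)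

 F≤1 : ∀ m {x} -> 0# ≤ x -> x ≤ 1# -> F m x ≤ 1#
 F≤1 m p q = ≤= (prod-mono m (\ n -> fst (1-nn≤1 (S n) p q)) \ n _ -> snd (1-nn≤1 (S n) p q)) (ΠQ.fold-ε m)

 F-dilate-upper : ∀ M c {x} -> 0# ≤ x -> x ≤ 1# -> F (M N.* c) x ≤ F M (x ^ c) ^ c
 F-dilate-upper M c {x} p q = =≤ (ΠQ.blocks M c _) (≤= (prod-mono M (\ i -> prod-nn c \ j -> fst (1-nn≤1 (S (i N.* c N.+ j)) p q)) \ i _ →
  ≤= (prod-mono c (\ j -> fst (1-nn≤1 (S (i N.* c N.+ j)) p q)) \ j j<c -> 1- (=≤ (! (^-^ x (S i) c)) (^-anti p q (exp i j j<c)))) (prod-const c (1# - (x ^ c) ^ S i))) (prod-^ M _ c)) where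
  exp : ∀ i j -> j N.< c -> S (i N.* c N.+ j) N.≤ S i N.* c
  exp i j l = &N (≡N (! (+-suc (i N.* c) j))) (&N (+-monoʳ-≤ (i N.* c) l) (≡N (NP.+-comm (i N.* c) c)))

 F-dilate-lower : ∀ M c {x} -> 0# ≤ x -> x ≤ 1# -> (1# - x) ^ c * F M (x ^ c) ^ c ≤ F (M N.* c) x
 F-dilate-lower M c {x} p q = ≤= (go M) (! (ΠQ.blocks M c _)) where
  inner : ℕ -> Q
  inner i = prod c (\ j -> 1# - x ^ S (i N.* c N.+ j))
  1-x≥0 : 0# ≤ 1# - x
  1-x≥0 = diff q
  1-x≤1 : 1# - x ≤ 1#
  1-x≤1 = tr (\ y -> 1# - y ≤ 1#) (*1r x) (snd (1-nn≤1 1 p q))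
  xc = x ^ c
  xc0 : 0# ≤ xc
  xc0 = ^n c p
  xc≤1 : xc ≤ 1#
  xc≤1 = ^-≤1 c p q
  inner-suc : ∀ i -> (1# - xc ^ S i) ^ c ≤ inner (S i)
  inner-suc i = =≤ (! (prod-const c _)) (prod-mono c (\ _ -> fst (1-nn≤1 (S i) xc0 xc≤1)) \ j _ -> 1- (≤= (^-anti p q (&N (m≤m+n (S i N.* c) j) (n≤1+n _))) (^-^ x (S i) c)))
  inner-0 : (1# - x) ^ c ≤ inner 0
  inner-0 = =≤ (! (prod-const c _)) (prod-mono c (\ _ -> 1-x≥0) \ j _ -> 1- (≤= (*l p (^-≤1 j p q)) (*1r x)))
  go : ∀ M -> (1# - x) ^ c * F M xc ^ c ≤ prod M inner
  go zero = ≤= (*-mono (^n c 1-x≥0) (^-≤1 c 1-x≥0 1-x≤1) (^n c 0≤1) (≤r (^-1 c))) (*1r 1#)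
  go (S M) = ≤= (*-mono (^n c 1-x≥0) inner-0 (^n c (F-nn (S M) xc0 xc≤1)) (<& (≤= (^-mono c (F-nn (S M) xc0 xc≤1) (≤= (*l (F-nn M xc0 xc≤1) (snd (1-nn≤1 (S M) xc0 xc≤1))) (*1r _))) (! (prod-^ M _ c)))
   (prod-mono M (\ i -> ^n c (fst (1-nn≤1 (S i) xc0 xc≤1))) \ i _ -> inner-suc i))) (! (ΠQ.front M inner))

 1-^≤ : ∀ {x} n -> 0# ≤ x -> x ≤ 1# -> 1# - x ^ n ≤ ι n * (1# - x)
 1-^≤ {x} n p q = undiff (tr (0# ≤_) (#o4 (x ^ n) (ι n * (1# - x))) (diff (≤= (bernoulli n (diff q) (tr (\ y -> 1# - y ≤ 1#) (*1r x) (snd (1-nn≤1 1 p q)))) (ap (_^ n) (#o3 x)))))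

 F-small : ∀ k m {x} -> 0# ≤ x -> x ≤ 1# -> k N.≤ m -> F m x ≤ (ι k * (1# - x)) ^ k
 F-small k m {x} p q l = tr (\ n -> F n x ≤ (ι k * (1# - x)) ^ k) (m+[n∸m]≡n l) (=≤ (ΠQ.split k (m ∸ k) _) (≤= (*-mono (F-nn k p q) first (prod-nn (m ∸ k) \ n -> fst (1-nn≤1 (S (k N.+ n)) p q))
  (≤= (prod-mono (m ∸ k) (\ n -> fst (1-nn≤1 (S (k N.+ n)) p q)) \ n _ -> snd (1-nn≤1 (S (k N.+ n)) p q)) (ΠQ.fold-ε (m ∸ k)))) (*1r _))) where
  first : F k x ≤ (ι k * (1# - x)) ^ k
  first = ≤= (prod-mono k (\ n -> fst (1-nn≤1 (S n) p q)) \ n n<k -> <& (1-^≤ (S n) p q) (*r (diff q) (ι-mono n<k))) (prod-const k _)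

 prod-bounded : ∀ {x K} -> 0# ≤ x -> x < 1# -> 0# ≤ K -> ∃ \ B -> 0# ≤ B × (∀ m -> prod m (\ n -> 1# + K * x ^ S n) ≤ B)
 prod-bounded {x} {K} x≥0 x<1 K0 = go (power-small x≥0 x<1 ε>0) where
  y = 1# - x
  y>0 : 0# < y
  y>0 z = x<1 (=≤ (#o2 x) (≤= (+m z r≤) (+-idl x)))
  2K = 2# * K + 1#
  2K>0 : 0# < 2K
  2K>0 = p≤ 0<1 (y≤x+y (nn* 0≤2 K0))
  ε = y * inv 2K
  ε>0 : 0# < ε
  ε>0 = pp* y>0 (inv-pos 2K>0)
  u : ℕ -> Q
  u n = K * x ^ S n
  u≥0 : ∀ n -> 0# ≤ u n
  u≥0 n = nn* K0 (^n (S n) x≥0)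
  1≤1+u : ∀ n -> 1# ≤ 1# + u n
  1≤1+u n = x≤x+y (u≥0 n)
  go : (∃ \ n₀ -> ∀ n -> n₀ N.≤ n -> x ^ n ≤ ε) -> _
  go (n₀ , h) = H * 2# , nn* H0 0≤2 , \ m -> <& (mono m) (=≤ (ΠQ.split n₀ m _) (*l H0 (tail m))) where
   H = prod n₀ (\ n -> 1# + u n)
   H0 : 0# ≤ H
   H0 = prod-nn n₀ \ n -> <& 0≤1 (1≤1+u n)
   mono : ∀ m -> prod m (\ n -> 1# + u n) ≤ prod (n₀ N.+ m) (\ n -> 1# + u n)
   mono m = tr (\ k -> prod m (\ n -> 1# + u n) ≤ prod k (\ n -> 1# + u n)) (NP.+-comm m n₀) (≤= (=≤ (! (*1r _)) (*l (prod-nn m \ n -> <& 0≤1 (1≤1+u n))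
    (=≤ (! (ΠQ.fold-ε n₀)) (prod-mono n₀ (\ _ -> 0≤1) \ n _ -> 1≤1+u (m N.+ n))))) (! (ΠQ.split m n₀ _)))
   small : ∀ m -> 2# * sum m (\ n -> u (n₀ N.+ n)) ≤ 1#
   small m = *x y>0 (=≤ (& (ap (\ z -> y * (2# * z)) (& (ΣQ.cong-f m \ n -> & (ap (K *_) (& (ap (x *_) (^-+ x n₀ n)) (! (*-assoc x _ _)))) (! *a)) (sum-*ˡ m (K * (x * x ^ n₀)) (x ^_)))) (#o6 y K (x * x ^ n₀) (sum m (x ^_))))
    (<& (*-mono (nn* (nn* 0≤2 K0) (^n (S n₀) x≥0)) (*l (nn* 0≤2 K0) (h (S n₀) (n≤1+n n₀))) (nn* (lt y>0) (sum-nn m \ k -> ^n k x≥0)) (=≤ (geom m x) (snd (1-nn≤1 m x≥0 (lt x<1)))))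
     (=≤ (*1r _) (≤= (*r (lt ε>0) (x≤x+y 0≤1)) (& (#o5 2K y (inv 2K)) (& (ap (y *_) (inv-r 2K>0)) refl))))))
   tail : ∀ m -> prod m (\ n -> 1# + u (n₀ N.+ n)) ≤ 2#
   tail m = <& (prod1+ m (\ n -> u≥0 (n₀ N.+ n)) (small m)) (+m r≤ (small m))

 F-lower : ∀ {x} -> 0# ≤ x -> x < 1# -> ∃ \ B -> 0# ≤ B × (∀ m -> 1# ≤ B * F m x)
 F-lower {x} x≥0 x<1 = go (prod-bounded {x} {K} x≥0 x<1 (inv-nn y>0)) where
  y = 1# - x
  y>0 : 0# < y
  y>0 z = x<1 (=≤ (#o2 x) (≤= (+m z r≤) (+-idl x)))
  K = inv y
  factor : ∀ n -> 1# ≤ (1# + K * x ^ S n) * (1# - x ^ S n)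
  factor n = le (p * (K * (1# - p) - 1#)) (nn* (^n (S n) x≥0) (diff (=≤ (! (& (*-comm K y) (inv-r y>0))) (*l (inv-nn y>0) (1- p≤x))))) (#o7 K p) where
   p = x ^ S n
   p≤x : p ≤ x
   p≤x = ≤= (*l x≥0 (^-≤1 n x≥0 (lt x<1))) (*1r x)
  go : (∃ \ B -> 0# ≤ B × (∀ m -> prod m (\ n -> 1# + K * x ^ S n) ≤ B)) -> ∃ \ B -> 0# ≤ B × (∀ m -> 1# ≤ B * F m x)
  go (B , B0 , h) = B , B0 , \ m -> <& (=≤ (! (ΠQ.fold-ε m)) (≤= (prod-mono m (\ _ -> 0≤1) \ n _ -> factor n) (ΠQ.distr m _ _))) (*r (F-nn m x≥0 (lt x<1)) (h m))

 infix 4 _⊴_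
 _⊴_ : (ℕ -> ℕ -> Q) -> (ℕ -> ℕ -> Q) -> Set
 x ⊴ y = ∃ \ c -> Ev (\ T s -> x T s ≤ ι T ^ c * y T s)

 ⊴-≤ : ∀ {x y} -> Ev (\ T s -> x T s ≤ y T s) -> x ⊴ y
 ⊴-≤ h = 0 , Evm (\ T s p -> ≤= p (! (*1l _))) h

 ⊴-trans : ∀ {x y z} -> x ⊴ y -> y ⊴ z -> x ⊴ z
 ⊴-trans {x} {y} {z} (c , p) (d , q) = c N.+ d , Evm2 (\ T s u v -> <& u (≤= (*l (^n c (ι-nn T)) v) (& (! *a) (ap (_* z T s) (! (^-+ (ι T) c d)))))) p q

 ⊴-* : ∀ {x y u v : ℕ -> ℕ -> Q} -> Ev (\ T s -> 0# ≤ x T s) -> Ev (\ T s -> 0# ≤ u T s) -> x ⊴ y -> u ⊴ v -> (\ T s -> x T s * u T s) ⊴ (\ T s -> y T s * v T s)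
 ⊴-* {x} {y} {u} {v} xn un (c , p) (d , q) = c N.+ d , Evm2 (\ T s (a , b) (i , j) -> ≤= (*-mono a i b j) (& (swap* _ _ _ _) (ap (_* (y T s * v T s)) (! (^-+ (ι T) c d))))) (Ev-∧ xn un) (Ev-∧ p q)

 ⊴-^ : ∀ {x y} n -> Ev (\ T s -> 0# ≤ x T s) -> x ⊴ y -> (\ T s -> x T s ^ n) ⊴ (\ T s -> y T s ^ n)
 ⊴-^ {x} {y} n xn (c , p) = n N.* c , Evm2 (\ T s a i -> ≤= (^-mono n a i) (& (*-^ _ _ n) (ap (_* y T s ^ n) (! (^-^ (ι T) n c))))) xn p

 ⊴-root : ∀ {x y} n -> Ev (\ T s -> 0# ≤ y T s) -> (\ T s -> x T s ^ S n) ⊴ (\ T s -> y T s ^ S n) -> x ⊴ y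
 ⊴-root {x} {y} n yn (c , p) = c , Evm2 (\ T s (b , 1T) i -> ^-cancel n (nn* (^n c (ι-nn T)) b) (<& i (≤= (*r (^n (S n) b) (big T 1T)) (! (*-^ _ _ (S n)))))) (Ev-∧ yn (Ev-T≥ 1)) p where
  big : ∀ T -> 1 N.≤ T -> ι T ^ c ≤ (ι T ^ c) ^ S n
  big T 1T = =≤ (! (*1r _)) (*l (^n c (ι-nn T)) (1≤^ n (1≤^ c (1≤ι 1T))))

 ⊴-const : ∀ {x y} K -> Ev (\ T s -> 0# ≤ y T s) -> Ev (\ T s -> x T s ≤ ι K * y T s) -> x ⊴ y
 ⊴-const {x} {y} K yn h = 1 , Evm2 (\ T s (b , l) i -> <& i (*r b (≤= (ι-mono l) (! (*1r _))))) (Ev-∧ yn (Ev-T≥ K)) h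

 infix 4 _⋈_
 _⋈_ : (ℕ -> ℕ -> Q) -> (ℕ -> ℕ -> Q) -> Set
 x ⋈ y = (Ev (\ T s -> 0# ≤ x T s) × Ev (\ T s -> 0# ≤ y T s)) × (x ⊴ y × y ⊴ x)

 ⋈-sym : ∀ {x y} -> x ⋈ y -> y ⋈ x
 ⋈-sym ((a , b) , (p , q)) = (b , a) , (q , p)

 ⋈t : ∀ {x y z} -> x ⋈ y -> y ⋈ z -> x ⋈ z
 ⋈t {x} {y} {z} ((a , _) , (p , p')) ((_ , b) , (q , q')) = (a , b) , (⊴-trans {x} {y} {z} p q , ⊴-trans {z} {y} {x} q' p')

 ⋈-≡ : ∀ {x y : ℕ -> ℕ -> Q} -> Ev (\ T s -> 0# ≤ x T s) -> Ev (\ T s -> x T s ~ y T s) -> x ⋈ y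
 ⋈-≡ {x} {y} a h = (a , Evm2 (\ T s -> tr (0# ≤_)) h a) , (⊴-≤ {x} {y} (Evm (\ T s -> ≤r) h) , ⊴-≤ {y} {x} (Evm (\ T s p -> ≤r (! p)) h))

 ⋈-refl : ∀ {x : ℕ -> ℕ -> Q} -> Ev (\ T s -> 0# ≤ x T s) -> x ⋈ x
 ⋈-refl {x} a = ⋈-≡ {x} {x} a (Ev! \ _ _ -> refl)

 ≍⇒⋈ : ∀ {x y} -> Ev (\ T s -> 0# ≤ x T s) -> Ev (\ T s -> 0# ≤ y T s) -> x ≍ y -> x ⋈ y
 ≍⇒⋈ {x} {y} xn yn (K , h) = (xn , yn) , (⊴-const {x} {y} K yn (Evm (\ T s -> fst) h) , ⊴-const {y} {x} K xn (Evm (\ T s -> snd) h))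

 ⋈-* : ∀ {x y u v : ℕ -> ℕ -> Q} -> x ⋈ y -> u ⋈ v -> (\ T s -> x T s * u T s) ⋈ (\ T s -> y T s * v T s)
 ⋈-* {x} {y} {u} {v} ((a , b) , (p , p')) ((c , d) , (q , q')) = (Evm2 (\ T s -> nn*) a c , Evm2 (\ T s -> nn*) b d) , (⊴-* {x} {y} {u} {v} a c p q , ⊴-* {y} {x} {v} {u} b d p' q')

 ⋈-^ : ∀ {x y} n -> x ⋈ y -> (\ T s -> x T s ^ n) ⋈ (\ T s -> y T s ^ n)
 ⋈-^ {x} {y} n ((a , b) , (p , q)) = (Evm (\ T s -> ^n n) a , Evm (\ T s -> ^n n) b) , (⊴-^ {x} {y} n a p , ⊴-^ {y} {x} n b q)

 ⋈-root : ∀ {x y} n -> Ev (\ T s -> 0# ≤ x T s) -> Ev (\ T s -> 0# ≤ y T s) -> (\ T s -> x T s ^ S n) ⋈ (\ T s -> y T s ^ S n) -> x ⋈ y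
 ⋈-root {x} {y} n a b (_ , (p , q)) = (a , b) , (⊴-root {x} {y} n b p , ⊴-root {y} {x} n a q)

 ⋈1 : ∀ {x} K k -> Ev (\ T s -> 1# ≤ x T s × x T s ≤ ι K * ι T ^ k) -> x ⋈ (\ _ _ -> 1#)
 ⋈1 {x} K k h = (Evm (\ T s (p , _) -> <& 0≤1 p) h , Ev! \ _ _ -> 0≤1) , ((S k , Evm2 (\ T s l (_ , q) -> <& q (≤= (*r (^n k (ι-nn T)) (ι-mono l)) (! (*1r _)))) (Ev-T≥ K) h) ,
  ⊴-≤ {\ _ _ -> 1#} {x} (Evm (\ T s -> fst) h))

module B16 where
 open Rationals
 open Gauss
 open Roots
 open B5
 open B6
 open B7
 open B8
 open B9
 open B11
 open B12
 open B13
 open B14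
 open B15
 open import Defs
 open Z using (ℤ)
 open import Data.Nat.DivMod using (_%_; m*n%n≡0)

 opaque
  unfolding Qr
  #p1 : ∀ x -> 1# - x + x ~ 1#
  #p1 = auto Qr
  #p2 : ∀ x z -> 1# - z ~ 1# - x + (x - z)
  #p2 = auto Qr
  #p4 : ∀ T t SS -> T * t * (T * t) * (T * t * (T * t)) * SS ~ T * T * (T * T) * (t * (t * (t * (t * SS))))
  #p4 = auto Qr
  #p5 : ∀ n k r -> n * k * (n * k) * r ~ n * n * r * (k * k)
  #p5 = auto Qr
  #p7 : ∀ u e k -> u * k + 4# * (4# * (e * k)) ~ (u + 4# * (4# * e)) * k
  #p7 = auto Qr
  #p8 : ∀ n w c k -> n * w * (c * (k * k)) ~ n * k * (w * c * k)
  #p8 = auto Qr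
  #p9 : ∀ x s n δ -> (1# + s) * (x * (n * 2# + 1#) + 2#) * δ ~ x * (1# + s) * (n * (δ + δ) + δ) + δ + δ + s * 2# * δ
  #p9 = auto Qr

 #p3 : ∀ h n a d -> h N.* (n N.* (a N.* d)) ~ h N.* n N.* d N.* a
 #p3 = nsolve
 #p6 : ∀ s a d -> s N.* (a N.* d) ~ d N.* s N.* a
 #p6 = nsolve
 #p10 : ∀ d s a -> d N.* s N.* a ~ d N.* a N.* s
 #p10 = nsolve

 cleared : Poly2 -> C -> C -> C -> C -> C
 cleared P e b e' b' = sumc (S (bound P)) (\ j -> sumc (S (bound P)) (\ k -> rl (κ (coeff P j k)) *c
  ((e ^c (3 N.* j) *c b ^c (bound P ∸ j)) *c (e' ^c (3 N.* k) *c b' ^c (bound P ∸ k)))))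

 r0<1 : ∀ {T} -> 2 N.≤ T -> r0 T < 1#
 r0<1 {T} 2T p = inv-pos (ι-pos {T} (&N z<s 2T)) (+-cancelr {z = r0 T} (=≤ (& (ap (_+ r0 T) (! (1-r0 2T))) (#p1 (r0 T))) (≤= p (! (+-idl _)))))

 -- The side of j(q^N): q^N is a positive real.
 module RealSide (a' d' : ℕ) where
  open Table a' d'
  Lv : ℕ
  Lv = a N.* d
  Bq : ℕ -> Q
  Bq T = r0 T ^ Lv * r0 T ^ Lv
  δc : ℕ -> ℕ -> ℕ -> C
  δc c T s = (rl (Bq T ^ 1) *c 1c) *c prodc (a N.* s) (\ n -> (1c -c rl (Bq T ^ S n) *c 1c) ^c c)
  δr : ℕ -> ℕ -> ℕ -> Q
  δr c T s = Bq T ^ 1 * F (a N.* s) (Bq T) ^ c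
  δ≡ : ∀ c T s -> δc c T s ~ rl (δr c T s)
  δ≡ c T s = & (ap2 _*c_ (*c1r _) (& (prodc-^ (a N.* s) _ c) (& (ap (_^c c) (& (ΠC.cong-f (a N.* s) \ n -> ap (\ u -> 1c -c u) (*c1r _)) (rl-F (a N.* s) (Bq T)))) (! (rl-^ _ c))))) (! (rl-* _ _))
  e'c : ℕ -> ℕ -> C
  e'c T s = 1c +c rl c240 *c sumc (a N.* s) (\ j -> sumc (a N.* s) (\ k -> rl (cube (S j)) *c (rl (Bq T ^ (S j N.* S k)) *c 1c)))
  e'r : ℕ -> ℕ -> Q
  e'r T s = 1# + c240 * sum (a N.* s) (\ j -> sum (a N.* s) (\ k -> cube (S j) * Bq T ^ (S j N.* S k)))
  e'≡ : ∀ T s -> e'c T s ~ rl (e'r T s)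
  e'≡ T s = ! (& (rl-+ 1# _) (ap2 _+c_ rl-1 (& (rl-* _ _) (ap (rl c240 *c_) (& (rl-sum (a N.* s) _) (ΣC.cong-f (a N.* s) \ j -> & (rl-sum (a N.* s) _) (ΣC.cong-f (a N.* s) \ k -> & (rl-* _ _) (ap (rl (cube (S j)) *c_) (! (*c1r _))))))))))
  Lv1 : 1 N.≤ Lv
  Lv1 = s≤s z≤n
  module _ {T} (2T : 2 N.≤ T) where
   private
    x≥0 : 0# ≤ r0 T
    x≥0 = lt (r0>0 2T)
    y = r0 T ^ Lv
    y≥0 : 0# ≤ y
    y≥0 = ^n Lv x≥0
    y≤1 : y ≤ 1#
    y≤1 = ^-≤1 Lv x≥0 (r0≤1 2T)
   y≤r0 : r0 T ^ Lv ≤ r0 T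
   y≤r0 = ≤= (^-anti {m = 1} {n = Lv} x≥0 (r0≤1 2T) Lv1) (*1r _)
   Bq>0 : 0# < Bq T
   Bq>0 = pp* (^-pos Lv (r0>0 2T)) (^-pos Lv (r0>0 2T))
   Bq≤ : Bq T ≤ r0 T
   Bq≤ = <& (≤= (*l y≥0 y≤1) (*1r y)) y≤r0
   Bq<1 : Bq T < 1#
   Bq<1 p = r0<1 2T (<& p Bq≤)
   gap : ∀ {z} -> z ≤ r0 T -> inv (ι T) ≤ 1# - z
   gap {z} l = =≤ (! (1-r0 2T)) (le (r0 T - z) (diff l) (#p2 (r0 T) z))
   1≤e'r : ∀ s -> 1# ≤ e'r T s
   1≤e'r s = x≤x+y (nn* c240-nn (sum-nn (a N.* s) \ j -> sum-nn (a N.* s) \ k -> nn* (cube-nn (S j)) (^n (S j N.* S k) (lt Bq>0))))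
   e'r≤ : ∀ s -> e'r T s ≤ 1# + c240 * (6# * ι T ^ 5)
   e'r≤ s = +m r≤ (*l c240-nn (e4Sum-≤ (&N z<s 2T) (lt Bq>0) (lt Bq<1) (gap Bq≤) (a N.* s)))

 module Evaluation (a' d' h h' : ℕ) (hh' : (h N.* h') % S a' ~ 1 % S a') where
  open Beta a' d' h h' hh'
  open MainTerm a' d' using (Mx)
  open Eisenstein a' d' h h' hh' using (e)
  open RealSide a' d'
  private
   z₀ : ℕ -> ℕ -> C
   z₀ s n = ζt s (h N.* n)
   z0-mul : ∀ s k n -> z₀ s (k N.+ n) -c z₀ s k *c z₀ s n << 4# * (4# * tol s)
   z0-mul s k n = tr (\ x -> ζt s x -c z₀ s k *c z₀ s n << 4# * (4# * tol s)) (! (*-distribˡ-+ h k n)) (ζt-mul s (h N.* k) (h N.* n))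
   z0-multiple : ∀ s n x -> h N.* n ~ x N.* a -> z₀ s n ~ 1c
   z0-multiple s n x p = & (ap (zt s) (& (ap (_% a) p) (m*n%n≡0 x a))) (zt-0 s)
   assoc : ∀ n -> h N.* (n N.* Lv) ~ h N.* n N.* d N.* a
   assoc n = #p3 h n a d
   η0 : ∀ s -> 0# ≤ 4# * (4# * tol s)
   η0 s = nn* 0≤4 (nn* 0≤4 (tol-nn s))
  module At {T} (2T : 2 N.≤ T) (P : Poly2) (van : ∀ n -> clearedEval P Lv n ~ 0Z) where
   1T : 1 N.≤ T
   1T = &N z<s 2T
   t₁ = inv (ι T)
   SS : Q
   SS = 6# * ι T ^ 5
   decay-sq : ∀ s -> r0 T ^ s ≤ 6# * (ι T * ι T * (ι T * ι T)) * (1/ s * 1/ s)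
   decay-sq s = =≤ (& (! (*1l _)) (& (ap (_* r0 T ^ s) (! one)) (#p5 (ι (S s)) (1/ s) (r0 T ^ s)))) (*r (nnsq _) (<& (<& (*r (^n s x≥0) sq≤) term) sum≤)) where
    x≥0 = lt (r0>0 2T)
    Σ3 = sum (S s) (\ k -> rise3 k * r0 T ^ k)
    one : ι (S s) * 1/ s * (ι (S s) * 1/ s) ~ 1#
    one = & (ap (\ z -> z * z) (ι*1/ s)) (*1l 1#)
    sq≤ : ι (S s) * ι (S s) ≤ rise3 s
    sq≤ = <& (*l (ι-nn (S s)) (ι-mono (n≤1+n (S s)))) (=≤ (! (*1r _)) (*l (rise2-nn s) (1≤ι {S (S (S s))} z<s)))
    term : rise3 s * r0 T ^ s ≤ Σ3
    term = y≤x+y (sum-nn s \ k -> nn* (rise3-nn k) (^n k x≥0))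
    Tt = inv-r (ι-pos 1T)
    sum≤ : Σ3 ≤ 6# * (ι T * ι T * (ι T * ι T))
    sum≤ = =≤ (& (! (*1l Σ3)) (& (ap (_* Σ3) (! one′)) (#p4 (ι T) t₁ Σ3))) (≤= (*l (nnsq _) (tr (\ y -> y * (y * (y * (y * Σ3))) ≤ 6#) (1-r0 2T) (level3 x≥0 (r0≤1 2T) (S s)))) (*-comm _ 6#)) where
     one′ : ι T * t₁ * (ι T * t₁) * (ι T * t₁ * (ι T * t₁)) ~ 1#
     one′ = & (ap (\ z -> z * z * (z * z)) Tt) one″ where
      opaque
       unfolding Qr
       one″ : 1# * 1# * (1# * 1#) ~ 1#
       one″ = refl
   Cδ Cx : Q
   Cδ = 6# * (ι T * ι T * (ι T * ι T)) + 4# * (4# * ε0)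
   Cx = (ι (d N.* a) * (ι 24 * 2# + 1#) + 2#) * Cδ
   eta-bound : ∃ \ B -> 0# ≤ B × (∀ n -> prod n (\ k -> 1# + 1# * r0 T ^ S k) ≤ B)
   eta-bound = prod-bounded (lt (r0>0 2T)) (r0<1 2T) 0≤1
   Bη : Q
   Bη = fst eta-bound ^ 24
   module AtStage (s : ℕ) where
    module DE = DilateEval (r0 T) (r0>0 2T) (r0≤1 2T) (z₀ s) (\ n -> zt-unit s _) (4# * (4# * tol s)) (η0 s) (z0-mul s)
     (z0-multiple s 0 0 (*-zeroʳ h)) Lv Lv1 (\ n -> z0-multiple s (n N.* Lv) (h N.* n N.* d) (assoc n)) s
    module E = DE.E
    module E' = DE.E'
    x0 : Q
    x0 = ι (Mx s) * E.etaErr + E.δ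
    δ'≤ : E'.δ ≤ E.δ
    δ'≤ = +m (≤r (! (^-^ (r0 T) s Lv))) (η0 s)
    E-nn : 0# ≤ E.etaErr
    E-nn = nn+ (nn* (ι-nn 24) (nn+ E.δ0 E.δ0)) E.δ0
    E'≤ : E'.etaErr ≤ E.etaErr
    E'≤ = +m (*l (ι-nn 24) (+m δ'≤ δ'≤)) δ'≤
    δ≤x0 : E.δ ≤ x0
    δ≤x0 = y≤x+y (nn* (ι-nn (Mx s)) E-nn)
    as≤ : a N.* s N.≤ Mx s
    as≤ = &N (≡N (NP.*-comm a s)) (*-monoˡ-≤ a (m≤n*m s d))
    etaMaj≤ : ∀ n -> E.etaMaj n ≤ Bη
    etaMaj≤ n = =≤ (prod-^ n _ 24) (^-mono 24 (prod-nn n \ k -> nn+ 0≤1 (^n (S k) (lt (r0>0 2T)))) (=≤ (ΠQ.cong-f n \ k -> ap (1# +_) (! (*1l _))) (snd (snd eta-bound) n)))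
    etaMaj'≤ : ∀ n -> E'.etaMaj n ≤ Bη
    etaMaj'≤ n = <& (prod-mono n (\ k -> ^n 24 (nn+ 0≤1 (^n (S k) y≥0))) \ k _ -> ^-mono 24 (nn+ 0≤1 (^n (S k) y≥0)) (+m r≤ (^-mono (S k) y≥0 (y≤r0 2T)))) (etaMaj≤ n) where
     y≥0 : 0# ≤ r0 T ^ Lv
     y≥0 = ^n Lv (lt (r0>0 2T))
    aE : E.Approx x0 (1# + c240 * SS) E₄ (e T s)
    aE = E.Approx-mono δ≤x0 r≤ (E.Approx-E4 (Mx s) L≤ (e4Sum-≤ 1T (lt (r0>0 2T)) (r0≤1 2T) (gap 2T r≤))) where
     L≤ : s N.* Lv N.≤ Mx s
     L≤ = ≡N (#p6 s a d)
    aΔ : E.Approx x0 Bη Δ (β 24 T s)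
    aΔ = E.Approx-Δ (Mx s) L≤ etaMaj≤ where
     L≤ : s N.* Lv N.≤ Mx s
     L≤ = ≡N (#p6 s a d)
    aE' : E.Approx x0 (1# + c240 * SS) (dilate Lv E₄) (e'c T s)
    aE' = DE.Approx-dilate (E'.Approx-mono (<& δ'≤ δ≤x0) r≤ (E'.Approx-E4 (a N.* s) (m≤n*m s a) (e4Sum-≤ 1T (^n Lv (lt (r0>0 2T))) (^-≤1 Lv (lt (r0>0 2T)) (r0≤1 2T)) (gap 2T (y≤r0 2T)))))
    aΔ' : E.Approx x0 Bη (dilate Lv Δ) (δc 24 T s)
    aΔ' = DE.Approx-dilate (E'.Approx-mono (+m (<& (*l (ι-nn (a N.* s)) E'≤) (*r E-nn (ι-mono as≤))) δ'≤) r≤ (E'.Approx-Δ (a N.* s) (m≤n*m s a) etaMaj'≤))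
    δ≤ : E.δ ≤ Cδ * (1/ s * 1/ s)
    δ≤ = ≤= (+m (<& (^-anti (lt (r0>0 2T)) (r0≤1 2T) (m≤m*n s Lv)) (decay-sq s)) r≤) (#p7 (6# * (ι T * ι T * (ι T * ι T))) ε0 (1/ s * 1/ s))
    x0≤ : x0 + E.δ ≤ Cx * 1/ s
    x0≤ = <& (+m (+m (*r E-nn (=≤ (& (ap ι (#p10 d s a)) (ι-* (d N.* a) s)) (*l (ι-nn (d N.* a)) (ι-mono (n≤1+n s))))) r≤) r≤)
     (<& (le (ι s * 2# * E.δ) (nn* (nn* (ι-nn s) 0≤2) E.δ0) (#p9 (ι (d N.* a)) (ι s) (ι 24) E.δ))
      (≤= (*l (nn* (ι-nn (S s)) (nn+ (nn* (ι-nn (d N.* a)) (nn+ (nn* (ι-nn 24) 0≤2) 0≤1)) 0≤2)) δ≤) (& (#p8 (ι (S s)) (ι (d N.* a) * (ι 24 * 2# + 1#) + 2#) Cδ (1/ s)) (& (ap (_* (Cx * 1/ s)) (ι*1/ s)) (*1l _)))))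
    small : cleared P (e T s) (β 24 T s) (e'c T s) (δc 24 T s) << E.clearedMaj P Lv aE aΔ aE' aΔ' * (ι (8 N.* bound P N.+ 3) * (x0 + E.δ))
    small = E.vanishing-<< P Lv aE aΔ aE' aΔ' van
   maj : Q
   maj = sum (S (bound P)) (\ j -> sum (S (bound P)) (\ k -> abs (κ (coeff P j k)) *
    (((1# + c240 * SS) ^ (3 N.* j) * Bη ^ (bound P ∸ j)) * ((1# + c240 * SS) ^ (3 N.* k) * Bη ^ (bound P ∸ k)))))
   maj0 : 0# ≤ maj
   maj0 = sum-nn (S (bound P)) \ j -> sum-nn (S (bound P)) \ k -> nn* (abs-nn _) (nn* (nn* (^n (3 N.* j) u) (^n (bound P ∸ j) v)) (nn* (^n (3 N.* k) u) (^n (bound P ∸ k) v))) where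
    u : 0# ≤ 1# + c240 * SS
    u = nn+ 0≤1 (nn* c240-nn (nn* (nn+ 0≤4 0≤2) (^n 5 (ι-nn T))))
    v : 0# ≤ Bη
    v = ^n 24 (fst (snd eta-bound))
   evaluation : ∃ \ K -> 0# ≤ K × (∀ s -> cleared P (e T s) (β 24 T s) (e'c T s) (δc 24 T s) << K * 1/ s)
   evaluation = maj * (ι (8 N.* bound P N.+ 3) * Cx) , nn* maj0 (nn* (ι-nn (8 N.* bound P N.+ 3)) Cx0) ,
    \ s -> <<m (AtStage.small s) (≤= (*l maj0 (*l (ι-nn (8 N.* bound P N.+ 3)) (AtStage.x0≤ s))) (& (ap (maj *_) (! *a)) (! *a))) where
    Cx0 : 0# ≤ Cx
    Cx0 = nn* (nn+ (nn* (ι-nn (d N.* a)) (nn+ (nn* (ι-nn 24) 0≤2) 0≤1)) 0≤2) (nn+ (nn* (nn+ 0≤4 0≤2) (nnsq _)) (nn* 0≤4 (nn* 0≤4 (lt ε0>0))))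

module B17 where
 open Rationals
 open Gauss
 open Roots
 open B5
 open B6
 open B7
 open B8
 open B9
 open B11
 open B12
 open B13
 open B14
 open B15
 open B16
 open import Defs
 open CSolver using (solve; _:*_; _:=_; con)
 open Z using (ℤ)
 open import Data.Nat.DivMod using (_%_)

 opaque
  unfolding Qr
  #q1 : ∀ t c s -> t + c * (s * t) ~ (1# + c * s) * t
  #q1 = auto Qr
  #q2 : ∀ t b i p -> t * (b * (i * p)) ~ b * i * (t * p)
  #q2 = auto Qr
  #q3 : ∀ x i j -> i * i * (x * x * j) ~ x * i * (x * i) * j
  #q3 = auto Qr

 #q4 : ∀ a s d -> a N.* s N.* d ~ d N.* s N.* a
 #q4 = nsolve
 #q5 : ∀ b r k -> b *c (r *c k) ~ r *c (b *c k)
 #q5 = solve 3 (\ b r k -> b :* (r :* k) := r :* (b :* k)) refl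
 #q6 : ∀ z b k -> z *c (b *c k) ~ z *c k *c b
 #q6 = solve 3 (\ z b k -> z :* (b :* k) := z :* k :* b) refl
 #q7 : ∀ z -> 1c *c (1c *c (z *c 1c)) ~ z
 #q7 = solve 1 (\ z -> con (Z.+ 1) :* (con (Z.+ 1) :* (z :* con (Z.+ 1))) := z) refl

 poly-const : ∃ \ K -> 1# + c240 * 6# ≤ ι K
 poly-const = arch _

 poly-≤ : ∀ {T x} -> 1 N.≤ T -> x ≤ 1# + c240 * (6# * ι T ^ 5) -> x ≤ ι (fst poly-const) * ι T ^ 5
 poly-≤ {T} {x} 1T p = <& p (<& (+m (1≤^ 5 (1≤ι 1T)) r≤) (=≤ (#q1 (ι T ^ 5) c240 6#) (*r (^n 5 (ι-nn T)) (snd poly-const))))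

 inv-^* : ∀ {x} n -> 0# < x -> inv x ^ n * x ^ n ~ 1#
 inv-^* {x} n p = & (! (*-^ (inv x) x n)) (& (ap (_^ n) (& (*-comm _ _) (inv-r p))) (^-1 n))

 -- Common scale of the two sides; c stands for the exponent 24.
 module Scale (a' d' c : ℕ) where
  open Table a' d'
  open RealSide a' d'
  x1 : ℕ -> Q
  x1 T = rT T ^ a
  U Φ Y nY : ℕ -> ℕ -> Q
  U T s = F (m s N.* a) (x1 T)
  Φ T s = (U T s * U T s) ^ c
  Y T s = e'r T s ^ 3 * inv (δr c T s)
  nY T s = Y T s * Y T s
  x10 : ∀ {T} -> 2 N.≤ T -> 0# ≤ x1 T
  x10 2T = ^n a (lt (r>0 2T))
  x1<1 : ∀ {T} -> 2 N.≤ T -> x1 T < 1#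
  x1<1 2T = ^-<1 a' (lt (r>0 2T)) (r<1 2T)
  U-nn : Ev (\ T s -> 0# ≤ U T s)
  U-nn = Evm (\ T s 2T -> F-nn (m s N.* a) (x10 2T) (lt (x1<1 2T))) (Ev-T≥ 2)
  Bq≡ : ∀ T -> Bq T ~ rT T ^ Lv
  Bq≡ T = ! (*-^ (r0 T) (r0 T) Lv)
  F-dilate : ∀ (M : ℕ -> ℕ) k -> (\ T s -> F (M s) (x1 T ^ k) ^ k) ⋈ (\ T s -> F (M s N.* k) (x1 T))
  F-dilate M k = (Evm (\ T s 2T -> ^n k (F-nn (M s) (^n k (x10 2T)) (^-≤1 k (x10 2T) (lt (x1<1 2T))))) (Ev-T≥ 2) ,
   Evm (\ T s 2T -> F-nn (M s N.* k) (x10 2T) (lt (x1<1 2T))) (Ev-T≥ 2)) ,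
   ((k , Evm (\ T s 2T -> lower T s 2T) (Ev-T≥ 2)) , ⊴-≤ {\ T s -> F (M s N.* k) (x1 T)} {\ T s -> F (M s) (x1 T ^ k) ^ k} (Evm (\ T s 2T -> F-dilate-upper (M s) k (x10 2T) (lt (x1<1 2T))) (Ev-T≥ 2))) where
   lower : ∀ T s -> 2 N.≤ T -> F (M s) (x1 T ^ k) ^ k ≤ ι T ^ k * F (M s N.* k) (x1 T)
   lower T s 2T = <& (=≤ (! (*1l _)) (*r (^n k (F-nn (M s) (^n k (x10 2T)) (^-≤1 k (x10 2T) (lt (x1<1 2T))))) one)) (=≤ (& (ap (_* F (M s) (x1 T ^ k) ^ k) (*-^ (ι T) _ k)) *a)
    (*l (^n k (ι-nn T)) (F-dilate-lower (M s) k (x10 2T) (lt (x1<1 2T))))) where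
    1T : 1 N.≤ T
    1T = &N z<s 2T
    x≤r0 : x1 T ≤ r0 T
    x≤r0 = <& (^-anti {m = 1} {n = a} (lt (r>0 2T)) (r≤1 2T) z<s) (=≤ (*1r _) (r≤r0 2T))
    one : 1# ≤ (ι T * (1# - x1 T)) ^ k
    one = 1≤^ k (=≤ (! (inv-r (ι-pos 1T))) (*l (ι-nn T) (gap 2T x≤r0)))
  Φ⋈ : ∀ {z : ℕ -> ℕ -> Q} -> z ⋈ U -> (\ T s -> (z T s * z T s) ^ c) ⋈ Φ
  Φ⋈ p = ⋈-^ c (⋈-* p p)
  swap-power : ∀ x n -> ((x * x) ^ c) ^ n ~ (x ^ n * x ^ n) ^ c
  swap-power x n = & (! (^-^ (x * x) n c)) (& (ap ((x * x) ^_) (NP.*-comm n c)) (& (^-^ (x * x) c n) (ap (_^ c) (*-^ x x n))))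
  Φ-small : 1 N.≤ c -> ∀ k -> Ev (\ T s -> ι T ^ k * Φ T s ≤ 1#)
  Φ-small c≥1 k = go (arch (ι B ^ S k)) where
   B = S k N.* (a N.* 2)
   go : (∃ \ n -> ι B ^ S k ≤ ι n) -> Ev (\ T s -> ι T ^ k * Φ T s ≤ 1#)
   go (n , h) = (2 N.+ n) , \ T l -> S k , \ s l' -> point T s (&N (m≤m+n 2 n) l) (&N (m≤n+m n 2) l) l' where
    point : ∀ T s -> 2 N.≤ T -> n N.≤ T -> S k N.≤ s -> ι T ^ k * Φ T s ≤ 1#
    point T s 2T n≤T k<s = <& (*l (^n k (ι-nn T)) (<& Φ≤U U≤)) (=≤ (& (ap (ι T ^ k *_) (*-^ (ι B) (inv (ι T)) (S k))) (#q2 (ι T ^ k) (ι B ^ S k) (inv (ι T)) (inv (ι T) ^ k)))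
     (=≤ (& (ap (\ z -> ι B ^ S k * inv (ι T) * z) (& (*-comm _ _) (inv-^* k (ι-pos 1T)))) (*1r _)) (≤= (*r (inv-nn (ι-pos 1T)) (<& h (ι-mono n≤T))) (inv-r (ι-pos 1T))))) where
     1T : 1 N.≤ T
     1T = &N z<s 2T
     x≥0 = x10 2T
     x≤1 = lt (x1<1 2T)
     M = m s N.* a
     U0 : 0# ≤ U T s
     U0 = F-nn M x≥0 x≤1
     U≤1 : U T s ≤ 1#
     U≤1 = F≤1 M x≥0 x≤1
     Φ≤U : Φ T s ≤ U T s
     Φ≤U = <& (^-anti {m = 1} {n = c} (nn* U0 U0) (≤= (*-mono U0 U≤1 U0 U≤1) (*1r 1#)) c≥1) (=≤ (*1r _) (≤= (*l U0 U≤1) (*1r _)))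
     k≤M : S k N.≤ M
     k≤M = &N k<s (&N (m≤n*m s d) (m≤m*n (m s) a))
     U≤ : U T s ≤ tε B T ^ S k
     U≤ = <& (F-small (S k) M x≥0 x≤1 k≤M) (^-mono (S k) (nn* (ι-nn (S k)) (diff x≤1)) (≤= (*l (ι-nn (S k)) (<& (1-^≤ a (lt (r>0 2T)) (r≤1 2T)) (≤= (*l (ι-nn a) (1-r≤ 2T)) (tε-* 2 a T)))) (tε-* (a N.* 2) (S k) T)))
  δr>0 : Ev (\ T s -> 0# < δr c T s)
  δr>0 = Evm (\ T s 2T -> pp* (^-pos 1 (Bq>0 2T)) (^-pos c (F>0 (a N.* s) (lt (Bq>0 2T)) (Bq<1 2T)))) (Ev-T≥ 2)
  Bq⋈1 : (\ T (s : ℕ) -> Bq T ^ 1 * Bq T ^ 1) ⋈ (\ _ _ -> 1#)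
  Bq⋈1 = ⋈t (⋈-* b b) (⋈-≡ (Ev! \ _ _ -> nn* 0≤1 0≤1) (Ev! \ _ _ -> *1r 1#)) where
   b : (\ T (s : ℕ) -> Bq T ^ 1) ⋈ (\ _ _ -> 1#)
   b = (Evm (\ T s 2T -> ^n 1 (lt (Bq>0 2T))) (Ev-T≥ 2) , Ev! \ _ _ -> 0≤1) , (⊴-≤ {\ T s -> Bq T ^ 1} {\ _ _ -> 1#} (Evm (\ T s 2T -> ^-≤1 1 (lt (Bq>0 2T)) (lt (Bq<1 2T))) (Ev-T≥ 2)) ,
    (Lv , Evm (\ T s T4 -> let 2T = &N {j = 4} (s≤s z<s) T4 in ≤= (1≤^ Lv (<& (r≥½ T4) (*r (lt (r>0 2T)) (ι-mono 2T)))) (& (*-^ (ι T) (rT T) Lv) (ap (ι T ^ Lv *_) (& (! (Bq≡ T)) (! (*1r _)))))) (Ev-T≥ 4)))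
  e'r⋈1 : e'r ⋈ (\ _ _ -> 1#)
  e'r⋈1 = ⋈1 (fst poly-const) 5 (Evm (\ T s 2T -> 1≤e'r 2T s , poly-≤ (&N z<s 2T) (e'r≤ 2T s)) (Ev-T≥ 2))
  cubed : ∀ {z : ℕ -> ℕ -> Q} -> z ⋈ (\ _ _ -> 1#) -> ∀ n -> (\ T s -> z T s ^ n) ⋈ (\ _ _ -> 1#)
  cubed p n = ⋈t (⋈-^ n p) (⋈-≡ (Ev! \ _ _ -> ^n n 0≤1) (Ev! \ _ _ -> ^-1 n))
  1*1 : ∀ {z w : ℕ -> ℕ -> Q} -> z ⋈ (\ _ _ -> 1#) -> w ⋈ (\ _ _ -> 1#) -> (\ T s -> z T s * w T s) ⋈ (\ _ _ -> 1#)
  1*1 p q = ⋈t (⋈-* p q) (⋈-≡ (Ev! \ _ _ -> nn* 0≤1 0≤1) (Ev! \ _ _ -> *1r 1#))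
  inverse-scale : ∀ {z : ℕ -> ℕ -> Q} n -> Ev (\ T s -> 0# < z T s) -> (\ T s -> z T s ^ n) ⋈ Φ -> (\ T s -> inv (z T s) ^ n * Φ T s) ⋈ (\ _ _ -> 1#)
  inverse-scale n z>0 p = ⋈t (⋈-* (⋈-refl (Evm (\ T s q -> ^n n (inv-nn q)) z>0)) (⋈-sym p)) (⋈-≡ (Evm (\ T s q -> nn* (^n n (inv-nn q)) (^n n (lt q))) z>0) (Evm (\ T s -> inv-^* n) z>0))
  nY-scale : (\ T s -> nY T s ^ d * Φ T s) ⋈ (\ _ _ -> 1#)
  nY-scale = ⋈t (⋈-≡ (Evm2 (\ T s p q -> nn* (^n d (nnsq (Y T s))) (^n c (nn* p p))) U-nn U-nn) (Evm (\ T s q -> shape T s q) δr>0))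
   (1*1 (cubed (1*1 (cubed e'r⋈1 3) (cubed e'r⋈1 3)) d) (inverse-scale d (Evm (\ T s p -> pp* p p) δr>0) δ²⋈)) where
   shape : ∀ T s -> 0# < δr c T s -> nY T s ^ d * Φ T s ~ (e'r T s ^ 3 * e'r T s ^ 3) ^ d * (inv (δr c T s * δr c T s) ^ d * Φ T s)
   shape T s p = & (ap (\ z -> z ^ d * Φ T s) (& (swap* _ _ _ _) (ap ((e'r T s ^ 3 * e'r T s ^ 3) *_) inv-sq))) (& (ap (_* Φ T s) (*-^ _ _ d)) *a) where
    δ = δr c T s
    inv-sq : inv δ * inv δ ~ inv (δ * δ)
    inv-sq = & (! (*1r _)) (& (ap (inv δ * inv δ *_) (! (inv-r (pp* p p)))) (& (#q3 δ (inv δ) (inv (δ * δ))) (& (ap (\ z -> z * z * inv (δ * δ)) (inv-r p)) (& (ap (_* inv (δ * δ)) (*1r 1#)) (*1l _)))))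
   Fd⋈ : (\ T s -> F (a N.* s) (Bq T) ^ d) ⋈ U
   Fd⋈ = ⋈t (⋈-≡ (Evm (\ T s 2T -> ^n d (F-nn (a N.* s) (lt (Bq>0 2T)) (lt (Bq<1 2T)))) (Ev-T≥ 2)) (Ev! \ T s -> ap (\ z -> F (a N.* s) z ^ d) (& (Bq≡ T) (& (ap (rT T ^_) (NP.*-comm a d)) (^-^ (rT T) d a)))))
    (⋈t (F-dilate (\ s -> a N.* s) d) (⋈-≡ (Evm (\ T s 2T -> F-nn (a N.* s N.* d) (x10 2T) (lt (x1<1 2T))) (Ev-T≥ 2)) (Ev! \ T s -> ap (\ n -> F n (x1 T)) (#q4 a s d))))
   δ²⋈ : (\ T s -> (δr c T s * δr c T s) ^ d) ⋈ Φ
   δ²⋈ = ⋈t (⋈-≡ (Ev! \ T s -> ^n d (nnsq _)) (Ev! \ T s -> & (ap (_^ d) (& (swap* _ _ _ _) (ap (Bq T ^ 1 * Bq T ^ 1 *_) (! (*-^ _ _ c))))) (& (*-^ _ _ d) (ap ((Bq T ^ 1 * Bq T ^ 1) ^ d *_) (swap-power (F (a N.* s) (Bq T)) d)))))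
    (⋈t (⋈-* (cubed Bq⋈1 d) (Φ⋈ Fd⋈)) (⋈-≡ (Evm (\ T s p -> nn* 0≤1 (^n c (nn* p p))) U-nn) (Ev! \ T s -> *1l _)))
  1≤nY : 1 N.≤ c -> Ev (\ T s -> 1# ≤ nY T s)
  1≤nY c≥1 = Evm2 (\ T s 2T p -> =≤ (! (*1r 1#)) (sq-mono 0≤1 (1≤Y T s 2T p))) (Ev-T≥ 2) δr>0 where
   1≤Y : ∀ T s -> 2 N.≤ T -> 0# < δr c T s -> 1# ≤ Y T s
   1≤Y T s 2T p = =≤ (! (*1r 1#)) (*-mono 0≤1 (1≤^ 3 (1≤e'r 2T s)) 0≤1 (=≤ (! (inv-r p)) (≤= (*r (inv-nn p) δ≤1) (*1l _)))) where
    B0 = lt (Bq>0 2T)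
    B≤1 = lt (Bq<1 2T)
    δ≤1 : δr c T s ≤ 1#
    δ≤1 = ≤= (*-mono (^n 1 B0) (^-≤1 1 B0 B≤1) (^n c (F-nn (a N.* s) B0 B≤1)) (^-≤1 c (F-nn (a N.* s) B0 B≤1) (F≤1 (a N.* s) B0 B≤1))) (*1r 1#)

 -- The point (X, Y) = (j(q), j(q^N)) near the cusp h/a.
 module Curve (a' d' h h' : ℕ) (hh' : (h N.* h') % S a' ~ 1 % S a') (c : ℕ) (c≥1 : 1 N.≤ c) where
  open Beta a' d' h h' hh' public
  open MainTerm a' d' using (main; 1≤main; main≤)
  open Eisenstein a' d' h h' hh' using (e; e≈main)
  open RealSide a' d'
  open Scale a' d' c
  nβ : ℕ -> ℕ -> Q
  nβ T s = N (β c T s)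
  iβ X : ℕ -> ℕ -> C
  iβ T s = rl (inv (nβ T s)) *c cj (β c T s)
  X T s = e T s ^c 3 *c iβ T s
  nX : ℕ -> ℕ -> Q
  nX T s = N (X T s)
  private
   Fa-bounds : ∀ {T} -> 2 N.≤ T -> 0# ≤ (rT T ^ a) ^ a × (rT T ^ a) ^ a < 1#
   Fa-bounds 2T = ^n a (x10 2T) , ^-<1 a' (x10 2T) (x1<1 2T)
   Fa² : ℕ -> ℕ -> Q
   Fa² T s = (Fa T s * Fa T s) ^ c
   Fa²>0 : Ev (\ T s -> 0# < Fa² T s)
   Fa²>0 = Evm (\ T s 2T -> let p = F>0 (m s) (fst (Fa-bounds 2T)) (snd (Fa-bounds 2T)) in ^-pos c (pp* p p)) (Ev-T≥ 2)
  nβ>0 : Ev (\ T s -> 0# < nβ T s)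
  nβ>0 = go (β-size c) where
   go : nβ ≍ Fa² -> Ev (\ T s -> 0# < nβ T s)
   go (K , p) = Evm2 (\ T s q (_ , r) z -> q (<& r (≤= (*l (ι-nn K) z) (*-0ʳ _)))) Fa²>0 p
  β-inverse : ∀ T s -> 0# < nβ T s -> β c T s *c iβ T s ~ 1c
  β-inverse T s p = & (#q5 (β c T s) (rl (inv (nβ T s))) (cj (β c T s))) (& (ap (rl (inv (nβ T s)) *c_) (u*cj _)) (& (! (rl-* _ _)) (& (ap rl (& (*-comm _ _) (inv-r p))) rl-1)))
  N-iβ : ∀ T s -> 0# < nβ T s -> N (iβ T s) ~ inv (nβ T s)
  N-iβ T s p = & (N-* _ _) (& (ap2 _*_ (N-rl _) (N-cj _)) (& *a (& (ap (inv (nβ T s) *_) (& (*-comm _ _) (inv-r p))) (*1r _))))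
  nX≡ : ∀ T s -> 0# < nβ T s -> nX T s ~ N (e T s) ^ 3 * inv (nβ T s)
  nX≡ T s p = & (N-* _ _) (ap2 _*_ (N-^ _ 3) (N-iβ T s p))
  Ne≍ : (\ T s -> N (e T s)) ≍ (\ T s -> main T s * main T s)
  Ne≍ = ≍t (≈⇒≍ e≈main) (≍-≡ \ T s -> N-rl _)
  nX-scale : (\ T s -> nX T s ^ a * Φ T s) ⋈ (\ _ _ -> 1#)
  nX-scale = ⋈t (⋈-≡ (Evm (\ T s p -> nn* (^n a (N-nn (X T s))) (^n c (nn* p p))) U-nn) (Evm (\ T s p -> & (ap (\ z -> z ^ a * Φ T s) (nX≡ T s p)) (& (ap (_* Φ T s) (*-^ _ _ a)) *a)) nβ>0))
   (1*1 (cubed (cubed Ne⋈1 3) a) (inverse-scale a nβ>0 nβ⋈)) where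
   main⋈1 : main ⋈ (\ _ _ -> 1#)
   main⋈1 = ⋈1 (fst poly-const) 5 (Evm (\ T s 2T -> 1≤main 2T s , poly-≤ (&N z<s 2T) (main≤ 2T s)) (Ev-T≥ 2))
   Ne⋈1 : (\ T s -> N (e T s)) ⋈ (\ _ _ -> 1#)
   Ne⋈1 = ⋈t (≍⇒⋈ (Ev! \ T s -> N-nn (e T s)) (Ev! \ T s -> nnsq (main T s)) Ne≍) (1*1 main⋈1 main⋈1)
   nβ⋈ : (\ T s -> nβ T s ^ a) ⋈ Φ
   nβ⋈ = ⋈t (⋈-^ a (≍⇒⋈ (Ev! \ T s -> N-nn (β c T s)) (Evm (\ T s -> lt) Fa²>0) (β-size c))) (⋈t (⋈-≡ (Evm (\ T s p -> ^n a (lt p)) Fa²>0) (Ev! \ T s -> swap-power (Fa T s) a)) (Φ⋈ (F-dilate m a)))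
  -- nX is, up to bounded factors, independent of h
  nX-size : (\ T s -> nX T s * Fa² T s) ≍ (\ T s -> (main T s * main T s) ^ 3)
  nX-size = go (β-size c) (≍-^ 3 (\ T s -> N-nn (e T s)) (\ T s -> nnsq (main T s)) Ne≍) where
   go : nβ ≍ Fa² -> (\ T s -> N (e T s) ^ 3) ≍ (\ T s -> (main T s * main T s) ^ 3) -> _
   go (K , p) q = ≍t (K , Evm2 (\ T s z (u , v) -> tr (\ x -> x * Fa² T s ≤ ι K * N (e T s) ^ 3) (! (nX≡ T s z)) (one T s z u v) , tr (\ x -> N (e T s) ^ 3 ≤ ι K * (x * Fa² T s)) (! (nX≡ T s z)) (two T s z u v)) nβ>0 p) q where
    module _ (T s : ℕ) (z : 0# < nβ T s) (u : nβ T s ≤ ι K * Fa² T s) (v : Fa² T s ≤ ι K * nβ T s) where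
     E³≥0 : 0# ≤ N (e T s) ^ 3
     E³≥0 = ^n 3 (N-nn (e T s))
     opaque
      unfolding Qr
      q1 : ∀ x i k n -> x * i * (k * n) ~ k * x * (n * i)
      q1 = auto Qr
      q2 : ∀ x i k n -> x * (i * (k * n)) ~ k * (x * i * n)
      q2 = auto Qr
     one : N (e T s) ^ 3 * inv (nβ T s) * Fa² T s ≤ ι K * N (e T s) ^ 3
     one = ≤= (*l (nn* E³≥0 (inv-nn z)) v) (& (q1 _ _ (ι K) (nβ T s)) (& (ap (ι K * N (e T s) ^ 3 *_) (inv-r z)) (*1r _)))
     two : N (e T s) ^ 3 ≤ ι K * (N (e T s) ^ 3 * inv (nβ T s) * Fa² T s)
     two = ≤= (=≤ (! (*1r _)) (*l E³≥0 (=≤ (& (! (inv-r z)) (*-comm _ _)) (*l (inv-nn z) u)))) (q2 _ _ (ι K) (Fa² T s))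
  1≤nX : ∃ \ K -> Ev (\ T s -> 1# ≤ ι K * nX T s)
  1≤nX = go nX-size where
   go : (\ T s -> nX T s * Fa² T s) ≍ (\ T s -> (main T s * main T s) ^ 3) -> ∃ \ K -> Ev (\ T s -> 1# ≤ ι K * nX T s)
   go (K , p) = K , Evm2 (\ T s 2T (_ , q) -> <& (<& (1≤^ 3 (=≤ (! (*1r 1#)) (sq-mono 0≤1 (1≤main 2T s)))) q)
    (*l (ι-nn K) (≤= (*l (N-nn (X T s)) (let F0 = F-nn (m s) (fst (Fa-bounds 2T)) (lt (snd (Fa-bounds 2T))) ; F≤ = F≤1 (m s) (fst (Fa-bounds 2T)) (lt (snd (Fa-bounds 2T))) in ^-≤1 c (nn* F0 F0) (≤= (*-mono F0 F≤ F0 F≤) (*1r 1#)))) (*1r _)))) (Ev-T≥ 2) p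
  X-direction : c ~ 24 -> X || (\ _ s -> ζt s h')
  X-direction c≡ = ||-≡ʳ (||-* (||-^ 3 (||-≈ e≈main (||-pos (Evm (\ T s 2T -> p≤ 0<1 (1≤main 2T s)) (Ev-T≥ 2))))) (||-* (||-pos (Evm (\ T s p -> inv-pos p) nβ>0))
   (||-≡ˡ (\ T s -> undo T s) (||-* (||-refl (\ _ s -> ζt s h')) (||-cj (β-direction c c≡))))))
   \ T s -> & (ap2 (\ u v -> u *c (1c *c (ζt s h' *c v))) (1^c 3) cj-1) (#q7 (ζt s h')) where
   undo : ∀ T s -> cj (β c T s) ~ ζt s h' *c cj (β c T s *c ζt s h')
   undo T s = ! (& (ap (ζt s h' *c_) (cj-* _ _)) (& (#q6 (ζt s h') (cj (β c T s)) (cj (ζt s h'))) (& (ap (_*c cj (β c T s)) (cj-unit (zt-unit s _))) (*c1l _))))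

module B18 where
 open Rationals
 open Gauss
 open Roots
 open B5
 open B6
 open B7
 open B8
 open B9
 open B11
 open B12
 open B13
 open B14
 open B15
 open B16
 open B17
 open import Defs
 open CSolver using (solve; _:*_; _:=_)
 open Z using (ℤ)
 open import Data.Nat.DivMod using (_%_)

 opaque
  unfolding Qr
  #r2 : ∀ x -> (1# + x) * (1# + x) ~ x + (1# + x + x * x)
  #r2 = auto Qr
  #r4 : ∀ b k n -> b * (k * n) ~ b * k * n
  #r4 = auto Qr
  #r5 : ∀ c k w -> c * k * w ~ c * w * k
  #r5 = auto Qr
  #r7 : ∀ n x y f -> n * (x * y * f) ~ x * y * n * f
  #r7 = auto Qr
  #r8 : ∀ x f y s p -> x * f * (y * (s * p)) ~ p * (x * f * y * s)
  #r8 = auto Qr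

 #r1 : ∀ x b k y -> x *c b *c (k *c y) ~ x *c y *c (b *c k)
 #r1 = solve 4 (\ x b k y -> x :* b :* (k :* y) := x :* y :* (b :* k)) refl
 #r3 : ∀ k u v x y -> k *c (u *c v) *c (x *c y) ~ k *c (u *c x *c (v *c y))
 #r3 = solve 5 (\ k u v x y -> k :* (u :* v) :* (x :* y) := k :* (u :* x :* (v :* y))) refl
 #r6 : ∀ n b j -> n N.* b N.* j ~ b N.* j N.* n
 #r6 = nsolve

 clear-denominator : ∀ e b i D j -> j N.≤ D -> b *c i ~ 1c -> e ^c (3 N.* j) *c b ^c (D ∸ j) *c i ^c D ~ (e ^c 3 *c i) ^c j
 clear-denominator e b i D j l p = & (ap2 (\ u v -> u *c b ^c (D ∸ j) *c v) (& (ap (e ^c_) (NP.*-comm 3 j)) (^c-^ e j 3)) (& (ap (i ^c_) (! (m∸n+n≡m l))) (^c-+ i (D ∸ j) j)))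
  (& (#r1 ((e ^c 3) ^c j) (b ^c (D ∸ j)) (i ^c (D ∸ j)) (i ^c j)) (& (ap ((e ^c 3) ^c j *c i ^c j *c_) (& (! (*c-^ b i (D ∸ j))) (& (ap (_^c (D ∸ j)) p) (1^c (D ∸ j))))) (& (*c1r _) (! (*c-^ _ i j)))))

 <<-N : ∀ {u x} -> 0# ≤ x -> N u ≤ x -> u << 1# + x
 <<-N {u} {x} p q = nn+ 0≤1 p , <& q (le (1# + x + x * x) (nn+ (nn+ 0≤1 p) (nnsq x)) (#r2 x))

 inv-≤ : ∀ {x y} -> 0# < x -> 1# ≤ y * x -> inv x ≤ y
 inv-≤ {x} {y} p q = =≤ (! (*1l _)) (≤= (*r (inv-nn p) q) (& (*-assoc y x _) (& (ap (y *_) (inv-r p)) (*1r y))))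

 χ-0 : ∀ {A : Set} (D : Dec A) -> χ D 0c ~ 0c
 χ-0 (yes _) = refl
 χ-0 (no _) = refl

 sum-indicator : ∀ D I J u -> (I N.≤ D × J N.≤ D) ⊎ u ~ 0c -> sumc (S D) (\ j -> sumc (S D) (\ k -> χ (j ≟ I) (χ (k ≟ J) u))) ~ u
 sum-indicator D I J u (inr refl) = ΣC.fold-none (S D) \ j _ -> ΣC.fold-none (S D) \ k _ -> & (ap (χ (j ≟ I)) (χ-0 (k ≟ J))) (χ-0 (j ≟ I))
 sum-indicator D I J u (inl (p , q)) = & (ΣC.fold-single (S D) I (s≤s p) \ j _ ne -> ΣC.fold-none (S D) \ k _ -> χ-no (j ≟ I) ne)
  (& (ΣC.fold-single (S D) J (s≤s q) \ k _ ne -> & (χ-yes (I ≟ I) refl) (χ-no (k ≟ J) ne)) (& (χ-yes (I ≟ I) refl) (χ-yes (J ≟ J) refl)))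

 module Relation (a' d' h h' : ℕ) (hh' : (h N.* h') % S a' ~ 1 % S a') (c : ℕ) (c≡ : c ~ 24) (Pol : Poly2)
  (van : ∀ n -> clearedEval Pol (S a' N.* S d') n ~ 0Z) where
  c≥1 : 1 N.≤ c
  c≥1 = tr (1 N.≤_) (! c≡) z<s
  open Curve a' d' h h' hh' c c≥1 public
  open Eisenstein a' d' h h' hh' using (e)
  open RealSide a' d'
  open Scale a' d' c
  Dg : ℕ
  Dg = bound Pol
  mono : ℕ -> ℕ -> ℕ -> ℕ -> C
  mono j k T s = X T s ^c j *c rl (Y T s ^ k)
  relation : ℕ -> ℕ -> C
  relation T s = sumc (S Dg) (\ j -> sumc (S Dg) (\ k -> rl (κ (coeff Pol j k)) *c mono j k T s))
  private
   relation≡ : ∀ T s -> 0# < nβ T s -> 0# < δr c T s -> relation T s ~ cleared Pol (e T s) (β c T s) (e'c T s) (δc c T s) *c (iβ T s ^c Dg *c rl (inv (δr c T s)) ^c Dg)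
   relation≡ T s p q = ! (& (DivisorSums.sumc-*ʳ (S Dg) _ _) (ΣC.cong-< (S Dg) \ j j≤ -> & (DivisorSums.sumc-*ʳ (S Dg) _ _) (ΣC.cong-< (S Dg) \ k k≤ →
    & (#r3 (rl (κ (coeff Pol j k))) (e T s ^c (3 N.* j) *c β c T s ^c (Dg ∸ j)) (e'c T s ^c (3 N.* k) *c δc c T s ^c (Dg ∸ k)) (iβ T s ^c Dg) (rl (inv (δr c T s)) ^c Dg))
     (ap2 (\ u v -> rl (κ (coeff Pol j k)) *c (u *c v)) (clear-denominator (e T s) (β c T s) (iβ T s) Dg j (s≤s⁻¹ j≤) (β-inverse T s p))
      (& (clear-denominator (e'c T s) (δc c T s) (rl (inv (δr c T s))) Dg k (s≤s⁻¹ k≤) (& (ap (_*c rl (inv (δr c T s))) (δ≡ c T s)) (& (! (rl-* _ _)) (& (ap rl (inv-r q)) rl-1))))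
       (! (& (rl-^ (Y T s) k) (ap (_^c k) (& (rl-* _ _) (ap (_*c rl (inv (δr c T s))) (& (rl-^ _ 3) (ap (_^c 3) (! (e'≡ T s)))))))))))))) 
  negligible : ∀ (ε : ℕ -> Q) -> (∀ T -> 2 N.≤ T -> 0# < ε T) -> Ev (\ T s -> relation T s << ε T)
  negligible ε ε>0 = go (β-size c) nβ>0 δr>0 where
   go : nβ ≍ (\ T s -> (Fa T s * Fa T s) ^ c) -> Ev (\ T s -> 0# < nβ T s) -> Ev (\ T s -> 0# < δr c T s) -> Ev (\ T s -> relation T s << ε T)
   go (K , (T₀ , f)) (T1 , g₁) (T2 , g2) = 2 N.+ (T₀ N.+ (T1 N.+ T2)) , \ T l -> at T (&N (m≤m+n 2 _) l) (f T (&N (&N (m≤m+n T₀ _) (m≤n+m _ 2)) l))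
    (g₁ T (&N (&N (&N (m≤m+n T1 T2) (m≤n+m _ T₀)) (m≤n+m _ 2)) l)) (g2 T (&N (&N (&N (m≤n+m T2 T1) (m≤n+m _ T₀)) (m≤n+m _ 2)) l)) where
    at : ∀ T -> 2 N.≤ T -> (∃ \ s0 -> ∀ s -> s0 N.≤ s -> nβ T s ≤ ι K * (Fa T s * Fa T s) ^ c × (Fa T s * Fa T s) ^ c ≤ ι K * nβ T s) -> (∃ \ s0 -> ∀ s -> s0 N.≤ s -> 0# < nβ T s) -> (∃ \ s0 -> ∀ s -> s0 N.≤ s -> 0# < δr c T s) -> ∃ \ s0 -> ∀ s -> s0 N.≤ s -> relation T s << ε T
    at T 2T (s0 , f) (s1 , g₁) (s2 , g2) = finish ev (F-lower (fst y-bounds) (snd y-bounds)) (F-lower (lt (Bq>0 2T)) (Bq<1 2T)) where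
     y-bounds : 0# ≤ x1 T ^ a × x1 T ^ a < 1#
     y-bounds = ^n a (x10 2T) , ^-<1 a' (x10 2T) (x1<1 2T)
     ev : ∃ \ K -> 0# ≤ K × (∀ s -> cleared Pol (e T s) (β c T s) (e'c T s) (δc c T s) << K * 1/ s)
     ev = tr (\ c -> ∃ \ K -> 0# ≤ K × (∀ s -> cleared Pol (e T s) (β c T s) (e'c T s) (δc c T s) << K * 1/ s)) (! c≡) (Evaluation.At.evaluation a' d' h h' hh' 2T Pol van)
     finish : (∃ \ K -> 0# ≤ K × (∀ s -> cleared Pol (e T s) (β c T s) (e'c T s) (δc c T s) << K * 1/ s)) -> (∃ \ B -> 0# ≤ B × (∀ n -> 1# ≤ B * F n (x1 T ^ a))) -> (∃ \ B -> 0# ≤ B × (∀ n -> 1# ≤ B * F n (Bq T))) -> ∃ \ s0 -> ∀ s -> s0 N.≤ s -> relation T s << ε T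
     finish (C1 , C10 , h1) (B , B0 , hB) (B' , B'0 , hB') = fst van′ N.+ (s0 N.+ (s1 N.+ s2)) , \ s l -> final s (&N (m≤m+n (fst van′) _) l) (&N (&N (m≤m+n s0 _) (m≤n+m _ (fst van′))) l)
      (&N (&N (&N (m≤m+n s1 s2) (m≤n+m _ s0)) (m≤n+m _ (fst van′))) l) (&N (&N (&N (m≤n+m s2 s1) (m≤n+m _ s0)) (m≤n+m _ (fst van′))) l) where
      Q1 = (B * B) ^ c * ι K
      Q10 : 0# ≤ Q1
      Q10 = nn* (^n c (nnsq B)) (ι-nn K)
      Q2 = inv (Bq T) ^ 1 * B' ^ c
      Q20 : 0# ≤ Q2
      Q20 = nn* (^n 1 (inv-nn (Bq>0 2T))) (^n c B'0)
      W1 = (1# + Q1) ^ Dg * Q2 ^ Dg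
      van′ = vanishing-1/ (C1 * W1) (ε T) (ε>0 T 2T)
      final : ∀ s -> fst van′ N.≤ s -> s0 N.≤ s -> s1 N.≤ s -> s2 N.≤ s -> relation T s << ε T
      final s l l0 l1 l2 = tr (_<< ε T) (! (relation≡ T s nβ₊ δ₊)) (<<m (<<-* (h1 s) (<<-* (<<-^ Dg iβ<<) (<<-^ Dg iδ<<))) (=≤ (#r5 C1 (1/ s) W1) (snd van′ s l))) where
       nβ₊ = g₁ s l1
       δ₊ = g2 s l2
       f₀ = F (m s) (x1 T ^ a)
       fδ = F (a N.* s) (Bq T)
       inv≤ : inv (nβ T s) ≤ Q1
       inv≤ = inv-≤ nβ₊ (<& (≤= (1≤^ c (=≤ (! (*1r 1#)) (sq-mono 0≤1 (hB (m s))))) (& (ap (_^ c) (swap* B f₀ B f₀)) (*-^ _ _ c))) (≤= (*l (^n c (nnsq B)) (snd (f s l0))) (#r4 _ (ι K) (nβ T s))))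
       iβ<< : iβ T s << 1# + Q1
       iβ<< = <<-N Q10 (=≤ (N-iβ T s nβ₊) inv≤)
       iδ<< : rl (inv (δr c T s)) << Q2
       iδ<< = <<m (<<-rl (inv-nn δ₊)) (inv-≤ δ₊ (≤= (=≤ (! (*1r 1#)) (*-mono 0≤1 (≤r (! (inv-^* 1 (Bq>0 2T)))) 0≤1 (≤= (1≤^ c (hB' (a N.* s))) (*-^ B' fδ c)))) (swap* _ _ _ _)))
  size : ℕ -> ℕ -> ℕ -> ℕ -> Q
  size j k T s = nX T s ^ j * nY T s ^ k
  N-mono : ∀ j k T s -> N (mono j k T s) ~ size j k T s
  N-mono j k T s = & (N-* _ _) (ap2 _*_ (N-^ _ j) (& (N-rl _) (! (*-^ _ _ k))))
  size-nn : ∀ j k T s -> 0# ≤ size j k T s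
  size-nn j k T s = nn* (^n j (N-nn _)) (^n k (nnsq _))
  weight : ℕ -> ℕ -> ℕ
  weight j k = d N.* j N.+ a N.* k
  size-weight : ∀ j k -> (\ T s -> size j k T s ^ Lv * Φ T s ^ weight j k) ⋈ (\ _ _ -> 1#)
  size-weight j k = ⋈t (⋈-≡ (Evm (\ T s u -> nn* (^n Lv (size-nn j k T s)) (^n (weight j k) (^n c (nn* u u)))) U-nn) (Ev! shape)) (1*1 (cubed nX-scale (d N.* j)) (cubed nY-scale (a N.* k))) where
   power : ∀ x n b j -> (x ^ j) ^ (n N.* b) ~ (x ^ n) ^ (b N.* j)
   power x n b j = & (! (^-^ x (n N.* b) j)) (& (ap (x ^_) (#r6 n b j)) (^-^ x (b N.* j) n))
   shape : ∀ T s -> size j k T s ^ Lv * Φ T s ^ weight j k ~ (nX T s ^ a * Φ T s) ^ (d N.* j) * (nY T s ^ d * Φ T s) ^ (a N.* k)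
   shape T s = & (ap2 _*_ (& (*-^ _ _ Lv) (ap2 _*_ (power (nX T s) a d j) (& (ap ((nY T s ^ k) ^_) (NP.*-comm a d)) (power (nY T s) d a k)))) (^-+ (Φ T s) (d N.* j) (a N.* k))) (& (swap* _ _ _ _) (ap2 _*_ (! (*-^ _ _ (d N.* j))) (! (*-^ _ _ (a N.* k)))))
  tT : ℕ -> Q
  tT T = inv (ι T)
  lighter : ∀ j k j0 k0 -> weight j k N.< weight j0 k0 -> ∀ l -> Ev (\ T s -> size j k T s ≤ tT T ^ l * tT T ^ l * size j0 k0 T s)
  lighter j k j0 k0 wt< l = go (size-weight j k) (size-weight j0 k0) where
   wt = weight j k
   wt0 = weight j0 k0
   go : (\ T s -> size j k T s ^ Lv * Φ T s ^ wt) ⋈ (\ _ _ -> 1#) -> (\ T s -> size j0 k0 T s ^ Lv * Φ T s ^ wt0) ⋈ (\ _ _ -> 1#) -> Ev (\ T s -> size j k T s ≤ tT T ^ l * tT T ^ l * size j0 k0 T s)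
   go (_ , ((c1 , p) , _)) (_ , (_ , (c2 , p2))) = Evm2 point (Ev-∧ (Ev-∧ p p2) (Ev-∧ (Ev-T≥ 2) U₊)) (Φ-small c≥1 (c1 N.+ c2 N.+ Lv N.* (l N.+ l))) where
    U₊ : Ev (\ T s -> 0# < U T s)
    U₊ = Evm (\ T s 2T -> F>0 (m s N.* a) (x10 2T) (x1<1 2T)) (Ev-T≥ 2)
    point : ∀ T s -> (size j k T s ^ Lv * Φ T s ^ wt ≤ ι T ^ c1 * 1# × 1# ≤ ι T ^ c2 * (size j0 k0 T s ^ Lv * Φ T s ^ wt0)) × (2 N.≤ T × 0# < U T s) →
     ι T ^ (c1 N.+ c2 N.+ Lv N.* (l N.+ l)) * Φ T s ≤ 1# -> size j k T s ≤ tT T ^ l * tT T ^ l * size j0 k0 T s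
    point T s ((u , v) , (2T , U>0)) small = ^-cancel (d' N.+ a' N.* d) (nn* tl0 (size-nn j0 k0 T s)) (*x {Φ1 ^ wt0} (^-pos wt0 Φ>0)
     (<& (=≤ (& (*-comm _ _) (& (ap (S1 *_) (& (ap (Φ1 ^_) (! (m+[n∸m]≡n (<⇒≤ wt<)))) (^-+ Φ1 wt (wt0 ∸ wt)))) (! *a))) (<& (*-mono (nn* S10 (^n wt (lt Φ>0))) (≤= u (*1r _)) (^n (wt0 ∸ wt) (lt Φ>0)) Φ≤) (=≤ (! (*1r _)) (*l (nn* (^n c1 (ι-nn T)) (lt Φ>0)) v))))
      (=≤ (#r8 (ι T ^ c1) Φ1 (ι T ^ c2) S0 (Φ1 ^ wt0)) (*l (^n wt0 (lt Φ>0)) (≤= (*r S00 small′) (! (*-^ _ _ Lv))))))) where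
     1T : 1 N.≤ T
     1T = &N z<s 2T
     Φ1 = Φ T s
     Φ>0 : 0# < Φ1
     Φ>0 = ^-pos c (pp* U>0 U>0)
     S1 = size j k T s ^ Lv
     S0 = size j0 k0 T s ^ Lv
     S10 : 0# ≤ S1
     S10 = ^n Lv (size-nn j k T s)
     S00 : 0# ≤ S0
     S00 = ^n Lv (size-nn j0 k0 T s)
     t≥0 : 0# ≤ tT T
     t≥0 = inv-nn (ι-pos 1T)
     tl = tT T ^ l * tT T ^ l
     tl0 : 0# ≤ tl
     tl0 = nnsq _
     n1 = c1 N.+ c2
     n₂ = Lv N.* (l N.+ l)
     U≤1 : U T s ≤ 1#
     U≤1 = F≤1 (m s N.* a) (x10 2T) (lt (x1<1 2T))
     Φ≤1 : Φ1 ≤ 1#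
     Φ≤1 = ^-≤1 c (nn* (lt U>0) (lt U>0)) (≤= (*-mono (lt U>0) U≤1 (lt U>0) U≤1) (*1r 1#))
     Φ≤ : Φ1 ^ (wt0 ∸ wt) ≤ Φ1
     Φ≤ = ≤= (^-anti {m = 1} {n = wt0 ∸ wt} (lt Φ>0) Φ≤1 (m<n⇒0<n∸m wt<)) (*1r _)
     tn : tT T ^ n₂ ~ tl ^ Lv
     tn = & (^-^ (tT T) Lv (l N.+ l)) (ap (_^ Lv) (^-+ (tT T) l l))
     small′ : ι T ^ c1 * Φ1 * ι T ^ c2 ≤ tl ^ Lv
     small′ = =≤ (& (#r5 (ι T ^ c1) Φ1 (ι T ^ c2)) (& (! (*1l _)) (ap (_* (ι T ^ c1 * ι T ^ c2 * Φ1)) (! (inv-^* n₂ (ι-pos 1T))))))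
      (=≤ (& *a (ap (tT T ^ n₂ *_) (& (#r7 (ι T ^ n₂) (ι T ^ c1) (ι T ^ c2) Φ1) (ap (_* Φ1) (& (ap (_* ι T ^ n₂) (! (^-+ (ι T) c1 c2))) (! (^-+ (ι T) n1 n₂))))))) (≤= (*l (^n n₂ t≥0) small) (& (*1r _) tn)))

module B19 where
 open Rationals
 open Gauss
 open Roots
 open B5
 open B6
 open B7
 open B8
 open B9
 open B11
 open B12
 open B14
 open B13
 open B15
 open B16
 open B17
 open B18
 open import Defs
 open CSolver using (solve; _:*_; :-_; _:-_; _:=_; con)
 open Z using (ℤ)
 open import Relation.Nullary.Decidable using (_×-dec_)
 open import Data.Nat.DivMod using (_/_; _%_; m≡m%n+[m/n]*n; m%n<n; %-distribˡ-*; m%n%n≡m%n)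

 opaque
  unfolding Qr
  #s4 : ∀ t p x y -> t * p * x + y * (t * p) ~ (x + y) * t * p
  #s4 = auto Qr

 #s1 : ∀ x u y v -> x *c u *c (y *c v) ~ x *c y *c (u *c v)
 #s1 = solve 4 (\ x u y v -> x :* u :* (y :* v) := x :* y :* (u :* v)) refl
 #s2 : ∀ x y z -> x *c (y *c z) ~ y *c (x *c z)
 #s2 = solve 3 (\ x y z -> x :* (y :* z) := y :* (x :* z)) refl
 #s3 : ∀ x y z -> (x *c y -c 0c) *c z ~ x *c (y *c z)
 #s3 = solve 3 (\ x y z -> (x :* y :- con (Z.+ 0)) :* z := x :* (y :* z)) refl
 #s5 : ∀ r v e i -> r *c i -c (r -c v *c e) *c i ~ v *c i *c e
 #s5 = solve 4 (\ r v e i -> r :* i :- (r :- v :* e) :* i := v :* i :* e) refl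
 #s6 : ∀ a r q -> 8 N.* a N.* (r N.+ q N.* a) ~ 8 N.* a N.* r N.+ 8 N.* (a N.* a) N.* q
 #s6 = nsolve
 #s7 : ∀ x a y -> x N.* (8 N.* a N.* y) ~ 8 N.* a N.* (x N.* y)
 #s7 = nsolve

 module EdgeAt (a' d' h h' : ℕ) (hh' : (h N.* h') % S a' ~ 1 % S a') (c : ℕ) (c≡ : c ~ 24) (Pol : Poly2)
  (van : ∀ n -> clearedEval Pol (S a' N.* S d') n ~ 0Z) (i0 j0 a1 d1 R1 : ℕ) (a11 : 1 N.≤ a1) (dR≤ : d1 N.* R1 N.≤ j0)
  (on-edge : ∀ j k -> coeff Pol j k ≢ 0Z -> (∃ \ n -> n N.< S R1 × (j ~ i0 N.+ a1 N.* n × k ~ j0 ∸ d1 N.* n)) ⊎ S d' N.* j N.+ S a' N.* k N.< S d' N.* i0 N.+ S a' N.* j0) where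
  open Relation a' d' h h' hh' c c≡ Pol van public
  open Scale a' d' c public using (Y; nY; Φ; δr>0; 1≤nY; U-nn; cubed; 1*1; nY-scale)
  open RealSide a' d' using (1≤e'r)
  cf : ℕ -> ℤ
  cf n = coeff Pol (i0 N.+ a1 N.* n) (j0 ∸ d1 N.* n)
  ratio edge : ℕ -> ℕ -> C
  ratio T s = X T s ^c a1 *c rl (inv (Y T s ^ d1))
  edge T s = sumc (S R1) (\ n -> rl (κ (cf n)) *c ratio T s ^c n)
  Y>0 : Ev (\ T s -> 0# < Y T s)
  Y>0 = Evm2 (\ T s 2T p -> pp* (^-pos 3 (p≤ 0<1 (1≤e'r 2T s))) (inv-pos p)) (Ev-T≥ 2) δr>0
  private
   K1 = fst 1≤nX
   mono-step : ∀ n -> n N.≤ R1 -> ∀ T s -> 0# < Y T s -> mono (i0 N.+ a1 N.* n) (j0 ∸ d1 N.* n) T s ~ mono i0 j0 T s *c ratio T s ^c n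
   mono-step n n≤ T s y>0 = & (ap2 _*c_ (& (^c-+ (X T s) i0 _) (ap (X T s ^c i0 *c_) (& (ap (X T s ^c_) (NP.*-comm a1 n)) (^c-^ (X T s) n a1)))) (& (ap rl Ystep) (& (rl-* _ _) (ap (rl (Y T s ^ j0) *c_) (rl-^ _ n)))))
    (& (#s1 (X T s ^c i0) ((X T s ^c a1) ^c n) (rl (Y T s ^ j0)) (rl (inv (Y T s ^ d1)) ^c n)) (ap (mono i0 j0 T s *c_) (! (*c-^ _ _ n)))) where
    Ystep : Y T s ^ (j0 ∸ d1 N.* n) ~ Y T s ^ j0 * inv (Y T s ^ d1) ^ n
    Ystep = ! (& (ap (_* inv (Y T s ^ d1) ^ n) (& (ap (Y T s ^_) (! (m∸n+n≡m (&N (*-monoʳ-≤ d1 n≤) dR≤)))) (& (^-+ (Y T s) (j0 ∸ d1 N.* n) (d1 N.* n)) (ap (Y T s ^ (j0 ∸ d1 N.* n) *_) (& (ap (Y T s ^_) (NP.*-comm d1 n)) (^-^ (Y T s) n d1))))))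
     (& *a (& (ap (Y T s ^ (j0 ∸ d1 N.* n) *_) (& (*-comm _ _) (inv-^* n (^-pos d1 y>0)))) (*1r _))))
   index-injective : ∀ {n n'} -> i0 N.+ a1 N.* n ~ i0 N.+ a1 N.* n' -> n ~ n'
   index-injective {n} {n'} e = NP.*-cancelˡ-≡ n n' a1 {{>-nonZero a11}} (NP.+-cancelˡ-≡ i0 _ _ e)
   module At (T s : ℕ) (u : ℕ -> C) where
    slot : ℕ -> ℕ -> ℕ -> C
    slot j k n = χ (j ≟ i0 N.+ a1 N.* n) (χ (k ≟ j0 ∸ d1 N.* n) (u n))
    slots-hit : ∀ j k n -> n N.< S R1 -> j ~ i0 N.+ a1 N.* n -> k ~ j0 ∸ d1 N.* n -> sumc (S R1) (slot j k) ~ u n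
    slots-hit j k n l p q = & (ΣC.fold-single (S R1) n l \ n' _ ne -> χ-no (j ≟ _) \ e -> ne (index-injective (& (! e) p))) (& (χ-yes (j ≟ _) p) (χ-yes (k ≟ _) q))
    slots-miss : ∀ j k -> ¬ (∃ \ n -> n N.< S R1 × (j ~ i0 N.+ a1 N.* n × k ~ j0 ∸ d1 N.* n)) -> sumc (S R1) (slot j k) ~ 0c
    slots-miss j k none = ΣC.fold-none (S R1) \ n l -> each n l (j ≟ i0 N.+ a1 N.* n) (k ≟ j0 ∸ d1 N.* n) where
     each : ∀ n -> n N.< S R1 -> (A : Dec (j ~ i0 N.+ a1 N.* n)) (B : Dec (k ~ j0 ∸ d1 N.* n)) -> χ A (χ B (u n)) ~ 0c
     each n l (yes p) (yes q) = abort (none (n , l , p , q))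
     each n l (yes p) (no _) = refl
     each n l (no _) B = refl
  off-bound : ℕ -> ℕ -> Q -> Q
  off-bound j k x = abs (κ (coeff Pol j k)) * x
  private
   bracket : ∀ T s -> 0# < Y T s -> ∀ (iV : C) x -> 0# ≤ x -> (∀ j k -> weight j k N.< weight i0 j0 -> mono j k T s *c iV << x) -> let u = \ n -> mono i0 j0 T s *c (rl (κ (cf n)) *c ratio T s ^c n) in
    ∀ j k -> (rl (κ (coeff Pol j k)) *c mono j k T s -c sumc (S R1) (At.slot T s u j k)) *c iV << off-bound j k x
   bracket T s y>0 iV x x≥0 small j k = go (NP.anyUpTo? (\ n -> (j ≟ i0 N.+ a1 N.* n) ×-dec (k ≟ j0 ∸ d1 N.* n)) (S R1)) where
    u : ℕ -> C
    u n = mono i0 j0 T s *c (rl (κ (cf n)) *c ratio T s ^c n)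
    open At T s u
    ob0 : 0# ≤ off-bound j k x
    ob0 = nn* (abs-nn _) x≥0
    tm = rl (κ (coeff Pol j k)) *c mono j k T s
    go : Dec (∃ \ n -> n N.< S R1 × (j ~ i0 N.+ a1 N.* n × k ~ j0 ∸ d1 N.* n)) -> (tm -c sumc (S R1) (slot j k)) *c iV << off-bound j k x
    go (yes (n , l , p , q)) = tr (_<< off-bound j k x) (! (& (ap (\ z -> (tm -c z) *c iV) (& (slots-hit j k n l p q) (! same))) (& (ap (_*c iV) (u-u tm)) (*c-0ˡ iV)))) (<<-0 ob0) where
     same : tm ~ u n
     same = & (ap2 (\ j k -> rl (κ (coeff Pol j k)) *c mono j k T s) p q) (& (ap (rl (κ (cf n)) *c_) (mono-step n (s≤s⁻¹ l) T s y>0)) (#s2 (rl (κ (cf n))) (mono i0 j0 T s) (ratio T s ^c n)))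
    go (no miss) = tr (_<< off-bound j k x) (! (& (ap (\ z -> (tm -c z) *c iV) (slots-miss j k miss)) (#s3 (rl (κ (coeff Pol j k))) (mono j k T s) iV))) (value (coeff Pol j k Z.≟ 0Z)) where
     value : Dec (coeff Pol j k ~ 0Z) -> rl (κ (coeff Pol j k)) *c (mono j k T s *c iV) << off-bound j k x
     value (yes z) = tr (_<< off-bound j k x) (! (& (ap (\ z -> rl (κ z) *c (mono j k T s *c iV)) z) (& (ap (\ z -> z *c (mono j k T s *c iV)) (& (ap rl (κ-ι 0)) rl-0)) (*c-0ˡ _)))) (<<-0 ob0)
     value (no nz) = <<-* (<<-rl-abs _) (small j k (light (on-edge j k nz))) where
      light : (∃ \ n -> n N.< S R1 × (j ~ i0 N.+ a1 N.* n × k ~ j0 ∸ d1 N.* n)) ⊎ weight j k N.< weight i0 j0 -> weight j k N.< weight i0 j0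
      light (inl hit) = abort (miss hit)
      light (inr w<) = w<
   out-of-range : ∀ I J -> (I N.≤ Dg × J N.≤ Dg) ⊎ coeff Pol I J ~ 0Z
   out-of-range I J with I N.≤? Dg | J N.≤? Dg
   ... | yes p | yes q = inl (p , q)
   ... | no p | _ = inr (support Pol I J (inl (≰⇒> p)))
   ... | yes _ | no q = inr (support Pol I J (inr (≰⇒> q)))
   split : ∀ T s -> relation T s -c mono i0 j0 T s *c edge T s ~ sumc (S Dg) (\ j -> sumc (S Dg) (\ k -> rl (κ (coeff Pol j k)) *c mono j k T s -c sumc (S R1) (At.slot T s (\ n -> mono i0 j0 T s *c (rl (κ (cf n)) *c ratio T s ^c n)) j k)))
   split T s = & (ap (\ z -> relation T s -c z) spread) (& (sub-sumc (S Dg) _ _) (ΣC.cong-f (S Dg) \ j -> sub-sumc (S Dg) _ _)) where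
    u : ℕ -> C
    u n = mono i0 j0 T s *c (rl (κ (cf n)) *c ratio T s ^c n)
    open At T s u
    u0 : ∀ n -> cf n ~ 0Z -> u n ~ 0c
    u0 n z = & (ap (\ z -> mono i0 j0 T s *c (rl (κ z) *c ratio T s ^c n)) z) (& (ap (\ z -> mono i0 j0 T s *c (z *c ratio T s ^c n)) (& (ap rl (κ-ι 0)) rl-0)) (& (ap (mono i0 j0 T s *c_) (*c-0ˡ _)) (*c-0ʳ _)))
    range : ∀ n -> (i0 N.+ a1 N.* n N.≤ Dg × j0 ∸ d1 N.* n N.≤ Dg) ⊎ u n ~ 0c
    range n with out-of-range (i0 N.+ a1 N.* n) (j0 ∸ d1 N.* n)
    ... | inl p = inl p
    ... | inr z = inr (u0 n z)
    spread : mono i0 j0 T s *c edge T s ~ sumc (S Dg) (\ j -> sumc (S Dg) (\ k -> sumc (S R1) (slot j k)))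
    spread = & (! (sumc-*ˡ (S R1) (mono i0 j0 T s) _)) (& (ΣC.cong-f (S R1) \ n -> ! (sum-indicator Dg (i0 N.+ a1 N.* n) (j0 ∸ d1 N.* n) (u n) (range n)))
     (& (ΣC.exchange (S R1) (S Dg) _) (ΣC.cong-f (S Dg) \ j -> ΣC.exchange (S R1) (S Dg) _)))
  edge-small : ∀ l -> Ev (\ T s -> edge T s << tT T ^ l)
  edge-small l = go (arch Ctot) where
   Σc = sum (S Dg) (\ j -> sum (S Dg) (\ k -> abs (κ (coeff Pol j k))))
   Ctot = (1# + ι K1 ^ i0) + Σc
   L1 = S l
   lights : Ev (\ T s -> ∀ j -> j N.< S (weight i0 j0) -> ∀ k -> k N.< S (weight i0 j0) -> weight j k N.< weight i0 j0 -> size j k T s ≤ tT T ^ L1 * tT T ^ L1 * size i0 j0 T s)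
   lights = Ev-all< (S (weight i0 j0)) \ j _ -> Ev-all< (S (weight i0 j0)) \ k _ -> one j k (weight j k N.<? weight i0 j0) where
    one : ∀ j k -> Dec (weight j k N.< weight i0 j0) -> Ev (\ T s -> weight j k N.< weight i0 j0 -> size j k T s ≤ tT T ^ L1 * tT T ^ L1 * size i0 j0 T s)
    one j k (yes p) = Evm (\ T s q _ -> q) (lighter j k i0 j0 p L1)
    one j k (no n) = Ev! \ T s p -> abort (n p)
   go : (∃ \ n -> Ctot ≤ ι n) -> Ev (\ T s -> edge T s << tT T ^ l)
   go (n , C≤) = Evm2 (\ T s ((x≥1 , y1) , y>0) ((lt′ , neg) , T≥) -> point T s x≥1 y1 y>0 lt′ neg T≥) (Ev-∧ (Ev-∧ (snd 1≤nX) (1≤nY c≥1)) Y>0)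
    (Ev-∧ (Ev-∧ lights (negligible (\ T -> tT T ^ L1) \ T 2T -> ^-pos L1 (inv-pos (ι-pos {T} (&N z<s 2T))))) (Ev-T≥ (S n))) where
    point : ∀ T s -> 1# ≤ ι K1 * nX T s -> 1# ≤ nY T s -> 0# < Y T s -> (∀ j -> j N.< S (weight i0 j0) -> ∀ k -> k N.< S (weight i0 j0) -> weight j k N.< weight i0 j0 -> size j k T s ≤ tT T ^ L1 * tT T ^ L1 * size i0 j0 T s) -> relation T s << tT T ^ L1 -> S n N.≤ T -> edge T s << tT T ^ l
    point T s x≥1 y1 y>0 lights′ neg T≥ = tr (_<< tT T ^ l) solve-edge (<<m (<<-- (<<-* neg iV<<) (tr (_<< sum (S Dg) (\ j -> sum (S Dg) (\ k -> off-bound j k tl))) (! push) (<<-sum (S Dg) \ j _ -> <<-sum (S Dg) \ k _ -> bracket T s y>0 iV tl tl0 small j k))) final) where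
     1T : 1 N.≤ T
     1T = &N z<s T≥
     tl = tT T ^ L1
     t≥0 : 0# ≤ tT T
     t≥0 = inv-nn (ι-pos 1T)
     tl0 : 0# ≤ tl
     tl0 = ^n L1 t≥0
     V₀ = mono i0 j0 T s
     t0 = size i0 j0 T s
     iV = rl (inv t0) *c cj V₀
     Kt0 : 1# ≤ ι K1 ^ i0 * t0
     Kt0 = ≤= (=≤ (! (*1r 1#)) (*-mono 0≤1 (≤= (1≤^ i0 x≥1) (*-^ _ _ i0)) 0≤1 (1≤^ j0 y1))) *a
     t0>0 : 0# < t0
     t0>0 z = 0<1 (<& Kt0 (≤= (*l (^n i0 (ι-nn K1)) z) (*-0ʳ _)))
     NiV : N iV ~ inv t0
     NiV = & (N-* _ _) (& (ap2 _*_ (N-rl _) (& (N-cj _) (N-mono i0 j0 T s))) (& *a (& (ap (inv t0 *_) (& (*-comm _ _) (inv-r t0>0))) (*1r _))))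
     ViV : V₀ *c iV ~ 1c
     ViV = & (#s2 V₀ (rl (inv t0)) (cj V₀)) (& (ap (rl (inv t0) *c_) (& (u*cj V₀) (ap rl (N-mono i0 j0 T s)))) (& (! (rl-* _ _)) (& (ap rl (& (*-comm _ _) (inv-r t0>0))) rl-1)))
     iV<< : iV << 1# + ι K1 ^ i0
     iV<< = <<-N (^n i0 (ι-nn K1)) (=≤ NiV (inv-≤ t0>0 Kt0))
     j≤w : ∀ j k -> weight j k N.< weight i0 j0 -> j N.< S (weight i0 j0) × k N.< S (weight i0 j0)
     j≤w j k p = s≤s (&N (&N (m≤n*m j d) (m≤m+n (d N.* j) (a N.* k))) (<⇒≤ p)) , s≤s (&N (&N (m≤n*m k a) (m≤n+m (a N.* k) (d N.* j))) (<⇒≤ p))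
     small : ∀ j k -> weight j k N.< weight i0 j0 -> mono j k T s *c iV << tl
     small j k p = tl0 , =≤ (& (N-* _ _) (ap2 _*_ (N-mono j k T s) NiV)) (≤= (*r (inv-nn t0>0) (lights′ j (fst (j≤w j k p)) k (snd (j≤w j k p)) p)) (& *a (& (ap (tl * tl *_) (inv-r t0>0)) (*1r _))))
     Br = sumc (S Dg) (\ j -> sumc (S Dg) (\ k -> rl (κ (coeff Pol j k)) *c mono j k T s -c sumc (S R1) (At.slot T s (\ n -> V₀ *c (rl (κ (cf n)) *c ratio T s ^c n)) j k)))
     push : Br *c iV ~ sumc (S Dg) (\ j -> sumc (S Dg) (\ k -> (rl (κ (coeff Pol j k)) *c mono j k T s -c sumc (S R1) (At.slot T s (\ n -> V₀ *c (rl (κ (cf n)) *c ratio T s ^c n)) j k)) *c iV))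
     push = & (DivisorSums.sumc-*ʳ (S Dg) iV _) (ΣC.cong-f (S Dg) \ j -> DivisorSums.sumc-*ʳ (S Dg) iV _)
     solve-edge : relation T s *c iV -c Br *c iV ~ edge T s
     solve-edge = & (ap (\ z -> relation T s *c iV -c z *c iV) (! (split T s))) (& (#s5 (relation T s) V₀ (edge T s) iV) (& (ap (_*c edge T s) ViV) (*c1l _)))
     final : tl * (1# + ι K1 ^ i0) + sum (S Dg) (\ j -> sum (S Dg) (\ k -> off-bound j k tl)) ≤ tT T ^ l
     final = =≤ (& (ap (tl * (1# + ι K1 ^ i0) +_) (& (ΣQ.cong-f (S Dg) \ j -> sum-*ʳ (S Dg) tl _) (sum-*ʳ (S Dg) tl _))) (#s4 (tT T) (tT T ^ l) (1# + ι K1 ^ i0) Σc))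
      (≤= (*r (^n l t≥0) (≤= (*r t≥0 (<& C≤ (ι-mono (&N (n≤1+n n) T≥)))) (inv-r (ι-pos 1T)))) (*1l _))
  ratio-size : ∀ e' -> a ~ a1 N.* S e' -> d ~ d1 N.* S e' -> (\ T s -> N (ratio T s)) ⋈ (\ _ _ -> 1#)
  ratio-size e' a≡ d≡ = ⋈-root e' (Ev! \ T s -> N-nn _) (Ev! \ _ _ -> 0≤1) (⋈t (⋈t (⋈t (⋈-≡ (Ev! \ T s -> ^n (S e') (N-nn _)) (Ev! \ T s -> ! (*1r _))) (⋈-* (⋈-refl (Ev! \ T s -> ^n (S e') (N-nn (ratio T s)))) (⋈-sym nY-scale)))
   (⋈t (⋈-≡ (Evm (\ T s u -> nn* (^n (S e') (N-nn (ratio T s))) (nn* (^n d (nnsq (Y T s))) (^n c (nn* u u)))) U-nn) (Evm (\ T s y>0 -> shape T s y>0) Y>0)) nX-scale)) (⋈-≡ (Ev! \ _ _ -> 0≤1) (Ev! \ _ _ -> ! (^-1 (S e'))))) where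
   shape : ∀ T s -> 0# < Y T s -> N (ratio T s) ^ S e' * (nY T s ^ d * Φ T s) ~ nX T s ^ a * Φ T s
   shape T s y>0 = & (! *a) (ap (_* Φ T s) (& (ap2 _*_ (& (ap (_^ S e') (& (N-* _ _) (ap2 _*_ (N-^ (X T s) a1) (N-rl _)))) (*-^ _ _ (S e'))) (& (ap (nY T s ^_) (& d≡ (NP.*-comm d1 (S e')))) (& (^-^ (nY T s) (S e') d1) (ap (_^ S e') (*-^ (Y T s) (Y T s) d1)))))
    (& *a (& (ap ((nX T s ^ a1) ^ S e' *_) (& (! (*-^ _ _ (S e'))) (& (ap (_^ S e') (& (swap* y⁻ y⁻ yd yd) (& (ap (\ z -> z * z) (& (*-comm _ _) (inv-r (^-pos d1 y>0)))) (*1r 1#)))) (^-1 (S e'))))) (& (*1r _) (& (! (^-^ (nX T s) (S e') a1)) (ap (nX T s ^_) (& (NP.*-comm (S e') a1) (! a≡))))))))) where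
    yd = Y T s ^ d1
    y⁻ = inv yd
  ratio-direction : ratio || (\ _ s -> ζt s (a1 N.* h'))
  ratio-direction = ||-≈ʳ (||-≡ʳ (||-* (||-^ a1 (X-direction c≡)) (||-pos (Evm (\ T s p -> inv-pos (^-pos d1 p)) Y>0))) \ T s -> *c1r _)
   (≈t (≈-^ a1 (root≈ (h' % a) (<⇒≤ (m%n<n h' a)))) (≈t (≈-≡ \ T s -> & (pw-^ s a1 _) (ap (pw s) exponent)) (≈t (pw-shift-≈ (8 N.* a N.* r) (q′)) (≈-sym (root≈ r (<⇒≤ (m%n<n (a1 N.* h') a))))))) where
   root≈ : ∀ x -> x N.≤ a -> (\ (T s : ℕ) -> zt s x) ≈ (\ _ s -> pw s (8 N.* a N.* x))
   root≈ x l = close⇒≈ _ _ 1 (\ T s -> pw-unit s _) \ T s -> <<m (zt-close s l) (≤r (! (& (ap (_* (4# * tol s)) (+-idr 1#)) (*1l _))))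
   r = (a1 N.* h') % a
   q′ = (a1 N.* (h' % a)) / a
   r≡ : (a1 N.* (h' % a)) % a ~ r
   r≡ = & (%-distribˡ-* a1 (h' % a) a) (& (ap (\ z -> ((a1 % a) N.* z) % a) (m%n%n≡m%n h' a)) (! (%-distribˡ-* a1 h' a)))
   exponent : a1 N.* (8 N.* a N.* (h' % a)) ~ 8 N.* a N.* r N.+ P N.* q′
   exponent = & (#s7 a1 a (h' % a)) (& (ap (8 N.* a N.*_) (& (m≡m%n+[m/n]*n (a1 N.* (h' % a)) a) (ap (N._+ q′ N.* a) r≡))) (#s6 a r q′))

module B20 where
 open Rationals
 open Gauss
 open Interpolation
 open Roots
 open B5
 open B6
 open B7
 open B8
 open B9
 open B10
 open B11
 open B12
 open B13
 open B14
 open B15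
 open B16
 open B17
 open B18
 open B19
 open import Defs
 open CSolver using (solve; _:+_; _:*_; :-_; _:-_; _:=_; con)
 open Z using (ℤ; -[1+_])
 open import Data.Nat.DivMod using (_%_; m%n<n)
 open import Relation.Binary.Definitions using (tri<; tri≈; tri>)

 opaque
  unfolding Qr
  #t1 : ∀ T y t -> T * y * t ~ y * (T * t)
  #t1 = auto Qr
  #t3 : ∀ x y n -> x * (x - y) * 1# + y * (y - x) * 1# + x * y * n ~ x * y * n + (x - y) * (x - y)
  #t3 = auto Qr
  #t4 : ∀ x y a b c d -> (x * a - y * c) * (x * a - y * c) + (x * b - y * d) * (x * b - y * d) ~ x * (x - y) * (a * a + b * b) + y * (y - x) * (c * c + d * d) + x * y * ((a + - c) * (a + - c) + (b + - d) * (b + - d))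
  #t4 = auto Qr
  #t6 : ∀ s n -> 4# * (s * 1# * n + (s - 1#) * (s - 1#)) ~ n * ((s + 1#) * (s + 1#)) + (4# - n) * ((s - 1#) * (s - 1#))
  #t6 = auto Qr
  #t7 : ∀ m x SS -> 2# * (4# * (2# * (m + x * x * SS))) ~ 4# * 4# * m + 4# * 4# * (x * x) * SS
  #t7 = auto Qr
  #t8 : ∀ c -> c + c ~ 2# * c
  #t8 = auto Qr
  #t9 : ∀ n L s -> n * (L * s) ~ L * (s * n)
  #t9 = auto Qr
  #t10 : ∀ L s t -> L * (s * s) * (L * (t * t)) ~ L * (s * t) * (L * (s * t))
  #t10 = auto Qr
  #t12 : ∀ T n t -> T * (n * t) ~ n * (T * t)
  #t12 = auto Qr
  #t13 : ∀ t b m u p -> t * b * (m * (u * p) * (m * (u * p))) ~ b * (m * m) * u * (u * p * (t * p))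
  #t13 = auto Qr
  #t14 : ∀ t l s -> t * (4# * (l * s)) ~ t * (4# * l) * s
  #t14 = auto Qr
  #t15 : ∀ c i l -> l * (c * i) ~ c * (l * i)
  #t15 = auto Qr
  #t16 : ∀ L -> 4# * L * L ~ 2# * L * (2# * L)
  #t16 = auto Qr
  #t17 : ∀ i L SS -> i * i * (4# * (L * SS)) ~ 4# * L * (i * i * SS)
  #t17 = auto Qr
  #t18 : ∀ i s -> i * i * (s * s) ~ s * i * (s * i)
  #t18 = auto Qr
  #t22 : ∀ t p -> 4# * 4# * (t * p * (t * p)) ~ 4# * 4# * t * t * (p * p)
  #t22 = auto Qr

 #t2 : ∀ f x p -> f *c (x *c p) ~ x *c (f *c p)
 #t2 = solve 3 (\ f x p -> f :* (x :* p) := x :* (f :* p)) refl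
 #t5 : ∀ v p -> v -c 1c ~ (-c (1c -c p)) +c (-c (p -c v))
 #t5 = solve 2 (\ v p -> v :- con (Z.+ 1) := (:- (con (Z.+ 1) :- p)) :+ (:- (p :- v))) refl
 #t11 : ∀ v v' p p' -> v -c v' ~ (p -c p') +c ((v -c p) +c (p' -c v'))
 #t11 = solve 4 (\ v v' p p' -> v :- v' := (p :- p') :+ ((v :- p) :+ (p' :- v'))) refl
 #t19 : ∀ c s i p -> c *c s *c (i *c p) ~ c *c p *c (s *c i)
 #t19 = solve 4 (\ c s i p -> c :* s :* (i :* p) := c :* p :* (s :* i)) refl
 #t20 : ∀ r x y -> r *c x -c r *c y ~ r *c (x -c y)
 #t20 = solve 3 (\ r x y -> r :* x :- r :* y := r :* (x :- y)) refl
 #t21 : ∀ p SS u q c -> (1c -c p) *c SS +c u *c q +c c *c (p *c q) ~ (1c -c p) *c (SS +c u *c q) +c (u +c c) *c (p *c q)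
 #t21 = solve 5 (\ p SS u q c -> (con (Z.+ 1) :- p) :* SS :+ u :* q :+ c :* (p :* q) := (con (Z.+ 1) :- p) :* (SS :+ u :* q) :+ (u :+ c) :* (p :* q)) refl

 Ev-point : ∀ {P : ℕ -> ℕ -> Set} -> Ev P -> ∃ \ T -> ∃ \ s -> P T s
 Ev-point (T₀ , h) = T₀ , fst (h T₀ NP.≤-refl) , snd (h T₀ NP.≤-refl) _ NP.≤-refl

 Ev-tε≤ : ∀ k {y} -> 0# < y -> Ev (\ T s -> tε k T ≤ y)
 Ev-tε≤ k {y} y>0 = go (arch (ι k * inv y)) where
  go : (∃ \ n -> ι k * inv y ≤ ι n) -> Ev (\ T s -> tε k T ≤ y)
  go (n , h) = Evm (\ T s l -> let 1T = &N z<s l in ≤= (*r (inv-ι-nn T) (=≤ (& (! (*1r (ι k))) (& (ap (ι k *_) (! (& (*-comm _ _) (inv-r y>0)))) (! *a)))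
   (*r (lt y>0) (<& h (ι-mono (&N (n≤1+n n) l)))))) (& (#t1 (ι T) y (inv (ι T))) (& (ap (y *_) (inv-r (ι-pos 1T))) (*1r y)))) (Ev-T≥ (S n))

 tabulate : ℕ -> (ℕ -> C) -> List C
 tabulate zero f = []
 tabulate (S n) f = f 0 ∷ tabulate n (\ k -> f (S k))

 tabulate-length : ∀ n f -> length (tabulate n f) ~ n
 tabulate-length zero f = refl
 tabulate-length (S n) f = ap S (tabulate-length n (\ k -> f (S k)))

 tabulate-eval : ∀ n f x -> evalP (tabulate n f) x ~ sumc n (\ k -> f k *c x ^c k)
 tabulate-eval zero f x = refl
 tabulate-eval (S n) f x = & (ap (\ z -> f 0 +c x *c z) (tabulate-eval n (\ k -> f (S k)) x)) (! (& (ΣC.front n (\ k -> f k *c x ^c k)) (ap2 _+c_ (*c1r _) (& (ΣC.cong-f n \ k -> #t2 (f (S k)) x (x ^c k)) (sumc-*ˡ n x _)))))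

 tabulate-all : ∀ n f {P : C -> Set} -> All P (tabulate n f) -> ∀ k -> k N.< n -> P (f k)
 tabulate-all (S n) f (p ∷ ps) zero _ = p
 tabulate-all (S n) f (p ∷ ps) (S k) (s≤s l) = tabulate-all n (\ k -> f (S k)) ps k l

 κ²≥1 : ∀ z -> z ≢ 0Z -> 1# ≤ κ z * κ z
 κ²≥1 (Z.+ zero) nz = abort (nz refl)
 κ²≥1 (Z.+ S n) nz = ≤= (=≤ (! (*1r 1#)) (sq-mono 0≤1 (1≤ι {S n} z<s))) (! (ap (\ z -> z * z) (κ-ι (S n))))
 κ²≥1 -[1+ n ] nz = ≤= (=≤ (! (*1r 1#)) (sq-mono 0≤1 (1≤ι {S n} z<s))) (! (& (ap (\ z -> z * z) (& (κ-neg (Z.+ S n)) (ap (\ z -> - z) (κ-ι (S n))))) (neg-sq _)))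

 unit-distance : ∀ {ω ω'} -> N ω ~ 1# -> N ω' ~ 1# -> ∀ x y -> N (rl x *c ω -c rl y *c ω') ~ x * y * N (ω -c ω') + (x - y) * (x - y)
 unit-distance {ω} {ω'} u u' x y = & (N-def _) (& (ap2 (\ p q -> p * p + q * q) (re-comb x y) (im-comb x y)) (& (expand x y (re ω) (im ω) (re ω') (im ω') (& (! (N-def ω)) u) (& (! (N-def ω')) u'))
  (ap (\ n -> x * y * n + (x - y) * (x - y)) (! (& (N-def _) (ap2 (\ p q -> p * p + q * q) (& (re-+ ω _) (ap (re ω +_) (re-neg ω'))) (& (im-+ ω _) (ap (im ω +_) (im-neg ω'))))))))) where
  re-comb : ∀ x y -> re (rl x *c ω -c rl y *c ω') ~ x * re ω - y * re ω'
  re-comb x y = & (re-+ _ _) (ap2 _+_ (part x ω) (& (re-neg _) (ap (\ z -> - z) (part y ω')))) where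
   part : ∀ x w -> re (rl x *c w) ~ x * re w
   part x w = & (re-* _ _) (& (ap2 (\ p q -> p * re w - q * im w) (re-rl x) (im-rl x)) (q x (re w) (im w))) where
    opaque
     unfolding Qr
     q : ∀ x a b -> x * a - 0# * b ~ x * a
     q = auto Qr
  im-comb : ∀ x y -> im (rl x *c ω -c rl y *c ω') ~ x * im ω - y * im ω'
  im-comb x y = & (im-+ _ _) (ap2 _+_ (part x ω) (& (im-neg _) (ap (\ z -> - z) (part y ω')))) where
   part : ∀ x w -> im (rl x *c w) ~ x * im w
   part x w = & (im-* _ _) (& (ap2 (\ p q -> p * im w + q * re w) (re-rl x) (im-rl x)) (q x (re w) (im w))) where
    opaque
     unfolding Qr
     q : ∀ x a b -> x * b + 0# * a ~ x * b
     q = auto Qr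
  expand : ∀ x y a b c d -> a * a + b * b ~ 1# -> c * c + d * d ~ 1# -> (x * a - y * c) * (x * a - y * c) + (x * b - y * d) * (x * b - y * d) ~ x * y * ((a + - c) * (a + - c) + (b + - d) * (b + - d)) + (x - y) * (x - y)
  expand x y a b c d p q = & (#t4 x y a b c d) (& (ap2 (\ u v -> x * (x - y) * u + y * (y - x) * v + x * y * ((a + - c) * (a + - c) + (b + - d) * (b + - d))) p q) (#t3 x y _))

 scaled-unit-distance : ∀ {ω ω'} -> N ω ~ 1# -> N ω' ~ 1# -> ∀ x y -> x * y * N (ω -c ω') ≤ N (rl x *c ω -c rl y *c ω')
 scaled-unit-distance u u' x y = le ((x - y) * (x - y)) (nnsq _) (unit-distance u u' x y)

 away-from-one : ∀ {p ω σ x c} -> 0# < σ -> N ω ~ 1# -> Rel p (rl σ *c ω) x -> c ≤ N (ω -c 1c) -> 0# ≤ c -> 4# * 4# * (x * x) ≤ c -> c ≤ 4# * 4# * N (1c -c p)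
 away-from-one {p} {ω} {σ} {x} {c} σ>0 u (_ , r) sep c≥0 small = <& c≤Z (+-cancelr {z = c * Z} (=≤ (#t8 (c * Z)) (<& (*l 0≤2 (<& far (*l 0≤4 close))) (=≤ (#t7 (N (1c -c p)) x (σ * σ)) (+m r≤ (<& (*r (nnsq σ) small) (*l c≥0 σ²≤))))))) where
  v = rl σ *c ω
  n = N (ω -c 1c)
  Z = (σ + 1#) * (σ + 1#)
  1≤Z : 1# ≤ Z
  1≤Z = =≤ (! (*1r 1#)) (sq-mono 0≤1 (y≤x+y (lt σ>0)))
  c≤Z : c ≤ c * Z
  c≤Z = =≤ (! (*1r c)) (*l c≥0 1≤Z)
  σ²≤ : σ * σ ≤ Z
  σ²≤ = sq-mono (lt σ>0) (x≤x+y 0≤1)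
  n≤4 : n ≤ 4#
  n≤4 = =≤ (& (ap N (swap-c ω 1c)) (N-neg _)) (N-1-≤4 u)
  Nv : N (v -c 1c) ~ σ * 1# * n + (σ - 1#) * (σ - 1#)
  Nv = & (ap (\ z -> N (v -c z)) (! (& (ap (_*c 1c) rl-1) (*c1l 1c)))) (unit-distance u N-1 σ 1#)
  far : c * Z ≤ 4# * N (v -c 1c)
  far = <& (*r (nnsq _) sep) (le ((4# - n) * ((σ - 1#) * (σ - 1#))) (nn* (diff n≤4) (nnsq _)) (& (ap (4# *_) Nv) (#t6 σ n)))
  close : N (v -c 1c) ≤ 2# * (N (1c -c p) + x * x * (σ * σ))
  close = =≤ (& (ap N (#t5 v p)) refl) (<& (N-tri _ _) (*l 0≤2 (+m (≤r (N-neg _)) (=≤ (N-neg _) (<& r (*l (nnsq x) (≤r (& (N-* _ _) (& (ap2 _*_ (N-rl σ) u) (*1r _))))))))))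

 separated-points : ∀ {p p' ω ω' σ σ' σ0 x L c} -> 0# < σ -> 0# < σ' -> 0# < σ0 -> 0# ≤ L -> N ω ~ 1# -> N ω' ~ 1# -> Rel p (rl σ *c ω) x -> Rel p' (rl σ' *c ω') x →
  σ0 * σ0 ≤ L * (σ * σ) -> σ * σ ≤ L * (σ0 * σ0) -> σ0 * σ0 ≤ L * (σ' * σ') -> σ' * σ' ≤ L * (σ0 * σ0) -> c ≤ N (ω -c ω') -> 0# ≤ c -> 4# * 4# * (L * L) * (x * x) ≤ c →
  c * (σ0 * σ0) ≤ 4# * L * N (p -c p')
 separated-points {p} {p'} {ω} {ω'} {σ} {σ'} {σ0} {x} {L} {c} σ>0 σ'>0 σ0>0 L≥0 u u' (_ , r) (_ , r') l1 l2 l3 l4 sep c≥0 small =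
  +-cancelr {z = c * SS} (<& (+m cS cS) (<& (+m bound1 bound1) (=≤ (h1 L (N (p -c p')) x SS) (+m r≤ (*r (nnsq σ0) small))))) where
  v = rl σ *c ω
  v' = rl σ' *c ω'
  SS = σ0 * σ0
  Nv : N v ~ σ * σ
  Nv = & (N-* _ _) (& (ap2 _*_ (N-rl σ) u) (*1r _))
  Nv' : N v' ~ σ' * σ'
  Nv' = & (N-* _ _) (& (ap2 _*_ (N-rl σ') u') (*1r _))
  e1 : N (v -c p) ≤ x * x * (L * SS)
  e1 = =≤ (& (ap N (swap-c v p)) (N-neg _)) (<& r (*l (nnsq x) (=≤ Nv l2)))
  e2 : N (p' -c v') ≤ x * x * (L * SS)
  e2 = <& r' (*l (nnsq x) (=≤ Nv' l4))
  low : σ * σ' * N (ω -c ω') ≤ N (v -c v')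
  low = scaled-unit-distance u u' σ σ'
  prodS : SS ≤ L * (σ * σ')
  prodS = sq-cancel (nn* L≥0 (nn* (lt σ>0) (lt σ'>0))) (≤= (*-mono (nnsq σ0) l1 (nnsq σ0) l3) (#t10 L σ σ'))
  cS : c * SS ≤ L * (σ * σ' * N (ω -c ω'))
  cS = ≤= (*-mono c≥0 sep (nnsq σ0) prodS) (#t9 (N (ω -c ω')) L (σ * σ'))
  bound1 : L * (σ * σ' * N (ω -c ω')) ≤ L * (2# * (N (p -c p') + 2# * (x * x * (L * SS) + x * x * (L * SS))))
  bound1 = *l L≥0 (<& low (=≤ (ap N (#t11 v v' p p')) (<& (N-tri _ _) (*l 0≤2 (+m r≤ (<& (N-tri _ _) (*l 0≤2 (+m e1 e2))))))))
  opaque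
   unfolding Qr
   h1 : ∀ L n x SS -> let u = L * (2# * (n + 2# * (x * x * (L * SS) + x * x * (L * SS)))) in u + u ~ 4# * L * n + 4# * 4# * (L * L) * (x * x) * SS
   h1 = auto Qr

 module EdgeVanishing (a' d' : ℕ) (c : ℕ) (c≡ : c ~ 24) (Pol : Poly2)
  (van : ∀ n -> clearedEval Pol (S a' N.* S d') n ~ 0Z) (i0 j0 a1 d1 R1 : ℕ) (a11 : 1 N.≤ a1) (dR≤ : d1 N.* R1 N.≤ j0)
  (on-edge : ∀ j k -> coeff Pol j k ≢ 0Z -> (∃ \ n -> n N.< S R1 × (j ~ i0 N.+ a1 N.* n × k ~ j0 ∸ d1 N.* n)) ⊎ S d' N.* j N.+ S a' N.* k N.< S d' N.* i0 N.+ S a' N.* j0)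
  (e' : ℕ) (a≡ : S a' ~ a1 N.* S e') (d≡ : S d' ~ d1 N.* S e')
  (K : ℕ) (hs h's : ℕ -> ℕ) (hh : ∀ k -> (hs k N.* h's k) % S a' ~ 1 % S a')
  (distinct : ∀ j k -> j N.< k -> k N.< S K -> (a1 N.* h's j) % S a' ≢ (a1 N.* h's k) % S a') where
  module At k = EdgeAt a' d' (hs k) (h's k) (hh k) c c≡ Pol van i0 j0 a1 d1 R1 a11 dR≤ on-edge
  open Table a' d' using (c0; c0>0; zt-separated; zt-unit; ζt)
  ρ : ℕ -> ℕ -> ℕ -> C
  ρ k = At.ratio k
  σ : ℕ -> ℕ -> ℕ -> Q
  σ k = fst (At.ratio-direction k)
  ω : ℕ -> ℕ -> C
  ω k s = ζt s (a1 N.* h's k)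
  σ>0 : ∀ k -> Ev (\ T s -> 0# < σ k T s)
  σ>0 k = fst (snd (At.ratio-direction k))
  ρ≈ : ∀ k -> ρ k ≈ (\ T s -> rl (σ k T s) *c ω k s)
  ρ≈ k = snd (snd (At.ratio-direction k))
  ω-separated : ∀ s j k -> j N.< k -> k N.< S K -> c0 ≤ N (ω k s -c ω j s)
  ω-separated s j k j<k k<K with NP.<-cmp ((a1 N.* h's j) % S a') ((a1 N.* h's k) % S a')
  ... | tri< l _ _ = zt-separated s l (m%n<n (a1 N.* h's k) (S a'))
  ... | tri≈ _ e _ = abort (distinct j k j<k k<K e)
  ... | tri> _ _ l = ≤= (zt-separated s l (m%n<n (a1 N.* h's j) (S a'))) (& (ap N (swap-c _ _)) (N-neg _))
  N-rlω : ∀ k T s -> N (rl (σ k T s) *c ω k s) ~ σ k T s * σ k T s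
  N-rlω k T s = & (N-* _ _) (& (ap2 _*_ (N-rl _) (zt-unit s _)) (*1r _))
  nX≍ : ∀ k -> (\ T s -> At.nX k T s) ≍ (\ T s -> At.nX 0 T s)
  nX≍ k = ≍-cancel (Evm (\ T s 2T -> let p = F>0 (S d' N.* s) (^n (S a') (^n (S a') (lt (r>0 2T)))) (^-<1 a' (^n (S a') (lt (r>0 2T))) (^-<1 a' (lt (r>0 2T)) (r<1 2T))) in ^-pos c (pp* p p)) (Ev-T≥ 2))
   (≍t (At.nX-size k) (≍-sym (At.nX-size 0)))
  ρ≍ : ∀ k -> (\ T s -> N (ρ k T s)) ≍ (\ T s -> N (ρ 0 T s))
  ρ≍ k = ≍t (At.≍-≡ 0 (\ T s -> & (N-* _ _) (ap (_* N (rl (inv (At.Y 0 T s ^ d1)))) (N-^ (At.X k T s) a1))))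
   (≍t (≍-* (Ev! \ T s -> ^n a1 (N-nn _) , N-nn _) (Ev! \ T s -> ^n a1 (N-nn _) , N-nn _) (≍-^ a1 (\ T s -> N-nn _) (\ T s -> N-nn _) (nX≍ k)) ≍-refl) (At.≍-≡ 0 (\ T s -> ! (& (N-* _ _) (ap (_* N (rl (inv (At.Y 0 T s ^ d1)))) (N-^ (At.X 0 T s) a1))))))
  σ≍ : ∀ k -> (\ T s -> σ k T s * σ k T s) ≍ (\ T s -> σ 0 T s * σ 0 T s)
  σ≍ k = ≍t (≍-sym (size k)) (≍t (ρ≍ k) (size 0)) where
   size : ∀ k -> (\ T s -> N (ρ k T s)) ≍ (\ T s -> σ k T s * σ k T s)
   size k = ≍t (≈⇒≍ (ρ≈ k)) (At.≍-≡ 0 (N-rlω k))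
  Facts : ℕ -> ℕ -> ℕ -> ℕ -> ℕ -> Set
  Facts L x k T s = 0# < σ k T s × Rel (ρ k T s) (rl (σ k T s) *c ω k s) (tε x T) × (σ k T s * σ k T s ≤ ι L * (σ 0 T s * σ 0 T s) × σ 0 T s * σ 0 T s ≤ ι L * (σ k T s * σ k T s))
  uniform : ∀ n -> ∃ \ L -> ∃ \ x -> Ev (\ T s -> ∀ k -> k N.< n -> Facts L x k T s)
  uniform zero = 0 , 0 , Ev! \ T s k ()
  uniform (S n) = go (uniform n) (ρ≈ n) (σ≍ n) where
   go : (∃ \ L -> ∃ \ x -> Ev (\ T s -> ∀ k -> k N.< n -> Facts L x k T s)) -> ρ n ≈ (\ T s -> rl (σ n T s) *c ω n s) -> (\ T s -> σ n T s * σ n T s) ≍ (\ T s -> σ 0 T s * σ 0 T s) -> ∃ \ L -> ∃ \ x -> Ev (\ T s -> ∀ k -> k N.< S n -> Facts L x k T s)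
   go (L , x , f) (y , r) (M , g) = L N.+ M , x N.+ y , Evm2 (\ T s f (p , (r , g)) k l -> pick T s f p r g k l (k ≟ n)) f (Ev-∧ (σ>0 n) (Ev-∧ r g)) where
    weaken : ∀ T s {u v : Q} {A B} -> A N.≤ B -> 0# ≤ v -> u ≤ ι A * v -> u ≤ ι B * v
    weaken T s l v≥0 p = <& p (*r v≥0 (ι-mono l))
    pick : ∀ T s -> (∀ k -> k N.< n -> Facts L x k T s) -> 0# < σ n T s -> Rel (ρ n T s) (rl (σ n T s) *c ω n s) (tε y T) -> (σ n T s * σ n T s ≤ ι M * (σ 0 T s * σ 0 T s) × σ 0 T s * σ 0 T s ≤ ι M * (σ n T s * σ n T s)) →
     ∀ k -> k N.< S n -> Dec (k ~ n) -> Facts (L N.+ M) (x N.+ y) k T s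
    pick T s f p r (g₁ , g2) k l (yes refl) = p , rel-mono (tε-mono T (m≤n+m y x)) r , (weaken T s (m≤n+m M L) (nnsq _) g₁ , weaken T s (m≤n+m M L) (nnsq _) g2)
    pick T s f p r g k l (no ne) = let (p' , r' , (g₁ , g2)) = f k (≤∧≢⇒< (s≤s⁻¹ l) ne) in p' , rel-mono (tε-mono T (m≤m+n x y)) r' , (weaken T s (m≤m+n L M) (nnsq _) g₁ , weaken T s (m≤m+n L M) (nnsq _) g2)
  coefficients-vanish : ∀ n (f : ℕ -> ℤ) -> n N.≤ S K -> (∀ k -> k N.< S K -> ∀ l -> Ev (\ T s -> sumc n (\ i -> rl (κ (f i)) *c ρ k T s ^c i) << At.tT 0 T ^ l)) -> ∀ i -> i N.< n -> f i ~ 0Z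
  coefficients-vanish n f n≤ small i i<n = go (f i Z.≟ 0Z) (uniform (S K)) (At.ratio-size 0 e' a≡ d≡) where
   go : Dec (f i ~ 0Z) -> (∃ \ L -> ∃ \ x -> Ev (\ T s -> ∀ k -> k N.< S K -> Facts L x k T s)) -> (\ T s -> N (ρ 0 T s)) ⋈ (\ _ _ -> 1#) -> f i ~ 0Z
   go (yes z) _ _ = z
   go (no nz) (L0 , x , facts) (_ , (_ , (cρ , low))) = abort (contradiction (Ev-point (Ev-∧ (Ev-∧ facts low) (Ev-∧ (Ev-all< (S K) \ k l -> small k l lx) (Ev-∧ (Ev-∧ (Ev-tε≤ (16 N.* (L N.* L) N.* x) c0>0) (Ev-≤1 x)) (Ev-T≥ (2 N.+ fst big))))))) where
    L = S L0
    L>0 : 0# < ι L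
    L>0 = ι-pos {L} z<s
    csep = c0 * inv (4# * ι L)
    4L>0 : 0# < 4# * ι L
    4L>0 = pp* (p≤ 0<1 (<& (x≤x+y 0≤1) (x≤x+y 0≤2))) L>0
    lag = lagrange (S K) csep (2# * ι L) (pp* c0>0 (inv-pos 4L>0)) (nn* 0≤2 (ι-nn L))
    M1 = fst lag
    M10 : 0# ≤ M1
    M10 = fst (snd lag)
    lx = S (cρ N.* i)
    A = (4# * ι L) ^ i * (M1 * M1)
    big = arch A
    contradiction : (∃ \ T -> ∃ \ s -> ((∀ k -> k N.< S K -> Facts L0 x k T s) × 1# ≤ ι T ^ cρ * N (ρ 0 T s)) × ((∀ k -> k N.< S K -> sumc n (\ j -> rl (κ (f j)) *c ρ k T s ^c j) << At.tT 0 T ^ lx) × ((tε (16 N.* (L N.* L) N.* x) T ≤ c0 × tε x T ≤ 1#) × 2 N.+ fst big N.≤ T))) -> ⊥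
    contradiction (T , s , (fc , low) , (sm , ((t1 , t2) , T≥))) = big-T (<& chain (*r t≥0 (snd big))) where
     1T : 1 N.≤ T
     1T = &N z<s T≥
     t⁻ = inv (ι T)
     t≥0 : 0# ≤ t⁻
     t≥0 = inv-nn (ι-pos 1T)
     t≤1 : t⁻ ≤ 1#
     t≤1 = =≤ (! (*1l t⁻)) (≤= (*r t≥0 (1≤ι 1T)) (inv-r (ι-pos 1T)))
     s0 = σ 0 T s
     s0>0 : 0# < s0
     s0>0 = fst (fc 0 z<s)
     SS = s0 * s0
     S≥0 : 0# ≤ SS
     S≥0 = nnsq s0
     i1 = inv s0
     unit-scale : i1 * i1 * SS ~ 1#
     unit-scale = & (#t18 i1 s0) (& (ap (\ z -> z * z) (inv-r s0>0)) (*1r 1#))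
     up : ∀ {u v} -> 0# ≤ v -> u ≤ ι L0 * v -> u ≤ ι L * v
     up v≥0 p = <& p (*r v≥0 (ι-mono (n≤1+n L0)))
     Nρ≤ : ∀ k -> k N.< S K -> N (ρ k T s) ≤ 4# * (ι L * SS)
     Nρ≤ k l = let (p , r , (g₁ , g2)) = fc k l in <& (rel-N r) (<& (*-mono (nnsq _) (≤= (sq-mono (nn+ (tε-nn x T) 0≤1) (+m t2 r≤)) four) (N-nn _) (=≤ (N-rlω k T s) (up S≥0 g₁))) r≤) where
      opaque
       unfolding Qr
       four : (1# + 1#) * (1# + 1#) ~ 4#
       four = refl
     pts : ℕ -> C
     pts k = rl i1 *c ρ k T s
     N-pts : ∀ k -> N (pts k) ~ i1 * i1 * N (ρ k T s)
     N-pts k = & (N-* _ _) (ap (_* N (ρ k T s)) (N-rl i1))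
     pts<< : ∀ k -> k N.< S K -> pts k << 2# * ι L
     pts<< k l = nn* 0≤2 (ι-nn L) , =≤ (N-pts k) (<& (*l (nnsq i1) (Nρ≤ k l)) (=≤ (& (#t17 i1 (ι L) SS) (& (ap (4# * ι L *_) unit-scale) (*1r _))) (≤= (=≤ (! (*1r _)) (*l (lt 4L>0) (1≤ι {L} z<s))) (#t16 (ι L)))))
     tiny : 4# * 4# * (ι L * ι L) * (tε x T * tε x T) ≤ c0
     tiny = <& (*l (nn* (nn* 0≤4 0≤4) (nn* (ι-nn L) (ι-nn L))) (≤= (*l (tε-nn x T) t2) (*1r _))) (=≤ (& (ap (_* tε x T) (& (ap (_* (ι L * ι L)) sixteen) (& (ap (ι 16 *_) (! (ι-* L L))) (! (ι-* 16 (L N.* L)))))) (tε-* x (16 N.* (L N.* L)) T)) t1) where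
      opaque
       unfolding Qr
       sixteen : 4# * 4# ~ ι 16
       sixteen = refl
     sep : ∀ j k -> j N.< k -> k N.< S K -> csep ≤ N (pts k -c pts j)
     sep j k j<k k<K = *x 4L>0 (=≤ lhs (≤= (*l (nnsq i1) main-sep) rhs)) where
      j<K = NP.<-trans j<k k<K
      main-sep : c0 * SS ≤ 4# * ι L * N (ρ k T s -c ρ j T s)
      main-sep = let (p , r , (g₁ , g2)) = fc k k<K ; (p' , r' , (g1' , g2')) = fc j j<K in
       separated-points p p' s0>0 (ι-nn L) (zt-unit s _) (zt-unit s _) r r' (up (nnsq _) g2) (up S≥0 g₁) (up (nnsq _) g2') (up S≥0 g1') (ω-separated s j k j<k k<K) (lt c0>0) tiny
      lhs : 4# * ι L * csep ~ i1 * i1 * (c0 * SS)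
      lhs = & (#t15 c0 (inv (4# * ι L)) (4# * ι L)) (& (ap (c0 *_) (& (inv-r 4L>0) (! unit-scale))) (#t12 c0 (i1 * i1) SS))
      rhs : i1 * i1 * (4# * ι L * N (ρ k T s -c ρ j T s)) ~ 4# * ι L * N (pts k -c pts j)
      rhs = & (#t12 (i1 * i1) (4# * ι L) (N (ρ k T s -c ρ j T s))) (ap (4# * ι L *_) (! (& (ap N (#t20 (rl i1) (ρ k T s) (ρ j T s))) (& (N-* _ _) (ap (_* N (ρ k T s -c ρ j T s)) (N-rl i1))))))
     coef : ℕ -> C
     coef k = rl (κ (f k)) *c rl (s0 ^ k)
     values : ∀ k -> k N.< S K -> evalP (tabulate n coef) (pts k) << t⁻ ^ lx
     values k l = tr (_<< t⁻ ^ lx) (! (& (tabulate-eval n coef (pts k)) (ΣC.cong-f n \ j -> & (ap (coef j *c_) (*c-^ (rl i1) (ρ k T s) j)) (& (#t19 (rl (κ (f j))) (rl (s0 ^ j)) (rl i1 ^c j) (ρ k T s ^c j)) (& (ap (\ z -> rl (κ (f j)) *c ρ k T s ^c j *c z) (one j)) (*c1r _)))))) (sm k l) where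
      one : ∀ j -> rl (s0 ^ j) *c rl i1 ^c j ~ 1c
      one j = & (ap (rl (s0 ^ j) *c_) (! (rl-^ i1 j))) (& (! (rl-* _ _)) (& (ap rl (& (*-comm _ _) (inv-^* j s0>0))) rl-1))
     all-small : All (_<< M1 * t⁻ ^ lx) (tabulate n coef)
     all-small = snd (snd lag) (tabulate n coef) pts (t⁻ ^ lx) (&N (≡N (tabulate-length n coef)) n≤) (^n lx t≥0) pts<< sep values
     coef-small : κ (f i) * κ (f i) * SS ^ i ≤ M1 * t⁻ ^ lx * (M1 * t⁻ ^ lx)
     coef-small = =≤ (! (& (N-* _ _) (ap2 _*_ (N-rl _) (& (N-rl _) (! (*-^ s0 s0 i)))))) (N-pos-<< (tabulate-all n coef all-small i i<n))
     B1 = ι T ^ cρ * (4# * ι L)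
     B10 : 0# ≤ B1
     B10 = nn* (^n cρ (ι-nn T)) (lt 4L>0)
     1≤BS : 1# ≤ B1 * SS
     1≤BS = <& low (≤= (*l (^n cρ (ι-nn T)) (Nρ≤ 0 z<s)) (#t14 (ι T ^ cρ) (ι L) SS))
     chain : 1# ≤ A * t⁻
     chain = <& (<& (κ²≥1 (f i) nz) (=≤ (! (*1r _)) (*l (nnsq _) (1≤^ i 1≤BS)))) (=≤ (& (ap (κ (f i) * κ (f i) *_) (*-^ B1 SS i)) (#t12 (κ (f i) * κ (f i)) (B1 ^ i) (SS ^ i)))
      (<& (*l (^n i B10) coef-small) (=≤ (& (ap (_* (M1 * t⁻ ^ lx * (M1 * t⁻ ^ lx))) (& (*-^ (ι T ^ cρ) (4# * ι L) i) (ap (_* (4# * ι L) ^ i) (& (! (^-^ (ι T) i cρ)) (ap (ι T ^_) (NP.*-comm i cρ)))))) (& (#t13 (ι T ^ (cρ N.* i)) ((4# * ι L) ^ i) M1 t⁻ (t⁻ ^ (cρ N.* i))) (& (ap (\ z -> A * t⁻ * (t⁻ ^ lx * z)) (& (*-comm _ _) (inv-^* (cρ N.* i) (ι-pos 1T)))) refl)))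
       (≤= (*l (nn* A0 t≥0) (=≤ (*1r _) (^-≤1 lx t≥0 t≤1))) (*1r _))))) where
      A0 : 0# ≤ A
      A0 = nn* (^n i (lt 4L>0)) (nnsq M1)
     big-T : ¬ (1# ≤ ι (fst big) * t⁻)
     big-T p = 0<1 (+-cancelr {z = ι (fst big)} (≤= (<& (ι-mono (&N (n≤1+n (S (fst big))) T≥)) (=≤ (! (*1r _)) (≤= (*l (ι-nn T) p) (& (#t12 (ι T) (ι (fst big)) t⁻) (& (ap (ι (fst big) *_) (inv-r (ι-pos 1T))) (*1r _)))))) (! (+-idl _))))
  -- With coefficients summing to zero, the edge polynomial is (1 - x) times the polynomial of partial sums.
  module Quotient (not-one : ∀ k -> (a1 N.* h's k) % S a' ≢ 0) (total : sumZ (S R1) (At.cf 0) ~ 0Z) where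
   partial : ℕ -> ℤ
   partial i = sumZ (S i) (At.cf 0)
   by-parts : ∀ n p -> sumc (S n) (\ i -> rl (κ (At.cf 0 i)) *c p ^c i) ~ (1c -c p) *c sumc n (\ i -> rl (κ (partial i)) *c p ^c i) +c rl (κ (partial n)) *c p ^c n
   by-parts zero p = & (ap (\ z -> 0c +c rl (κ z) *c 1c) (! (ZP.+-identityˡ _))) (ap (_+c rl (κ (partial 0)) *c 1c) (! (*c-0ʳ _)))
   by-parts (S n) p = & (ap (_+c rl (κ c1) *c p ^c S n) (by-parts n p)) (& (#t21 p (sumc n (\ i -> rl (κ (partial i)) *c p ^c i)) (rl (κ (partial n))) (p ^c n) (rl (κ c1)))
    (ap (\ z -> (1c -c p) *c sumc (S n) (\ i -> rl (κ (partial i)) *c p ^c i) +c z *c p ^c S n) (! (& (ap rl (κ-+ (partial n) c1)) (rl-+ _ _))))) where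
    c1 = At.cf 0 (S n)
   factored : ∀ p -> sumc (S R1) (\ i -> rl (κ (At.cf 0 i)) *c p ^c i) ~ (1c -c p) *c sumc R1 (\ i -> rl (κ (partial i)) *c p ^c i)
   factored p = & (by-parts R1 p) (& (ap (\ z -> (1c -c p) *c sumc R1 (\ i -> rl (κ (partial i)) *c p ^c i) +c z *c p ^c R1) (& (ap (\ z -> rl (κ z)) total) (& (ap rl (κ-ι 0)) rl-0)))
    (& (ap (\ z -> (1c -c p) *c sumc R1 (\ i -> rl (κ (partial i)) *c p ^c i) +c z) (*c-0ˡ _)) (& (+c-comm _ 0c) (+c-idl _))))
   quotient-small : ∀ k l -> Ev (\ T s -> sumc R1 (\ i -> rl (κ (partial i)) *c ρ k T s ^c i) << At.tT 0 T ^ l)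
   quotient-small k l = go (ρ≈ k) where
    go : ρ k ≈ (\ T s -> rl (σ k T s) *c ω k s) -> Ev (\ T s -> sumc R1 (\ i -> rl (κ (partial i)) *c ρ k T s ^c i) << At.tT 0 T ^ l)
    go (x , r) = Evm2 point (Ev-∧ (Ev-∧ r (σ>0 k)) (At.edge-small k (S l))) (Ev-∧ (Ev-∧ (Ev-≤1 x) (Ev-tε≤ (16 N.* x) c0>0)) (Ev-∧ (Ev-tε≤ 16 c0>0) (Ev-T≥ 1))) where
     point : ∀ T s -> (Rel (ρ k T s) (rl (σ k T s) *c ω k s) (tε x T) × 0# < σ k T s) × At.edge k T s << At.tT 0 T ^ S l -> (tε x T ≤ 1# × tε (16 N.* x) T ≤ c0) × (tε 16 T ≤ c0 × 1 N.≤ T) →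
      sumc R1 (\ i -> rl (κ (partial i)) *c ρ k T s ^c i) << At.tT 0 T ^ l
     point T s ((r , σ₊) , small) ((x≤1 , x16) , (t16 , 1T)) = ^n l t≥0 , *x {c0} c0>0 (<& (*r (N-nn Gv) away) (=≤ (& *a (ap (4# * 4# *_) (& (! (N-* _ _)) (ap N (! (factored (ρ k T s))))))) (<& (*l (nn* 0≤4 0≤4) (snd small))
      (=≤ (#t22 t⁻ (t⁻ ^ l)) (*r (nnsq _) (<& (*l (nn* (nn* 0≤4 0≤4) t≥0) t≤1) (=≤ (& (*1r _) (ap (_* t⁻) sixteen)) t16))))))) where
      Gv = sumc R1 (\ i -> rl (κ (partial i)) *c ρ k T s ^c i)
      t⁻ = inv (ι T)
      t≥0 : 0# ≤ t⁻
      t≥0 = inv-nn (ι-pos 1T)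
      t≤1 : t⁻ ≤ 1#
      t≤1 = =≤ (! (*1l t⁻)) (≤= (*r t≥0 (1≤ι 1T)) (inv-r (ι-pos 1T)))
      opaque
       unfolding Qr
       sixteen : 4# * 4# ~ ι 16
       sixteen = refl
      sep : c0 ≤ N (ω k s -c 1c)
      sep = ≤= (Table.zt-≠1 a' d' s (n≢0⇒n>0 (not-one k)) (m%n<n (a1 N.* h's k) (S a'))) (& (! (N-neg _)) (ap N (! (swap-c _ _))))
      away : c0 ≤ 4# * 4# * N (1c -c ρ k T s)
      away = away-from-one σ₊ (zt-unit s _) r sep (lt c0>0) (<& (*l (nn* 0≤4 0≤4) (≤= (*l (tε-nn x T) x≤1) (*1r _))) (=≤ (& (ap (_* tε x T) sixteen) (tε-* x 16 T)) x16))
   contradictory : 1 N.≤ R1 -> R1 N.≤ S K -> At.cf 0 0 ~ 0Z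
   contradictory R≥1 R≤ = & (! (ZP.+-identityˡ _)) (coefficients-vanish R1 partial R≤ (\ k _ -> quotient-small k) 0 R≥1)

module B21 where
 open B10 using (module ΣN; sumN)
 open import Defs
 open import Relation.Nullary using (¬_; yes; no; Dec; does)
 open import Relation.Nullary.Decidable using (dec-true; dec-false)
 open import Data.Bool using (if_then_else_; _∧_)
 open import Data.Nat.Divisibility using (_∣_; divides; _∣?_; ∣⇒≤; ∣m+n∣m⇒∣n; n∣m*n; ∣-trans; ∣m∣n⇒∣m+n; 0∣⇒≡0; ∣-refl; ∣n⇒∣m*n; ∣m⇒∣m*n; ∣1⇒≡1)
 open import Data.Nat.DivMod using (_%_; [m+kn]%n≡m%n; m%n*o≡m*o%[n*o]; m<n⇒m%n≡m)
 open import Data.Nat.Primality using (Prime; prime?; euclidsLemma; prime⇒nonZero; prime⇒irreducible; ¬prime[1])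
 open import Data.Nat.Primality.Factorisation using (factorise; module PrimeFactorisation)
 open import Data.Nat.Coprimality using (Coprime; coprime?; coprime-Bézout)
 open import Data.Nat.GCD using (gcd; gcd[m,n]∣m; gcd[m,n]∣n; gcd-greatest; gcd[m,n]≡0⇒m≡0; module Bézout)
 open N using (_*_; _+_; _<_; _∸_; _≤_)

 #u1 : ∀ a d p -> a * d * p ~ a * p * d
 #u1 = nsolve
 #u2 : ∀ p u -> S p * (p * u) ~ p * (S p * u)
 #u2 = nsolve
 #u3 : ∀ p s m b -> p * s * (m * b) ~ m * p * (s * b)
 #u3 = nsolve
 #u4 : ∀ b y -> 1 + b * (y * S b) ~ 1 + b * y * S b
 #u4 = nsolve
 #u5 : ∀ x b h -> x * b * h + 1 * S b ~ 1 + b * (1 + x * h)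
 #u5 = nsolve

 ind : ∀ {A : Set} -> Dec A -> ℕ
 ind (yes _) = 1
 ind (no _) = 0

 ind-yes : ∀ {A : Set} (D : Dec A) -> A -> ind D ~ 1
 ind-yes (yes _) _ = refl
 ind-yes (no n) p = abort (n p)

 ind-no : ∀ {A : Set} (D : Dec A) -> ¬ A -> ind D ~ 0
 ind-no (yes p) n = abort (n p)
 ind-no (no _) _ = refl

 ind-cong : ∀ {A B : Set} (D : Dec A) (E : Dec B) -> (A -> B) -> (B -> A) -> ind D ~ ind E
 ind-cong (yes p) E f g = ! (ind-yes E (f p))
 ind-cong (no n) E f g = ! (ind-no E \ q -> n (g q))

 when unless : ∀ {A : Set} -> Dec A -> ℕ -> ℕ
 when (yes _) x = x
 when (no _) x = 0
 unless (yes _) x = 0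
 unless (no _) x = x

 when-no : ∀ {A : Set} (D : Dec A) {x} -> (A -> x ~ 0) -> when D x ~ 0
 when-no (yes p) f = f p
 when-no (no _) f = refl

 when-cong : ∀ {A B : Set} (D : Dec A) (E : Dec B) {x y} -> (A -> B) -> (B -> A) -> (A -> x ~ y) -> when D x ~ when E y
 when-cong (yes p) (yes _) f g h = h p
 when-cong (yes p) (no n) f g h = abort (n (f p))
 when-cong (no n) (yes q) f g h = abort (n (g q))
 when-cong (no _) (no _) f g h = refl

 unless-yes : ∀ {A : Set} (D : Dec A) {x} -> A -> unless D x ~ 0
 unless-yes (yes _) _ = refl
 unless-yes (no n) p = abort (n p)

 unless-cong : ∀ {A : Set} (D : Dec A) {x y} -> (¬ A -> x ~ y) -> unless D x ~ unless D y
 unless-cong (yes _) h = refl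
 unless-cong (no n) h = h n

 prime-divisor : ∀ k -> k ≢ 0 -> k ≢ 1 -> ∃ \ q -> Prime q × q ∣ k
 prime-divisor k k≢0 k≢1 = go (PrimeFactorisation.factors fac) (PrimeFactorisation.isFactorisation fac) (PrimeFactorisation.factorsPrime fac) where
  fac = factorise k {{N.≢-nonZero k≢0}}
  go : ∀ fs -> k ~ Data.Nat.ListAction.product fs -> All Prime fs -> ∃ \ q -> Prime q × q ∣ k
  go [] e _ = abort (k≢1 e)
  go (q ∷ qs) e (pq ∷ _) = q , pq , divides (Data.Nat.ListAction.product qs) (& e (NP.*-comm q _))

 prime-∣-prime : ∀ {p q} -> Prime p -> Prime q -> q ∣ p -> q ~ p
 prime-∣-prime pp pq q∣p with prime⇒irreducible pp q∣p
 ... | inl refl = abort (¬prime[1] pq)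
 ... | inr e = e

 prime1 : ∀ {p} -> Prime p -> 1 ≤ p
 prime1 pp = N.>-nonZero⁻¹ _ {{prime⇒nonZero pp}}

 NoPrime : ℕ -> ℕ -> ℕ -> Set
 NoPrime b a d = ∀ {q} -> Prime q -> q ∣ b -> q ∣ a -> q ∣ d -> ⊥

 noPrime⇒coprime : ∀ {b a d} -> 1 ≤ a -> NoPrime b a d -> Coprime b (gcd a d)
 noPrime⇒coprime {b} {a} {d} a≥1 np {i} (i∣b , i∣g) with i ≟ 1 | i ≟ 0
 ... | yes e | _ = e
 ... | no _ | yes refl = abort (<⇒≢ a≥1 (! (gcd[m,n]≡0⇒m≡0 (0∣⇒≡0 i∣g))))
 ... | no i≢1 | no i≢0 = let (q , pq , q∣i) = prime-divisor i i≢0 i≢1 in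
  abort (np pq (∣-trans q∣i i∣b) (∣-trans (∣-trans q∣i i∣g) (gcd[m,n]∣m a d)) (∣-trans (∣-trans q∣i i∣g) (gcd[m,n]∣n a d)))

 coprime⇒noPrime : ∀ {b a d} -> Coprime b (gcd a d) -> NoPrime b a d
 coprime⇒noPrime cop pq q∣b q∣a q∣d with cop (q∣b , gcd-greatest q∣a q∣d)
 ... | refl = ¬prime[1] pq

 opaque
  I : ℕ -> ℕ -> ℕ -> ℕ
  I b a d = ind (coprime? b (gcd a d))
  I-def : ∀ b a d -> I b a d ~ ind (coprime? b (gcd a d))
  I-def b a d = refl

 -- G(a, d) counts the cosets (a b; 0 d) with 0 ≤ b < d and gcd(a, b, d) = 1.
 G : ℕ -> ℕ -> ℕ
 G a d = sumN d (\ b -> I b a d)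

 I-cong : ∀ {b a d b' a' d'} -> 1 ≤ a -> 1 ≤ a' -> (NoPrime b a d -> NoPrime b' a' d') -> (NoPrime b' a' d' -> NoPrime b a d) -> I b a d ~ I b' a' d'
 I-cong {b} {a} {d} {b'} {a'} {d'} a≥1 a'1 f g = & (I-def b a d) (& (ind-cong (coprime? b (gcd a d)) (coprime? b' (gcd a' d')) (\ c -> noPrime⇒coprime a'1 (f (coprime⇒noPrime c))) (\ c -> noPrime⇒coprime a≥1 (g (coprime⇒noPrime c)))) (! (I-def b' a' d')))

 sumN-const : ∀ n c -> sumN n (\ _ -> c) ~ n * c
 sumN-const zero c = refl
 sumN-const (S n) c = & (ap (_+ c) (sumN-const n c)) (NP.+-comm (n * c) c)

 sumN-*ˡ : ∀ n c f -> sumN n (\ k -> c * f k) ~ c * sumN n f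
 sumN-*ˡ n c f = ! (ΣN.fold-hom n f (\ x -> c * x) (*-zeroʳ c) (*-distribˡ-+ c))

 sumN-tail : ∀ {n m} g -> n ≤ m -> (∀ i -> n ≤ i -> g i ~ 0) -> sumN m g ~ sumN n g
 sumN-tail {n} {m} g l z = & (ap (\ k -> sumN k g) (! (m+[n∸m]≡n l))) (& (ΣN.split n (m ∸ n) g) (& (ap (sumN n g +_) (ΣN.fold-none (m ∸ n) \ k _ -> z (n + k) (m≤m+n n k))) (NP.+-identityʳ _)))

 pairs : ℕ -> ℕ -> ℕ -> (ℕ -> ℕ -> ℕ) -> ℕ
 pairs A B N f = sumN A (\ i -> sumN B (\ j -> when (S i * S j ≟ N) (f (S i) (S j))))

 pairs-cong : ∀ A B N {f g : ℕ -> ℕ -> ℕ} -> (∀ a d -> 1 ≤ a -> 1 ≤ d -> a * d ~ N -> f a d ~ g a d) -> pairs A B N f ~ pairs A B N g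
 pairs-cong A B N h = ΣN.cong-f A \ i -> ΣN.cong-f B \ j -> when-cong (S i * S j ≟ N) (S i * S j ≟ N) (\ e -> e) (\ e -> e) (h (S i) (S j) z<s z<s)

 pairs-+ : ∀ A B N (f g : ℕ -> ℕ -> ℕ) -> pairs A B N (\ a d -> f a d + g a d) ~ pairs A B N f + pairs A B N g
 pairs-+ A B N f g = & (ΣN.cong-f A \ i -> & (ΣN.cong-f B \ j -> w+ (S i * S j ≟ N)) (ΣN.distr B _ _)) (ΣN.distr A _ _) where
  w+ : ∀ {X : Set} (D : Dec X) {x y} -> when D (x + y) ~ when D x + when D y
  w+ (yes _) = refl
  w+ (no _) = refl

 pairs-* : ∀ A B N c (f : ℕ -> ℕ -> ℕ) -> pairs A B N (\ a d -> c * f a d) ~ c * pairs A B N f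
 pairs-* A B N c f = & (ΣN.cong-f A \ i -> & (ΣN.cong-f B \ j -> w* (S i * S j ≟ N)) (sumN-*ˡ B c _)) (sumN-*ˡ A c _) where
  w* : ∀ {X : Set} (D : Dec X) {x} -> when D (c * x) ~ c * when D x
  w* (yes _) = refl
  w* (no _) = ! (*-zeroʳ c)

 pairs-range : ∀ {A B N} f -> N ≤ A -> N ≤ B -> pairs A B N f ~ pairs N N N f
 pairs-range {A} {B} {N} f N≤A N≤B = & (ΣN.cong-f A \ i -> sumN-tail (\ j -> when (S i * S j ≟ N) (f (S i) (S j))) N≤B \ j l -> when-no (S i * S j ≟ N) \ e -> abort (<⇒≢ (≤-<-trans l (m≤n*m (S j) (S i))) (! e)))
  (sumN-tail (\ i -> sumN N (\ j -> when (S i * S j ≟ N) (f (S i) (S j)))) N≤A \ i l -> ΣN.fold-none N \ j _ -> when-no (S i * S j ≟ N) \ e -> abort (<⇒≢ (≤-<-trans l (m≤m*n (S i) (S j))) (! e)))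

 module AtPrime {p' : ℕ} (pp : Prime (S p')) where
  p = S p'
  I-A : ∀ {b a d} -> 1 ≤ a -> p ∣ a -> I b (a * p) d ~ I b a d
  I-A {b} {a} {d} a≥1 p∣a = I-cong (&N a≥1 (m≤m*n a p)) a≥1 (\ np pq q∣b q∣a -> np pq q∣b (∣m⇒∣m*n p q∣a)) \ np pq q∣b q∣ap q∣d -> np pq q∣b (down pq (euclidsLemma a p pq q∣ap)) q∣d where
   down : ∀ {q} -> Prime q -> q ∣ a ⊎ q ∣ p -> q ∣ a
   down pq (inl x) = x
   down pq (inr x) = ∣-trans x p∣a
  I-B : ∀ {b a d} -> 1 ≤ a -> ¬ (p ∣ d) -> I b (a * p) d ~ I b a d
  I-B {b} {a} {d} a≥1 p∤d = I-cong (&N a≥1 (m≤m*n a p)) a≥1 (\ np pq q∣b q∣a -> np pq q∣b (∣m⇒∣m*n p q∣a)) \ np pq q∣b q∣ap q∣d -> np pq q∣b (down pq q∣d (euclidsLemma a p pq q∣ap)) q∣d where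
   down : ∀ {q} -> Prime q -> q ∣ d -> q ∣ a ⊎ q ∣ p -> q ∣ a
   down pq q∣d (inl x) = x
   down pq q∣d (inr x) = abort (p∤d (tr (_∣ d) (prime-∣-prime pp pq x) q∣d))
  I-C : ∀ {b a d} -> 1 ≤ a -> ¬ (p ∣ a) -> I b a (d * p) ~ I b a d
  I-C {b} {a} {d} a≥1 p∤a = I-cong a≥1 a≥1 (\ np pq q∣b q∣a q∣d -> np pq q∣b q∣a (∣m⇒∣m*n p q∣d)) \ np pq q∣b q∣a q∣dp -> np pq q∣b q∣a (down pq q∣a (euclidsLemma d p pq q∣dp)) where
   down : ∀ {q} -> Prime q -> q ∣ a -> q ∣ d ⊎ q ∣ p -> q ∣ d
   down pq q∣a (inl x) = x
   down pq q∣a (inr x) = abort (p∤a (tr (_∣ a) (prime-∣-prime pp pq x) q∣a))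
  G-C : ∀ {a d} -> 1 ≤ a -> ¬ (p ∣ a) -> G a (d * p) ~ p * G a d
  G-C {a} {d} a≥1 p∤a = & (ap (\ n -> sumN n (\ b -> I b a (d * p))) (NP.*-comm d p)) (& (ΣN.blocks p d _) (& (ΣN.cong-f p \ i -> ΣN.cong-f d \ b -> & (I-C a≥1 p∤a) (shift i b)) (sumN-const p (G a d)))) where
   shift : ∀ i b -> I (i * d + b) a d ~ I b a d
   shift i b = I-cong a≥1 a≥1 (\ np pq q∣b q∣a q∣d -> np pq (∣m∣n⇒∣m+n (∣n⇒∣m*n i q∣d) q∣b) q∣a q∣d) \ np pq q∣s q∣a q∣d -> np pq (∣m+n∣m⇒∣n q∣s (∣n⇒∣m*n i q∣d)) q∣a q∣d
  G-E : ∀ {a d} -> 1 ≤ a -> ¬ (p ∣ a) -> G (a * p) (d * p) + G a d ~ G a (d * p)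
  G-E {a} {d} a≥1 p∤a = & (ap (G (a * p) (d * p) +_) (! multiples)) (& (! (ΣN.distr (d * p) _ _)) (ΣN.cong-f (d * p) \ b -> ! (split b (p ∣? b)))) where
   split : ∀ b (D : Dec (p ∣ b)) -> I b a (d * p) ~ I b (a * p) (d * p) + when D (I b a (d * p))
   split b (yes p∣b) = ap (_+ I b a (d * p)) (! (& (I-def b (a * p) (d * p)) (ind-no (coprime? b (gcd (a * p) (d * p))) \ c -> coprime⇒noPrime c pp p∣b (n∣m*n a) (n∣m*n d))))
   split b (no p∤b) = & (I-cong a≥1 (&N a≥1 (m≤m*n a p)) (\ np pq q∣b q∣ap q∣d -> np pq q∣b (down pq q∣b (euclidsLemma a p pq q∣ap)) q∣d) \ np pq q∣b q∣a -> np pq q∣b (∣m⇒∣m*n p q∣a)) (! (NP.+-identityʳ _)) where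
    down : ∀ {q} -> Prime q -> q ∣ b -> q ∣ a ⊎ q ∣ p -> q ∣ a
    down pq q∣b (inl x) = x
    down pq q∣b (inr x) = abort (p∤b (tr (_∣ b) (prime-∣-prime pp pq x) q∣b))
   multiples : sumN (d * p) (\ b -> when (p ∣? b) (I b a (d * p))) ~ G a d
   multiples = & (ΣN.blocks d p _) (ΣN.cong-f d \ i -> & (ΣN.front p' _) (& (ap2 _+_ (first i) (ΣN.fold-none p' \ k k<p' -> when-no (p ∣? (i * p + S k)) \ p∣ -> abort (<⇒≱ (s≤s k<p') (∣⇒≤ (∣m+n∣m⇒∣n p∣ (n∣m*n i)))))) (NP.+-identityʳ _))) where
    first : ∀ i -> when (p ∣? (i * p + 0)) (I (i * p + 0) a (d * p)) ~ I i a d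
    first i = & (ap (\ b -> when (p ∣? b) (I b a (d * p))) (NP.+-identityʳ (i * p))) (& (yes! (p ∣? (i * p)) (n∣m*n i))
     (I-cong a≥1 a≥1 (\ np pq q∣i q∣a q∣d -> np pq (∣m⇒∣m*n p q∣i) q∣a (∣m⇒∣m*n p q∣d)) \ np pq q∣ip q∣a q∣dp -> np pq (down pq q∣a (euclidsLemma i p pq q∣ip)) q∣a (down pq q∣a (euclidsLemma d p pq q∣dp)))) where
     yes! : ∀ {X : Set} (D : Dec X) {x} -> X -> when D x ~ x
     yes! (yes _) _ = refl
     yes! (no n) p = abort (n p)
     down : ∀ {q x} -> Prime q -> q ∣ a -> q ∣ x ⊎ q ∣ p -> q ∣ x
     down pq q∣a (inl x) = x
     down pq q∣a (inr x) = abort (p∤a (tr (_∣ a) (prime-∣-prime pp pq x) q∣a))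
  every-pth : ∀ n (g : ℕ -> ℕ) -> (∀ i -> ¬ (p ∣ S i) -> g i ~ 0) -> sumN (n * p) g ~ sumN n (\ i -> g (i * p + p'))
  every-pth n g z = & (ΣN.blocks n p g) (ΣN.cong-f n \ i -> ap (_+ g (i * p + p')) (ΣN.fold-none p' \ k k<p' -> z (i * p + k) \ p∣ -> <⇒≱ (s≤s k<p') (∣⇒≤ (∣m+n∣m⇒∣n (tr (p ∣_) (! (+-suc (i * p) k)) p∣) (n∣m*n i)))))
  last : ∀ i -> S (i * p + p') ~ S i * p
  last i = & (! (+-suc (i * p) p')) (NP.+-comm (i * p) p)
  columns : ∀ N (g : ℕ -> ℕ -> ℕ) -> pairs (N * p) (N * p) (N * p) (\ a d -> unless (p ∣? a) (g a d)) ~ pairs N N N (\ a d -> unless (p ∣? a) (g a (d * p)))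
  columns N g = & (ΣN.cong-f (N * p) \ i -> & (every-pth N _ \ j p∤ -> when-no (S i * S j ≟ N * p) \ e -> unless-yes (p ∣? S i) (side i j p∤ e (euclidsLemma (S i) (S j) pp (tr (p ∣_) (! e) (n∣m*n N)))))
   (ΣN.cong-f N \ j -> & (ap (\ d -> when (S i * d ≟ N * p) (unless (p ∣? S i) (g (S i) d))) (last j)) (when-cong (S i * (S j * p) ≟ N * p) (S i * S j ≟ N) (\ e -> NP.*-cancelʳ-≡ (S i * S j) N p (& (NP.*-assoc (S i) (S j) p) e)) (\ e -> & (! (NP.*-assoc (S i) (S j) p)) (ap (_* p) e)) \ _ -> refl)))
   (pairs-range (\ a d -> unless (p ∣? a) (g a (d * p))) (m≤m*n N p) NP.≤-refl) where
   side : ∀ i j -> ¬ (p ∣ S j) -> S i * S j ~ N * p -> p ∣ S i ⊎ p ∣ S j -> p ∣ S i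
   side i j p∤ e (inl x) = x
   side i j p∤ e (inr x) = abort (p∤ x)
  rows : ∀ N (g : ℕ -> ℕ -> ℕ) -> pairs (N * p) (N * p) (N * p) (\ a d -> when (p ∣? a) (g a d)) ~ pairs N N N (\ a d -> g (a * p) d)
  rows N g = & (every-pth N _ \ i p∤ -> ΣN.fold-none (N * p) \ j _ -> when-no (S i * S j ≟ N * p) \ _ -> when-no (p ∣? S i) \ p∣ -> abort (p∤ p∣))
   (& (ΣN.cong-f N \ i -> ΣN.cong-f (N * p) \ j -> & (ap (\ a -> when (a * S j ≟ N * p) (when (p ∣? a) (g a (S j)))) (last i)) (when-cong (S i * p * S j ≟ N * p) (S i * S j ≟ N)
    (\ e -> NP.*-cancelʳ-≡ (S i * S j) N p (& (#u1 (S i) (S j) p) e)) (\ e -> & (! (#u1 (S i) (S j) p)) (ap (_* p) e)) \ _ -> yes! (p ∣? (S i * p)) (n∣m*n (S i))))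
   (pairs-range (\ a d -> g (a * p) d) NP.≤-refl (m≤m*n N p))) where
   yes! : ∀ {X : Set} (D : Dec X) {x} -> X -> when D x ~ x
   yes! (yes _) _ = refl
   yes! (no n) p = abort (n p)
  U V W : ℕ -> ℕ
  U N = pairs N N N (\ a d -> unless (p ∣? a) (G a d))
  V N = pairs N N N (\ a d -> when (p ∣? a) (G a d))
  W N = pairs N N N (\ a d -> G (a * p) d)
  U-step : ∀ N -> U (N * p) ~ p * U N
  U-step N = & (columns N G) (& (pairs-cong N N N \ a d a≥1 _ _ -> & (unless-cong (p ∣? a) \ p∤a -> G-C {a} {d} a≥1 p∤a) (u* (p ∣? a))) (pairs-* N N N p (\ a d -> unless (p ∣? a) (G a d)))) where
   u* : ∀ {X : Set} (D : Dec X) {x} -> unless D (p * x) ~ p * unless D x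
   u* (yes _) = ! (*-zeroʳ p)
   u* (no _) = refl
  V-step : ∀ N -> V (N * p) ~ W N
  V-step N = rows N G
  W≡U : ∀ fuel N -> N ≤ fuel -> 1 ≤ N -> W N ~ U N
  W≡U zero zero _ ()
  W≡U (S fuel) N l N≥1 = go (p ∣? N) where
   go : Dec (p ∣ N) -> W N ~ U N
   go (no p∤N) = pairs-cong N N N \ a d a≥1 _ e -> & (ΣN.cong-f d \ b -> I-B {b} {a} {d} a≥1 \ p∣d -> p∤N (tr (p ∣_) e (∣n⇒∣m*n a p∣d))) (! (no! (p ∣? a) \ p∣a -> p∤N (tr (p ∣_) e (∣m⇒∣m*n d p∣a)))) where
    no! : ∀ {X : Set} (D : Dec X) {x} -> ¬ X -> unless D x ~ x
    no! (yes q) n = abort (n q)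
    no! (no _) _ = refl
   go (yes (divides M refl)) = & (pairs-cong N N N \ a d a≥1 _ _ -> parts a d a≥1 (p ∣? a)) (& (pairs-+ N N N (\ a d -> when (p ∣? a) (G a d)) (\ a d -> unless (p ∣? a) (G (a * p) d)))
    (& (ap2 _+_ (& (V-step M) (W≡U fuel M (≤-pred (<-≤-trans M<N l)) M≥1)) (columns M (\ a d -> G (a * p) d)))
     (& (NP.+-comm (U M) _) (& (! (pairs-+ M M M (\ a d -> unless (p ∣? a) (G (a * p) (d * p))) (\ a d -> unless (p ∣? a) (G a d)))) (& (pairs-cong M M M \ a d a≥1 _ _ -> join a d a≥1 (p ∣? a)) (! (columns M G))))))) where
    M≥1 : 1 ≤ M
    M≥1 = n≢0⇒n>0 \ { refl -> <⇒≢ N≥1 refl }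
    M<N : M < M * p
    M<N = NP.m<m*n M p {{>-nonZero M≥1}} (p>1 pp) where
     p>1 : ∀ {p} -> Prime p -> 1 < p
     p>1 {zero} pr = abort (<⇒≢ (prime1 pr) refl)
     p>1 {S zero} pr = abort (¬prime[1] pr)
     p>1 {S (S _)} _ = s≤s z<s
    parts : ∀ a d -> 1 ≤ a -> (D : Dec (p ∣ a)) -> G (a * p) d ~ when D (G a d) + unless D (G (a * p) d)
    parts a d a≥1 (yes p∣a) = & (ΣN.cong-f d \ b -> I-A {b} {a} {d} a≥1 p∣a) (! (NP.+-identityʳ _))
    parts a d a≥1 (no _) = refl
    join : ∀ a d -> 1 ≤ a -> (D : Dec (p ∣ a)) -> unless D (G (a * p) (d * p)) + unless D (G a d) ~ unless D (G a (d * p))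
    join a d a≥1 (yes _) = refl
    join a d a≥1 (no p∤a) = G-E {a} {d} a≥1 p∤a

 cosets : ℕ -> ℕ
 cosets N = pairs N N N G

 module CosetsAtPrime {p' : ℕ} (pp : Prime (S p')) where
  open AtPrime pp
  cosets-split : ∀ N -> cosets N ~ U N + V N
  cosets-split N = & (pairs-cong N N N {G} \ a d _ _ _ -> parts (p ∣? a)) (pairs-+ N N N (\ a d -> unless (p ∣? a) (G a d)) (\ a d -> when (p ∣? a) (G a d))) where
   parts : ∀ {X : Set} (D : Dec X) {x} -> x ~ unless D x + when D x
   parts (yes _) = refl
   parts (no _) = ! (NP.+-identityʳ _)
  cosets-step : ∀ N -> 1 ≤ N -> cosets (N * p) ~ S p * U N
  cosets-step N N≥1 = & (cosets-split (N * p)) (& (ap2 _+_ (U-step N) (& (V-step N) (W≡U N N NP.≤-refl N≥1))) (NP.+-comm (p * U N) (U N)))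
  cosets-new : ∀ N -> 1 ≤ N -> ¬ (p ∣ N) -> cosets (N * p) ~ S p * cosets N
  cosets-new N N≥1 p∤N = & (cosets-step N N≥1) (ap (S p *_) (! (& (cosets-split N) (& (ap (U N +_) V0) (NP.+-identityʳ _))))) where
   V0 : V N ~ 0
   V0 = ΣN.fold-none N \ i _ -> ΣN.fold-none N \ j _ -> when-no (S i * S j ≟ N) {when (p ∣? S i) (G (S i) (S j))} \ e -> when-no (p ∣? S i) {G (S i) (S j)} \ p∣ -> abort (p∤N (tr (p ∣_) e (∣m⇒∣m*n (S j) p∣)))
  cosets-old : ∀ M -> 1 ≤ M -> cosets (M * p * p) ~ p * cosets (M * p)
  cosets-old M M≥1 = & (cosets-step (M * p) (&N M≥1 (m≤m*n M p))) (& (ap (S p *_) (U-step M)) (& (#u2 p (U M)) (ap (p *_) (! (cosets-step M M≥1)))))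

 factor : (ℕ -> ℕ) -> ℕ -> ℕ -> ℕ
 factor f N q = if (does (prime? q) ∧ does (q ∣? N)) then f q else 1

 factor-yes : ∀ f {N q} -> Prime q -> q ∣ N -> factor f N q ~ f q
 factor-yes f {N} {q} pq d = ap2 (\ u v -> if u ∧ v then f q else 1) (dec-true (prime? q) pq) (dec-true (q ∣? N) d)

 factor-no : ∀ f {N q} -> ¬ (Prime q × q ∣ N) -> factor f N q ~ 1
 factor-no f {N} {q} n = go (prime? q) (q ∣? N) where
  go : Dec (Prime q) -> Dec (q ∣ N) -> factor f N q ~ 1
  go (yes a) (yes b) = abort (n (a , b))
  go (no a) _ = ap (\ u -> if u ∧ does (q ∣? N) then f q else 1) (dec-false (prime? q) a)
  go (yes a) (no b) = ap2 (\ u v -> if u ∧ v then f q else 1) (dec-true (prime? q) a) (dec-false (q ∣? N) b)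

 factor-cong : ∀ f {N N' q} -> (Prime q -> q ∣ N -> q ∣ N') -> (Prime q -> q ∣ N' -> q ∣ N) -> factor f N q ~ factor f N' q
 factor-cong f {N} {N'} {q} g h = go (prime? q) (q ∣? N) where
  go : Dec (Prime q) -> Dec (q ∣ N) -> factor f N q ~ factor f N' q
  go (yes a) (yes b) = & (factor-yes f a b) (! (factor-yes f a (g a b)))
  go (no a) _ = & (factor-no f \ x -> a (fst x)) (! (factor-no f \ x -> a (fst x)))
  go (yes a) (no b) = & (factor-no f \ x -> b (snd x)) (! (factor-no f \ x -> b (h a (snd x))))

 ppd-cong : ∀ f {N N'} k -> (∀ q -> q ≤ k -> Prime q -> q ∣ N -> q ∣ N') -> (∀ q -> q ≤ k -> Prime q -> q ∣ N' -> q ∣ N) -> prodPrimeDivisors f N k ~ prodPrimeDivisors f N' k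
 ppd-cong f zero g h = refl
 ppd-cong f (S k) g h = ap2 _*_ (ppd-cong f k (\ q l -> g q (NP.m≤n⇒m≤1+n l)) (\ q l -> h q (NP.m≤n⇒m≤1+n l))) (factor-cong f (g (S k) NP.≤-refl) (h (S k) NP.≤-refl))

 ppd-extend : ∀ f N r -> 1 ≤ N -> prodPrimeDivisors f N (r + N) ~ prodPrimeDivisors f N N
 ppd-extend f N zero _ = refl
 ppd-extend f N (S r) N≥1 = & (ap2 _*_ (ppd-extend f N r N≥1) (factor-no f {N} {S (r + N)} \ (_ , d) -> <⇒≱ (s≤s (m≤n+m N r)) (∣⇒≤ {{>-nonZero N≥1}} d))) (*-identityʳ _)

 ppd-new : ∀ f M p k -> Prime p -> ¬ (p ∣ M) -> p ≤ k -> prodPrimeDivisors f (M * p) k ~ f p * prodPrimeDivisors f M k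
 ppd-new f M p zero pp p∤M l = abort (<⇒≢ (&N (prime1 pp) l) refl)
 ppd-new f M p (S k) pp p∤M l = go (p ≟ S k) where
  other : ∀ q -> q ≢ p -> Prime q -> q ∣ M * p -> q ∣ M
  other q ne pq d = case (euclidsLemma M p pq d) where
   case : q ∣ M ⊎ q ∣ p -> q ∣ M
   case (inl x) = x
   case (inr x) = abort (ne (prime-∣-prime pp pq x))
  go : Dec (p ~ S k) -> prodPrimeDivisors f (M * p) (S k) ~ f p * prodPrimeDivisors f M (S k)
  go (yes refl) = & (ap2 _*_ (ppd-cong f k (\ q l pq d -> other q (<⇒≢ (s≤s l)) pq d) \ q _ _ d -> ∣m⇒∣m*n p d) (factor-yes f {M * p} {S k} pp (n∣m*n M)))
   (& (NP.*-comm (prodPrimeDivisors f M k) (f p)) (ap (f p *_) (! (& (ap (prodPrimeDivisors f M k *_) (factor-no f {M} {S k} \ x -> p∤M (snd x))) (*-identityʳ (prodPrimeDivisors f M k))))))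
  go (no ne) = & (ap2 _*_ (ppd-new f M p k pp p∤M (≤-pred (≤∧≢⇒< l ne))) (factor-cong f {M * p} {M} {S k} (other (S k) \ e -> ne (! e)) \ _ d -> ∣m⇒∣m*n p d)) (NP.*-assoc (f p) _ _)

 ppd-pos : ∀ N k -> 1 ≤ prodPrimeDivisors (\ q -> q) N k
 ppd-pos N zero = NP.≤-refl
 ppd-pos N (S k) = *-mono-≤ (ppd-pos N k) (go (prime? (S k)) (S k ∣? N)) where
  go : Dec (Prime (S k)) -> Dec (S k ∣ N) -> 1 ≤ factor (\ q -> q) N (S k)
  go (yes a) (yes b) = tr (1 ≤_) (! (factor-yes (\ q -> q) {N} {S k} a b)) z<s
  go (no a) _ = ≡N (! (factor-no (\ q -> q) {N} {S k} \ x -> a (fst x)))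
  go (yes _) (no b) = ≡N (! (factor-no (\ q -> q) {N} {S k} \ x -> b (snd x)))

 cosets-formula : ∀ fuel N -> N ≤ fuel -> 1 ≤ N -> cosets N * prodPrimeDivisors (\ q -> q) N N ~ N * prodPrimeDivisors S N N
 cosets-formula zero zero _ ()
 cosets-formula (S fuel) N l N≥1 = go (N ≟ 1) where
  go : Dec (N ~ 1) -> cosets N * prodPrimeDivisors (\ q -> q) N N ~ N * prodPrimeDivisors S N N
  go (yes refl) = ap (\ x -> x * prodPrimeDivisors (\ q -> q) 1 1) (& (I-def 0 1 1) (ind-yes (coprime? 0 (gcd 1 1)) \ (_ , d) -> ∣1⇒≡1 (∣-trans d (gcd[m,n]∣m 1 1))))
  go (no N≢1) = step (prime-divisor N (\ e -> <⇒≢ N≥1 (! e)) N≢1) where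
   step : (∃ \ q -> Prime q × q ∣ N) -> cosets N * prodPrimeDivisors (\ q -> q) N N ~ N * prodPrimeDivisors S N N
   step (zero , pq , _) = abort (<⇒≢ (prime1 pq) refl)
   step (S p' , pq , divides M refl) = split (p ∣? M) where
    p = S p'
    open CosetsAtPrime pq
    M≥1 : 1 ≤ M
    M≥1 = n≢0⇒n>0 \ { refl -> <⇒≢ N≥1 refl }
    p>1 : 1 < p
    p>1 = ≤∧≢⇒< z<s \ e -> ¬prime[1] (tr Prime (! e) pq)
    IH = cosets-formula fuel M (≤-pred (<-≤-trans (NP.m<m*n M p {{>-nonZero M≥1}} p>1) l)) M≥1
    range : ∀ f -> prodPrimeDivisors f M (M * p) ~ prodPrimeDivisors f M M
    range f = & (ap (prodPrimeDivisors f M) (& (NP.*-comm M p) (NP.+-comm M (p' * M)))) (ppd-extend f M (p' * M) M≥1)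
    A = prodPrimeDivisors (\ q -> q) M M
    B = prodPrimeDivisors S M M
    split : Dec (p ∣ M) -> cosets (M * p) * prodPrimeDivisors (\ q -> q) (M * p) (M * p) ~ M * p * prodPrimeDivisors S (M * p) (M * p)
    split (no p∤M) = & (ap2 _*_ (cosets-new M M≥1 p∤M) (& (ppd-new (\ q -> q) M p (M * p) pq p∤M p≤) (ap (p *_) (range (\ q -> q)))))
     (& (#u3 (S p) (cosets M) p A) (& (ap (\ z -> p * S p * z) IH) (& (#u3 p (S p) M B) (ap (M * p *_) (! (& (ppd-new S M p (M * p) pq p∤M p≤) (ap (S p *_) (range S)))))))) where
     p≤ : p ≤ M * p
     p≤ = m≤n*m p M {{>-nonZero M≥1}}
    split (yes p∣M@(divides L refl)) = & (ap2 _*_ (cosets-old L (n≢0⇒n>0 \ { refl -> <⇒≢ M≥1 refl })) (same (\ q -> q))) (& (NP.*-assoc p (cosets M) A) (& (ap (p *_) IH) (& (! (NP.*-assoc p M B)) (ap2 _*_ (NP.*-comm p M) (! (same S)))))) where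
     down : ∀ {q} -> q ∣ M ⊎ q ∣ p -> q ∣ M
     down (inl x) = x
     down (inr x) = ∣-trans x p∣M
     same : ∀ f -> prodPrimeDivisors f (M * p) (M * p) ~ prodPrimeDivisors f M M
     same f = & (ppd-cong f (M * p) (\ q _ pr d -> down (euclidsLemma M p pr d)) \ q _ _ d -> ∣m⇒∣m*n p d) (range f)

 cosets≡ψ : ∀ {N n} -> 1 ≤ N -> IsPsi N n -> cosets N ~ n
 cosets≡ψ {N} {n} N≥1 ψ = NP.*-cancelʳ-≡ (cosets N) n (prodPrimeDivisors (\ q -> q) N N) {{>-nonZero (ppd-pos N N)}} (& (cosets-formula N N NP.≤-refl N≥1) (! ψ))

 φ : ℕ -> ℕ
 φ e = sumN e (\ b -> ind (coprime? b e))

 G-φ : ∀ a d d1 -> d ~ d1 * gcd a d -> G a d ~ d1 * φ (gcd a d)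
 G-φ a d d1 d≡ = & (ap (\ n -> sumN n (\ b -> I b a d)) d≡) (& (ΣN.blocks d1 (gcd a d) _) (& (ΣN.cong-f d1 \ i -> ΣN.cong-f (gcd a d) \ b -> & (I-def (i * gcd a d + b) a d) (ind-cong (coprime? (i * gcd a d + b) (gcd a d)) (coprime? b (gcd a d))
  (\ c {j} (j∣b , j∣e) -> c (∣m∣n⇒∣m+n (∣n⇒∣m*n i j∣e) j∣b , j∣e)) \ c {j} (j∣s , j∣e) -> c (∣m+n∣m⇒∣n j∣s (∣n⇒∣m*n i j∣e) , j∣e))) (sumN-const d1 _)))

 enumerate : ∀ {P : ℕ -> Set} (P? : ∀ k -> Dec (P k)) n -> let c = sumN n (\ k -> ind (P? k)) in
  Σ (ℕ -> ℕ) \ u -> (∀ k -> k < c -> u k < n × P (u k)) × (∀ j k -> j < k -> k < c -> u j ≢ u k)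
 enumerate P? zero = (\ _ -> 0) , (\ k ()) , \ j k _ ()
 enumerate {P} P? (S n) = go (enumerate P? n) (P? n) where
  c = sumN n (\ k -> ind (P? k))
  go : (Σ (ℕ -> ℕ) \ u -> (∀ k -> k < c -> u k < n × P (u k)) × (∀ j k -> j < k -> k < c -> u j ≢ u k)) -> (D : Dec (P n)) →
   Σ (ℕ -> ℕ) \ u -> (∀ k -> k < c + ind D -> u k < S n × P (u k)) × (∀ j k -> j < k -> k < c + ind D -> u j ≢ u k)
  go (u , h , inj) (no _) = u , (\ k l -> let (x , y) = h k (tr (k <_) (NP.+-identityʳ c) l) in m<n⇒m<1+n x , y) , \ j k j<k l -> inj j k j<k (tr (k <_) (NP.+-identityʳ c) l)
  go (u , h , inj) (yes p) = v , (\ k l -> both k (≤c k l) (k ≟ c)) , \ j k j<k l -> sep j k j<k (≤c k l) (k ≟ c) where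
   ≤c : ∀ k -> k < c + 1 -> k ≤ c
   ≤c k l = ≤-pred (tr (k <_) (NP.+-comm c 1) l)
   choose : ∀ {X : Set} -> Dec X -> ℕ -> ℕ -> ℕ
   choose (yes _) x y = x
   choose (no _) x y = y
   choose-no : ∀ {X : Set} (D : Dec X) {x y} -> ¬ X -> choose D x y ~ y
   choose-no (yes q) n = abort (n q)
   choose-no (no _) _ = refl
   v : ℕ -> ℕ
   v k = choose (k ≟ c) n (u k)
   both : ∀ k -> k ≤ c -> (D : Dec (k ~ c)) -> choose D n (u k) < S n × P (choose D n (u k))
   both k l (yes _) = NP.≤-refl , p
   both k l (no ne) = let (x , y) = h k (≤∧≢⇒< l ne) in m<n⇒m<1+n x , y
   sep : ∀ j k -> j < k -> k ≤ c -> (D : Dec (k ~ c)) -> v j ≢ choose D n (u k)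
   sep j k j<k l D e = at D (& (! (choose-no (j ≟ c) \ j≡c -> <⇒≢ (<-≤-trans j<k l) j≡c)) e) where
    at : (D : Dec (k ~ c)) -> u j ≢ choose D n (u k)
    at (yes _) e = <⇒≢ (fst (h j (<-≤-trans j<k l))) e
    at (no ne) e = inj j k j<k (≤∧≢⇒< l ne) e

 lift-unit : ∀ a e u -> 1 ≤ a -> Coprime u e -> ∃ \ k -> Coprime (u + k * e) a
 lift-unit a e u a≥1 cop = K a , tr (Coprime (u + K a * e)) (gcd-refl a) (noPrime⇒coprime a≥1 \ {q} pq q∣h q∣a _ -> check q pq q∣h q∣a (q ∣? u)) where
  gcd-refl : ∀ a -> gcd a a ~ a
  gcd-refl a = Data.Nat.Divisibility.∣-antisym (gcd[m,n]∣m a a) (gcd-greatest ∣-refl ∣-refl)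
  pickP : ∀ {X Y Z : Set} -> Dec X -> Dec Y -> Dec Z -> ℕ -> ℕ
  pickP (yes _) (yes _) (no _) n = n
  pickP _ _ _ n = 1
  K : ℕ -> ℕ
  K zero = 1
  K (S m) = K m * pickP (prime? (S m)) (S m ∣? a) (S m ∣? u) (S m)
  K∤ : ∀ m q -> Prime q -> q ∣ K m -> ¬ (q ∣ u)
  K∤ zero q pq d _ = ¬prime[1] (tr Prime (∣1⇒≡1 d) pq)
  K∤ (S m) q pq d = either (euclidsLemma (K m) _ pq d) where
   top : ∀ (X : Dec (Prime (S m))) (Y : Dec (S m ∣ a)) (Z : Dec (S m ∣ u)) -> q ∣ pickP X Y Z (S m) -> ¬ (q ∣ u)
   top (yes x) (yes _) (no z) d = \ q∣u -> z (tr (_∣ u) (prime-∣-prime x pq d) q∣u)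
   top (no _) _ _ d = \ _ -> ¬prime[1] (tr Prime (∣1⇒≡1 d) pq)
   top (yes _) (no _) _ d = \ _ -> ¬prime[1] (tr Prime (∣1⇒≡1 d) pq)
   top (yes _) (yes _) (yes _) d = \ _ -> ¬prime[1] (tr Prime (∣1⇒≡1 d) pq)
   either : q ∣ K m ⊎ q ∣ pickP (prime? (S m)) (S m ∣? a) (S m ∣? u) (S m) -> ¬ (q ∣ u)
   either (inl x) = K∤ m q pq x
   either (inr x) = top _ _ _ x
  K∣ : ∀ m q -> q ≤ m -> Prime q -> q ∣ a -> ¬ (q ∣ u) -> q ∣ K m
  K∣ zero q l pq _ _ = abort (<⇒≢ (&N (prime1 pq) l) refl)
  K∣ (S m) q l pq q∣a q∤u = at (q ≟ S m) where
   hit : ∀ (X : Dec (Prime (S m))) (Y : Dec (S m ∣ a)) (Z : Dec (S m ∣ u)) -> Prime (S m) -> S m ∣ a -> ¬ (S m ∣ u) -> S m ∣ pickP X Y Z (S m)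
   hit (yes _) (yes _) (no _) _ _ _ = ∣-refl
   hit (no n) _ _ x _ _ = abort (n x)
   hit (yes _) (no n) _ _ y _ = abort (n y)
   hit (yes _) (yes _) (yes z) _ _ n = abort (n z)
   at : Dec (q ~ S m) -> q ∣ K (S m)
   at (yes refl) = ∣n⇒∣m*n (K m) (hit _ _ _ pq q∣a q∤u)
   at (no ne) = ∣m⇒∣m*n _ (K∣ m q (≤-pred (≤∧≢⇒< l ne)) pq q∣a q∤u)
  check : ∀ q -> Prime q -> q ∣ u + K a * e -> q ∣ a -> Dec (q ∣ u) -> ⊥
  check q pq q∣h q∣a (yes q∣u) = either (euclidsLemma (K a) e pq (∣m+n∣m⇒∣n q∣h q∣u)) where
   either : q ∣ K a ⊎ q ∣ e -> ⊥
   either (inl x) = K∤ a q pq x q∣u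
   either (inr x) = ¬prime[1] (tr Prime (cop (q∣u , x)) pq)
  check q pq q∣h q∣a (no q∤u) = q∤u (∣m+n∣m⇒∣n (tr (q ∣_) (NP.+-comm u _) q∣h) (∣m⇒∣m*n e (K∣ a q (∣⇒≤ {{>-nonZero a≥1}} q∣a) pq q∣a q∤u)))

 modular-inverse : ∀ a' h' -> Coprime h' (S a') -> ∃ \ h -> (h * h') % S a' ~ 1 % S a'
 modular-inverse a' h' cop = go (coprime-Bézout cop) where
  a = S a'
  go : Bézout.Identity 1 h' a -> ∃ \ h -> (h * h') % a ~ 1 % a
  go (Bézout.+- x y eq) = x , & (ap (_% a) (! eq)) ([m+kn]%n≡m%n 1 y a)
  go (Bézout.-+ x y eq) = x * a' , & (! ([m+kn]%n≡m%n (x * a' * h') 1 a)) (& (ap (_% a) (& (#u5 x a' h') (& (ap (\ z -> 1 + a' * z) eq) (#u4 a' y)))) ([m+kn]%n≡m%n 1 (a' * y) a))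

 record Classes (a' a1 K : ℕ) : Set where
  field
   h h' : ℕ -> ℕ
   inverse : ∀ k -> (h k * h' k) % S a' ~ 1 % S a'
   distinct : ∀ j k -> j < k -> k < K -> (a1 * h' j) % S a' ≢ (a1 * h' k) % S a'

 classes : ∀ a' a1 e' -> S a' ~ a1 * S e' -> Classes a' a1 (φ (S e'))
 classes a' a1 e' a≡ = record { h = \ k -> fst (inv k) ; h' = h' ; inverse = \ k -> snd (inv k) ; distinct = \ j k j<k l e -> snd (snd en) j k j<k l (residues j k j<k l e) } where
  e = S e'
  en = enumerate (\ b -> coprime? b e) e
  u = fst en
  unit : ∀ k -> Dec (k < φ e) -> ∃ \ h' -> Coprime h' (S a') × (k < φ e -> h' % e ~ u k)
  unit k (no n) = 1 , (\ (d , _) -> ∣1⇒≡1 d) , \ l -> abort (n l)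
  unit k (yes l) = let (x , c) = fst (snd en) k l ; (r , cop) = lift-unit (S a') e (u k) z<s c in
   u k + r * e , cop , \ _ -> & ([m+kn]%n≡m%n (u k) r e) (m<n⇒m%n≡m x)
  h' : ℕ -> ℕ
  h' k = fst (unit k (k N.<? φ e))
  inv : ∀ k -> ∃ \ h -> (h * h' k) % S a' ~ 1 % S a'
  inv k = modular-inverse a' (h' k) (fst (snd (unit k (k N.<? φ e))))
  a11 : 1 ≤ a1
  a11 = n≢0⇒n>0 \ { refl -> <⇒≢ (s≤s {n = a'} z≤n) (! a≡) }
  residues : ∀ j k -> j < k -> k < φ e -> (a1 * h' j) % S a' ~ (a1 * h' k) % S a' -> u j ~ u k
  residues j k j<k l eq = & (! (snd (snd (unit j (j N.<? φ e))) (NP.<-trans j<k l))) (& (NP.*-cancelʳ-≡ _ _ a1 {{>-nonZero a11}} (& (reduce (h' j)) (& eq (! (reduce (h' k)))))) (snd (snd (unit k (k N.<? φ e))) l)) where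
   mod-cong : ∀ x {m n} .{{_ : N.NonZero m}} .{{_ : N.NonZero n}} -> m ~ n -> x % m ~ x % n
   mod-cong x refl = refl
   instance
    nz : N.NonZero (e * a1)
    nz = >-nonZero (&N a11 (m≤n*m a1 e))
   reduce : ∀ x -> x % e * a1 ~ (a1 * x) % S a'
   reduce x = & (m%n*o≡m*o%[n*o] x e a1) (& (ap (\ z -> z % (e * a1)) (NP.*-comm x a1)) (mod-cong (a1 * x) (& (NP.*-comm e a1) (! a≡))))

module B22 where
 open B10 using (module ΣN; sumN; module ΣZ; sumZ)
 open B20 using (module EdgeVanishing)
 open B21
 open import Defs
 open import Relation.Nullary.Decidable using (_×-dec_; ¬?)
 open Z using (ℤ)
 open import Data.Nat.Divisibility using (_∣_; divides; _∣?_; *-monoˡ-∣; ∣⇒≤; m∣m*n)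
 open import Data.Nat.DivMod using (_%_; %-distribˡ-*; m<n⇒m%n≡m)
 open import Data.Nat.Coprimality using (Coprime; coprime-divisor)
 open import Data.Nat.GCD using (gcd; gcd[m,n]∣m; gcd[m,n]∣n; gcd-greatest; gcd[m,n]≡0⇒m≡0)
 open N using (_*_; _+_; _<_; _∸_; _≤_)

 #v1 : ∀ u v u' v' i' j' i k -> u' * (u * i + v * (j' + k)) + u * (u' * i' + v' * j') ~ u' * (u * i') + u' * (v * j') + (u * (u' * i) + u * (v' * j')) + v * u' * k
 #v1 = nsolve
 #v2 : ∀ u v u' v' i' j' i k -> u' * (u * i' + v * j') + u * (u' * i + v' * (j' + k)) ~ u' * (u * i') + u' * (v * j') + (u * (u' * i) + u * (v' * j')) + v' * u * k
 #v2 = nsolve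
 #v3 : ∀ d i a k -> d * i + a * (k * d) ~ d * (i + a * k)
 #v3 = nsolve
 #v4 : ∀ d e i a j t -> d * e * i + a * e * (j + t) ~ e * (d * i + a * t) + a * e * j
 #v4 = nsolve
 #v5 : ∀ d e i a j -> e * (d * i) + a * e * j ~ d * e * i + a * e * j
 #v5 = nsolve

 lex : ∀ {w w' SS t t'} -> t < SS -> w' * SS + t' ≤ w * SS + t -> w' ≤ w
 lex {w} {w'} {SS} {t} {t'} t<S l = ≮⇒≥ \ w<w' -> <⇒≱ (<-≤-trans (NP.+-monoʳ-< (w * SS) t<S) (&N (≡N (NP.+-comm (w * SS) SS)) (&N (*-monoˡ-≤ SS w<w') (m≤m+n (w' * SS) t')))) l

 module NewtonPolygon (P : Poly2) where
  B = bound P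
  InSupport : ℕ -> ℕ -> Set
  InSupport i j = coeff P i j ≢ 0Z
  i≤B : ∀ {i j} -> InSupport i j -> i ≤ B
  i≤B {i} {j} nz = ≮⇒≥ \ l -> nz (support P i j (inl l))
  j≤B : ∀ {i j} -> InSupport i j -> j ≤ B
  j≤B {i} {j} nz = ≮⇒≥ \ l -> nz (support P i j (inr l))
  maximiser : (g : ℕ -> ℕ -> ℕ) -> ∀ bnd -> (∀ i j -> InSupport i j -> g i j ≤ bnd) -> ∀ i0 j0 -> InSupport i0 j0 -> ∃ \ i -> ∃ \ j -> InSupport i j × (∀ i' j' -> InSupport i' j' -> g i' j' ≤ g i j)
  maximiser g bnd g≤ i0 j0 nz0 = climb bnd i0 j0 nz0 (m≤n+m bnd (g i0 j0)) where
   climb : ∀ fuel i j -> InSupport i j -> bnd ≤ g i j + fuel -> ∃ \ i -> ∃ \ j -> InSupport i j × (∀ i' j' -> InSupport i' j' -> g i' j' ≤ g i j)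
   climb fuel i j nz l = go fuel l (NP.anyUpTo? (\ i' -> NP.anyUpTo? (\ j' -> ¬? (coeff P i' j' Z.≟ 0Z) ×-dec (g i j N.<? g i' j')) (S B)) (S B)) where
    go : ∀ fuel -> bnd ≤ g i j + fuel -> Dec (∃ \ i' -> i' < S B × ∃ \ j' -> j' < S B × (InSupport i' j' × g i j < g i' j')) -> ∃ \ i -> ∃ \ j -> InSupport i j × (∀ i' j' -> InSupport i' j' -> g i' j' ≤ g i j)
    go _ _ (no none) = i , j , nz , \ i' j' nz' -> ≮⇒≥ \ lt -> none (i' , s≤s (i≤B nz') , j' , s≤s (j≤B nz') , nz' , lt)
    go zero l (yes (i' , _ , j' , _ , nz' , lt)) = abort (<⇒≱ (≤-<-trans (&N l (≡N (NP.+-identityʳ _))) lt) (g≤ i' j' nz'))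
    go (S fuel) l (yes (i' , _ , j' , _ , nz' , lt)) = climb fuel i' j' nz' (&N l (&N (≡N (+-suc (g i j) fuel)) (+-monoˡ-≤ fuel lt)))
  IsMax : ℕ -> ℕ -> ℕ -> ℕ -> Set
  IsMax u v i j = InSupport i j × (∀ i' j' -> InSupport i' j' -> u * i' + v * j' ≤ u * i + v * j)
  slope-monotone : ∀ {u v u' v' i j i' j'} -> IsMax u v i j -> IsMax u' v' i' j' -> v * u' < v' * u -> j ≤ j'
  slope-monotone {u} {v} {u'} {v'} {i} {j} {i'} {j'} (nz , m) (nz' , m') s = ≮⇒≥ \ j'<j -> contra (j ∸ j') (m<n⇒0<n∸m j'<j) (! (m+[n∸m]≡n (<⇒≤ j'<j))) where
   contra : ∀ k -> 1 ≤ k -> j ~ j' + k -> ⊥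
   contra k k≥1 refl = <⇒≱ (NP.*-monoˡ-< k {{>-nonZero k≥1}} s) (NP.+-cancelˡ-≤ (u' * (u * i') + u' * (v * j') + (u * (u' * i) + u * (v' * j'))) _ _
    (tr2 _≤_ (#v2 u v u' v' i' j' i k) (#v1 u v u' v' i' j' i k) (+-mono-≤ (*-monoʳ-≤ u' (m i' j' nz')) (*-monoʳ-≤ u (m' i (j' + k) nz)))))
  edge-ends : ∀ u v -> (∃ \ i -> ∃ \ j -> InSupport i j) -> ∃ \ i0 -> ∃ \ j0 -> ∃ \ i1 -> ∃ \ j1 -> IsMax u v i0 j0 × IsMax u v i1 j1 ×
   (∀ i j -> InSupport i j -> u * i + v * j ~ u * i0 + v * j0 -> j1 ≤ j × j ≤ j0)
  edge-ends u v (is , js , nzs) = go (maximiser gt bt gt≤ is js nzs) (maximiser gb bt gb≤ is js nzs) where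
   SS = S B
   w : ℕ -> ℕ -> ℕ
   w i j = u * i + v * j
   gt gb : ℕ -> ℕ -> ℕ
   gt i j = w i j * SS + j
   gb i j = w i j * SS + (B ∸ j)
   bt = w B B * SS + B
   w≤ : ∀ i j -> InSupport i j -> w i j ≤ w B B
   w≤ i j nz = +-mono-≤ (*-monoʳ-≤ u (i≤B nz)) (*-monoʳ-≤ v (j≤B nz))
   gt≤ : ∀ i j -> InSupport i j -> gt i j ≤ bt
   gt≤ i j nz = +-mono-≤ (*-monoˡ-≤ SS (w≤ i j nz)) (j≤B nz)
   gb≤ : ∀ i j -> InSupport i j -> gb i j ≤ bt
   gb≤ i j nz = +-mono-≤ (*-monoˡ-≤ SS (w≤ i j nz)) (m∸n≤m B j)
   go : (∃ \ i -> ∃ \ j -> InSupport i j × (∀ i' j' -> InSupport i' j' -> gt i' j' ≤ gt i j)) -> (∃ \ i -> ∃ \ j -> InSupport i j × (∀ i' j' -> InSupport i' j' -> gb i' j' ≤ gb i j)) -> _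
   go (i0 , j0 , nz0 , m0) (i1 , j1 , nz1 , m1) = i0 , j0 , i1 , j1 , max0 , max1 , \ i j nz e -> low i j nz e , high i j nz e where
    max0 : IsMax u v i0 j0
    max0 = nz0 , \ i' j' nz' -> lex (s≤s (j≤B nz0)) (m0 i' j' nz')
    max1 : IsMax u v i1 j1
    max1 = nz1 , \ i' j' nz' -> lex (s≤s (m∸n≤m B j1)) (m1 i' j' nz')
    high : ∀ i j -> InSupport i j -> w i j ~ w i0 j0 -> j ≤ j0
    high i j nz e = NP.+-cancelˡ-≤ (w i0 j0 * SS) j j0 (tr (\ z -> z * SS + j ≤ gt i0 j0) e (m0 i j nz))
    low : ∀ i j -> InSupport i j -> w i j ~ w i0 j0 -> j1 ≤ j
    low i j nz e = ≮⇒≥ \ j<j1 -> <⇒≱ (NP.∸-monoʳ-< j<j1 (j≤B nz1)) (NP.+-cancelˡ-≤ (w i1 j1 * SS) _ _ (tr (\ z -> z * SS + (B ∸ j) ≤ gb i1 j1) (& e (NP.≤-antisym (snd max1 i0 j0 nz0) (snd max0 i1 j1 nz1))) (m1 i j nz)))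

 lattice-step : ∀ {a1 d1 e i i0 j t} -> 1 ≤ e -> 1 ≤ d1 -> Coprime d1 a1 -> d1 * e * i + a1 * e * j ~ d1 * e * i0 + a1 * e * (j + t) -> ∃ \ k -> t ~ d1 * k × i ~ i0 + a1 * k
 lattice-step {a1} {d1} {e} {i} {i0} {j} {t} e≥1 d≥1 cop eq = go (coprime-divisor cop (divides-diff)) where
  instance
   e≢0 : N.NonZero e
   e≢0 = >-nonZero e≥1
   d≢0 : N.NonZero d1
   d≢0 = >-nonZero d≥1
  reduced : d1 * i ~ d1 * i0 + a1 * t
  reduced = NP.*-cancelˡ-≡ _ _ e (NP.+-cancelʳ-≡ (a1 * e * j) _ _ (& (#v5 d1 e i a1 j) (& eq (#v4 d1 e i0 a1 j t))))
  divides-diff : d1 ∣ a1 * t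
  divides-diff = Data.Nat.Divisibility.∣m+n∣m⇒∣n (tr (d1 ∣_) reduced (m∣m*n i)) (m∣m*n i0)
  go : d1 ∣ t -> ∃ \ k -> t ~ d1 * k × i ~ i0 + a1 * k
  go (divides k t≡) = k , & t≡ (NP.*-comm k d1) , NP.*-cancelˡ-≡ _ _ d1 (& reduced (& (ap (\ z -> d1 * i0 + a1 * z) t≡) (#v3 d1 i0 a1 k)))

 sumTo-sumZ : ∀ f n -> sumTo f n ~ sumZ (S n) f
 sumTo-sumZ f zero = ! (ZP.+-identityˡ _)
 sumTo-sumZ f (S n) = ap (\ z -> z Z.+ f (S n)) (sumTo-sumZ f n)

 module ModularPolynomial (N : ℕ) (N≥2 : 2 ≤ N) (P : Poly2) (n : ℕ) (ψ : IsPsi N n) (monic : MonicInY P n) (van : VanishesOnModularCurve N P) (c : ℕ) (c≡ : c ~ 24) where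
  open NewtonPolygon P
  leading : InSupport 0 n
  leading e = 1≢0 (& (! (fst monic)) e) where
   1≢0 : Z.1ℤ ≢ 0Z
   1≢0 ()
  j≤n : ∀ {i j} -> InSupport i j -> j ≤ n
  j≤n {i} {j} nz = ≮⇒≥ \ l -> nz (snd (snd monic) i j l)
  module Edge (a' d' : ℕ) (ad≡ : S a' * S d' ~ N) where
   a = S a'
   d = S d'
   vanish : ∀ k -> clearedEval P (a * d) k ~ 0Z
   vanish = tr (VanishesOnModularCurve′) (! ad≡) van where
    VanishesOnModularCurve′ : ℕ -> Set
    VanishesOnModularCurve′ M = ∀ k -> clearedEval P M k ~ 0Z
   edge-length : ∃ \ i0 -> ∃ \ j0 -> ∃ \ i1 -> ∃ \ j1 -> IsMax d a i0 j0 × IsMax d a i1 j1 × j1 + G a d ≤ j0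
   edge-length = go (gcd a d) refl (gcd[m,n]∣m a d) (gcd[m,n]∣n a d) where
    go : ∀ e -> gcd a d ~ e -> gcd a d ∣ a -> gcd a d ∣ d -> ∃ \ i0 -> ∃ \ j0 -> ∃ \ i1 -> ∃ \ j1 -> IsMax d a i0 j0 × IsMax d a i1 j1 × j1 + G a d ≤ j0
    go zero e≡ _ _ = abort (<⇒≢ (s≤s {n = a'} z≤n) (! (gcd[m,n]≡0⇒m≡0 {a} {d} e≡)))
    go (S e') e≡ (divides a1 a≡′) (divides d1 d≡′) = ends (edge-ends d a (0 , n , leading)) where
     e = S e'
     a≡ : a ~ a1 * e
     a≡ = & a≡′ (ap (a1 *_) e≡)
     d≡ : d ~ d1 * e
     d≡ = & d≡′ (ap (d1 *_) e≡)
     nonzero : ∀ {x y} -> S x ~ y * e -> 1 ≤ y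
     nonzero {x} {zero} ()
     nonzero {x} {S y} _ = s≤s z≤n
     a11 = nonzero a≡
     d11 = nonzero d≡
     cop : Coprime d1 a1
     cop {i} (i∣d , i∣a) = NP.≤-antisym (NP.*-cancelʳ-≤ i 1 e (&N (∣⇒≤ (tr (i * e ∣_) e≡ (gcd-greatest {a} {d} {i * e} (tr (i * e ∣_) (! a≡) (*-monoˡ-∣ e i∣a)) (tr (i * e ∣_) (! d≡) (*-monoˡ-∣ e i∣d))))) (≡N (! (NP.*-identityˡ e)))))
      (n≢0⇒n>0 \ { refl -> <⇒≢ a11 (! (Data.Nat.Divisibility.0∣⇒≡0 i∣a)) })
     G≡ : G a d ~ d1 * φ e
     G≡ = & (G-φ a d d1 d≡′) (ap (\ z -> d1 * φ z) e≡)
     ends : (∃ \ i0 -> ∃ \ j0 -> ∃ \ i1 -> ∃ \ j1 -> IsMax d a i0 j0 × IsMax d a i1 j1 × (∀ i j -> InSupport i j -> d * i + a * j ~ d * i0 + a * j0 -> j1 ≤ j × j ≤ j0)) →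
      ∃ \ i0 -> ∃ \ j0 -> ∃ \ i1 -> ∃ \ j1 -> IsMax d a i0 j0 × IsMax d a i1 j1 × j1 + G a d ≤ j0
     ends (i0 , j0 , i1 , j1 , max0 , max1 , between) = measure (step i1 j1 (fst max1) w1) where
      w1 : d * i1 + a * j1 ~ d * i0 + a * j0
      w1 = NP.≤-antisym (snd max0 i1 j1 (fst max1)) (snd max1 i0 j0 (fst max0))
      step : ∀ i j -> InSupport i j -> d * i + a * j ~ d * i0 + a * j0 -> ∃ \ k -> j0 ∸ j ~ d1 * k × i ~ i0 + a1 * k
      step i j nz w = lattice-step {a1} {d1} {e} {i} {i0} {j} z<s d11 cop (tr2 (\ x y -> x * i + y * j ~ x * i0 + y * (j + (j0 ∸ j))) d≡ a≡ (& w (ap (\ z -> d * i0 + a * z) (! (m+[n∸m]≡n (snd (between i j nz w)))))))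
      measure : (∃ \ k -> j0 ∸ j1 ~ d1 * k × i1 ~ i0 + a1 * k) -> ∃ \ i0 -> ∃ \ j0 -> ∃ \ i1 -> ∃ \ j1 -> IsMax d a i0 j0 × IsMax d a i1 j1 × j1 + G a d ≤ j0
      measure (R , R≡ , _) = compare (φ e) refl (φ e N.≤? R) where
       j1≤j0 = fst (between i0 j0 (fst max0) refl)
       compare : ∀ f -> φ e ~ f -> Dec (φ e ≤ R) -> ∃ \ i0 -> ∃ \ j0 -> ∃ \ i1 -> ∃ \ j1 -> IsMax d a i0 j0 × IsMax d a i1 j1 × j1 + G a d ≤ j0
       compare _ _ (yes l) = i0 , j0 , i1 , j1 , max0 , max1 , &N (+-monoʳ-≤ j1 (&N (≡N G≡) (&N (*-monoʳ-≤ d1 l) (≡N (! R≡))))) (≡N (m+[n∸m]≡n j1≤j0))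
       compare zero f≡ (no nl) = abort (nl (tr (_≤ R) (! f≡) z≤n))
       compare (S K) f≡ (no nl) = abort (fst max0 (& (! (ap2 (coeff P) (& (ap (i0 +_) (*-zeroʳ a1)) (NP.+-identityʳ i0)) (ap (j0 ∸_) (*-zeroʳ d1)))) (EV.coefficients-vanish (S R) (EV.At.cf 0) (tr (S R ≤_) f≡ (≰⇒> nl)) (\ k _ l -> EV.At.edge-small k l) 0 z<s))) where
        cl = classes a' a1 e' a≡
        on-edge : ∀ i j -> coeff P i j ≢ 0Z -> (∃ \ k -> k < S R × (i ~ i0 + a1 * k × j ~ j0 ∸ d1 * k)) ⊎ d * i + a * j < d * i0 + a * j0
        on-edge i j nz = decide (d * i + a * j ≟ d * i0 + a * j0) where
         decide : Dec (d * i + a * j ~ d * i0 + a * j0) -> (∃ \ k -> k < S R × (i ~ i0 + a1 * k × j ~ j0 ∸ d1 * k)) ⊎ d * i + a * j < d * i0 + a * j0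
         decide (no ne) = inr (≤∧≢⇒< (snd max0 i j nz) ne)
         decide (yes w) = let (k , t≡ , i≡) = step i j nz w in inl (k , s≤s (NP.*-cancelˡ-≤ d1 {{>-nonZero d11}} (&N (≡N (! t≡)) (&N (NP.∸-monoʳ-≤ j0 (fst (between i j nz w))) (≡N R≡)))) ,
          i≡ , & (! (NP.m∸[m∸n]≡n (snd (between i j nz w)))) (ap (j0 ∸_) t≡))
        module EV = EdgeVanishing a' d' c c≡ P vanish i0 j0 a1 d1 R a11 (&N (≡N (! R≡)) (m∸n≤m j0 j1)) on-edge e' a≡ d≡ K (Classes.h cl) (Classes.h' cl) (Classes.inverse cl)
         (\ j k j<k k<K -> Classes.distinct cl j k j<k (tr (k <_) (! f≡) k<K))
  share : ℕ -> ℕ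
  share b = sumN N (\ j -> when (S b * S j ≟ N) (G (S b) (S j)))
  share-total : sumN N share ~ n
  share-total = cosets≡ψ (&N z<s N≥2) ψ
  share-at : ∀ b d' -> S b * S d' ~ N -> share b ~ G (S b) (S d')
  share-at b d' e = & (ΣN.fold-single N d' (&N (m≤n*m (S d') (S b)) (≡N e)) \ j _ ne -> when-no (S b * S j ≟ N) \ e' -> abort (ne (NP.suc-injective (NP.*-cancelˡ-≡ (S j) (S d') (S b) (& e' (! e))))))
   (yes! (S b * S d' ≟ N) e) where
   yes! : ∀ {X : Set} (D : Dec X) {x} -> X -> when D x ~ x
   yes! (yes _) _ = refl
   yes! (no k) p = abort (k p)
  cofactor : ∀ b -> (∃ \ d' -> S b * S d' ~ N) ⊎ share b ~ 0
  cofactor b = go (S b ∣? N) where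
   go : Dec (S b ∣ N) -> (∃ \ d' -> S b * S d' ~ N) ⊎ share b ~ 0
   go (yes (divides zero e)) = abort (<⇒≢ (&N z<s N≥2) (! e))
   go (yes (divides (S d') e)) = inl (d' , & (NP.*-comm (S b) (S d')) (! e))
   go (no k) = inr (ΣN.fold-none N \ j _ -> when-no (S b * S j ≟ N) \ e -> abort (k (divides (S j) (& (! e) (NP.*-comm (S b) (S j))))))
  -- The edges of the directions (d, a), ad = N, in order of slope, exhaust the height n.
  below : ∀ m {u v i j} -> IsMax u v i j -> (∀ b d' -> b < m -> S b * S d' ~ N -> S b * u < S d' * v) -> sumN m share ≤ j
  below zero _ _ = z≤n
  below (S m) {u} {v} {i} {j} mx cond = go (cofactor m) where
   go : (∃ \ d' -> S m * S d' ~ N) ⊎ share m ~ 0 -> sumN m share + share m ≤ j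
   go (inr z) = &N (≡N (& (ap (sumN m share +_) z) (NP.+-identityʳ _))) (below m {u} {v} {i} {j} mx \ b d' b<m -> cond b d' (m<n⇒m<1+n b<m))
   go (inl (d' , e)) = via (Edge.edge-length m d' e) where
    via : (∃ \ i0 -> ∃ \ j0 -> ∃ \ i1 -> ∃ \ j1 -> IsMax (S d') (S m) i0 j0 × IsMax (S d') (S m) i1 j1 × j1 + G (S m) (S d') ≤ j0) -> sumN m share + share m ≤ j
    via (i0 , j0 , i1 , j1 , max0 , max1 , len) = &N (+-mono-≤ (below m {S d'} {S m} {i1} {j1} max1 steeper) (≡N (share-at m d' e))) (&N len (slope-monotone {S d'} {S m} {u} {v} {i0} {j0} {i} {j} max0 mx (<-≤-trans (cond m d' NP.≤-refl e) (≡N (NP.*-comm (S d') v))))) where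
     steeper : ∀ b db -> b < m -> S b * S db ~ N -> S b * S d' < S db * S m
     steeper b db b<m e' = <-≤-trans (NP.*-monoˡ-< (S d') (s≤s b<m)) (&N (≡N (& e (& (! e') (NP.*-comm (S b) (S db))))) (*-monoʳ-≤ (S db) (s≤s (<⇒≤ b<m))))
  above : ∀ r m {u v i j} -> IsMax u v i j -> (∀ b d' -> m ≤ b -> S b * S d' ~ N -> S d' * v < S b * u) -> j + sumN r (\ k -> share (m + k)) ≤ n
  above zero m {j = j} mx _ = &N (≡N (NP.+-identityʳ j)) (j≤n (fst mx))
  above (S r) m {u} {v} {i} {j} mx cond = &N (≡N (ap (j +_) (& (ΣN.front r (\ k -> share (m + k))) (ap2 _+_ (ap share (NP.+-identityʳ m)) (ΣN.cong-f r \ k -> ap share (+-suc m k)))))) (go (cofactor m)) where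
   rest = sumN r (\ k -> share (S m + k))
   go : (∃ \ d' -> S m * S d' ~ N) ⊎ share m ~ 0 -> j + (share m + rest) ≤ n
   go (inr z) = &N (≡N (ap (\ x -> j + (x + rest)) z)) (above r (S m) {u} {v} {i} {j} mx \ b d' l -> cond b d' (&N (n≤1+n m) l))
   go (inl (d' , e)) = via (Edge.edge-length m d' e) where
    via : (∃ \ i0 -> ∃ \ j0 -> ∃ \ i1 -> ∃ \ j1 -> IsMax (S d') (S m) i0 j0 × IsMax (S d') (S m) i1 j1 × j1 + G (S m) (S d') ≤ j0) -> j + (share m + rest) ≤ n
    via (i0 , j0 , i1 , j1 , max0 , max1 , len) = &N (≡N (! (NP.+-assoc j (share m) rest))) (&N (+-monoˡ-≤ rest (&N (+-mono-≤ (slope-monotone {u} {v} {S d'} {S m} {i} {j} {i1} {j1} mx max1 (≤-<-trans (≡N (NP.*-comm v (S d'))) (cond m d' NP.≤-refl e))) (≡N (share-at m d' e))) len)) (above r (S m) {S d'} {S m} {i0} {j0} max0 flatter)) where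
     flatter : ∀ b db -> S m ≤ b -> S b * S db ~ N -> S db * S m < S b * S d'
     flatter b db l e' = <-≤-trans (NP.*-monoʳ-< (S db) (s≤s l)) (&N (≡N (& (NP.*-comm (S db) (S b)) (& e' (! e)))) (*-monoˡ-≤ (S d') (&N l (n≤1+n b))))
  sqrt : ∀ k -> (∃ \ m -> N ≤ S m * S m × (∀ b -> b < m -> S b * S b < N)) ⊎ (∀ b -> b < k -> S b * S b < N)
  sqrt zero = inr \ b ()
  sqrt (S k) = go (sqrt k) (N N.≤? S k * S k) where
   go : (∃ \ m -> N ≤ S m * S m × (∀ b -> b < m -> S b * S b < N)) ⊎ (∀ b -> b < k -> S b * S b < N) -> Dec (N ≤ S k * S k) →
    (∃ \ m -> N ≤ S m * S m × (∀ b -> b < m -> S b * S b < N)) ⊎ (∀ b -> b < S k -> S b * S b < N)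
   go (inl x) _ = inl x
   go (inr f) (yes l) = inl (k , l , f)
   go (inr f) (no l) = inr \ b b<k -> case b b<k (b ≟ k) where
    case : ∀ b -> b < S k -> Dec (b ~ k) -> S b * S b < N
    case b _ (yes refl) = ≰⇒> l
    case b b<k (no ne) = f b (≤∧≢⇒< (s≤s⁻¹ b<k) ne)
  module Top (D : ℕ) (isTotal : IsTotalDegree P D) where
   top-bound : ∀ {i j} -> InSupport i j -> i + j ≤ D
   top-bound {i} {j} nz = snd isTotal i j nz
   one-weight : ∀ i j -> 1 * i + 1 * j ~ i + j
   one-weight i j = ap2 _+_ (NP.*-identityˡ i) (NP.*-identityˡ j)
   is-top : ∀ {i j} -> IsMax 1 1 i j -> i + j ~ D
   is-top {i} {j} (nz , m) = let (x , y , e , nz') = fst isTotal in NP.≤-antisym (top-bound nz) (&N (≡N (! e)) (tr2 _≤_ (one-weight x y) (one-weight i j) (m x y nz')))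
   Spread : ℕ -> ℕ -> Set
   Spread j1 j0 = j1 ~ j0 ⊎ (∃ \ m -> S m * S m ~ N × j0 ≤ j1 + G (S m) (S m))
   spread : ∀ {i0 j0 i1 j1} -> IsMax 1 1 i0 j0 -> IsMax 1 1 i1 j1 -> j1 ≤ j0 -> Spread j1 j0
   spread {i0} {j0} {i1} {j1} max0 max1 l = at (root (sqrt N)) where
    root : _ ⊎ (∀ b -> b < N -> S b * S b < N) -> ∃ \ m -> N ≤ S m * S m × (∀ b -> b < m -> S b * S b < N)
    root (inl x) = x
    root (inr f) = N , &N (n≤1+n N) (m≤m*n (S N) (S N)) , f
    at : (∃ \ m -> N ≤ S m * S m × (∀ b -> b < m -> S b * S b < N)) -> Spread j1 j0
    at (m , N≤ , f) = decide (S m * S m ≟ N) where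
     m≤N : m ≤ N
     m≤N = ≮⇒≥ \ N<m -> <⇒≱ (f N N<m) (&N (n≤1+n N) (m≤m*n (S N) (S N)))
     lower : sumN m share ≤ j1
     lower = below m {1} {1} {i1} {j1} max1 \ b d' b<m e -> tr2 _<_ (! (*-identityʳ (S b))) (! (*-identityʳ (S d'))) (NP.*-cancelˡ-< (S b) (S b) (S d') (<-≤-trans (f b b<m) (≡N (! e))))
     upper : ∀ m' -> (∀ b -> m' ≤ b -> N < S b * S b) -> j0 + sumN (N ∸ m') (\ k -> share (m' + k)) ≤ n
     upper m' g = above (N ∸ m') m' {1} {1} {i0} {j0} max0 \ b d' l e -> tr2 _<_ (! (*-identityʳ (S d'))) (! (*-identityʳ (S b))) (NP.*-cancelˡ-< (S b) (S d') (S b) (≤-<-trans (≡N e) (g b l)))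
     squares : ∀ {x y} -> x ≤ y -> S x * S x ≤ S y * S y
     squares l = *-mono-≤ (s≤s l) (s≤s l)
     total : ∀ m' -> m' ≤ N -> n ~ sumN m' share + sumN (N ∸ m') (\ k -> share (m' + k))
     total m' l = & (! share-total) (& (ap (\ z -> sumN z share) (! (m+[n∸m]≡n l))) (ΣN.split m' (N ∸ m') share))
     decide : Dec (S m * S m ~ N) -> Spread j1 j0
     decide (no ne) = inl (NP.≤-antisym l (&N (NP.+-cancelʳ-≤ _ j0 (sumN m share) (&N (upper m \ b k -> <-≤-trans (≤∧≢⇒< N≤ \ e -> ne (! e)) (squares k)) (≡N (total m m≤N)))) lower))
     decide (yes e) = inr (m , e , &N (NP.+-cancelʳ-≤ _ j0 (sumN (S m) share) (&N (upper (S m) \ b k -> ≤-<-trans (≡N (! e)) (<-≤-trans (NP.*-mono-< (NP.n<1+n (S m)) (NP.n<1+n (S m))) (squares k))) (≡N (total (S m) (&N (m≤m*n (S m) (S m)) (≡N e))))))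
      (+-mono-≤ lower (≡N (share-at m m e))))
   diagonal≢0 : diagonal P D ≢ 0Z
   diagonal≢0 = go (edge-ends 1 1 (0 , n , leading)) where
    go : (∃ \ i0 -> ∃ \ j0 -> ∃ \ i1 -> ∃ \ j1 -> IsMax 1 1 i0 j0 × IsMax 1 1 i1 j1 × (∀ i j -> InSupport i j -> 1 * i + 1 * j ~ 1 * i0 + 1 * j0 -> j1 ≤ j × j ≤ j0)) -> diagonal P D ≢ 0Z
    go (i0 , j0 , i1 , j1 , max0 , max1 , between) diag0 = fst max0 (conclude (spread {i0} {j0} {i1} {j1} max0 max1 j1≤j0)) where
     D≡ : i0 + j0 ~ D
     D≡ = is-top {i0} {j0} max0
     on-top : ∀ i j -> InSupport i j -> i + j ~ D -> j1 ≤ j × j ≤ j0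
     on-top i j nz e = between i j nz (& (one-weight i j) (& e (& (! D≡) (! (one-weight i0 j0)))))
     j1≤j0 = fst (on-top i0 j0 (fst max0) D≡)
     R = j0 ∸ j1
     R≤j0 : R ≤ j0
     R≤j0 = m∸n≤m j0 j1
     cf : ℕ -> ℤ
     cf k = coeff P (i0 + k) (j0 ∸ k)
     off-top : ∀ i -> i ≤ D -> (D ∸ i < j1 ⊎ j0 < D ∸ i) -> coeff P i (D ∸ i) ~ 0Z
     off-top i i≤D out = decide (coeff P i (D ∸ i) Z.≟ 0Z) where
      decide : Dec (coeff P i (D ∸ i) ~ 0Z) -> coeff P i (D ∸ i) ~ 0Z
      decide (yes z) = z
      decide (no nz) = abort (clash out (on-top i (D ∸ i) nz (m+[n∸m]≡n i≤D))) where
       clash : D ∸ i < j1 ⊎ j0 < D ∸ i -> j1 ≤ D ∸ i × D ∸ i ≤ j0 -> ⊥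
       clash (inl x) (y , _) = <⇒≱ x y
       clash (inr x) (_ , y) = <⇒≱ x y
     term : ℕ -> ℤ
     term i = coeff P i (D ∸ i)
     D∸ : ∀ k -> D ∸ (i0 + k) ~ j0 ∸ k
     D∸ k = & (ap (_∸ (i0 + k)) (! D≡)) (& (! (NP.∸-+-assoc (i0 + j0) i0 k)) (ap (_∸ k) (NP.m+n∸m≡n i0 j0)))
     sizes : S D ~ i0 + (S R + j1)
     sizes = & (ap S (& (! D≡) (ap (i0 +_) (! (m∸n+n≡m j1≤j0))))) (! (+-suc i0 (R + j1)))
     sum-cf : sumZ (S R) cf ~ 0Z
     sum-cf = & (! (& (ap (\ k -> sumZ k term) sizes) (& (ΣZ.split i0 (S R + j1) term) (& (ap2 Z._+_ (ΣZ.fold-none i0 left) (& (ΣZ.split (S R) j1 (\ k -> term (i0 + k))) (& (ap2 Z._+_ (ΣZ.cong-f (S R) \ k -> ap (coeff P (i0 + k)) (D∸ k)) (ΣZ.fold-none j1 right)) (ZP.+-identityʳ (sumZ (S R) cf))))) (ZP.+-identityˡ (sumZ (S R) cf))))))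
      (& (! (sumTo-sumZ term D)) diag0) where
      left : ∀ i -> i < i0 -> term i ~ 0Z
      left i i<i0 = off-top i (&N (<⇒≤ i<i0) (&N (m≤m+n i0 j0) (≡N D≡))) (inr (&N (≡N (& (ap S (! (NP.m+n∸m≡n i0 j0))) (! (NP.+-∸-assoc 1 (m≤m+n i0 j0))))) (&N (NP.∸-monoʳ-≤ (S (i0 + j0)) i<i0) (≡N (ap (_∸ i) D≡)))))
      right : ∀ k -> k < j1 -> term (i0 + (S R + k)) ~ 0Z
      right k k<j1 = off-top (i0 + (S R + k)) (&N (+-monoʳ-≤ i0 Rk≤) (≡N D≡)) (inl (≤-<-trans (≡N (& (D∸ (S R + k)) (& (ap (_∸ (S R + k)) (! (m∸n+n≡m j1≤j0))) (& (ap (R + j1 ∸_) (! (+-suc R k))) (NP.[m+n]∸[m+o]≡n∸o R j1 (S k)))))) (NP.∸-monoʳ-< z<s k<j1))) where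
       Rk≤ : S R + k ≤ j0
       Rk≤ = &N (≡N (! (+-suc R k))) (&N (+-monoʳ-≤ R k<j1) (≡N (m∸n+n≡m j1≤j0)))
     cf0 : cf 0 ~ coeff P i0 j0
     cf0 = ap (\ x -> coeff P x j0) (NP.+-identityʳ i0)
     single : R ~ 0 -> coeff P i0 j0 ~ 0Z
     single R≡0 = & (! cf0) (& (! (ZP.+-identityˡ _)) (& (ap (\ r -> sumZ (S r) cf) (! R≡0)) sum-cf))
     conclude : Spread j1 j0 -> coeff P i0 j0 ~ 0Z
     conclude (inl e) = single (& (ap (j0 ∸_) e) (NP.n∸n≡0 j0))
     conclude (inr (m , e , l)) = square R refl (φ (S m)) refl where
      a = S m
      gcd-self : gcd a a ~ a
      gcd-self = Data.Nat.Divisibility.∣-antisym (gcd[m,n]∣m a a) (gcd-greatest {a} {a} {a} Data.Nat.Divisibility.∣-refl Data.Nat.Divisibility.∣-refl)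
      R≤φ : R ≤ φ a
      R≤φ = &N (NP.m≤n+o⇒m∸n≤o j0 j1 l) (≡N (& (G-φ a a 1 (& (! gcd-self) (! (NP.*-identityˡ _)))) (& (NP.*-identityˡ _) (ap φ gcd-self))))
      a≥2 : 2 ≤ a
      a≥2 = two m e where
       two : ∀ m -> S m * S m ~ N -> 2 ≤ S m
       two zero e = abort (<⇒≢ N≥2 e)
       two (S m) _ = s≤s z<s
      square : ∀ r -> R ~ r -> ∀ f -> φ a ~ f -> coeff P i0 j0 ~ 0Z
      square zero r≡ _ _ = single r≡
      square (S r) r≡ zero f≡ = abort (<⇒≱ (&N z<s (≡N (! r≡))) (&N R≤φ (≡N f≡)))
      square (S r) r≡ (S K) f≡ = & (! (ap2 (coeff P) (NP.+-identityʳ i0) refl)) (EV.Quotient.contradictory not-one total (tr (1 ≤_) (! r≡) z<s) (&N R≤φ (≡N f≡))) where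
       a≡ : a ~ 1 * a
       a≡ = ! (NP.*-identityˡ a)
       cl = classes m 1 m a≡
       on-edge : ∀ i j -> coeff P i j ≢ 0Z -> (∃ \ k -> k < S R × (i ~ i0 + 1 * k × j ~ j0 ∸ 1 * k)) ⊎ a * i + a * j < a * i0 + a * j0
       on-edge i j nz = decide (i + j ≟ D) where
        decide : Dec (i + j ~ D) -> (∃ \ k -> k < S R × (i ~ i0 + 1 * k × j ~ j0 ∸ 1 * k)) ⊎ a * i + a * j < a * i0 + a * j0
        decide (no ne) = inr (tr2 _<_ (*-distribˡ-+ a i j) (*-distribˡ-+ a i0 j0) (NP.*-monoʳ-< a (<-≤-trans (≤∧≢⇒< (top-bound nz) ne) (≡N (! D≡)))))
        decide (yes e) = inl (k , s≤s (NP.∸-monoʳ-≤ j0 (fst (on-top i j nz e))) , & i≡ (ap (i0 +_) (! (NP.*-identityˡ k))) , ! (& (ap (j0 ∸_) (NP.*-identityˡ k)) (NP.m∸[m∸n]≡n j≤j0))) where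
         j≤j0 = snd (on-top i j nz e)
         k = j0 ∸ j
         i≡ : i ~ i0 + k
         i≡ = NP.+-cancelʳ-≡ j i (i0 + k) (& e (& (! D≡) (& (ap (i0 +_) (! (m∸n+n≡m j≤j0))) (! (NP.+-assoc i0 k j)))))
       module EV = EdgeVanishing m m c c≡ P (Edge.vanish m m e) i0 j0 1 1 R NP.≤-refl (&N (≡N (NP.*-identityˡ R)) R≤j0) on-edge m a≡ a≡ K (Classes.h cl) (Classes.h' cl) (Classes.inverse cl)
        (\ j k j<k k<K -> Classes.distinct cl j k j<k (tr (k <_) (! f≡) k<K))
       not-one : ∀ k -> (1 * Classes.h' cl k) % a ≢ 0
       not-one k z = 0≢1 (& (! (& (%-distribˡ-* (Classes.h cl k) (Classes.h' cl k) a) (& (ap (\ x -> ((Classes.h cl k % a) * x) % a) (& (ap (_% a) (! (NP.*-identityˡ (Classes.h' cl k)))) z)) (ap (_% a) (*-zeroʳ (Classes.h cl k % a)))))) (& (Classes.inverse cl k) (m<n⇒m%n≡m a≥2))) where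
        0≢1 : 0 ≢ 1
        0≢1 ()
       total : sumZ (S R) (EV.At.cf 0) ~ 0Z
       total = & (ΣZ.cong-f (S R) \ k -> ap2 (coeff P) (ap (i0 +_) (NP.*-identityˡ k)) (ap (j0 ∸_) (NP.*-identityˡ k))) sum-cf
   diagonal-bound : ∀ k -> diagonal P k ≢ 0Z -> k ≤ D
   diagonal-bound k nz = ≮⇒≥ \ D<k -> nz (& (sumTo-sumZ (\ i -> coeff P i (k ∸ i)) k) (ΣZ.fold-none (S k) \ i i≤k -> zero-term i (s≤s⁻¹ i≤k) D<k (coeff P i (k ∸ i) Z.≟ 0Z))) where
    zero-term : ∀ i -> i ≤ k -> D < k -> Dec (coeff P i (k ∸ i) ~ 0Z) -> coeff P i (k ∸ i) ~ 0Z
    zero-term i l D<k (yes z) = z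
    zero-term i l D<k (no nz′) = abort (<⇒≱ D<k (&N (≡N (! (m+[n∸m]≡n l))) (top-bound nz′)))

 theorem1p1 : (N : ℕ) -> 2 ≤ N -> (P : Poly2) -> IsModularPolynomial N P →
  (d : ℕ) -> IsTotalDegree P d -> IsDegree (diagonal P) d
 theorem1p1 N N≥2 P (n , ψ , monic , van) d total = Top.diagonal≢0 d total , Top.diagonal-bound d total
  where open ModularPolynomial N N≥2 P n ψ monic van 24 refl

open import Defs
open import Data.Nat using (_≤_)

theorem1p1 : (N : ℕ) → 2 ≤ N → (P : Poly2) → IsModularPolynomial N P →
    (d : ℕ) → IsTotalDegree P d → IsDegree (diagonal P) d
theorem1p1 = B22.theorem1p1
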